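{- Let $D$ be a digraph of order $p\geq 5$ such that $d(x)=id(x)+od(x)\geq p-1$ for every vertex $x$, and $\min\{id(x),od(x)\}\geq p/2-1$ for every vertex $x$. Put $n:=\lfloor p/2\rfloor$. Then either $D$ contains a directed cycle of length $p-1$, or $D\in \mathcal{H}(n,n)\cup\mathcal{B}(n,n)\cup\{[(K_n\cup K_n)+K_1]^*,\,H_{2n},\,H'_{2n},\,Q_5^*\}$ (up to isomorphism).
   Context: Digraphs are finite, without loops and without multiple arcs, but may contain both arcs $xy$ and $yx$. For a vertex $x$, $O(x)$ and $I(x)$ are its out- and in-neighbourhoods, $od(x)=|O(x)|$, $id(x)=|I(x)|$, $d(x)=od(x)+id(x)$. Cycles are directed and simple. For an undirected graph $G$, $G^*$ denotes the symmetric digraph obtained by replacing each edge $xy$ by the two arcs $xy,yx$. $K_m$ is the complete graph, $K_{a,b}$ the complete bipartite graph, $Q_5$ the undirected 5-cycle; $G_1\cup G_2$ is disjoint union and $G_1+G_2$ is the join. $K_m^*$ is the complete symmetric digraph on $m$ vertices. $\mathcal{B}(n,n)$: the set of digraphs of order $2n\geq 6$ obtained from $K^*_{n,n}$ by deleting $k$ pairwise vertex-disjoint arcs, where $0\leq k\leq n$. $\mathcal{H}(n,n)$: the set of digraphs $D$ of order $2n$ with $V(D)=F\cup B$, $|F|=|B|=n$, $D[F]$ and $D[B]$ both equal to $K_n^*$, no arc from a vertex of $B$ to a vertex of $F$, every vertex of $F$ has an out-neighbour in $B$ and every vertex of $B$ has an in-neighbour in $F$. $H_{2n}$ ($n\geq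 2$): the digraph of order $2n$ with vertex set $F\cup B\cup\{x,y\}$, where $H_{2n}[F\cup\{x\}]$ and $H_{2n}[B\cup\{y\}]$ are both $K_n^*$, there is no arc between $F$ and $B$, $O(x)=F\cup\{y\}$, $I(y)=B\cup\{x\}$, and $I(x)=O(y)=F\cup B$. $H'_{2n}$ is obtained from $H_{2n}$ by adding the arc $yx$. -}

module Defs where

open import Data.Nat using (ℕ; zero; suc; _+_; _*_; _∸_; _≡ᵇ_; _%_)
open import Data.Bool using (Bool; true; false; _∧_; _∨_; not)
open import Data.Fin using (Fin; zero; suc; toℕ; inject₁; fromℕ)
open import Data.Fin.Properties using (_≟_)
open import Data.List using (List; length; filterᵇ; allFin)
open import Data.Sum using (_⊎_; inj₁; inj₂)
open import Data.Product using (Σ; _×_; ∃)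
open import Data.Empty using (⊥)
open import Function.Bundles using (_↔_; Inverse)
open import Function.Definitions using (Injective)
open import Relation.Binary.PropositionalEquality using (_≡_)
open import Relation.Nullary.Decidable using (⌊_⌋)

Digraph : Set → Set
Digraph V = V → V → Bool

Loopless : {V : Set} → Digraph V → Set
Loopless {V} A = ∀ (x : V) → A x x ≡ false

outdeg : {p : ℕ} → Digraph (Fin p) → Fin p → ℕ
outdeg {p} A x = length (filterᵇ (λ y → A x y) (allFin p))

indeg : {p : ℕ} → Digraph (Fin p) → Fin p → ℕ
indeg {p} A x = length (filterᵇ (λ y → A y x) (allFin p))

HasCycle : {V : Set} → Digraph V → ℕ → Set
HasCycle A zero = ⊥
HasCycle {V} A (suc m) =
  Σ (Fin (suc m) → V) λ c →
    Injective _≡_ _≡_ c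
    × (∀ (i : Fin m) → A (c (inject₁ i)) (c (suc i)) ≡ true)
    × A (c (fromℕ m)) (c zero) ≡ true

Iso : {p : ℕ} {V : Set} → Digraph (Fin p) → Digraph V → Set
Iso {p} {V} A M =
  Σ (Fin p ↔ V) λ φ → ∀ x y → A x y ≡ M (Inverse.to φ x) (Inverse.to φ y)

_==_ : {n : ℕ} → Fin n → Fin n → Bool
i == j = ⌊ i ≟ j ⌋

-- ℋ(n,n): vertex set F ⊎ B (inj₁ = F, inj₂ = B); D[F], D[B] complete
-- symmetric; arcs F→B given by R; no arc B→F.

HModel : (n : ℕ) → (Fin n → Fin n → Bool) → Digraph (Fin n ⊎ Fin n)
HModel n R (inj₁ i) (inj₁ j) = not (i == j)
HModel n R (inj₂ i) (inj₂ j) = not (i == j)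
HModel n R (inj₁ i) (inj₂ j) = R i j
HModel n R (inj₂ i) (inj₁ j) = false

ValidH : (n : ℕ) → (Fin n → Fin n → Bool) → Set
ValidH n R = (∀ i → ∃ λ j → R i j ≡ true) × (∀ j → ∃ λ i → R i j ≡ true)

InCalH : {p : ℕ} → Digraph (Fin p) → ℕ → Set
InCalH A n = Σ (Fin n → Fin n → Bool) λ R → ValidH n R × Iso A (HModel n R)

cross : {n : ℕ} → Fin n ⊎ Fin n → Fin n ⊎ Fin n → Bool
cross (inj₁ _) (inj₂ _) = true
cross (inj₂ _) (inj₁ _) = true
cross (inj₁ _) (inj₁ _) = false
cross (inj₂ _) (inj₂ _) = false

BModel : (n : ℕ) → Digraph (Fin n ⊎ Fin n) → Digraph (Fin n ⊎ Fin n)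
BModel n del u v = cross u v ∧ not (del u v)

ValidDel : (n : ℕ) → Digraph (Fin n ⊎ Fin n) → Set
ValidDel n del =
  (∀ u v → del u v ≡ true → cross u v ≡ true)
  × (∀ u v u' v' → del u v ≡ true → del u' v' ≡ true →
       (u ≡ u' ⊎ u ≡ v' ⊎ v ≡ u' ⊎ v ≡ v') → (u ≡ u' × v ≡ v'))

InCalB : {p : ℕ} → Digraph (Fin p) → ℕ → Set
InCalB A n = Σ (Digraph (Fin n ⊎ Fin n)) λ del → ValidDel n del × Iso A (BModel n del)

data KV (n : ℕ) : Set where
  k₁ : Fin n → KV n
  k₂ : Fin n → KV n
  apex : KV n

KKModel : (n : ℕ) → Digraph (KV n)
KKModel n (k₁ i) (k₁ j) = not (i == j)
KKModel n (k₂ i) (k₂ j) = not (i == j)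
KKModel n (k₁ _) (k₂ _) = false
KKModel n (k₂ _) (k₁ _) = false
KKModel n (k₁ _) apex = true
KKModel n (k₂ _) apex = true
KKModel n apex (k₁ _) = true
KKModel n apex (k₂ _) = true
KKModel n apex apex = false

-- H_{2n} (flag = false) and H'_{2n} (flag = true, extra arc yx),
-- with |F| = |B| = m = n - 1.

data HV (m : ℕ) : Set where
  f : Fin m → HV m
  b : Fin m → HV m
  vx : HV m
  vy : HV m

H2Model : (m : ℕ) → Bool → Digraph (HV m)
H2Model m yx (f i) (f j) = not (i == j)
H2Model m yx (f i) (b j) = false
H2Model m yx (f i) vx = true
H2Model m yx (f i) vy = false
H2Model m yx (b i) (f j) = false
H2Model m yx (b i) (b j) = not (i == j)
H2Model m yx (b i) vx = true
H2Model m yx (b i) vy = true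
H2Model m yx vx (f j) = true
H2Model m yx vx (b j) = false
H2Model m yx vx vx = false
H2Model m yx vx vy = true
H2Model m yx vy (f j) = true
H2Model m yx vy (b j) = true
H2Model m yx vy vx = yx
H2Model m yx vy vy = false

Q5Model : Digraph (Fin 5)
Q5Model i j = (toℕ j ≡ᵇ (toℕ i + 1) % 5) ∨ (toℕ i ≡ᵇ (toℕ j + 1) % 5)

InExceptional : {p : ℕ} → Digraph (Fin p) → ℕ → Set
InExceptional A n =
  InCalH A n
  ⊎ InCalB A n
  ⊎ Iso A (KKModel n)
  ⊎ Iso A (H2Model (n ∸ 1) false)
  ⊎ Iso A (H2Model (n ∸ 1) true)
  ⊎ Iso A Q5Model

{-# OPTIONS --safe #-}
-- For a contradiction consider a digraph without a cycle of length N = p − 1 that is not exceptional, and a longest cycle C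
-- among those of length m < N. If s marks the positions of C with an arc to u, and t those with an arc from v, and a path
-- with h vertices off C leads from u to v, then no t-position follows an s-position within distance h, unless the resulting
-- cycle is Hamiltonian. Hence |s| + |t| + h ≤ m + 1, and with the degree conditions a path spans the vertices off C.
-- If that path can be inserted between consecutive vertices of C, counting the chords of the Hamiltonian cycle leaves
-- 𝓑(n,n) (when p = m + 2) and the pentagon. Otherwise the inequality is an equality for all h paths obtained from a
-- cycle Q through the vertices off C, so these vertices have the same neighbours on C, and C decomposes into
-- a path W and a complete P such that P and Q are exchangeable; |W| = 1 gives (K ∪ K) + K₁ and |W| = 2 gives H and H′.
-- If there are no arcs in one direction between C and Q, then the digraph lies in 𝓗(n,n).
-- All structures are described by lists of vertices, so their existence is decidable and the argument is constructive.
module Submission where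

open import Defs using (Digraph; HasCycle; indeg; outdeg; Loopless; Iso; HModel; InCalH; cross; BModel; ValidDel; InCalB;
  KV; k₁; k₂; apex; KKModel; HV; vx; vy; H2Model; Q5Model; _==_; InExceptional)
open import Data.Bool using (Bool; true; false; not; T; T?; _∧_; _∨_)
open import Data.Bool.Properties using (not-involutive) renaming (_≟_ to _≟ᵇ_)
open import Data.Nat
open import Data.Nat.Properties
open import Data.Nat.DivMod using (m%n<n; m≡m%n+[m/n]*n; m*n/n≡m; +-distrib-/-∣ʳ)
open import Data.Nat.Divisibility using (divides)
open import Data.Nat.Induction using (<-rec)
open import Data.Fin using (Fin; toℕ; fromℕ<)
import Data.Fin.Properties as FinP
open import Data.List using (List; length; _++_; applyUpTo; filterᵇ; allFin)
open import Data.List.Properties using (length-++; length-applyUpTo; length-tabulate; length-++-≤ˡ; length-++-≤ʳ)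
open import Data.List.Membership.Propositional using (_∈_; _∉_)
open import Data.List.Membership.Propositional.Properties
  using (∈-++⁺ˡ; ∈-++⁺ʳ; ∈-++⁻; ∈-applyUpTo⁺; ∈-applyUpTo⁻; ∈-allFin; ∈-filter⁺; ∈-filter⁻)
import Data.List.Membership.DecPropositional as MembershipDec
open import Data.List.Relation.Unary.Any using (here; there)
open import Data.List.Relation.Unary.All.Properties using (All¬⇒¬Any; ¬Any⇒All¬)
open import Data.List.Relation.Unary.AllPairs using ([]; _∷_)
open import Data.List.Relation.Unary.Unique.Propositional using (Unique)
import Data.List.Relation.Unary.Unique.Propositional.Properties as Uniq
import Data.List.Relation.Unary.Unique.DecPropositional as UniqueDec
open import Data.Product using (_×_; _,_; proj₁; proj₂; ∃)
open import Data.Sum using (_⊎_; inj₁; inj₂; [_,_]′)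
open import Data.Empty using (⊥; ⊥-elim)
open import Function using (_∘_; case_of_)
open import Function.Bundles using (mk↔ₛ′)
open import Relation.Nullary using (¬_; yes; no; Dec; _×-dec_; _→-dec_; ¬?)
open import Relation.Nullary.Decidable using (⌊_⌋; map′)
open import Relation.Binary.PropositionalEquality

-- The obstacle is that the length to be produced is p - 1 and not p. A path through all h vertices
-- off C that fits between consecutive vertices of C closes a Hamiltonian cycle, about which the
-- choice of C says nothing. This case is therefore refuted separately, before the inequality is
-- used at full strength. Its tool is that a chord of the Hamiltonian cycle skipping at least one
-- and at most h - 1 vertices gives a cycle with a length between m + 1 and p - 1. For h = 2 this
-- excludes only chords over one vertex, so the two vertices x, y off C are studied instead:
-- whenever c_i → x → c_{i+2}, the vertices x and c_{i+1} can be exchanged, and every rule valid for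
-- (x, y) holds for (c_{i+1}, y) on the new cycle. Outside the Hamiltonian case equality comes from
-- going around Q: the number of in-neighbours on C cannot increase from one vertex of Q to the
-- next, so it is constant. The linear inequalities are checked by Farkas certificates, the lists of
-- numbers after `lin₁` and `lin₂`.

-- Linear arithmetic over the naturals by Farkas certificates

module LinearArithmetic where

  open import Data.Nat.Tactic.RingSolver using (solve-∀)
  open import Data.Fin using (Fin; zero; suc)
  open import Data.Vec public using ([]; _∷_)
  open import Data.Vec using (Vec; zipWith; lookup; replicate; tabulate)
  open import Data.Vec.N-ary using (N-ary; _$ⁿ_)
  open import Data.List public using ([]; _∷_)
  open import Data.List.Relation.Unary.All using (All; []; _∷_)
  open import Data.List.Relation.Unary.All.Properties using (++⁺)

  infixl 6 _⊕_
  infixl 7 _⊛_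
  infix 5 _≼_ _≐_
  infixr 4 _⇛_
  infix 4 ⊢_

  -- Inequalities are reflected as syntax, so that a certificate is verified by evaluating
  -- coefficient vectors while the variables stay opaque.
  data Ex (n : ℕ) : Set where
    var : Fin n → Ex n
    κ : ℕ → Ex n
    _⊕_ : Ex n → Ex n → Ex n
    _⊛_ : ℕ → Ex n → Ex n

  data Rel (n : ℕ) : Set where
    _≼_ _≐_ : Ex n → Ex n → Rel n
    ff : Rel n

  data Prob (n : ℕ) : Set where
    _⇛_ : Rel n → Prob n → Prob n
    ⊢_ : Rel n → Prob n

  ⟦_⟧ : ∀ {n} → Ex n → Vec ℕ n → ℕ
  ⟦ var i ⟧ ρ = lookup ρ i
  ⟦ κ c ⟧ ρ = c
  ⟦ a ⊕ b ⟧ ρ = ⟦ a ⟧ ρ + ⟦ b ⟧ ρ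
  ⟦ c ⊛ a ⟧ ρ = c * ⟦ a ⟧ ρ

  ⟦_⟧ʳ : ∀ {n} → Rel n → Vec ℕ n → Set
  ⟦ a ≼ b ⟧ʳ ρ = ⟦ a ⟧ ρ ≤ ⟦ b ⟧ ρ
  ⟦ a ≐ b ⟧ʳ ρ = ⟦ a ⟧ ρ ≡ ⟦ b ⟧ ρ
  ⟦ ff ⟧ʳ ρ = ⊥

  ⟦_⟧ᵖ : ∀ {n} → Prob n → Vec ℕ n → Set
  ⟦ r ⇛ p ⟧ᵖ ρ = ⟦ r ⟧ʳ ρ → ⟦ p ⟧ᵖ ρ
  ⟦ ⊢ r ⟧ᵖ ρ = ⟦ r ⟧ʳ ρ

  private
    Form : ℕ → Set
    Form n = ℕ × Vec ℕ n

    ev : ∀ {n} → Vec ℕ n → Vec ℕ n → ℕ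
    ev [] [] = 0
    ev (a ∷ as) (x ∷ xs) = a * x + ev as xs

    val : ∀ {n} → Form n → Vec ℕ n → ℕ
    val (c , as) ρ = c + ev as ρ

    unit : ∀ {n} → Fin n → Vec ℕ n
    unit zero = 1 ∷ replicate _ 0
    unit (suc i) = 0 ∷ unit i

    comb : ∀ {n} → ℕ → Form n → Form n → Form n
    comb w (c , u) (d , v) = w * c + d , zipWith (λ s t → w * s + t) u v

    null : ∀ {n} → Form n
    null = 0 , replicate _ 0

    nf : ∀ {n} → Ex n → Form n
    nf (var i) = 0 , unit i
    nf (κ c) = c , replicate _ 0
    nf (a ⊕ b) = comb 1 (nf a) (nf b)
    nf (c ⊛ a) = comb c (nf a) null

    ev-0 : ∀ {n} (ρ : Vec ℕ n) → ev (replicate n 0) ρ ≡ 0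
    ev-0 [] = refl
    ev-0 (x ∷ ρ) = ev-0 ρ

    ev-unit : ∀ {n} (i : Fin n) ρ → ev (unit i) ρ ≡ lookup ρ i
    ev-unit zero (x ∷ ρ) = trans (cong₂ _+_ (*-identityˡ x) (ev-0 ρ)) (+-identityʳ x)
    ev-unit (suc i) (x ∷ ρ) = ev-unit i ρ

    ev-comb : ∀ {n} w (u v : Vec ℕ n) ρ → ev (zipWith (λ s t → w * s + t) u v) ρ ≡ w * ev u ρ + ev v ρ
    ev-comb w [] [] [] = sym (trans (+-identityʳ (w * 0)) (*-zeroʳ w))
    ev-comb w (s ∷ u) (t ∷ v) (x ∷ ρ) =
      trans (cong ((w * s + t) * x +_) (ev-comb w u v ρ)) (rearrange w s t x (ev u ρ) (ev v ρ))
      where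
      rearrange : ∀ w s t x e f → (w * s + t) * x + (w * e + f) ≡ w * (s * x + e) + (t * x + f)
      rearrange = solve-∀

    val-comb : ∀ {n} w (p q : Form n) ρ → val (comb w p q) ρ ≡ w * val p ρ + val q ρ
    val-comb w (c , u) (d , v) ρ =
      trans (cong (w * c + d +_) (ev-comb w u v ρ)) (rearrange w c d (ev u ρ) (ev v ρ))
      where
      rearrange : ∀ w c d e f → w * c + d + (w * e + f) ≡ w * (c + e) + (d + f)
      rearrange = solve-∀

    nf-val : ∀ {n} (e : Ex n) ρ → val (nf e) ρ ≡ ⟦ e ⟧ ρ
    nf-val (var i) ρ = ev-unit i ρ
    nf-val (κ c) ρ = trans (cong (c +_) (ev-0 ρ)) (+-identityʳ c)
    nf-val (a ⊕ b) ρ = trans (val-comb 1 (nf a) (nf b) ρ)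
      (cong₂ _+_ (trans (*-identityˡ _) (nf-val a ρ)) (nf-val b ρ))
    nf-val (c ⊛ a) ρ = trans (val-comb c (nf a) null ρ)
      (trans (cong₂ _+_ (cong (c *_) (nf-val a ρ)) (ev-0 ρ)) (+-identityʳ _))

    Ineqs : ℕ → Set
    Ineqs n = List (Ex n × Ex n)

    Holds : ∀ {n} → Vec ℕ n → Ex n × Ex n → Set
    Holds ρ (a , b) = ⟦ a ⟧ ρ ≤ ⟦ b ⟧ ρ

    lhs rhs : ∀ {n} → List ℕ → Ineqs n → Form n
    lhs (w ∷ ws) ((a , _) ∷ is) = comb w (nf a) (lhs ws is)
    lhs _ _ = null
    rhs (w ∷ ws) ((_ , b) ∷ is) = comb w (nf b) (rhs ws is)
    rhs _ _ = null

    sum-≤ : ∀ {n} ws (is : Ineqs n) ρ → All (Holds ρ) is → val (lhs ws is) ρ ≤ val (rhs ws is) ρ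
    sum-≤ [] is ρ hs = ≤-refl
    sum-≤ (w ∷ ws) [] ρ hs = ≤-refl
    sum-≤ (w ∷ ws) ((a , b) ∷ is) ρ (h ∷ hs) = subst₂ _≤_
      (sym (trans (val-comb w (nf a) (lhs ws is) ρ) (cong (λ z → w * z + val (lhs ws is) ρ) (nf-val a ρ))))
      (sym (trans (val-comb w (nf b) (rhs ws is) ρ) (cong (λ z → w * z + val (rhs ws is) ρ) (nf-val b ρ))))
      (+-mono-≤ (*-monoʳ-≤ w h) (sum-≤ ws is ρ hs))

    _≤ᵛ_ : ∀ {n} → Vec ℕ n → Vec ℕ n → Bool
    [] ≤ᵛ [] = true
    (a ∷ as) ≤ᵛ (b ∷ bs) = (a ≤ᵇ b) ∧ (as ≤ᵛ bs)

    T-∧ : ∀ {a b} → T (a ∧ b) → T a × T b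
    T-∧ {true} {true} _ = _ , _

    ≤ᵛ-sound : ∀ {n} (as bs : Vec ℕ n) ρ → T (as ≤ᵛ bs) → ev as ρ ≤ ev bs ρ
    ≤ᵛ-sound [] [] [] t = z≤n
    ≤ᵛ-sound (a ∷ as) (b ∷ bs) (x ∷ ρ) t =
      +-mono-≤ (*-monoˡ-≤ x (≤ᵇ⇒≤ a b (proj₁ (T-∧ t)))) (≤ᵛ-sound as bs ρ (proj₂ (T-∧ {a = a ≤ᵇ b} t)))

    _<ᶠ_ : ∀ {n} → Form n → Form n → Bool
    (c , as) <ᶠ (d , bs) = (suc c ≤ᵇ d) ∧ (as ≤ᵛ bs)

    -- Farkas: the weights refute the inequalities if the weighted right-hand side is termwise below the left-hand one.
    refutes : ∀ {n} → List ℕ → Ineqs n → Bool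
    refutes ws is = rhs ws is <ᶠ lhs ws is

    refutes-sound : ∀ {n} ws (is : Ineqs n) ρ → T (refutes ws is) → All (Holds ρ) is → ⊥
    refutes-sound ws is ρ t hs = <-irrefl refl (≤-trans
      (+-mono-≤ (≤ᵇ⇒≤ (suc (proj₁ (rhs ws is))) (proj₁ (lhs ws is)) (proj₁ (T-∧ t)))
                (≤ᵛ-sound (proj₂ (rhs ws is)) (proj₂ (lhs ws is)) ρ (proj₂ (T-∧ {a = suc (proj₁ (rhs ws is)) ≤ᵇ proj₁ (lhs ws is)} t))))
      (sum-≤ ws is ρ hs))

    hyp : ∀ {n} → Rel n → Ineqs n
    hyp (a ≼ b) = (a , b) ∷ []
    hyp (a ≐ b) = (a , b) ∷ (b , a) ∷ []
    hyp ff = []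

    hyp-sat : ∀ {n} (r : Rel n) ρ → ⟦ r ⟧ʳ ρ → All (Holds ρ) (hyp r)
    hyp-sat (a ≼ b) ρ h = h ∷ []
    hyp-sat (a ≐ b) ρ h = ≤-reflexive h ∷ ≤-reflexive (sym h) ∷ []
    hyp-sat ff ρ ()

    -- Over the naturals the negation of `a ≤ b` is `1 + b ≤ a`, which joins the inequalities to be
    -- refuted. An equation needs one refutation for each strict inequality, hence the two lists of
    -- weights.
    valid : ∀ {n} → List ℕ → List ℕ → Ineqs n → Prob n → Bool
    valid ws vs is (r ⇛ p) = valid ws vs (hyp r ++ is) p
    valid ws vs is (⊢ (a ≼ b)) = refutes ws ((κ 1 ⊕ b , a) ∷ is)
    valid ws vs is (⊢ (a ≐ b)) = refutes ws ((κ 1 ⊕ b , a) ∷ is) ∧ refutes vs ((κ 1 ⊕ a , b) ∷ is)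
    valid ws vs is (⊢ ff) = refutes ws is

    valid-sound : ∀ {n} ws vs (is : Ineqs n) p → T (valid ws vs is p) → ∀ ρ → All (Holds ρ) is → ⟦ p ⟧ᵖ ρ
    valid-sound ws vs is (r ⇛ p) t ρ hs h = valid-sound ws vs (hyp r ++ is) p t ρ (++⁺ (hyp-sat r ρ h) hs)
    valid-sound ws vs is (⊢ (a ≼ b)) t ρ hs =
      ≮⇒≥ λ lt → refutes-sound ws ((κ 1 ⊕ b , a) ∷ is) ρ t (lt ∷ hs)
    valid-sound ws vs is (⊢ (a ≐ b)) t ρ hs = ≤-antisym
      (≮⇒≥ λ lt → refutes-sound ws ((κ 1 ⊕ b , a) ∷ is) ρ (proj₁ (T-∧ t)) (lt ∷ hs))
      (≮⇒≥ λ lt → refutes-sound vs ((κ 1 ⊕ a , b) ∷ is) ρ (proj₂ (T-∧ {a = refutes ws ((κ 1 ⊕ b , a) ∷ is)} t)) (lt ∷ hs))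
    valid-sound ws vs is (⊢ ff) t ρ hs = refutes-sound ws is ρ t hs

  vars : ∀ {n} → Vec (Ex n) n
  vars = tabulate var

  -- The weights list the negated goal first, then the hypotheses from last to first, an equation counting twice.
  lin₂ : (ws vs : List ℕ) → ∀ {n} (ρ : Vec ℕ n) (f : N-ary n (Ex n) (Prob n)) →
    {_ : T (valid ws vs [] (f $ⁿ vars))} → ⟦ f $ⁿ vars ⟧ᵖ ρ
  lin₂ ws vs ρ f {t} = valid-sound ws vs [] (f $ⁿ vars) t ρ []

  lin₁ : (ws : List ℕ) → ∀ {n} (ρ : Vec ℕ n) (f : N-ary n (Ex n) (Prob n)) →
    {_ : T (valid ws [] [] (f $ⁿ vars))} → ⟦ f $ⁿ vars ⟧ᵖ ρ
  lin₁ ws = lin₂ ws []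

open LinearArithmetic

-- Counting positions in periodic 0-1 sequences, and the gap inequality

module Counting where

  bit : Bool → ℕ
  bit true = 1
  bit false = 0

  # : (ℕ → Bool) → ℕ → ℕ
  # f zero = 0
  # f (suc k) = bit (f 0) + # (f ∘ suc) k

  bool-cases : ∀ b → b ≡ true ⊎ b ≡ false
  bool-cases true = inj₁ refl
  bool-cases false = inj₂ refl

  ¬true : ∀ {b} → (b ≡ true → ⊥) → b ≡ false
  ¬true {true} h = ⊥-elim (h refl)
  ¬true {false} h = refl

  ¬false : ∀ {b} → (b ≡ false → ⊥) → b ≡ true
  ¬false {true} h = refl
  ¬false {false} h = ⊥-elim (h refl)

  true≢false : ∀ {b} → b ≡ true → b ≡ false → ⊥
  true≢false refl ()

  bit-true : ∀ {b} → b ≡ true → bit b ≡ 1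
  bit-true refl = refl

  bit-false : ∀ {b} → b ≡ false → bit b ≡ 0
  bit-false refl = refl

  bit≤1 : ∀ b → bit b ≤ 1
  bit≤1 true = ≤-refl
  bit≤1 false = z≤n

  bit-mono : ∀ {a b} → (a ≡ true → b ≡ true) → bit a ≤ bit b
  bit-mono {true} h rewrite h refl = ≤-refl
  bit-mono {false} h = z≤n

  #-mono : ∀ {f g} k → (∀ i → i < k → f i ≡ true → g i ≡ true) → # f k ≤ # g k
  #-mono zero h = z≤n
  #-mono (suc k) h = +-mono-≤ (bit-mono (h 0 z<s)) (#-mono k λ i lt → h (suc i) (s<s lt))

  #-cong : ∀ {f g} k → (∀ i → i < k → f i ≡ g i) → # f k ≡ # g k
  #-cong zero h = refl
  #-cong (suc k) h = cong₂ _+_ (cong bit (h 0 z<s)) (#-cong k λ i lt → h (suc i) (s<s lt))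

  #-+ : ∀ f a b → # f (a + b) ≡ # f a + # (λ i → f (a + i)) b
  #-+ f zero b = refl
  #-+ f (suc a) b = trans (cong (bit (f 0) +_) (#-+ (f ∘ suc) a b)) (sym (+-assoc (bit (f 0)) _ _))

  #-snoc : ∀ f k → # f (suc k) ≡ # f k + bit (f k)
  #-snoc f zero = +-comm (bit (f 0)) 0
  #-snoc f (suc k) = trans (cong (bit (f 0) +_) (#-snoc (f ∘ suc) k)) (sym (+-assoc (bit (f 0)) _ _))

  #≤ : ∀ f k → # f k ≤ k
  #≤ f zero = z≤n
  #≤ f (suc k) = +-mono-≤ (bit≤1 (f 0)) (#≤ (f ∘ suc) k)

  #-none : ∀ {f} k → (∀ i → i < k → f i ≡ false) → # f k ≡ 0
  #-none zero h = refl
  #-none (suc k) h = cong₂ _+_ (bit-false (h 0 z<s)) (#-none k λ i lt → h (suc i) (s<s lt))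

  #-all : ∀ {f} k → (∀ i → i < k → f i ≡ true) → # f k ≡ k
  #-all zero h = refl
  #-all (suc k) h = cong₂ _+_ (bit-true (h 0 z<s)) (#-all k λ i lt → h (suc i) (s<s lt))

  #-find : ∀ f k → 1 ≤ # f k → ∃ λ i → i < k × f i ≡ true
  #-find f (suc k) h with bool-cases (f 0)
  ... | inj₁ e = 0 , z<s , e
  ... | inj₂ e with #-find (f ∘ suc) k (subst (λ z → 1 ≤ z + # (f ∘ suc) k) (bit-false e) h)
  ... | i , lt , e′ = suc i , s<s lt , e′

  some-or-none : ∀ f k → (∃ λ i → i < k × f i ≡ true) ⊎ (∀ i → i < k → f i ≡ false)
  some-or-none f zero = inj₂ λ i ()
  some-or-none f (suc k) with bool-cases (f 0) | some-or-none (f ∘ suc) k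
  ... | inj₁ e | _ = inj₁ (0 , z<s , e)
  ... | inj₂ e | inj₁ (i , lt , e′) = inj₁ (suc i , s<s lt , e′)
  ... | inj₂ e | inj₂ n = inj₂ λ { zero _ → e ; (suc i) (s<s lt) → n i lt }

  #-1≤ : ∀ f {k} i → i < k → f i ≡ true → 1 ≤ # f k
  #-1≤ f {suc k} zero lt e rewrite e = s≤s z≤n
  #-1≤ f {suc k} (suc i) (s<s lt) e = ≤-trans (#-1≤ (f ∘ suc) i lt e) (m≤n+m _ _)

  #-2≤ : ∀ f {k} i j → i < j → j < k → f i ≡ true → f j ≡ true → 2 ≤ # f k
  #-2≤ f {suc k} zero (suc j) lt (s<s lt′) e e′ rewrite e = s≤s (#-1≤ (f ∘ suc) j lt′ e′)
  #-2≤ f {suc k} (suc i) (suc j) (s<s lt) (s<s lt′) e e′ = ≤-trans (#-2≤ (f ∘ suc) i j lt lt′ e e′) (m≤n+m _ _)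

  #-run : ∀ f {k} a z → a + z ≤ k → (∀ i → i < z → f (a + i) ≡ true) → z ≤ # f k
  #-run f {k} a z le h with m≤n⇒∃[o]m+o≡n le
  ... | o , refl rewrite #-+ f (a + z) o | #-+ f a z | #-all z h =
    (lin₁ (1 ∷ []) (# f a ∷ z ∷ # (λ i → f (a + z + i)) o ∷ []) (λ u z o → ⊢ (z ≼ u ⊕ z ⊕ o)))

  #-0 : ∀ f {k} i → # f k ≡ 0 → i < k → f i ≡ false
  #-0 f i e lt = ¬true λ e′ → <-irrefl (sym e) (#-1≤ f i lt e′)

  -- The idle positions. In most uses s and t cannot hold at the same position, so the number of
  -- idle positions is the slack in |s| + |t| ≤ k.
  nor : (ℕ → Bool) → (ℕ → Bool) → ℕ → Bool
  nor s t i = not (s i ∨ t i)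

  nor-intro : ∀ {s t} i → s i ≡ false → t i ≡ false → nor s t i ≡ true
  nor-intro i e e′ rewrite e | e′ = refl

  nor-elim : ∀ {s t} i → nor s t i ≡ false → s i ≡ false → t i ≡ true
  nor-elim i e e′ rewrite e′ = h e
    where
    h : ∀ {b} → not b ≡ false → b ≡ true
    h {true} _ = refl

  nor-true : ∀ {s t} i → nor s t i ≡ true → s i ≡ false × t i ≡ false
  nor-true {s} {t} i e = go (s i) (t i) e
    where
    go : ∀ a b → not (a ∨ b) ≡ true → a ≡ false × b ≡ false
    go false false _ = refl , refl

  #-nor : ∀ s t k → (∀ i → i < k → s i ≡ true → t i ≡ true → ⊥) → # s k + # t k + # (nor s t) k ≡ k
  #-nor s t zero h = refl
  #-nor s t (suc k) h = trans
    (lin₂ (1 ∷ []) (1 ∷ []) (bit (s 0) ∷ bit (t 0) ∷ bit (nor s t 0) ∷ # (s ∘ suc) k ∷ # (t ∘ suc) k ∷ # (nor s t ∘ suc) k ∷ []) (λ a b c x y z → ⊢ (a ⊕ x ⊕ (b ⊕ y) ⊕ (c ⊕ z) ≐ a ⊕ b ⊕ c ⊕ (x ⊕ y ⊕ z))))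
    (cong₂ _+_ (one (s 0) (t 0) (h 0 z<s)) (#-nor (s ∘ suc) (t ∘ suc) k λ i lt → h (suc i) (s<s lt)))
    where
    one : ∀ a b → (a ≡ true → b ≡ true → ⊥) → bit a + bit b + bit (not (a ∨ b)) ≡ 1
    one true true h = ⊥-elim (h refl refl)
    one true false h = refl
    one false true h = refl
    one false false h = refl

  #-not : ∀ f k → # f k + # (not ∘ f) k ≡ k
  #-not f zero = refl
  #-not f (suc k) = trans
    (lin₂ (1 ∷ []) (1 ∷ []) (bit (f 0) ∷ bit (not (f 0)) ∷ # (f ∘ suc) k ∷ # (not ∘ f ∘ suc) k ∷ []) (λ a b x y → ⊢ (a ⊕ x ⊕ (b ⊕ y) ≐ a ⊕ b ⊕ (x ⊕ y))))
    (cong₂ _+_ (one (f 0)) (#-not (f ∘ suc) k))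
    where
    one : ∀ b → bit b + bit (not b) ≡ 1
    one true = refl
    one false = refl

  #-full : ∀ f k → k ≤ # f k → ∀ i → i < k → f i ≡ true
  #-full f k le i lt = ¬false λ e → let q = #-1≤ (not ∘ f) i lt (cong not e) in
    (lin₁ (1 ∷ 1 ∷ 1 ∷ 0 ∷ []) (# f k ∷ # (not ∘ f) k ∷ k ∷ []) (λ a b n → (a ⊕ b ≐ n) ⇛ (n ≼ a) ⇛ (κ 1 ≼ b) ⇛ ⊢ (ff))) (#-not f k) le q

  #-sub : ∀ f g k → (∀ i → i < k → f i ≡ true → g i ≡ true) → # g k ≤ # f k →
    ∀ i → i < k → g i ≡ true → f i ≡ true
  #-sub f g (suc k) h le zero lt e = ¬false λ e′ →
    (lin₁ (1 ∷ 1 ∷ []) (# (f ∘ suc) k ∷ # (g ∘ suc) k ∷ []) (λ a b → (κ 1 ⊕ b ≼ κ 0 ⊕ a) ⇛ (a ≼ b) ⇛ ⊢ (ff)))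
      (subst₂ (λ x y → x + # (g ∘ suc) k ≤ y + # (f ∘ suc) k) (bit-true e) (bit-false e′) le)
      (#-mono k λ i lt → h (suc i) (s<s lt))
  #-sub f g (suc k) h le (suc i) (s<s lt) e =
    #-sub (f ∘ suc) (g ∘ suc) k (λ i lt → h (suc i) (s<s lt))
     ((lin₁ (1 ∷ 1 ∷ 1 ∷ []) (bit (f 0) ∷ bit (g 0) ∷ # (f ∘ suc) k ∷ # (g ∘ suc) k ∷ []) (λ a b x y → (b ⊕ y ≼ a ⊕ x) ⇛ (a ≼ b) ⇛ ⊢ (y ≼ x))) le (bit-mono (h 0 z<s)))
     i lt e

  Periodic : {X : Set} → ℕ → (ℕ → X) → Set
  Periodic m f = ∀ i → f (m + i) ≡ f i

  period-shift : ∀ {X : Set} {m} {f : ℕ → X} a → Periodic m f → Periodic m (λ i → f (i + a))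
  period-shift {m = m} {f} a per i = trans (cong f (+-assoc m i a)) (per (i + a))

  period-* : ∀ {X : Set} {m} {f : ℕ → X} → Periodic m f → ∀ n i → f (n * m + i) ≡ f i
  period-* per zero i = refl
  period-* {m = m} {f} per (suc n) i = trans (cong f (+-assoc m (n * m) i)) (trans (per (n * m + i)) (period-* per n i))

  #-shift : ∀ f m → f m ≡ f 0 → # (f ∘ suc) m ≡ # f m
  #-shift f m e = (lin₂ (1 ∷ 1 ∷ 0 ∷ 1 ∷ 0 ∷ []) (1 ∷ 0 ∷ 1 ∷ 0 ∷ 1 ∷ []) (bit (f 0) ∷ bit (f m) ∷ # (f ∘ suc) m ∷ # f m ∷ []) (λ a b x y → (a ⊕ x ≐ y ⊕ b) ⇛ (b ≐ a) ⇛ ⊢ (x ≐ y))) (#-snoc f m) (cong bit e)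

  #-rot : ∀ {f m} a → Periodic m f → # (λ i → f (i + a)) m ≡ # f m
  #-rot {f} {m} zero per = #-cong m λ i _ → cong f (+-identityʳ i)
  #-rot {f} {m} (suc a) per = trans (#-cong m λ i _ → cong f (+-suc i a))
    (trans (#-shift (λ i → f (i + a)) m (per a)) (#-rot a per))

  -- The last s-position before some t-position is followed by at least h positions without s.
  module Gap {m h} {s t : ℕ → Bool} (sper : Periodic m s) (tper : Periodic m t)
    (apart : ∀ i j → 1 ≤ j → j ≤ h → j ≤ m → s i ≡ true → t (j + i) ≡ true → ⊥) where

    Start : ℕ → Set
    Start σ = s σ ≡ true × h < m + 1 × (∀ e → 1 ≤ e → e ≤ h → s (e + σ) ≡ false)

    -- Well-founded recursion on the distance g to a fixed t-position. `apart` keeps that position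
    -- more than h away, so any s-position among the next h lies strictly before it and is closer to
    -- it.
    scan : ∀ g i → 1 ≤ g → g ≤ m → s i ≡ true → t (g + i) ≡ true → ∃ Start
    scan = <-rec _ step
      where
      step : ∀ g → (∀ {g′} → g′ < g → ∀ i → 1 ≤ g′ → g′ ≤ m → s i ≡ true → t (g′ + i) ≡ true → ∃ Start) →
        ∀ i → 1 ≤ g → g ≤ m → s i ≡ true → t (g + i) ≡ true → ∃ Start
      step g rec i 1≤g g≤m si tg = split (g ≤? h) (some-or-none (λ e → s (suc e + i)) h)
        where
        next : h < g → ∀ e → e < h → s (suc e + i) ≡ true → ∀ o → suc e + o ≡ g → ∃ Start
        next h<g e e<h se zero refl = ⊥-elim (<⇒≱ h<g (subst (_≤ h) (sym (+-identityʳ (suc e))) e<h))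
        next h<g e e<h se (suc o) refl = rec (m<n+m (suc o) {suc e} z<s) (suc e + i) z<s
          (≤-trans (m≤n+m (suc o) (suc e)) g≤m) se
          (subst (λ z → t z ≡ true) ((lin₂ (1 ∷ []) (1 ∷ []) (e ∷ o ∷ i ∷ []) (λ e o i → ⊢ (κ 1 ⊕ e ⊕ (κ 1 ⊕ o) ⊕ i ≐ κ 1 ⊕ o ⊕ (κ 1 ⊕ e ⊕ i))))) tg)
        split : _ → _ → ∃ Start
        split (yes g≤h) _ = ⊥-elim (apart i g 1≤g g≤h g≤m si tg)
        split (no g≰h) (inj₂ none) = i , si
          , (lin₁ (1 ∷ 1 ∷ 1 ∷ []) (g ∷ h ∷ m ∷ []) (λ g h m → (κ 1 ⊕ h ≼ g) ⇛ (g ≼ m) ⇛ ⊢ (κ 1 ⊕ h ≼ m ⊕ κ 1))) (≰⇒> g≰h) g≤m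
          , λ { (suc e) _ le → none e le }
        split (no g≰h) (inj₁ (e , e<h , se)) =
          let o , eq = m≤n⇒∃[o]m+o≡n (≤-trans e<h (<⇒≤ (≰⇒> g≰h))) in next (≰⇒> g≰h) e e<h se o eq

    find : ∀ i → s i ≡ true → 1 ≤ # t m → ∃ Start
    -- Rotating by `suc i` makes the t-position found lie between 1 and m places after i.
    find i si tne = go (#-find (λ e → t (e + suc i)) m (subst (1 ≤_) (sym (#-rot {t} {m} (suc i) tper)) tne))
      where
      go : (∃ λ e → e < m × t (e + suc i) ≡ true) → ∃ Start
      go (e , e<m , te) = scan (suc e) i z<s e<m si (subst (λ z → t z ≡ true) (+-suc e i) te)

    private
      module At (σ : ℕ) where
        s′ t′ : ℕ → Bool
        s′ j = s (j + σ)
        t′ j = t (suc j + σ)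

        tcount : # t′ m ≡ # t m
        tcount = trans (#-cong m λ j _ → cong t (sym (+-suc j σ))) (#-rot {t} {m} (suc σ) tper)

        total : 1 ≤ h → h ≤ m → # s m + # t m + # (nor s′ t′) m ≡ m
        total 1≤h h≤m = subst₂ (λ x y → x + y + # (nor s′ t′) m ≡ m) (#-rot {s} {m} σ sper) tcount
          (#-nor s′ t′ m λ j _ sj tj → apart (j + σ) 1 ≤-refl 1≤h (≤-trans 1≤h h≤m) sj tj)

        idle : s σ ≡ true → (∀ e → 1 ≤ e → e ≤ h → s (e + σ) ≡ false) →
          h ≤ m → ∀ j → suc j < h → nor s′ t′ (suc j) ≡ true
        idle sσ zs h≤m j lt = nor-intro {s′} {t′} (suc j) (zs (suc j) z<s (<⇒≤ lt))
          (¬true λ tj → apart σ (suc (suc j)) z<s lt (≤-trans lt h≤m) sσ tj)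

    -- By `apart` at distance 1, s and t shifted back by one are disjoint. The l = h - 1 positions
    -- after σ belong to neither, so |s| + |t| + (h - 1) ≤ m.
    bound : 1 ≤ h → 1 ≤ # s m → 1 ≤ # t m → # s m + # t m + h ≤ suc m
    bound 1≤h sne tne = go (#-find s m sne) (m≤n⇒∃[o]m+o≡n 1≤h)
      where
      go : (∃ λ i → i < m × s i ≡ true) → (∃ λ l → 1 + l ≡ h) → # s m + # t m + h ≤ suc m
      go (i , _ , si) (l , refl) =
        let σ , sσ , h<m+1 , zs = find i si tne
            h≤m = s≤s⁻¹ (subst (suc l <_) (+-comm m 1) h<m+1)
            open At σ
        in (lin₁ (1 ∷ 1 ∷ 1 ∷ 0 ∷ []) (# s m ∷ # t m ∷ # (nor s′ t′) m ∷ l ∷ m ∷ []) (λ a b n l m → (a ⊕ b ⊕ n ≐ m) ⇛ (l ≼ n) ⇛ ⊢ (a ⊕ b ⊕ (κ 1 ⊕ l) ≼ κ 1 ⊕ m)))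
          (total 1≤h h≤m)
          (#-run (nor s′ t′) {m} 1 l ((lin₁ (1 ∷ 1 ∷ []) (l ∷ m ∷ []) (λ l m → (κ 1 ⊕ (κ 1 ⊕ l) ≼ m ⊕ κ 1) ⇛ ⊢ (κ 1 ⊕ l ≼ m))) h<m+1) λ j j<l → idle sσ zs h≤m j (s≤s j<l))

    -- With equality the h - 1 positions just after σ are the only idle ones.
    tight : 1 ≤ h → ∀ σ → s σ ≡ true → (∀ e → 1 ≤ e → e ≤ h → s (e + σ) ≡ false) → h ≤ m →
      suc m ≤ # s m + # t m + h → ∀ j → h ≤ j → j < m → s (j + σ) ≡ false → t (suc j + σ) ≡ true
    tight 1≤h σ sσ zs h≤m eq j h≤j j<m sj = ¬false λ tj →
      go tj (m≤n⇒∃[o]m+o≡n 1≤h) (m≤n⇒∃[o]m+o≡n h≤m) (m≤n⇒∃[o]m+o≡n h≤j)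
      where
      open At σ
      go : t′ j ≡ false → (∃ λ l → 1 + l ≡ h) → (∃ λ o → h + o ≡ m) → (∃ λ i → h + i ≡ j) → ⊥
      go tj (l , refl) (o , om) (i , refl) =
        (lin₁ (1 ∷ 1 ∷ 0 ∷ 1 ∷ 1 ∷ 1 ∷ 0 ∷ []) (# s m ∷ # t m ∷ # (nor s′ t′) m ∷ # (nor s′ t′) (suc l) ∷ # (λ i → nor s′ t′ (suc l + i)) o ∷ l ∷ m ∷ []) (λ a b n n₁ n₂ l m → (a ⊕ b ⊕ n ≐ m) ⇛ (κ 1 ⊕ m ≼ a ⊕ b ⊕ (κ 1 ⊕ l)) ⇛ (n ≐ n₁ ⊕ n₂) ⇛ (l ≼ n₁) ⇛ (κ 1 ≼ n₂) ⇛ ⊢ (ff)))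
          (total 1≤h h≤m) eq (trans (cong (# (nor s′ t′)) (sym om)) (#-+ (nor s′ t′) (suc l) o))
          (#-run (nor s′ t′) {suc l} 1 l ≤-refl λ j j<l → idle sσ zs h≤m j (s≤s j<l))
          (#-1≤ (λ i → nor s′ t′ (suc l + i)) i (+-cancelˡ-< (suc l) i o (subst (suc l + i <_) (sym om) j<m))
            (nor-intro {s′} {t′} (suc l + i) sj tj))

open Counting

-- Lists of vertices, cycles as periodic sequences, and detours

module Graph where

  private variable X : Set

  ∷-unique : {x : X} {xs : List X} → x ∉ xs → Unique xs → Unique (x ∷ xs)
  ∷-unique x∉ u = ¬Any⇒All¬ _ x∉ ∷ u

  unique-∉ : {x : X} {xs : List X} → Unique (x ∷ xs) → x ∉ xs
  unique-∉ (a ∷ _) = All¬⇒¬Any a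

  unique-tail : {x : X} {xs : List X} → Unique (x ∷ xs) → Unique xs
  unique-tail (_ ∷ u) = u

  ∉-∷ : {x y : X} {xs : List X} → x ≢ y → x ∉ xs → x ∉ y ∷ xs
  ∉-∷ x≢y x∉ (here e) = x≢y e
  ∉-∷ x≢y x∉ (there e) = x∉ e

  ∉-[] : {x : X} → x ∉ []
  ∉-[] ()

  delete : {x : X} (ys : List X) → x ∈ ys → ∃ λ zs → length ys ≡ suc (length zs) × (∀ {z} → z ∈ ys → z ≢ x → z ∈ zs)
  delete (y ∷ ys) (here refl) = ys , refl , λ { (here e) z≢ → ⊥-elim (z≢ e) ; (there e) _ → e }
  delete (y ∷ ys) (there x∈) =
    let zs , eq , keep = delete ys x∈ in
    y ∷ zs , cong suc eq , λ { (here e) _ → here e ; (there e) z≢ → there (keep e z≢) }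

  length-⊆ : (xs ys : List X) → Unique xs → (∀ {x} → x ∈ xs → x ∈ ys) → length xs ≤ length ys
  length-⊆ [] ys u sub = z≤n
  length-⊆ (x ∷ xs) ys u sub =
    let zs , eq , keep = delete ys (sub (here refl)) in
    subst (suc (length xs) ≤_) (sym eq) (s≤s (length-⊆ xs zs (unique-tail u)
      λ z∈ → keep (sub (there z∈)) λ { refl → unique-∉ u z∈ }))

  cnt : (X → Bool) → List X → ℕ
  cnt f [] = 0
  cnt f (x ∷ xs) = bit (f x) + cnt f xs

  cnt-++ : (f : X → Bool) (xs ys : List X) → cnt f (xs ++ ys) ≡ cnt f xs + cnt f ys
  cnt-++ f [] ys = refl
  cnt-++ f (x ∷ xs) ys = trans (cong (bit (f x) +_) (cnt-++ f xs ys)) (sym (+-assoc (bit (f x)) _ _))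

  cnt-applyUpTo : (f : X → Bool) (g : ℕ → X) (n : ℕ) → cnt f (applyUpTo g n) ≡ # (f ∘ g) n
  cnt-applyUpTo f g zero = refl
  cnt-applyUpTo f g (suc n) = cong (bit (f (g 0)) +_) (cnt-applyUpTo f (g ∘ suc) n)

  length-filterᵇ : (f : X → Bool) (xs : List X) → length (filterᵇ f xs) ≡ cnt f xs
  length-filterᵇ f [] = refl
  length-filterᵇ f (x ∷ xs) with f x
  ... | true = cong suc (length-filterᵇ f xs)
  ... | false = length-filterᵇ f xs

  T⇒true : ∀ {b} → T b → b ≡ true
  T⇒true {true} _ = refl

  count-≤ : ∀ {p} (f : Fin p → Bool) (L : List (Fin p)) → (∀ u → f u ≡ true → u ∈ L) →
    length (filterᵇ f (allFin p)) ≤ cnt f L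
  count-≤ {p} f L cov = subst (length (filterᵇ f (allFin p)) ≤_) (length-filterᵇ f L)
    (length-⊆ _ _ (Uniq.filter⁺ (T? ∘ f) (Uniq.allFin⁺ p)) λ {u} u∈ →
      let fu = proj₂ (∈-filter⁻ (T? ∘ f) {v = u} {xs = allFin p} u∈)
      in ∈-filter⁺ (T? ∘ f) (cov u (T⇒true fu)) fu)

  _∈?_ : ∀ {p} (v : Fin p) (L : List (Fin p)) → Dec (v ∈ L)
  _∈?_ {p} = MembershipDec._∈?_ (FinP._≟_ {p})

  unique-length : ∀ {p} (L : List (Fin p)) → Unique L → length L ≤ p
  unique-length {p} L u = subst (length L ≤_) (length-tabulate {n = p} (λ i → i)) (length-⊆ L (allFin p) u λ {x} _ → ∈-allFin x)

  cover : ∀ {p} (L : List (Fin p)) → Unique L → p ≤ length L → ∀ v → v ∈ L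
  cover {p} L u le v = go (v ∈? L)
    where
    go : Dec (v ∈ L) → v ∈ L
    go (yes v∈) = v∈
    go (no v∉) = ⊥-elim (<⇒≱ (unique-length (v ∷ L) (∷-unique v∉ u)) le)

  at : X → List X → ℕ → X
  at d [] i = d
  at d (x ∷ xs) zero = x
  at d (x ∷ xs) (suc i) = at d xs i

  at-∈ : (d : X) (xs : List X) → ∀ i → i < length xs → at d xs i ∈ xs
  at-∈ d (x ∷ xs) zero lt = here refl
  at-∈ d (x ∷ xs) (suc i) (s<s lt) = there (at-∈ d xs i lt)

  ∈-at : (d : X) {x : X} (xs : List X) → x ∈ xs → ∃ λ i → i < length xs × at d xs i ≡ x
  ∈-at d (x ∷ xs) (here e) = 0 , z<s , sym e
  ∈-at d (x ∷ xs) (there e) = let i , lt , q = ∈-at d xs e in suc i , s<s lt , q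

  at-inj : (d : X) (xs : List X) → Unique xs → ∀ i j → i < length xs → j < length xs → at d xs i ≡ at d xs j → i ≡ j
  at-inj d (x ∷ xs) u zero zero _ _ e = refl
  at-inj d (x ∷ xs) u zero (suc j) _ (s<s lt) e = ⊥-elim (unique-∉ u (subst (_∈ xs) (sym e) (at-∈ d xs j lt)))
  at-inj d (x ∷ xs) u (suc i) zero (s<s lt) _ e = ⊥-elim (unique-∉ u (subst (_∈ xs) e (at-∈ d xs i lt)))
  at-inj d (x ∷ xs) u (suc i) (suc j) (s<s lt) (s<s lt′) e = cong suc (at-inj d xs (unique-tail u) i j lt lt′ e)

  at-applyUpTo : (d : X) (g : ℕ → X) (n : ℕ) → ∀ i → i < n → at d (applyUpTo g n) i ≡ g i
  at-applyUpTo d g (suc n) zero lt = refl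
  at-applyUpTo d g (suc n) (suc i) (s<s lt) = at-applyUpTo d (g ∘ suc) n i lt

  at-++ˡ : (d : X) (xs ys : List X) → ∀ i → i < length xs → at d (xs ++ ys) i ≡ at d xs i
  at-++ˡ d (x ∷ xs) ys zero lt = refl
  at-++ˡ d (x ∷ xs) ys (suc i) (s<s lt) = at-++ˡ d xs ys i lt

  at-++ʳ : (d : X) (xs ys : List X) → ∀ j → at d (xs ++ ys) (length xs + j) ≡ at d ys j
  at-++ʳ d [] ys j = refl
  at-++ʳ d (x ∷ xs) ys j = at-++ʳ d xs ys j

  cnt-at : (f : X → Bool) (d : X) (xs : List X) → cnt f xs ≡ # (λ i → f (at d xs i)) (length xs)
  cnt-at f d [] = refl
  cnt-at f d (x ∷ xs) = cong (bit (f x) +_) (cnt-at f d xs)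

  seg-unique : (g : ℕ → X) (n : ℕ) → (∀ i j → i < n → j < n → g i ≡ g j → i ≡ j) → Unique (applyUpTo g n)
  seg-unique g n inj = Uniq.applyUpTo⁺₁ g n λ {i} {j} i<j j<n e → <⇒≢ i<j (inj i j (<-trans i<j j<n) j<n e)

  ∈-seg⁻ : (g : ℕ → X) (n : ℕ) {v : X} → v ∈ applyUpTo g n → ∃ λ i → i < n × v ≡ g i
  ∈-seg⁻ g n = ∈-applyUpTo⁻ g

  ++-unique : {xs ys : List X} → Unique xs → Unique ys → (∀ {v} → v ∈ xs → v ∉ ys) → Unique (xs ++ ys)
  ++-unique u u′ d = Uniq.++⁺ u u′ λ (a , b) → d a b

  ++-unique-left : (xs : List X) {ys : List X} → Unique (xs ++ ys) → Unique xs
  ++-unique-left [] u = []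
  ++-unique-left (x ∷ xs) u = ∷-unique (λ x∈ → unique-∉ u (∈-++⁺ˡ x∈)) (++-unique-left xs (unique-tail u))

  ++-unique-right : (xs : List X) {ys : List X} → Unique (xs ++ ys) → Unique ys
  ++-unique-right [] u = u
  ++-unique-right (x ∷ xs) u = ++-unique-right xs (unique-tail u)

  ++-disjoint : (xs : List X) {ys : List X} → Unique (xs ++ ys) → ∀ {v} → v ∈ xs → v ∉ ys
  ++-disjoint (x ∷ xs) u (here refl) v∈ = unique-∉ u (∈-++⁺ʳ xs v∈)
  ++-disjoint (x ∷ xs) u (there v∈) = ++-disjoint xs (unique-tail u) v∈

  -- The remainder modulo n + 1, by recursion on i, so that consecutive values are compared by
  -- `wrap-step` without division.
  wrap : ℕ → ℕ → ℕ
  wrap n zero = 0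
  wrap n (suc i) with wrap n i ≟ n
  ... | yes _ = 0
  ... | no _ = suc (wrap n i)

  wrap-≤ : ∀ n i → wrap n i ≤ n
  wrap-≤ n zero = z≤n
  wrap-≤ n (suc i) with wrap n i ≟ n
  ... | yes _ = z≤n
  ... | no ne = ≤∧≢⇒< (wrap-≤ n i) ne

  wrap-step : ∀ n i → (wrap n i ≡ n × wrap n (suc i) ≡ 0) ⊎ (wrap n i < n × wrap n (suc i) ≡ suc (wrap n i))
  wrap-step n i with wrap n i ≟ n
  ... | yes e = inj₁ (e , refl)
  ... | no ne = inj₂ (≤∧≢⇒< (wrap-≤ n i) ne , refl)

  wrap-id : ∀ n i → i ≤ n → wrap n i ≡ i
  wrap-id n zero le = refl
  wrap-id n (suc i) le with wrap n i ≟ n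
  ... | yes e = ⊥-elim (<⇒≢ le (trans (sym (wrap-id n i (<⇒≤ le))) e))
  ... | no ne = cong suc (wrap-id n i (<⇒≤ le))

  wrap-per : ∀ n i → wrap n (suc n + i) ≡ wrap n i
  wrap-per n zero = trans (cong (wrap n ∘ suc) (+-identityʳ n)) (h (wrap-step n n))
    where
    h : _ → wrap n (suc n) ≡ 0
    h (inj₁ (_ , e)) = e
    h (inj₂ (lt , _)) = ⊥-elim (<⇒≢ lt (wrap-id n n ≤-refl))
  wrap-per n (suc i) = trans (cong (wrap n) (+-suc (suc n) i)) (h (wrap-step n (suc n + i)) (wrap-step n i))
    where
    e₀ = wrap-per n i
    h : _ → _ → wrap n (suc (suc n + i)) ≡ wrap n (suc i)
    h (inj₁ (_ , e)) (inj₁ (_ , e′)) = trans e (sym e′)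
    h (inj₁ (e , _)) (inj₂ (lt , _)) = ⊥-elim (<⇒≢ lt (trans (sym e₀) e))
    h (inj₂ (lt , _)) (inj₁ (e , _)) = ⊥-elim (<⇒≢ lt (trans e₀ e))
    h (inj₂ (_ , e)) (inj₂ (_ , e′)) = trans e (trans (cong suc e₀) (sym e′))

  wrap-periodic : ∀ {n} {f : ℕ → X} → Periodic (suc n) f → ∀ i → f i ≡ f (wrap n i)
  wrap-periodic {n = n} {f = f} per zero = refl
  wrap-periodic {n = n} {f = f} per (suc i) = go (wrap-step n i)
    where
    shifted : f (suc i) ≡ f (suc (wrap n i))
    shifted = wrap-periodic {n = n} {f = f ∘ suc} (λ j → trans (cong f (sym (+-suc (suc n) j))) (per (suc j))) i
    go : _ → f (suc i) ≡ f (wrap n (suc i))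
    go (inj₁ (e , e′)) = trans shifted (trans (cong (f ∘ suc) e) (trans (cong f (sym (+-identityʳ (suc n)))) (trans (per 0) (cong f (sym e′)))))
    go (inj₂ (_ , e′)) = trans shifted (cong f (sym e′))

  reduce : ∀ {m} → 1 ≤ m → ∀ i j → ∃ λ s → s < m × (∀ {X : Set} {f : ℕ → X} → Periodic m f → f j ≡ f (s + i))
  -- Adding i · m to j, where m = n + 1, allows i to be split off without subtraction.
  reduce {suc n} _ i j = wrap n (j + i * n) , s≤s (wrap-≤ n (j + i * n)) , λ {_} {f} per →
    trans (sym (period-* per i j)) (trans (cong f ((lin₂ (1 ∷ 1 ∷ 0 ∷ []) (1 ∷ 0 ∷ 1 ∷ []) (i * suc n ∷ i ∷ i * n ∷ j ∷ []) (λ im i k j → (im ≐ i ⊕ k) ⇛ ⊢ (im ⊕ j ≐ j ⊕ k ⊕ i))) (*-suc i n)))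
      (wrap-periodic (period-shift i per) (j + i * n)))

  at-past : (d : X) (xs : List X) → ∀ i → length xs ≤ i → at d xs i ≡ d
  at-past d [] i _ = refl
  at-past d (x ∷ xs) (suc i) (s≤s le) = at-past d xs i le

  module Cycles {p : ℕ} (A : Digraph (Fin p)) where

    V : Set
    V = Fin p

    infix 4 _⇒_
    _⇒_ : V → V → Set
    u ⇒ v = A u v ≡ true

    Walk : V → List V → V → Set
    Walk u [] v = u ⇒ v
    Walk u (x ∷ xs) v = u ⇒ x × Walk x xs v

    walk-++ : ∀ {u v w} xs {ys} → Walk u xs w → Walk w ys v → Walk u (xs ++ w ∷ ys) v
    walk-++ [] a b = a , b
    walk-++ (x ∷ xs) (a , r) b = a , walk-++ xs r b

    walk-seg : ∀ {v} (g : ℕ → V) n {ys} → (∀ i → i < n → g i ⇒ g (suc i)) → Walk (g n) ys v →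
      Walk (g 0) (applyUpTo (g ∘ suc) n ++ ys) v
    walk-seg g zero arcs w = w
    walk-seg g (suc n) arcs w = arcs 0 z<s , walk-seg (g ∘ suc) n (λ i lt → arcs (suc i) (s<s lt)) w

    walk-arcs : ∀ {v} (g : ℕ → V) n → (∀ i → i < n → g i ⇒ g (suc i)) → g n ⇒ v → Walk (g 0) (applyUpTo (g ∘ suc) n) v
    walk-arcs g zero arcs a = a
    walk-arcs g (suc n) arcs a = arcs 0 z<s , walk-arcs (g ∘ suc) n (λ i lt → arcs (suc i) (s<s lt)) a

    walk-at : ∀ {u v} d xs → Walk u xs v → ∀ i → suc i < suc (length xs) → at d (u ∷ xs) i ⇒ at d (u ∷ xs) (suc i)
    walk-at d [] w i (s<s ())
    walk-at d (x ∷ xs) (a , w) zero lt = a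
    walk-at d (x ∷ xs) (a , w) (suc i) (s<s lt) = walk-at d xs w i lt

    walk-last : ∀ {u v} d xs → Walk u xs v → at d (u ∷ xs) (length xs) ⇒ v
    walk-last d [] w = w
    walk-last d (x ∷ xs) (a , w) = walk-last d xs w

    -- Indices run over ℕ with period m instead of `Fin m`: they need no reduction, and a rotation
    -- is a shift of the argument.
    record Cyc (m : ℕ) : Set where
      field
        c : ℕ → V
        per : Periodic m c
        inj : ∀ i j → i < m → j < m → c i ≡ c j → i ≡ j
        arc : ∀ i → c i ⇒ c (suc i)

      c-m : c m ≡ c 0
      c-m = trans (cong c (sym (+-identityʳ m))) (per 0)

    open Cyc public using (c; per; inj; arc; c-m)

    rot₁ : ∀ {m} → Cyc m → Cyc m
    rot₁ {m} C = record { c = c C ∘ suc ; per = λ i → trans (cong (c C) (sym (+-suc m i))) (per C (suc i))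
                        ; inj = λ i j lt lt′ → inj₁′ i j lt lt′ ; arc = arc C ∘ suc }
      where
      inj₁′ : ∀ i j → i < m → j < m → c C (suc i) ≡ c C (suc j) → i ≡ j
      inj₁′ i j lt lt′ e = go (suc i <? m) (suc j <? m)
        where
        eqm : ∀ {k} → k < m → ¬ (suc k < m) → suc k ≡ m
        eqm lt ge = ≤-antisym lt (≮⇒≥ ge)
        zero-of : ∀ {k} → k < m → ¬ (suc k < m) → c C (suc k) ≡ c C 0
        zero-of lt ge = trans (cong (c C) (eqm lt ge)) (c-m C)
        0<m : 0 < m
        0<m = ≤-<-trans z≤n lt
        go : Dec (suc i < m) → Dec (suc j < m) → i ≡ j
        go (yes a) (yes b) = suc-injective (inj C _ _ a b e)
        go (yes a) (no b) with () ← inj C _ _ a 0<m (trans e (zero-of lt′ b))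
        go (no a) (yes b) with () ← inj C _ _ b 0<m (trans (sym e) (zero-of lt a))
        go (no a) (no b) = suc-injective (trans (eqm lt a) (sym (eqm lt′ b)))

    rot : ∀ {m} → ℕ → Cyc m → Cyc m
    rot {m} a C = record { c = λ i → c C (i + a) ; per = period-shift a (per C)
                     ; inj = inj′ a ; arc = λ i → arc C (i + a) }
      where
      iter : ℕ → Cyc m
      iter zero = C
      iter (suc a) = rot₁ (iter a)
      iter-c : ∀ a i → c (iter a) i ≡ c C (i + a)
      iter-c zero i = cong (c C) (sym (+-identityʳ i))
      iter-c (suc a) i = trans (iter-c a (suc i)) (cong (c C) (sym (+-suc i a)))
      inj′ : ∀ a i j → i < m → j < m → c C (i + a) ≡ c C (j + a) → i ≡ j
      inj′ a i j lt lt′ e = inj (iter a) i j lt lt′ (trans (iter-c a i) (trans e (sym (iter-c a j))))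

    cycle-window : ∀ {m} (C : Cyc m) i → 1 ≤ m → ∃ λ s → s < m × c C i ≡ c C s
    cycle-window {suc n} C i _ = wrap n i , s≤s (wrap-≤ n i) , wrap-periodic (per C) i

    Off : ∀ {m} → Cyc m → V → Set
    Off C x = ∀ i → c C i ≢ x

    module _ (x : V) (xs : List V) (w : Walk x xs x) (u : Unique (x ∷ xs)) where

      private
        n = length xs
        g : ℕ → V
        g = at x (x ∷ xs)

        arcs : ∀ i → g (wrap n i) ⇒ g (wrap n (suc i))
        arcs i = go (wrap-step n i)
          where
          go : _ → g (wrap n i) ⇒ g (wrap n (suc i))
          go (inj₁ (e , e′)) = subst₂ (λ a b → g a ⇒ g b) (sym e) (sym e′) (walk-last x xs w)
          go (inj₂ (lt , e′)) = subst (λ b → g (wrap n i) ⇒ g b) (sym e′) (walk-at x xs w (wrap n i) (s<s lt))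

      closed : Cyc (suc n)
      closed = record
        { c = λ i → g (wrap n i)
        ; per = λ i → cong g (wrap-per n i)
        ; inj = λ i j lt lt′ e → trans (sym (wrap-id n i (s≤s⁻¹ lt))) (trans
            (at-inj x (x ∷ xs) u _ _ (s≤s (wrap-≤ n i)) (s≤s (wrap-≤ n j)) e) (wrap-id n j (s≤s⁻¹ lt′)))
        ; arc = arcs }

    close : ∀ {m} x xs → suc (length xs) ≡ m → Walk x xs x → Unique (x ∷ xs) → Cyc m
    close x xs refl w u = closed x xs w u

    close-at : ∀ {m} x xs (e : suc (length xs) ≡ m) w u → ∀ i → i < m → c (close x xs e w u) i ≡ at x (x ∷ xs) i
    close-at x xs refl w u i lt = cong (at x (x ∷ xs)) (wrap-id (length xs) i (s≤s⁻¹ lt))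

    close-# : ∀ {m} (f : V → Bool) x xs (e : suc (length xs) ≡ m) w u → # (λ i → f (c (close x xs e w u) i)) m ≡ cnt f (x ∷ xs)
    close-# f x xs refl w u = trans (#-cong (suc (length xs)) λ i lt → cong f (close-at x xs refl w u i lt)) (sym (cnt-at f x (x ∷ xs)))

    module _ {m} (C : Cyc m) where

      arcs-unique : ∀ a n → n ≤ m → Unique (applyUpTo (λ i → c C (i + a)) n)
      arcs-unique a n n≤m = seg-unique _ n λ i j lt lt′ → inj (rot a C) i j (≤-trans lt n≤m) (≤-trans lt′ n≤m)

      -- The cycle c₀ Q c_k c_{k+1} … c₀, listed from c_k on.
      module Detour (k r : ℕ) (k+r : k + r ≡ m) (1≤k : 1 ≤ k) (Q : List V) (w : Walk (c C 0) Q (c C k)) (u : Unique Q)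
        (off : ∀ i → i ≤ r → c C (i + k) ∉ Q) where

        -- As k + r = m, the last vertex listed is c_m = c₀, where Q starts.
        rest : List V
        rest = applyUpTo (λ i → c C (suc i + k)) r

        private
          r<m : suc r ≤ m
          r<m = subst (suc r ≤_) k+r (+-monoˡ-≤ r 1≤k)

        detour-walk : Walk (c C k) (rest ++ Q) (c C k)
        detour-walk = walk-seg (λ i → c C (i + k)) r (λ i _ → arc C (i + k))
          (subst (λ z → Walk z Q (c C k)) (sym (trans (cong (c C) (trans (+-comm r k) k+r)) (c-m C))) w)

        detour-unique : Unique (c C k ∷ rest ++ Q)
        detour-unique = ++-unique (arcs-unique k (suc r) r<m) u λ v∈ v∈Q →
          let i , lt , e = ∈-seg⁻ (λ i → c C (i + k)) (suc r) v∈ in off i (s≤s⁻¹ lt) (subst (_∈ Q) e v∈Q)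

        length-detour : suc (length (rest ++ Q)) ≡ suc r + length Q
        length-detour = cong suc (trans (length-++ rest) (cong (_+ length Q) (length-applyUpTo _ r)))

        detour : ∀ {n} → suc r + length Q ≡ n → Cyc n
        detour e = close (c C k) (rest ++ Q) (trans length-detour e) detour-walk detour-unique

        detour-old : ∀ {n} (e : suc r + length Q ≡ n) i → i ≤ r → c (detour e) i ≡ c C (i + k)
        detour-old e i le = trans
          (close-at _ (rest ++ Q) (trans length-detour e) detour-walk detour-unique i (subst (i <_) e (≤-trans (s≤s le) (m≤m+n (suc r) (length Q)))))
          (trans (at-++ˡ _ (applyUpTo (λ i → c C (i + k)) (suc r)) Q i (subst (i <_) (sym (length-applyUpTo (λ i → c C (i + k)) (suc r))) (s≤s le)))
                 (at-applyUpTo _ (λ i → c C (i + k)) (suc r) i (s≤s le)))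

        detour-new : ∀ {n} (e : suc r + length Q ≡ n) j → j < length Q → c (detour e) (suc r + j) ≡ at (c C k) Q j
        detour-new e j lt = trans
          (close-at _ (rest ++ Q) (trans length-detour e) detour-walk detour-unique (suc r + j) (subst (suc r + j <_) e (+-monoʳ-< (suc r) lt)))
          (trans (cong (at (c C k) (c C k ∷ rest ++ Q)) (cong (_+ j) (sym (length-applyUpTo (λ i → c C (i + k)) (suc r)))))
                 (at-++ʳ _ (applyUpTo (λ i → c C (i + k)) (suc r)) Q j))

        detour-# : ∀ {n} (f : V → Bool) (e : suc r + length Q ≡ n) →
          # (λ i → f (c (detour e) i)) n ≡ # (λ i → f (c C (i + k))) (suc r) + cnt f Q
        detour-# f e = trans (close-# f _ (rest ++ Q) (trans length-detour e) detour-walk detour-unique)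
          (trans (cnt-++ f (applyUpTo (λ i → c C (i + k)) (suc r)) Q) (cong (_+ cnt f Q) (cnt-applyUpTo f (λ i → c C (i + k)) (suc r))))

    OffL : ∀ {m} → Cyc m → List V → Set
    OffL C Q = ∀ i → c C i ∉ Q

    -- The encoding makes u and v the ends of Q without mentioning its first and last entry, and
    -- treats a single vertex like any other path.
    Path : V → List V → V → Set
    Path u Q v = ∀ {a b} → a ⇒ u → v ⇒ b → Walk a Q b

    inC outC : ∀ {m} → Cyc m → V → ℕ
    inC {m} C v = # (λ i → A (c C i) v) m
    outC {m} C v = # (λ i → A v (c C i)) m

    -- Here l counts arcs; the path has l + 1 vertices, and a path through all vertices off C
    -- satisfies m + (l + 1) = p.
    record FPath {m : ℕ} (C : Cyc m) (l : ℕ) : Set where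
      field
        q : ℕ → V
        q-inj : ∀ i j → i ≤ l → j ≤ l → q i ≡ q j → i ≡ j
        q-arc : ∀ i → i < l → q i ⇒ q (suc i)
        q-off : ∀ i → i ≤ l → Off C (q i)

      whole : List V
      whole = applyUpTo q (suc l)

      length-whole : length whole ≡ suc l
      length-whole = length-applyUpTo q (suc l)

      whole-unique : Unique whole
      whole-unique = seg-unique q (suc l) λ i j lt lt′ → q-inj i j (s≤s⁻¹ lt) (s≤s⁻¹ lt′)

      whole-off : OffL C whole
      whole-off k v∈ = let i , lt , e = ∈-seg⁻ q (suc l) v∈ in q-off i (s≤s⁻¹ lt) k e

      whole-path : Path (q 0) whole (q l)
      whole-path a b = a , walk-arcs q l q-arc b

      inP outP : V → ℕ
      inP v = # (λ i → A (q i) v) (suc l)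
      outP v = # (λ i → A v (q i)) (suc l)

    cycle-path : ∀ {m l} (C : Cyc m) (Q : Cyc (suc l)) → (∀ i → Off C (c Q i)) → ℕ → FPath C l
    cycle-path C Q off a = record { q = λ i → c Q (i + a) ; q-inj = λ i j le le′ → inj (rot a Q) i j (s≤s le) (s≤s le′)
      ; q-arc = λ i _ → arc Q (i + a) ; q-off = λ i _ → off (i + a) }

    module Self (loopless : ∀ v → A v v ≡ false) where

      in-self : ∀ {n} (Q : Cyc (suc n)) i → inC Q (c Q i) ≡ # (λ k → A (c Q (suc k + i)) (c Q i)) n
      in-self {n} Q i = trans (sym (#-rot {λ k → A (c Q k) (c Q i)} {suc n} i (λ k → cong (λ z → A z (c Q i)) (per Q k))))
        (cong (λ z → bit z + # (λ k → A (c Q (suc k + i)) (c Q i)) n) (loopless _))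

      out-self : ∀ {n} (Q : Cyc (suc n)) i → outC Q (c Q i) ≡ # (λ k → A (c Q i) (c Q (suc k + i))) n
      out-self {n} Q i = trans (sym (#-rot {λ k → A (c Q i) (c Q k)} {suc n} i (λ k → cong (A (c Q i)) (per Q k))))
        (cong (λ z → bit z + # (λ k → A (c Q i) (c Q (suc k + i))) n) (loopless _))

      full-in : ∀ {m} (Q : Cyc m) n → suc n ≡ m → ∀ i → n ≤ inC Q (c Q i) → ∀ j → c Q j ≢ c Q i → c Q j ⇒ c Q i
      full-in Q n refl i le j ne = let s , lt , f = reduce (s≤s z≤n) i j in go s lt (f (per Q))
        where
        go : ∀ s → s < suc n → c Q j ≡ c Q (s + i) → c Q j ⇒ c Q i
        go zero _ e = ⊥-elim (ne e)
        go (suc s) lt e = subst (_⇒ c Q i) (sym e) (#-full _ n (subst (n ≤_) (in-self Q i) le) s (s≤s⁻¹ lt))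

      full-out : ∀ {m} (Q : Cyc m) n → suc n ≡ m → ∀ i → n ≤ outC Q (c Q i) → ∀ j → c Q j ≢ c Q i → c Q i ⇒ c Q j
      full-out Q n refl i le j ne = let s , lt , f = reduce (s≤s z≤n) i j in go s lt (f (per Q))
        where
        go : ∀ s → s < suc n → c Q j ≡ c Q (s + i) → c Q i ⇒ c Q j
        go zero _ e = ⊥-elim (ne e)
        go (suc s) lt e = subst (c Q i ⇒_) (sym e) (#-full _ n (subst (n ≤_) (out-self Q i) le) s (s≤s⁻¹ lt))

    cyc⇒HasCycle : ∀ {n} → Cyc n → 1 ≤ n → HasCycle A n
    cyc⇒HasCycle {suc n} C _ = c C ∘ toℕ
      , (λ {i} {j} e → FinP.toℕ-injective (inj C _ _ (FinP.toℕ<n i) (FinP.toℕ<n j) e))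
      , (λ i → subst (λ z → c C z ⇒ c C (suc (toℕ i))) (sym (FinP.toℕ-inject₁ i)) (arc C (toℕ i)))
      , subst₂ _⇒_ (cong (c C) (sym (FinP.toℕ-fromℕ n))) (c-m C) (arc C n)

-- The equality case of the gap inequality

module TightGaps where

  open Graph using (reduce)

  Apart : ℕ → ℕ → (ℕ → Bool) → (ℕ → Bool) → Set
  Apart m h s t = ∀ i j → 1 ≤ j → j ≤ h → j ≤ m → s i ≡ true → t (j + i) ≡ true → ⊥

  ≡-from-⇒ : ∀ {a b} → (a ≡ true → b ≡ true) → (b ≡ true → a ≡ true) → a ≡ b
  ≡-from-⇒ {true} f g = sym (f refl)
  ≡-from-⇒ {false} {true} f g = g refl
  ≡-from-⇒ {false} {false} f g = refl

  module _ {m : ℕ} (1≤m : 1 ≤ m) where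

    equal-sets : ∀ {f g : ℕ → Bool} σ → Periodic m f → Periodic m g → # f m ≡ # g m →
      (∀ i → i < m → f (i + σ) ≡ true → g (i + σ) ≡ true) → ∀ k → f k ≡ g k
    equal-sets {f} {g} σ fp gp eq sub k = let i , lt , h = reduce 1≤m σ k in
      trans (h fp) (trans (≡-from-⇒ (sub i lt) (back i lt)) (sym (h gp)))
      where
      back : ∀ i → i < m → g (i + σ) ≡ true → f (i + σ) ≡ true
      back = #-sub (λ i → f (i + σ)) (λ i → g (i + σ)) m sub
        (≤-reflexive (trans (#-rot {g} {m} σ gp) (trans (sym eq) (sym (#-rot {f} {m} σ fp)))))

  module Extremal {m h : ℕ} {s t : ℕ → Bool} (sp : Periodic m s) (tp : Periodic m t) (1≤h : 1 ≤ h)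
    (apart : Apart m h s t) (s≥1 : 1 ≤ # s m) (t≥1 : 1 ≤ # t m) (tot : # s m + # t m + h ≡ suc m) where

    h<m : h < m
    h<m = (lin₁ (1 ∷ 1 ∷ 1 ∷ 1 ∷ 0 ∷ []) (# s m ∷ # t m ∷ h ∷ m ∷ []) (λ a b h m → (a ⊕ b ⊕ h ≐ κ 1 ⊕ m) ⇛ (κ 1 ≼ a) ⇛ (κ 1 ≼ b) ⇛ ⊢ (κ 1 ⊕ h ≼ m))) tot s≥1 t≥1

    1≤m : 1 ≤ m
    1≤m = ≤-trans (s≤s z≤n) h<m

    private
      module G = Gap {m} {h} {s} {t} sp tp apart

    start : ∃ λ σ → s σ ≡ true × (∀ e → 1 ≤ e → e ≤ h → s (e + σ) ≡ false)
    start = let i , _ , si = #-find s m s≥1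
                σ , sσ , _ , z = G.find i si t≥1 in σ , sσ , z

    module At (σ : ℕ) (sσ : s σ ≡ true) (zs : ∀ e → 1 ≤ e → e ≤ h → s (e + σ) ≡ false) where

      t-zero : ∀ e → 1 ≤ e → e ≤ h → t (e + σ) ≡ false
      t-zero e 1≤e e≤h = ¬true λ a → apart σ e 1≤e e≤h (<⇒≤ (≤-<-trans e≤h h<m)) sσ a

      t-next : ∀ j → h ≤ j → j < m → s (j + σ) ≡ false → t (suc j + σ) ≡ true
      t-next = G.tight 1≤h σ sσ zs (<⇒≤ h<m) (≤-reflexive (sym tot))

      t-not : ∀ j → h ≤ j → j < m → t (suc j + σ) ≡ not (s (j + σ))
      t-not j h≤j j<m = go (bool-cases (s (j + σ)))
        where
        go : _ → t (suc j + σ) ≡ not (s (j + σ))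
        go (inj₁ a) = trans (¬true λ b → apart (j + σ) 1 ≤-refl 1≤h 1≤m a b) (cong not (sym a))
        go (inj₂ a) = trans (t-next j h≤j j<m a) (cong not (sym a))

      -- If s stopped after j, `t-next` would put a t-position at distance 2 from the s-position j.
      -- Beyond offset h the s-positions therefore form a final interval.
      up-closed : 2 ≤ h → ∀ j → h < j → suc j ≤ m → s (j + σ) ≡ true → s (suc j + σ) ≡ true
      up-closed 2≤h j h<j j<m a = ¬false λ b → go b (suc j ≟ m)
        where
        go : s (suc j + σ) ≡ false → Dec (suc j ≡ m) → ⊥
        go b (yes refl) = true≢false sσ (trans (sym (sp σ)) b)
        go b (no ne) = apart (j + σ) 2 (s≤s z≤n) 2≤h (≤-trans 2≤h (<⇒≤ h<m)) a (t-next (suc j) (<⇒≤ (m≤n⇒m≤1+n h<j)) (≤∧≢⇒< j<m ne) b)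

    -- The sequence t alone determines s. An s′-position has no t-position within distance h after
    -- it, whereas every position outside s has one: t holds at offset h + 1 for the offsets 1 to h,
    -- and directly afterwards for the later ones. So s′ is contained in s, and the sizes agree.
    same-s : ∀ {s′} → Periodic m s′ → Apart m h s′ t → # s′ m ≡ # s m → ∀ k → s′ k ≡ s k
    same-s {s′} sp′ apart′ eq = let σ , sσ , zs = start in equal-sets 1≤m (suc σ) sp′ sp eq (sub σ sσ zs)
      where
      module _ (σ : ℕ) (sσ : s σ ≡ true) (zs : ∀ e → 1 ≤ e → e ≤ h → s (e + σ) ≡ false) where
        open At σ sσ zs
        sub : ∀ i → i < m → s′ (i + suc σ) ≡ true → s (i + suc σ) ≡ true
        sub i lt a = subst (λ z → s z ≡ true) (sym (+-suc i σ)) (go (subst (λ z → s′ z ≡ true) (+-suc i σ) a) (suc i ≤? h) (suc i ≟ m))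
          where
          early : ∀ o → suc i + o ≡ h → s′ (suc i + σ) ≡ true → ⊥
          early o e a = apart′ (suc i + σ) (suc o) (s≤s z≤n) ((lin₁ (1 ∷ 1 ∷ 0 ∷ []) (i ∷ o ∷ h ∷ []) (λ i o h → (κ 1 ⊕ i ⊕ o ≐ h) ⇛ ⊢ (κ 1 ⊕ o ≼ h))) e)
            ((lin₁ (1 ∷ 1 ∷ 1 ∷ 0 ∷ []) (i ∷ o ∷ h ∷ m ∷ []) (λ i o h m → (κ 1 ⊕ i ⊕ o ≐ h) ⇛ (κ 1 ⊕ h ≼ m) ⇛ ⊢ (κ 1 ⊕ o ≼ m))) e h<m) a
            (subst (λ z → t z ≡ true) ((lin₂ (1 ∷ 0 ∷ 1 ∷ []) (1 ∷ 1 ∷ 0 ∷ []) (i ∷ o ∷ h ∷ σ ∷ []) (λ i o h σ → (κ 1 ⊕ i ⊕ o ≐ h) ⇛ ⊢ (κ 1 ⊕ h ⊕ σ ≐ κ 1 ⊕ o ⊕ (κ 1 ⊕ i ⊕ σ)))) e) (t-next h ≤-refl h<m (zs h 1≤h ≤-refl)))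
          go : s′ (suc i + σ) ≡ true → Dec (suc i ≤ h) → Dec (suc i ≡ m) → s (suc i + σ) ≡ true
          go a (yes le) _ = ⊥-elim (let o , e = m≤n⇒∃[o]m+o≡n le in early o e a)
          go a (no _) (yes refl) = trans (sp σ) sσ
          go a (no ≰) (no ne) = ¬false λ b → apart′ (suc i + σ) 1 ≤-refl 1≤h 1≤m a (t-next (suc i) (<⇒≤ (≰⇒> ≰)) (≤∧≢⇒< lt ne) b)

    -- Dually, s excludes the offsets 1 to h after σ and the successors of its own positions; at
    -- every other position t holds by `t-next`.
    same-t : ∀ {t′} → Periodic m t′ → Apart m h s t′ → # t′ m ≡ # t m → ∀ k → t′ k ≡ t k
    same-t {t′} tp′ apart′ eq = let σ , sσ , zs = start in equal-sets 1≤m (suc σ) tp′ tp eq (sub σ sσ zs)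
      where
      module _ (σ : ℕ) (sσ : s σ ≡ true) (zs : ∀ e → 1 ≤ e → e ≤ h → s (e + σ) ≡ false) where
        open At σ sσ zs
        sub : ∀ i → i < m → t′ (i + suc σ) ≡ true → t (i + suc σ) ≡ true
        sub i lt a = subst (λ z → t z ≡ true) (sym (+-suc i σ)) (go (subst (λ z → t′ z ≡ true) (+-suc i σ) a) (suc i ≤? h))
          where
          go : t′ (suc i + σ) ≡ true → Dec (suc i ≤ h) → t (suc i + σ) ≡ true
          go a (yes le) = ⊥-elim (apart′ σ (suc i) (s≤s z≤n) le lt sσ a)
          go a (no ≰) = t-next i (s≤s⁻¹ (≰⇒> ≰)) lt (¬true λ b → apart′ (i + σ) 1 ≤-refl 1≤h 1≤m b a)

  -- For h = 2 there are only two vertices off C, and each of them alone also gives a restriction.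
  module Pair {m : ℕ} {s t s′ t′ : ℕ → Bool} (sp : Periodic m s) (tp : Periodic m t) (sp′ : Periodic m s′) (tp′ : Periodic m t′)
    (st : Apart m 2 s t) (s′t′ : Apart m 2 s′ t′) (s′t : Apart m 1 s′ t) (st′ : Apart m 1 s t′)
    (s≥1 : 1 ≤ # s m) (t≥1 : 1 ≤ # t m) (tot : # s m + # t m + 2 ≡ suc m) (s-eq : # s′ m ≡ # s m) (t-eq : # t′ m ≡ # t m) where

    open Extremal {m} {2} {s} {t} sp tp (s≤s z≤n) st s≥1 t≥1 tot

    private
      module _ (σ : ℕ) (sσ : s σ ≡ true) (zs : ∀ e → 1 ≤ e → e ≤ 2 → s (e + σ) ≡ false) where
        open At σ sσ zs

        s′2 : s′ (2 + σ) ≡ false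
        s′2 = ¬true λ a → s′t (2 + σ) 1 ≤-refl ≤-refl 1≤m a (t-next 2 ≤-refl h<m (zs 2 (s≤s z≤n) ≤-refl))

        late : ∀ j → 2 ≤ j → j < m → s′ (j + σ) ≡ true → s (j + σ) ≡ true
        late j le lt a = ¬false λ b → s′t (j + σ) 1 ≤-refl ≤-refl 1≤m a (t-next j le lt b)

        -- Offset 1 is the only place where s′ could leave s. If it did, offset 2 would be the
        -- single idle position of the pair s′, t′, so that s would be contained in s′ and hence
        -- equal to it, although s is false at offset 1.
        s′1 : s′ (1 + σ) ≡ false
        s′1 = ¬true λ a → true≢false (trans (sym (eq a (1 + σ))) a) (zs 1 ≤-refl (s≤s z≤n))
          where
          module _ (a : s′ (1 + σ) ≡ true) where
            f g : ℕ → Bool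
            f i = s′ (i + (2 + σ))
            g i = t′ (suc i + (2 + σ))
            t′3 : t′ (3 + σ) ≡ false
            t′3 = ¬true λ b → s′t′ (1 + σ) 2 (s≤s z≤n) ≤-refl (<⇒≤ h<m) a b
            count : # f m + # g m + # (nor f g) m ≡ m
            count = #-nor f g m λ i _ p q → s′t′ (i + (2 + σ)) 1 ≤-refl (s≤s z≤n) 1≤m p q
            f-eq : # f m ≡ # s m
            f-eq = trans (#-rot {s′} {m} (2 + σ) sp′) s-eq
            g-eq : # g m ≡ # t m
            g-eq = trans (#-cong m λ i _ → cong t′ (sym (+-suc i (2 + σ)))) (trans (#-rot {t′} {m} (3 + σ) tp′) t-eq)
            only : ∀ i → 1 ≤ i → i < m → f i ≡ false → g i ≡ true
            only i 1≤i lt p = ¬false λ q → <⇒≱ (#-2≤ (nor f g) 0 i 1≤i lt (nor-intro {f} {g} 0 s′2 t′3) (nor-intro {f} {g} i p q))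
              ((lin₁ (1 ∷ 1 ∷ 0 ∷ 0 ∷ 1 ∷ 0 ∷ 1 ∷ 0 ∷ 1 ∷ []) (# s m ∷ # t m ∷ # f m ∷ # g m ∷ # (nor f g) m ∷ m ∷ []) (λ a b f g n m → (a ⊕ b ⊕ κ 2 ≐ κ 1 ⊕ m) ⇛ (f ≐ a) ⇛ (g ≐ b) ⇛ (f ⊕ g ⊕ n ≐ m) ⇛ ⊢ (n ≼ κ 1))) tot f-eq g-eq count)
            sub : ∀ i → i < m → s (i + (2 + σ)) ≡ true → s′ (i + (2 + σ)) ≡ true
            sub zero lt p = ⊥-elim (true≢false p (zs 2 (s≤s z≤n) ≤-refl))
            sub (suc i) lt p = ¬false λ q → st′ (suc i + (2 + σ)) 1 ≤-refl ≤-refl 1≤m p (only (suc i) (s≤s z≤n) lt q)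
            eq : ∀ k → s′ k ≡ s k
            eq k = sym (equal-sets 1≤m (2 + σ) sp sp′ (sym s-eq) sub k)

        sub : ∀ i → i < m → s′ (i + suc σ) ≡ true → s (i + suc σ) ≡ true
        sub zero lt a = ⊥-elim (true≢false a s′1)
        sub (suc i) lt a = subst (λ z → s z ≡ true) (sym (+-suc (suc i) σ)) (go (subst (λ z → s′ z ≡ true) (+-suc (suc i) σ) a) (2 + i ≟ m))
          where
          go : s′ (2 + i + σ) ≡ true → Dec (2 + i ≡ m) → s (2 + i + σ) ≡ true
          go a (yes refl) = trans (sp σ) sσ
          go a (no ne) = late (2 + i) (s≤s (s≤s z≤n)) (≤∧≢⇒< lt ne) a

    same : ∀ k → s′ k ≡ s k
    same = let σ , sσ , zs = start in equal-sets 1≤m (suc σ) sp′ sp s-eq (sub σ sσ zs)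

-- The exceptional digraphs as lists of vertices, and the supposed counterexample

module Setup where

  open Graph

  module Structures {p : ℕ} (A : Digraph (Fin p)) where
    open Cycles A

    Complete : List V → Set
    Complete xs = ∀ {u v} → u ∈ xs → v ∈ xs → u ≢ v → A u v ≡ true

    NoArc Joined : List V → List V → Set
    NoArc xs ys = ∀ {u v} → u ∈ xs → v ∈ ys → A u v ≡ false
    Joined xs ys = ∀ {u v} → u ∈ xs → v ∈ ys → A u v ≡ true

    Spanning : List V → Set
    Spanning xs = Unique xs × length xs ≡ p

    -- The arcs from F to B that `ValidH` asks for are obtained from the degree condition when the
    -- isomorphism is built.
    record IsH (F B : List V) : Set where
      field
        spanning : Spanning (F ++ B)
        balanced : length F ≡ length B
        F-complete : Complete F
        B-complete : Complete B
        no-back : NoArc B F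

    -- The deleted arcs are the arcs missing between X and Y; the degree condition makes them
    -- vertex-disjoint.
    record IsB (X Y : List V) : Set where
      field
        spanning : Spanning (X ++ Y)
        balanced : length X ≡ length Y
        X-independent : NoArc X X
        Y-independent : NoArc Y Y

    record IsK (F B : List V) (a : V) : Set where
      field
        spanning : Spanning (a ∷ F ++ B)
        balanced : length F ≡ length B
        F-complete : Complete F
        B-complete : Complete B
        F-B : NoArc F B
        B-F : NoArc B F
        to-a : Joined (F ++ B) (a ∷ [])
        from-a : Joined (a ∷ []) (F ++ B)

    -- The arc from y to x is left open, so that H and H′ are treated together.
    record IsH2 (F B : List V) (x y : V) : Set where
      field
        spanning : Spanning (x ∷ y ∷ F ++ B)
        balanced : length F ≡ length B
        F-complete : Complete F
        B-complete : Complete B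
        F-B : NoArc F B
        B-F : NoArc B F
        F-x : Joined F (x ∷ [])
        F-y : NoArc F (y ∷ [])
        B-xy : Joined B (x ∷ y ∷ [])
        x-F : Joined (x ∷ []) F
        x-B : NoArc (x ∷ []) B
        x-y : A x y ≡ true
        y-FB : Joined (y ∷ []) (F ++ B)

    -- Modulo 5 the index `4 + i` is the predecessor of i, so `back` makes every arc of C symmetric.
    record IsQ (C : Cyc 5) : Set where
      field
        p≡5 : p ≡ 5
        back : ∀ i → A (c C i) (c C (4 + i)) ≡ true
        no-chord : ∀ i → A (c C i) (c C (2 + i)) ≡ false × A (c C i) (c C (3 + i)) ≡ false

  -- Written with p = N + 1, so that N is the forbidden length and the half-degree conditions become
  -- N ≤ 2 d + 1.
  record Counterexample {N : ℕ} (A : Digraph (Fin (suc N))) : Set where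
    open Cycles A
    open Structures A
    field
      loopless : ∀ v → A v v ≡ false
      order : 4 ≤ N
      deg-in : ∀ v → N ≤ 2 * indeg A v + 1
      deg-out : ∀ v → N ≤ 2 * outdeg A v + 1
      deg : ∀ v → N ≤ indeg A v + outdeg A v
      noC : Cyc N → ⊥
      noH : ∀ F B → IsH F B → ⊥
      noB : ∀ X Y → IsB X Y → ⊥
      noK : ∀ F B a → IsK F B a → ⊥
      noH2 : ∀ F B x y → IsH2 F B x y → ⊥
      noQ : ∀ C → IsQ C → ⊥

    loop-free : ∀ {u v} → u ⇒ v → u ≢ v
    loop-free e refl = true≢false e (loopless _)

    indeg≤ : ∀ v L → (∀ u → u ⇒ v → u ∈ L) → indeg A v ≤ cnt (λ u → A u v) L
    indeg≤ v L = count-≤ (λ u → A u v) L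

    outdeg≤ : ∀ v L → (∀ u → v ⇒ u → u ∈ L) → outdeg A v ≤ cnt (λ u → A v u) L
    outdeg≤ v L = count-≤ (λ u → A v u) L

open Setup using (Counterexample)

-- Two vertices x and y off a cycle of length p - 2

module Configuration {N : ℕ} (A : Digraph (Fin (suc N))) (S : Counterexample A) (m : ℕ) (N≡ : N ≡ suc m) where

  open Graph hiding (reduce)
  open Cycles A
  open Counterexample S

  1<m : 3 ≤ m
  1<m = s≤s⁻¹ (subst (4 ≤_) N≡ order)

  -- As N = m + 1, the vertices x and y are the only ones off C.
  record Conf : Set where
    field
      C : Cyc m
      x y : V
      x∉ : Off C x
      y∉ : Off C y
      x≢y : x ≢ y

    α β γ δ : ℕ → Bool
    α i = A (c C i) x
    β i = A x (c C i)
    γ i = A (c C i) y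
    δ i = A y (c C i)

    α-per : Periodic m α
    α-per i = cong (λ z → A z x) (per C i)
    β-per : Periodic m β
    β-per i = cong (A x) (per C i)
    γ-per : Periodic m γ
    γ-per i = cong (λ z → A z y) (per C i)
    δ-per : Periodic m δ
    δ-per i = cong (A y) (per C i)

  rotK : ℕ → Conf → Conf
  rotK a K = record { C = rot a C ; x = x ; y = y ; x∉ = λ i → x∉ (i + a) ; y∉ = λ i → y∉ (i + a) ; x≢y = x≢y }
    where open Conf K

  flipK : Conf → Conf
  flipK K = record { C = C ; x = y ; y = x ; x∉ = y∉ ; y∉ = x∉ ; x≢y = x≢y ∘ sym }
    where open Conf K

  pair-unique : {u v : V} → u ≢ v → Unique (u ∷ v ∷ [])
  pair-unique u≢v = ∷-unique (∉-∷ u≢v ∉-[]) (∷-unique ∉-[] [])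

  one-unique : {u : V} → Unique (u ∷ [])
  one-unique = ∷-unique ∉-[] []

  periodic-suc : ∀ {f : ℕ → Bool} → Periodic m f → # (f ∘ suc) m ≡ # f m
  periodic-suc {f} per = #-shift f m (trans (cong f (sym (+-identityʳ m))) (per 0))

  periodic-suc² : ∀ {f : ℕ → Bool} → Periodic m f → # (λ i → f (2 + i)) m ≡ # f m
  periodic-suc² {f} per = trans (periodic-suc {f ∘ suc} λ i → trans (cong f (sym (+-suc m i))) (per (suc i))) (periodic-suc {f} per)

  reduce : ∀ i j → ∃ λ s → s < m × (∀ {X : Set} {f : ℕ → X} → Periodic m f → f j ≡ f (s + i))
  reduce = Graph.reduce (<⇒≤ (<⇒≤ 1<m))

  off-window : ∀ {n} (C : Cyc n) {x} → 1 ≤ n → (∀ i → i < n → c C i ≢ x) → Off C x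
  off-window {suc n} C _ h i e = h (i % suc n) (m%n<n i (suc n))
    (trans (sym (period-* (per C) (i / suc n) (i % suc n)))
      (trans (cong (c C) (trans (+-comm _ (i % suc n)) (sym (m≡m%n+[m/n]*n i (suc n))))) e))

  no-detour : ∀ {n} (C : Cyc n) k r Q → k + r ≡ n → suc r + length Q ≡ N → 1 ≤ k →
    Walk (c C 0) Q (c C k) → Unique Q → (∀ i → i ≤ r → c C (i + k) ∉ Q) → ⊥
  no-detour C k r Q k+r len 1≤k w u off = noC (Detour.detour C k r k+r 1≤k Q w u off len)

  -- The h vertices of Q replace the h - 1 vertices between c₀ and c_h, which lengthens C by exactly
  -- one, to N.
  off-path : ∀ (C : Cyc m) h Q → length Q ≡ h → 1 ≤ h → h ≤ m → Walk (c C 0) Q (c C h) → Unique Q →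
    (∀ i → c C i ∉ Q) → ⊥
  off-path C h Q lenQ 1≤h h≤m w u off =
    let r , h+r = m≤n⇒∃[o]m+o≡n h≤m
    in no-detour C h r Q h+r (trans (cong (suc r +_) lenQ) (trans (cong suc (trans (+-comm r h) h+r)) (sym N≡))) 1≤h w u (λ i _ → off (i + h))

  module Facts (K : Conf) where
    open Conf K

    c′ : ℕ → V
    c′ = c C

    distinct : ∀ a i j → i < m → j < m → i ≢ j → c′ (i + a) ≢ c′ (j + a)
    distinct a i j lt lt′ ne e = ne (inj (rot a C) i j lt lt′ e)

    F1x : ∀ i → α i ≡ true → β (1 + i) ≡ true → ⊥
    F1x i a b = off-path (rot i C) 1 (x ∷ []) refl ≤-refl (<⇒≤ (<⇒≤ 1<m)) (a , b) one-unique
      λ j → ∉-∷ (x∉ (j + i)) ∉-[]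

    F2xy : x ⇒ y → ∀ i → α i ≡ true → δ (2 + i) ≡ true → ⊥
    F2xy xy i a d = off-path (rot i C) 2 (x ∷ y ∷ []) refl (s≤s z≤n) (<⇒≤ 1<m) (a , xy , d) (pair-unique x≢y)
      λ j → ∉-∷ (x∉ (j + i)) (∉-∷ (y∉ (j + i)) ∉-[])

    everything : List V
    everything = x ∷ y ∷ applyUpTo c′ m

    seg∌ : ∀ {v} → Off C v → v ∉ applyUpTo c′ m
    seg∌ off v∈ = let i , _ , e = ∈-seg⁻ c′ m v∈ in off i (sym e)

    all∈ : ∀ v → v ∈ everything
    all∈ = cover everything
      (∷-unique (∉-∷ x≢y (seg∌ x∉)) (∷-unique (seg∌ y∉) (seg-unique c′ m (inj C))))
      (≤-reflexive (trans (cong suc N≡) (cong (2 +_) (sym (length-applyUpTo c′ m)))))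

    in-count : ∀ v → indeg A v ≤ bit (A x v) + (bit (A y v) + # (λ i → A (c′ i) v) m)
    in-count v = ≤-trans (indeg≤ v everything λ u _ → all∈ u)
      (≤-reflexive (cong (λ z → bit (A x v) + (bit (A y v) + z)) (cnt-applyUpTo (λ u → A u v) c′ m)))

    out-count : ∀ v → outdeg A v ≤ bit (A v x) + (bit (A v y) + # (λ i → A v (c′ i)) m)
    out-count v = ≤-trans (outdeg≤ v everything λ u _ → all∈ u)
      (≤-reflexive (cong (λ z → bit (A v x) + (bit (A v y) + z)) (cnt-applyUpTo (A v) c′ m)))

    in-x : indeg A x ≤ # α m + bit (A y x)
    in-x = (lin₁ (1 ∷ 1 ∷ 0 ∷ 1 ∷ []) (indeg A x ∷ bit (A x x) ∷ bit (A y x) ∷ # α m ∷ []) (λ d o b n → (d ≼ o ⊕ (b ⊕ n)) ⇛ (o ≐ κ 0) ⇛ ⊢ (d ≼ n ⊕ b)))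
      (in-count x) (bit-false (loopless x))

    out-x : outdeg A x ≤ # β m + bit (A x y)
    out-x = (lin₁ (1 ∷ 1 ∷ 0 ∷ 1 ∷ []) (outdeg A x ∷ bit (A x x) ∷ bit (A x y) ∷ # β m ∷ []) (λ d o b n → (d ≼ o ⊕ (b ⊕ n)) ⇛ (o ≐ κ 0) ⇛ ⊢ (d ≼ n ⊕ b)))
      (out-count x) (bit-false (loopless x))

    -- Gaps are the places i with neither c_i → x nor x → c_{i+1}. They measure how far the degree
    -- of x stays below the maximum that `F1x` permits, and the degree condition keeps them scarce.
    gaps : ℕ
    gaps = # (nor α (β ∘ suc)) m

    gaps-eq : # α m + # β m + gaps ≡ m
    gaps-eq = trans (cong (λ z → # α m + z + gaps) (sym (periodic-suc {β} β-per)))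
      (#-nor α (β ∘ suc) m λ i _ → F1x i)

    adjacent-gaps : x ⇒ y → # α m + # δ m + # (nor α (λ i → δ (2 + i))) m ≡ m
    adjacent-gaps xy = trans (cong (λ z → # α m + z + # (nor α (λ i → δ (2 + i))) m) (sym (periodic-suc² {δ} δ-per)))
      (#-nor α (λ i → δ (2 + i)) m λ i _ → F2xy xy i)

    -- Exchanging x with c₁, when c₀ → x → c₂.
    module Swap (a : α 0 ≡ true) (b : β 2 ≡ true) where
      private
        r = proj₁ (m≤n⇒∃[o]m+o≡n {2} {m} (<⇒≤ 1<m))
        2+r : 2 + r ≡ m
        2+r = proj₂ (m≤n⇒∃[o]m+o≡n {2} {m} (<⇒≤ 1<m))
        open Detour C 2 r 2+r (s≤s z≤n) (x ∷ []) (a , b) one-unique (λ i _ → ∉-∷ (x∉ (i + 2)) ∉-[])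
        len : suc r + 1 ≡ m
        len = trans (cong suc (+-comm r 1)) 2+r
        D = detour len

      swapped : Cyc m
      -- The detour lists c₂ first, c₀ at position r and then x; the rotation restores the numbering
      -- of C except at position 1.
      swapped = rot r D

      at-0 : c swapped 0 ≡ c′ 0
      at-0 = trans (detour-old len r ≤-refl) (trans (cong c′ (trans (+-comm r 2) 2+r)) (c-m C))

      at-1 : c swapped 1 ≡ x
      at-1 = trans (cong (c D) (sym (+-identityʳ (suc r)))) (detour-new len 0 z<s)

      at-old : ∀ t → 2 ≤ t → t ≤ m → c swapped t ≡ c′ t
      at-old (suc (suc u)) _ le = trans
        (cong (c D) (trans ((lin₂ (1 ∷ 1 ∷ 0 ∷ []) (1 ∷ 0 ∷ 1 ∷ []) (u ∷ r ∷ m ∷ []) (λ u r m → (κ 2 ⊕ r ≐ m) ⇛ ⊢ (κ 2 ⊕ (u ⊕ r) ≐ m ⊕ u))) 2+r) refl))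
        (trans (per D u) (trans (detour-old len u (s≤s⁻¹ (s≤s⁻¹ (subst (2 + u ≤_) (sym 2+r) le)))) (cong c′ (+-comm u 2))))
      at-old (suc zero) (s≤s ()) _

      swap : Conf
      swap = record { C = swapped ; x = c′ 1 ; y = y
        ; x∉ = off-window swapped (<⇒≤ (<⇒≤ 1<m)) off₁
        ; y∉ = off-window swapped (<⇒≤ (<⇒≤ 1<m)) off₂
        ; x≢y = y∉ 1 }
        where
        off₁ : ∀ i → i < m → c swapped i ≢ c′ 1
        off₁ 0 lt e = distinct 0 0 1 lt (<⇒≤ 1<m) (λ ()) (trans (sym at-0) e)
        off₁ 1 lt e = x∉ 1 (trans (sym e) at-1)
        off₁ (suc (suc i)) lt e = distinct 0 (2 + i) 1 lt (<⇒≤ 1<m) (λ ())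
          (trans (cong c′ (+-identityʳ (2 + i))) (trans (sym (at-old (2 + i) (s≤s (s≤s z≤n)) (<⇒≤ lt))) e))
        off₂ : ∀ i → i < m → c swapped i ≢ y
        off₂ 0 lt e = y∉ 0 (trans (sym at-0) e)
        off₂ 1 lt e = x≢y (trans (sym at-1) e)
        off₂ (suc (suc i)) lt e = y∉ (2 + i) (trans (sym (at-old (2 + i) (s≤s (s≤s z≤n)) (<⇒≤ lt))) e)

  -- Without arcs between x and y the degree of x would be at most |α| + |β| ≤ m < N.
  nonadjacent : ∀ K → let open Conf K in A x y ≡ false → A y x ≡ false → ⊥
  nonadjacent K xy yx =
    (lin₁ (1 ∷ 0 ∷ 1 ∷ 0 ∷ 1 ∷ 0 ∷ 1 ∷ 1 ∷ 1 ∷ 0 ∷ 1 ∷ []) (indeg A x ∷ outdeg A x ∷ # α m ∷ # β m ∷ bit (A x y) ∷ bit (A y x) ∷ gaps ∷ N ∷ m ∷ []) (λ i o a b p q g N m → (N ≐ κ 1 ⊕ m) ⇛ (N ≼ i ⊕ o) ⇛ (i ≼ a ⊕ q) ⇛ (o ≼ b ⊕ p) ⇛ (p ≐ κ 0) ⇛ (q ≐ κ 0) ⇛ (a ⊕ b ⊕ g ≐ m) ⇛ ⊢ (ff)))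
      N≡ (deg x) in-x out-x (bit-false xy) (bit-false yx) gaps-eq
    where
    open Conf K
    open Facts K

-- The case of a single arc between x and y

module OneWay {N : ℕ} (A : Digraph (Fin (suc N))) (S : Counterexample A) (m : ℕ) (N≡ : N ≡ suc m) where

  open Graph hiding (reduce)
  open Cycles A
  open Setup.Structures A
  open Counterexample S
  open Configuration A S m N≡

  alt-even : (e : ℕ → Bool) → (∀ i → e (suc i) ≡ not (e i)) → ∀ t i → e (t + t + i) ≡ e i
  alt-even e alt zero i = refl
  alt-even e alt (suc t) i = trans (cong (λ z → e (suc z + i)) (+-suc t t))
    (trans (alt (suc (t + t + i))) (trans (cong not (alt (t + t + i))) (trans (not-involutive _) (alt-even e alt t i))))

  b≢not : ∀ {b} → b ≡ not b → ⊥
  b≢not {true} ()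
  b≢not {false} ()

  -- For odd m the period would identify a value of e with its own negation.
  halve : (e : ℕ → Bool) → (∀ i → e (suc i) ≡ not (e i)) → Periodic m e → ∃ λ h → h + h ≡ m
  halve e alt per = go (m % 2) (m%n<n m 2) (m≡m%n+[m/n]*n m 2)
    where
    go : ∀ r → r < 2 → m ≡ r + m / 2 * 2 → ∃ λ h → h + h ≡ m
    go 0 _ eq = m / 2 , trans (trans (cong (m / 2 +_) (sym (+-identityʳ (m / 2)))) (*-comm 2 (m / 2))) (sym eq)
    go 1 _ eq = ⊥-elim (b≢not (trans (sym (per 0)) (trans (cong (λ z → e (z + 0)) (trans eq (cong suc (trans (*-comm (m / 2) 2) (cong (m / 2 +_) (+-identityʳ (m / 2)))))))
       (trans (alt (m / 2 + m / 2 + 0)) (cong not (alt-even e alt (m / 2) 0))))))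
    go (suc (suc r)) (s≤s (s≤s ())) eq

  module Bipartition (K : Conf) (e : ℕ → Bool) (alt : ∀ i → e (suc i) ≡ not (e i)) (e-per : Periodic m e) (e0 : e 0 ≡ true) where
    open Conf K
    open Facts K

    open-nbrs : Set
    open-nbrs = ∀ i → (α i ≡ true → e i ≡ true) × (β i ≡ true → e i ≡ true) × (γ i ≡ true → e i ≡ false) × (δ i ≡ true → e i ≡ false)

    -- The tail is written c_{a+1} because vertices are exchanged with x or y between their
    -- neighbours c_a and c_{a+2}.
    independent : Bool → Set
    independent b = ∀ a s → 1 ≤ s → s < m → e (suc a) ≡ b → e (s + suc a) ≡ b → c′ (suc a) ⇒ c′ (s + suc a) → ⊥

    -- Here x joins the odd positions and y the even ones, which e marks. `open-nbrs` keeps x and y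
    -- apart from their own classes, so both classes are independent and the digraph lies in 𝓑(n,n).
    bipartite : open-nbrs → independent true → independent false → ⊥
    bipartite nbrs indY indX = noB X Y record
      { spanning = subst Unique refl unique , total
      ; balanced = cong suc (trans (length-applyUpTo odd h) (sym (length-applyUpTo even h)))
      ; X-independent = noX ; Y-independent = noY }
      where
      h = proj₁ (halve e alt e-per)
      h+h : h + h ≡ m
      h+h = proj₂ (halve e alt e-per)
      odd even : ℕ → V
      odd t = c′ (suc (t + t))
      even t = c′ (suc (suc (t + t)))
      X Y : List V
      X = x ∷ applyUpTo odd h
      Y = y ∷ applyUpTo even h

      e-odd : ∀ t → e (suc (t + t)) ≡ false
      e-odd t = trans (alt (t + t)) (cong not (trans (cong e (sym (+-identityʳ (t + t)))) (trans (alt-even e alt t 0) e0)))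
      e-even : ∀ t → e (suc (suc (t + t))) ≡ true
      e-even t = trans (alt (suc (t + t))) (cong not (e-odd t))

      dbl< : ∀ {t} → t < h → t + t < m
      dbl< {t} lt = subst (t + t <_) h+h (+-mono-< lt lt)

      dbl-inj : ∀ {t s} → t + t ≡ s + s → t ≡ s
      dbl-inj {t} {s} eq = (lin₂ (2 ∷ 1 ∷ 0 ∷ []) (2 ∷ 0 ∷ 1 ∷ []) (t ∷ s ∷ []) (λ t s → (t ⊕ t ≐ s ⊕ s) ⇛ ⊢ (t ≐ s))) eq

      odd-inj : ∀ i j → i < h → j < h → odd i ≡ odd j → i ≡ j
      odd-inj i j lt lt′ eq = dbl-inj (inj (rot 1 C) _ _ (dbl< lt) (dbl< lt′)
        (trans (cong c′ (+-comm (i + i) 1)) (trans eq (cong c′ (+-comm 1 (j + j))))))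
      even-inj : ∀ i j → i < h → j < h → even i ≡ even j → i ≡ j
      even-inj i j lt lt′ eq = dbl-inj (inj (rot 2 C) _ _ (dbl< lt) (dbl< lt′)
        (trans (cong c′ (+-comm (i + i) 2)) (trans eq (cong c′ (+-comm 2 (j + j))))))

      e-cong : ∀ i j → c′ i ≡ c′ j → e i ≡ e j
      e-cong i j eq = let s , lt , f = reduce i j in
        sym (trans (f e-per) (cong (λ z → e (z + i)) (inj (rot i C) s 0 lt (≤-trans (s≤s z≤n) 1<m) (trans (sym (f (per C))) (sym eq)))))

      unique : Unique (X ++ Y)
      unique = ++-unique (∷-unique (λ v∈ → let i , _ , eq = ∈-seg⁻ odd h v∈ in x∉ _ (sym eq)) (seg-unique odd h odd-inj))
        (∷-unique (λ v∈ → let i , _ , eq = ∈-seg⁻ even h v∈ in y∉ _ (sym eq)) (seg-unique even h even-inj)) disj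
        where
        disj : ∀ {v} → v ∈ X → v ∉ Y
        disj (here refl) (here eq) = x≢y eq
        disj (here refl) (there v∈) = let i , _ , eq = ∈-seg⁻ even h v∈ in x∉ _ (sym eq)
        disj (there v∈) (here refl) = let i , _ , eq = ∈-seg⁻ odd h v∈ in y∉ _ (sym eq)
        disj (there v∈) (there v∈′) =
          let i , _ , eq = ∈-seg⁻ odd h v∈
              j , _ , eq′ = ∈-seg⁻ even h v∈′
          in true≢false (e-even j) (trans (e-cong (suc (suc (j + j))) (suc (i + i)) (trans (sym eq′) eq)) (e-odd i))

      total : length (X ++ Y) ≡ suc N
      total = trans (length-++ X {Y}) (trans (cong₂ (λ p q → suc p + suc q) (length-applyUpTo odd h) (length-applyUpTo even h))
        ((lin₂ (1 ∷ 0 ∷ 1 ∷ 1 ∷ 0 ∷ []) (1 ∷ 1 ∷ 0 ∷ 0 ∷ 1 ∷ []) (h ∷ m ∷ N ∷ []) (λ h m N → (h ⊕ h ≐ m) ⇛ (N ≐ κ 1 ⊕ m) ⇛ ⊢ (κ 1 ⊕ h ⊕ (κ 1 ⊕ h) ≐ κ 1 ⊕ N))) h+h N≡))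

      indep′ : ∀ b → independent b → ∀ i j → e (suc i) ≡ b → e (suc j) ≡ b → A (c′ (suc i)) (c′ (suc j)) ≡ false
      indep′ b ind i j ei ej = ¬true λ ij →
        let s , lt , f = reduce (suc i) (suc j)
        in case s of λ where
          zero → go i j ei ej ij s lt (f (per C)) (f e-per)
          (suc _) → go i j ei ej ij s lt (f (per C)) (f e-per)
        where
        go : ∀ i j → e (suc i) ≡ b → e (suc j) ≡ b → c′ (suc i) ⇒ c′ (suc j) → ∀ s → s < m → c′ (suc j) ≡ c′ (s + suc i) → e (suc j) ≡ e (s + suc i) → ⊥
        go i j ei ej ij zero lt eq eqe = loop-free ij (sym eq)
        go i j ei ej ij (suc s) lt eq eqe = ind i (suc s) (s≤s z≤n) lt ei (trans (sym eqe) ej) (subst (c′ (suc i) ⇒_) eq ij)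

      noX : NoArc X X
      noX (here refl) (here refl) = loopless x
      noX (here refl) (there v∈) with ∈-seg⁻ odd h v∈
      ... | i , _ , refl = ¬true λ b → true≢false (proj₁ (proj₂ (nbrs (suc (i + i)))) b) (e-odd i)
      noX (there u∈) (here refl) with ∈-seg⁻ odd h u∈
      ... | i , _ , refl = ¬true λ b → true≢false (proj₁ (nbrs (suc (i + i))) b) (e-odd i)
      noX (there u∈) (there v∈) with ∈-seg⁻ odd h u∈ | ∈-seg⁻ odd h v∈
      ... | i , _ , refl | j , _ , refl = indep′ false indX (i + i) (j + j) (e-odd i) (e-odd j)

      noY : NoArc Y Y
      noY (here refl) (here refl) = loopless y
      noY (here refl) (there v∈) with ∈-seg⁻ even h v∈
      ... | i , _ , refl = ¬true λ b → true≢false (e-even i) (proj₂ (proj₂ (proj₂ (nbrs (suc (suc (i + i)))))) b)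
      noY (there u∈) (here refl) with ∈-seg⁻ even h u∈
      ... | i , _ , refl = ¬true λ b → true≢false (e-even i) (proj₁ (proj₂ (proj₂ (nbrs (suc (suc (i + i)))))) b)
      noY (there u∈) (there v∈) with ∈-seg⁻ even h u∈ | ∈-seg⁻ even h v∈
      ... | i , _ , refl | j , _ , refl = indep′ true indY (suc (i + i)) (suc (j + j)) (e-even i) (e-even j)

  IsSingle : Conf → Set
  IsSingle K = A x y ≡ true × A y x ≡ false
    where open Conf K

  module Tight (K : Conf) (sgl : IsSingle K) where
    open Conf K
    private
      module F = Facts K
      module G = Facts (flipK K)
      xy = proj₁ sgl
      yx = proj₂ sgl

    private
      z = # (nor α (λ i → δ (2 + i))) m

      total-x : # α m + # β m + F.gaps ≡ m
      total-x = F.gaps-eq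
      total-y : # γ m + # δ m + G.gaps ≡ m
      total-y = G.gaps-eq

    -- As y → x is missing, x has at most |α| in-neighbours and y at most |δ| out-neighbours. Both
    -- numbers are at least m / 2, while `adjacent-gaps` gives |α| + |δ| ≤ m; so all of these are
    -- equalities, and `no-z` follows in the same way.
    half : 2 * # α m ≡ m
    half = (lin₂ (1 ∷ 2 ∷ 0 ∷ 2 ∷ 0 ∷ 2 ∷ 0 ∷ 1 ∷ 0 ∷ 0 ∷ 1 ∷ []) (1 ∷ 0 ∷ 0 ∷ 2 ∷ 0 ∷ 0 ∷ 2 ∷ 0 ∷ 1 ∷ 0 ∷ 1 ∷ []) (indeg A x ∷ outdeg A y ∷ # α m ∷ # δ m ∷ bit (A y x) ∷ z ∷ N ∷ m ∷ []) (λ i o a d p z N m → (N ≐ κ 1 ⊕ m) ⇛ (N ≼ 2 ⊛ i ⊕ κ 1) ⇛ (N ≼ 2 ⊛ o ⊕ κ 1) ⇛ (i ≼ a ⊕ p) ⇛ (o ≼ d ⊕ p) ⇛ (p ≐ κ 0) ⇛ (a ⊕ d ⊕ z ≐ m) ⇛ ⊢ (2 ⊛ a ≐ m)))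
      N≡ (deg-in x) (deg-out y) F.in-x G.out-x (bit-false yx) (F.adjacent-gaps xy)

    no-z : z ≡ 0
    no-z = (lin₂ (2 ∷ 2 ∷ 0 ∷ 4 ∷ 0 ∷ 2 ∷ 2 ∷ 1 ∷ 1 ∷ 0 ∷ 2 ∷ []) (1 ∷ 0 ∷ 0 ∷ 0 ∷ 0 ∷ 0 ∷ 0 ∷ 0 ∷ 0 ∷ 0 ∷ 0 ∷ []) (indeg A x ∷ outdeg A y ∷ # α m ∷ # δ m ∷ bit (A y x) ∷ z ∷ N ∷ m ∷ []) (λ i o a d p z N m → (N ≐ κ 1 ⊕ m) ⇛ (N ≼ 2 ⊛ i ⊕ κ 1) ⇛ (N ≼ 2 ⊛ o ⊕ κ 1) ⇛ (i ≼ a ⊕ p) ⇛ (o ≼ d ⊕ p) ⇛ (p ≐ κ 0) ⇛ (a ⊕ d ⊕ z ≐ m) ⇛ ⊢ (z ≐ κ 0)))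
      N≡ (deg-in x) (deg-out y) F.in-x G.out-x (bit-false yx) (F.adjacent-gaps xy)

    -- The one arc between x and y contributes 1 to the degree N = m + 1 of x, so |α| + |β| already
    -- fills m.
    no-x : F.gaps ≡ 0
    no-x = (lin₂ (1 ∷ 1 ∷ 0 ∷ 1 ∷ 0 ∷ 1 ∷ 0 ∷ 1 ∷ 1 ∷ 1 ∷ 0 ∷ 1 ∷ []) (1 ∷ 0 ∷ 0 ∷ 0 ∷ 0 ∷ 0 ∷ 0 ∷ 0 ∷ 0 ∷ 0 ∷ 0 ∷ 0 ∷ []) (indeg A x ∷ outdeg A x ∷ # α m ∷ # β m ∷ bit (A y x) ∷ bit (A x y) ∷ F.gaps ∷ N ∷ m ∷ []) (λ i o a b p q g N m → (N ≐ κ 1 ⊕ m) ⇛ (N ≼ i ⊕ o) ⇛ (i ≼ a ⊕ p) ⇛ (o ≼ b ⊕ q) ⇛ (p ≐ κ 0) ⇛ (q ≐ κ 1) ⇛ (a ⊕ b ⊕ g ≐ m) ⇛ ⊢ (g ≐ κ 0)))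
      N≡ (deg x) F.in-x F.out-x (bit-false yx) (bit-true xy) total-x

    no-y : G.gaps ≡ 0
    no-y = (lin₂ (1 ∷ 1 ∷ 0 ∷ 1 ∷ 0 ∷ 1 ∷ 0 ∷ 1 ∷ 1 ∷ 1 ∷ 0 ∷ 1 ∷ []) (1 ∷ 0 ∷ 0 ∷ 0 ∷ 0 ∷ 0 ∷ 0 ∷ 0 ∷ 0 ∷ 0 ∷ 0 ∷ 0 ∷ []) (indeg A y ∷ outdeg A y ∷ # γ m ∷ # δ m ∷ bit (A y x) ∷ bit (A x y) ∷ G.gaps ∷ N ∷ m ∷ []) (λ i o a b p q g N m → (N ≐ κ 1 ⊕ m) ⇛ (N ≼ i ⊕ o) ⇛ (i ≼ a ⊕ q) ⇛ (o ≼ b ⊕ p) ⇛ (p ≐ κ 0) ⇛ (q ≐ κ 1) ⇛ (a ⊕ b ⊕ g ≐ m) ⇛ ⊢ (g ≐ κ 0)))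
      N≡ (deg y) G.in-x G.out-x (bit-false yx) (bit-true xy) total-y

    private
      0<m : 0 < m
      0<m = ≤-trans (s≤s z≤n) 1<m

    β-0 : α 0 ≡ false → β 1 ≡ true
    β-0 = nor-elim {α} {β ∘ suc} 0 (#-0 (nor α (β ∘ suc)) 0 no-x 0<m)

    δ-0 : γ 0 ≡ false → δ 1 ≡ true
    δ-0 = nor-elim {γ} {δ ∘ suc} 0 (#-0 (nor γ (δ ∘ suc)) 0 no-y 0<m)

    δ-1 : α 0 ≡ false → δ 2 ≡ true
    δ-1 = nor-elim {α} {λ i → δ (2 + i)} 0 (#-0 (nor α (λ i → δ (2 + i))) 0 no-z 0<m)

  module Pattern (K : Conf) (sgl : IsSingle K) where
    open Conf K
    open Facts K
    open Tight K sgl public using (half)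
    private
      module T i = Tight (rotK i K) sgl
      xy = proj₁ sgl
      yx = proj₂ sgl

    β-of : ∀ i → α i ≡ false → β (1 + i) ≡ true
    β-of i = T.β-0 i

    δ-of : ∀ i → γ i ≡ false → δ (1 + i) ≡ true
    δ-of i = T.δ-0 i

    δ-of² : ∀ i → α i ≡ false → δ (2 + i) ≡ true
    δ-of² i = T.δ-1 i

    -- Otherwise y → c_{i+2}, and x, y could replace c_{i+1}. With `γ-false` this makes γ the shift
    -- of α by one.
    γ-true : ∀ i → α i ≡ true → γ (1 + i) ≡ true
    γ-true i a = ¬false λ g → F2xy xy i a (δ-of (1 + i) g)

    γ-false : ∀ i → α i ≡ false → γ (1 + i) ≡ false
    γ-false i a = ¬true λ g → Facts.F1x (flipK K) (1 + i) g (δ-of² i a)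

  rise : ∀ (f : ℕ → Bool) n → f 0 ≡ false → f n ≡ true → ∃ λ t → t < n × f t ≡ false × f (suc t) ≡ true
  rise f zero e e′ = ⊥-elim (true≢false e′ e)
  rise f (suc n) e e′ with bool-cases (f 1)
  ... | inj₁ e₁ = 0 , z<s , e , e₁
  ... | inj₂ e₁ = let t , lt , p = rise (f ∘ suc) n e₁ e′ in suc t , s<s lt , p

  -- The pattern 110 among the in-neighbours of x gives the arc c₀c₂, hence a cycle of length N.
  module Pattern110 (K : Conf) (sgl : IsSingle K) (α0 : Conf.α K 0 ≡ true) (α1 : Conf.α K 1 ≡ true) (α2 : Conf.α K 2 ≡ false) where
    open Conf K
    open Facts K
    open Pattern K sgl
    private
      xy = proj₁ sgl
      yx = proj₂ sgl

    -- Let x take the place of c₂. The pair (c₂, y) is again joined by the single arc c₂ → y, and if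
    -- c₀ → c₂ were missing, the rules of the new configuration would give y → x.
    c0⇒c2 : c′ 0 ⇒ c′ 2
    c0⇒c2 = go (m≤n⇒∃[o]m+o≡n {1} {m} (<⇒≤ (<⇒≤ 1<m)))
      where
      K′ = rotK 1 K
      open Facts.Swap K′ α1 (β-of 2 α2)
      sgl′ : IsSingle swap
      sgl′ = γ-true 1 α1 , ¬true (F2xy xy 0 α0)
      go : (∃ λ n → 1 + n ≡ m) → c′ 0 ⇒ c′ 2
      go (n , e) = subst (_⇒ c′ 2) (trans (at-old n (s≤s⁻¹ (subst (3 ≤_) (sym e) 1<m)) (subst (n ≤_) e (n≤1+n n))) (trans (cong c′ (trans (+-comm n 1) e)) (c-m C)))
        (¬false λ a → true≢false (Pattern.δ-of² swap sgl′ n a)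
           (trans (cong (A y) (trans (cong (λ z → c swapped (suc z)) e) (trans (cong (c swapped) (+-comm 1 m)) (trans (per swapped 1) at-1)))) yx))

    -- The chord c₀c₂ drops c₁, and x, y go between c_{t+3} and c_{t+4}: this makes m - 1 + 2 = N
    -- vertices.
    absurd-rise : ∀ t → 2 + t < m → α (2 + t) ≡ false → α (3 + t) ≡ true → 3 + t < m → ⊥
    absurd-rise t _ at-f at-t lt = go (m≤n⇒∃[o]m+o≡n {2} {m} (<⇒≤ 1<m))
      where
      go : (∃ λ r → 2 + r ≡ m) → ⊥
      go (r , e) = no-detour (rot (suc t) D) 1 r (x ∷ y ∷ []) refl
        (trans (cong suc (trans (+-comm r 2) e)) (sym N≡)) ≤-refl
        (subst (_⇒ x) (sym (D-at (suc t) t<r)) (subst (λ z → A (c′ z) x ≡ true) (+-comm 2 (suc t)) at-t)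
          , xy , subst (y ⇒_) (sym (D-at (2 + t) t<r′)) (subst (λ z → A y (c′ z) ≡ true) (+-comm 2 (2 + t)) (δ-of (3 + t) (γ-false (2 + t) at-f))))
        (pair-unique x≢y) (λ i _ → ∉-∷ (D-off x∉ _) (∉-∷ (D-off y∉ _) ∉-[]))
        where
        open Detour C 2 r e (s≤s z≤n) [] c0⇒c2 [] (λ i _ → ∉-[])
        D : Cyc (suc r)
        D = detour (+-identityʳ (suc r))
        D-at : ∀ i → i ≤ r → c D i ≡ c′ (i + 2)
        D-at = detour-old (+-identityʳ (suc r))
        D-off : ∀ {v} → Off C v → Off D v
        D-off off = off-window D (s≤s z≤n) λ i lt q → off (i + 2) (trans (sym (D-at i (s≤s⁻¹ lt))) q)
        t<r′ : 2 + t ≤ r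
        t<r′ = (lin₁ (1 ∷ 1 ∷ 0 ∷ 1 ∷ []) (t ∷ r ∷ m ∷ []) (λ t r m → (κ 2 ⊕ r ≐ m) ⇛ (κ 1 ⊕ (κ 3 ⊕ t) ≼ m) ⇛ ⊢ (κ 2 ⊕ t ≼ r))) e lt
        t<r : 1 + t ≤ r
        t<r = <⇒≤ t<r′

    -- If one of c₃, ..., c_{m-1} sends an arc to x, the pattern rises somewhere and `absurd-rise`
    -- applies. Otherwise c₀ c₂ c₃ c₁ x c₄ ... is a cycle of length N; two ones in α and `half`
    -- provide m ≥ 4.
    absurd : ⊥
    absurd = go (m≤n⇒∃[o]m+o≡n {4} {m} 4≤m)
      where
      4≤m : 4 ≤ m
      4≤m = (lin₁ (1 ∷ 2 ∷ 1 ∷ 0 ∷ 0 ∷ []) (# α m ∷ m ∷ []) (λ a m → (κ 3 ≼ m) ⇛ (2 ⊛ a ≐ m) ⇛ (κ 2 ≼ a) ⇛ ⊢ (κ 4 ≼ m))) 1<m half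
        (#-2≤ α 0 1 z<s (<⇒≤ 1<m) α0 α1)
      go : (∃ λ r → 4 + r ≡ m) → ⊥
      go (r , e) = split (some-or-none (λ t → α (3 + t)) (suc r))
        where
        split : (∃ λ t → t < suc r × α (3 + t) ≡ true) ⊎ (∀ t → t < suc r → α (3 + t) ≡ false) → ⊥
        split (inj₁ (t , lt , a)) =
          let u , u≤t , f , g = rise (λ u → α (2 + u)) (suc t) α2 a
          in absurd-rise u (subst (2 + u <_) e ((lin₁ (1 ∷ 1 ∷ 1 ∷ []) (u ∷ t ∷ r ∷ []) (λ u t r → (κ 1 ⊕ u ≼ κ 1 ⊕ t) ⇛ (κ 1 ⊕ t ≼ κ 1 ⊕ r) ⇛ ⊢ (κ 1 ⊕ (κ 2 ⊕ u) ≼ κ 4 ⊕ r))) u≤t lt)) f g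
               (subst (3 + u <_) e ((lin₁ (1 ∷ 1 ∷ 1 ∷ []) (u ∷ t ∷ r ∷ []) (λ u t r → (κ 1 ⊕ u ≼ κ 1 ⊕ t) ⇛ (κ 1 ⊕ t ≼ κ 1 ⊕ r) ⇛ ⊢ (κ 1 ⊕ (κ 3 ⊕ u) ≼ κ 4 ⊕ r))) u≤t lt))
        split (inj₂ none) = no-detour C 4 r (c′ 2 ∷ c′ 3 ∷ c′ 1 ∷ x ∷ []) e
            (trans (cong suc (trans (+-comm r 4) e)) (sym N≡)) (s≤s z≤n)
            (c0⇒c2 , arc C 2 , c3⇒c1 , α1 , β-of 3 α3)
            (∷-unique (∉-∷ (ne 2 3 λ ()) (∉-∷ (ne 2 1 λ ()) (∉-∷ (x∉ 2) ∉-[])))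
              (∷-unique (∉-∷ (ne 3 1 λ ()) (∉-∷ (x∉ 3) ∉-[])) (pair-unique (x∉ 1))))
            (λ i le → ∉-∷ (far i le 2) (∉-∷ (far i le 3) (∉-∷ (far i le 1) (∉-∷ (x∉ (i + 4)) ∉-[]))))
          where
          α3 : α 3 ≡ false
          α3 = none 0 z<s
          4>0 : ∀ j → j ≤ 3 → j < m
          4>0 j le = ≤-trans (s≤s le) 4≤m
          ne : ∀ i j {_ : T (i ≤ᵇ 3)} {_ : T (j ≤ᵇ 3)} → i ≢ j → c′ i ≢ c′ j
          ne i j {p} {q} i≢j eq = i≢j (inj C i j (4>0 i (≤ᵇ⇒≤ i 3 p)) (4>0 j (≤ᵇ⇒≤ j 3 q)) eq)
          far : ∀ i → i ≤ r → ∀ j {_ : T (1 ≤ᵇ j)} {_ : T (j ≤ᵇ 3)} → c′ (i + 4) ≢ c′ j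
          far i le (suc j) {_} {q′} eq = case inj (rot 1 C) (i + 3) j
              (subst (i + 3 <_) e ((lin₁ (1 ∷ 1 ∷ []) (i ∷ r ∷ []) (λ i r → (i ≼ r) ⇛ ⊢ (κ 1 ⊕ (i ⊕ κ 3) ≼ κ 4 ⊕ r))) le)) (4>0 j (<⇒≤ (≤ᵇ⇒≤ (suc j) 3 q′)))
              (trans (cong c′ (trans (+-assoc i 3 1) refl)) (trans eq (cong c′ (+-comm 1 j)))) of λ eq′ →
              (lin₁ (1 ∷ 1 ∷ 0 ∷ []) (i ∷ j ∷ []) (λ i j → (i ⊕ κ 3 ≐ j) ⇛ (κ 1 ⊕ j ≼ κ 3) ⇛ ⊢ (ff))) eq′ (≤ᵇ⇒≤ (suc j) 3 q′)

          -- Now y takes the place of c₃, and the pair (x, c₃) carries the single arc x → c₃. The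
          -- vertex two places before c₁ on the new cycle sends no arc to x, so the rules give c₃ →
          -- c₁.
          c3⇒c1 : c′ 3 ⇒ c′ 1
          c3⇒c1 = subst (c′ 3 ⇒_) (trans (at-old (3 + r) (s≤s (s≤s z≤n)) (subst (3 + r ≤_) e (n≤1+n (3 + r)))) (trans (cong c′ (trans ((lin₂ (1 ∷ 1 ∷ 0 ∷ []) (1 ∷ 0 ∷ 1 ∷ []) (r ∷ m ∷ []) (λ r m → (κ 4 ⊕ r ≐ m) ⇛ ⊢ (κ 3 ⊕ r ⊕ κ 2 ≐ m ⊕ κ 1))) e) refl)) (per C 1)))
              (Pattern.δ-of² K″ sgl″ (suc r) hyp)
            where
            K′ = rotK 2 (flipK K)
            open Facts.Swap K′ (γ-true 1 α1) (δ-of 3 (γ-false 2 α2))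
            K″ = flipK swap
            sgl″ : IsSingle K″
            sgl″ = β-of 2 α2 , α3
            hyp : A (c swapped (suc r)) x ≡ false
            hyp = case-r r refl
              where
              case-r : ∀ q → q ≡ r → A (c swapped (suc q)) x ≡ false
              case-r zero eq = trans (cong (λ z → A z x) at-1) yx
              case-r (suc q) eq = trans (cong (λ z → A z x) (at-old (2 + q) (s≤s (s≤s z≤n)) (subst (2 + q ≤_) e ((lin₁ (1 ∷ 1 ∷ 0 ∷ []) (q ∷ r ∷ []) (λ q r → (κ 1 ⊕ q ≐ r) ⇛ ⊢ (κ 2 ⊕ q ≼ κ 4 ⊕ r))) eq))))
                (trans (cong α (+-comm (2 + q) 2)) (trans (cong α ((lin₂ (1 ∷ []) (1 ∷ []) (q ∷ []) (λ q → ⊢ (κ 2 ⊕ (κ 2 ⊕ q) ≐ κ 3 ⊕ (κ 1 ⊕ q)))))) (none (suc q) (subst (_< suc r) (sym eq) ≤-refl))))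

  -- As 110 is impossible, a pair 11 would spread over all of C, against `half`. So ones are
  -- isolated, `half` makes α alternate, and the digraph is bipartite.
  single-absurd : ∀ K → IsSingle K → ⊥
  single-absurd K sgl = go (bool-cases (α 0))
    where
    open Conf K
    open Facts K
    open Pattern K sgl
    xy = proj₁ sgl
    yx = proj₂ sgl

    step : ∀ i → α i ≡ true → α (1 + i) ≡ true → α (2 + i) ≡ true
    step i a a′ = ¬false λ a″ → Pattern110.absurd (rotK i K) sgl a a′ a″

    no-11 : ∀ i → α i ≡ true → α (1 + i) ≡ true → ⊥
    no-11 i a a′ = (lin₁ (1 ∷ 1 ∷ 0 ∷ 0 ∷ 2 ∷ 2 ∷ 0 ∷ []) (# α m ∷ # (λ t → α (t + i)) m ∷ m ∷ []) (λ n n′ m → (n′ ≐ n) ⇛ (n′ ≐ m) ⇛ (2 ⊛ n ≐ m) ⇛ (κ 3 ≼ m) ⇛ ⊢ (ff)))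
        (#-rot {α} {m} i α-per) (#-all m λ t _ → proj₁ (ones t)) half 1<m
      where
      ones : ∀ t → α (t + i) ≡ true × α (suc t + i) ≡ true
      ones zero = a , a′
      ones (suc t) = let p , q = ones t in q , step (t + i) p q

    two-counts : # α m + # (α ∘ suc) m + # (nor α (α ∘ suc)) m ≡ m
    two-counts = #-nor α (α ∘ suc) m λ i _ → no-11 i

    no-00 : ∀ i → α i ≡ false → α (1 + i) ≡ true
    no-00 i a = let s , lt , f = reduce 0 i in
      trans (trans (shifted s f) refl) (nor-elim {α} {α ∘ suc} s
        (#-0 (nor α (α ∘ suc)) s none lt) (trans (cong α (sym (+-identityʳ s))) (trans (sym (f α-per)) a)))
      where
      none : # (nor α (α ∘ suc)) m ≡ 0
      none = (lin₂ (1 ∷ 0 ∷ 1 ∷ 0 ∷ 1 ∷ 1 ∷ 0 ∷ []) (1 ∷ 0 ∷ 0 ∷ 0 ∷ 0 ∷ 0 ∷ 0 ∷ []) (# α m ∷ # (α ∘ suc) m ∷ # (nor α (α ∘ suc)) m ∷ m ∷ []) (λ n n′ g m → (n ⊕ n′ ⊕ g ≐ m) ⇛ (n′ ≐ n) ⇛ (2 ⊛ n ≐ m) ⇛ ⊢ (g ≐ κ 0)))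
        two-counts (periodic-suc {α} α-per) half
      shifted : ∀ s → (∀ {X : Set} {f : ℕ → X} → Periodic m f → f i ≡ f (s + 0)) → α (suc i) ≡ α (suc s)
      shifted s f = trans (f {f = α ∘ suc} (λ j → trans (cong α (sym (+-suc m j))) (α-per (suc j)))) (cong (α ∘ suc) (+-identityʳ s))

    alt : ∀ i → α (suc i) ≡ not (α i)
    alt i with bool-cases (α i)
    ... | inj₁ a = trans (¬true (no-11 i a)) (cong not (sym a))
    ... | inj₂ a = trans (no-00 i a) (cong not (sym a))

    with-α0 : ∀ K′ → IsSingle K′ → (∀ i → Conf.α K′ (suc i) ≡ not (Conf.α K′ i)) → Conf.α K′ 0 ≡ true → ⊥
    with-α0 K′ sgl′ alt′ e0 = bipartite nbrs indY indX
      where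
      module K = Conf K′
      module F = Facts K′
      module P = Pattern K′ sgl′
      open Bipartition K′ K.α alt′ K.α-per e0
      open K using () renaming (α to α′; β to β′; γ to γ′; δ to δ′)
      prev-true : ∀ i → α′ (suc i) ≡ false → α′ i ≡ true
      prev-true i a = ¬false λ b → true≢false (trans (alt′ i) (cong not b)) a
      prev-false : ∀ i → α′ (suc i) ≡ true → α′ i ≡ false
      prev-false i a = ¬true λ b → true≢false a (trans (alt′ i) (cong not b))
      next-true : ∀ i → α′ i ≡ false → α′ (suc i) ≡ true
      next-true i a = trans (alt′ i) (cong not a)
      next-false : ∀ i → α′ i ≡ true → α′ (suc i) ≡ false
      next-false i a = trans (alt′ i) (cong not a)

      shift-down : ∀ (f : ℕ → Bool) → Periodic m f → ∀ (g : ℕ → Bool) → Periodic m g → ∀ {b} →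
        (∀ i → f (suc i) ≡ true → g (suc i) ≡ b) → ∀ i → f i ≡ true → g i ≡ b
      shift-down f fp g gp h zero fi = trans (sym (gp 0)) (lift m 1<m (h _) )
        where
        lift : ∀ n → 3 ≤ n → (∀ {i} → f (suc i) ≡ true → g (suc i) ≡ _) → g (m + 0) ≡ _
        lift n _ h′ = go′ (m≤n⇒∃[o]m+o≡n {1} {m} (<⇒≤ (<⇒≤ 1<m)))
          where
          go′ : (∃ λ n → 1 + n ≡ m) → g (m + 0) ≡ _
          go′ (n , eq) = trans (cong g (trans (+-identityʳ m) (sym eq))) (h n (trans (cong f eq) (trans (cong f (sym (+-identityʳ m))) (trans (fp 0) fi))))
      shift-down f fp g gp h (suc i) fi = h i fi

      γ-here : ∀ j → α′ j ≡ false → γ′ j ≡ true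
      γ-here j a = ¬false λ g → true≢false
          (shift-down (not ∘ γ′) (cong not ∘ K.γ-per) α′ K.α-per (λ j ng → next-true j (¬true λ a → true≢false ng (cong not (P.γ-true j a)))) j (cong not g)) a

      nbrs : open-nbrs
      nbrs i = (λ a → a) , shift-down β′ K.β-per α′ K.α-per (λ j b → next-true j (¬true λ a → F.F1x j a b)) i
        , shift-down γ′ K.γ-per α′ K.α-per (λ j g → next-false j (¬false λ a → true≢false g (P.γ-false j a))) i
        , shift-down δ′ K.δ-per α′ K.α-per (λ j d → next-false j (¬false λ a →
              Facts.F1x (flipK K′) j (γ-here j a) d)) i

      -- Let x take the place of c_{a+1}; the pair off the cycle then has the arc y → c_{a+1}. An
      -- arc from c_{a+1} to c_{s+a+1} would let y, c_{a+1} replace the vertex before c_{s+a+1}.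
      indX : independent false
      indX a (suc u) _ lt e₁ e₂ arc′ = F2 (A-at u refl) (subst (λ z → A (K″.c′ 1) z ≡ true) (sym (at-old (2 + u) (s≤s (s≤s z≤n)) lt))
          (subst (λ z → F.c′ (suc a) ⇒ F.c′ z) ((lin₂ (1 ∷ []) (1 ∷ []) (u ∷ a ∷ []) (λ u a → ⊢ (κ 1 ⊕ u ⊕ (κ 1 ⊕ a) ≐ κ 2 ⊕ u ⊕ a)))) arc′))
        where
        K₁ = rotK a K′
        module K″ = Facts K₁
        open Facts.Swap K₁ (prev-true a e₁) (P.β-of (1 + a) e₁)
        F2 : A (c swapped u) K.y ≡ true → A (K″.c′ 1) (c swapped (2 + u)) ≡ true → ⊥
        F2 = Facts.F2xy (flipK swap) (P.δ-of a (¬true λ g → true≢false (prev-true a e₁) (proj₁ (proj₂ (proj₂ (nbrs a))) g))) u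
        αu : α′ (u + a) ≡ false
        αu = prev-false′ (u + a) (prev-true (suc (u + a)) (trans (cong α′ ((lin₂ (1 ∷ []) (1 ∷ []) (u ∷ a ∷ []) (λ u a → ⊢ (κ 1 ⊕ (κ 1 ⊕ (u ⊕ a)) ≐ κ 1 ⊕ u ⊕ (κ 1 ⊕ a)))))) e₂))
          where
          prev-false′ : ∀ i → α′ (suc i) ≡ true → α′ i ≡ false
          prev-false′ = prev-false
        A-at : ∀ w → w ≡ u → A (c swapped w) K.y ≡ true
        A-at 0 refl = trans (cong (λ z → A z K.y) at-0) (γ-here a αu)
        A-at 1 refl = trans (cong (λ z → A z K.y) at-1) (proj₁ sgl′)
        A-at (suc (suc w)) refl = trans (cong (λ z → A z K.y) (at-old (2 + w) (s≤s (s≤s z≤n)) (<⇒≤ (<⇒≤ lt)))) (γ-here (2 + w + a) αu)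

      -- Here the head of the arc, which sends an arc to x, is exchanged with y. The head and x
      -- would then replace the vertex after the tail c_{a+1}.
      indY : independent true
      indY a s 1≤s lt e₁ e₂ arc′ = go′ (m≤n⇒∃[o]m+o≡n (<⇒≤ lt))
        where
        b = s + a
        e₂′ : α′ (suc b) ≡ true
        e₂′ = trans (cong α′ (sym (+-suc s a))) e₂
        K₁ = flipK (rotK b K′)
        open Facts.Swap K₁ (γ-here b (prev-false b e₂′)) (P.δ-of (1 + b) (P.γ-false b (prev-false b e₂′)))
        F2 : ∀ u → A (c swapped u) (F.c′ (suc b)) ≡ true → A K.x (c swapped (2 + u)) ≡ true → ⊥
        F2 = Facts.F2xy swap e₂′
        go′ : (∃ λ o → s + o ≡ m) → ⊥
        go′ (zero , eq) = <⇒≢ lt (trans (sym (+-identityʳ s)) eq)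
        go′ (suc o , eq) = F2 (2 + o) (subst₂ _⇒_ (sym (trans (at-old (2 + o) (s≤s (s≤s z≤n)) o≤) src)) (cong F.c′ (+-suc s a)) arc′)
            (split (suc (suc (suc (suc o))) ≤? m))
          where
          o≤ : 2 + o ≤ m
          o≤ = (lin₁ (1 ∷ 1 ∷ 1 ∷ 0 ∷ []) (s ∷ o ∷ m ∷ []) (λ s o m → (s ⊕ (κ 1 ⊕ o) ≐ m) ⇛ (κ 1 ≼ s) ⇛ ⊢ (κ 2 ⊕ o ≼ m))) eq 1≤s
          src : F.c′ (2 + o + b) ≡ F.c′ (suc a)
          src = trans (cong F.c′ ((lin₂ (1 ∷ 1 ∷ 0 ∷ []) (1 ∷ 0 ∷ 1 ∷ []) (s ∷ o ∷ m ∷ a ∷ []) (λ s o m a → (s ⊕ (κ 1 ⊕ o) ≐ m) ⇛ ⊢ (κ 2 ⊕ o ⊕ (s ⊕ a) ≐ m ⊕ (κ 1 ⊕ a)))) eq)) (per K.C (suc a))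
          αs : α′ (3 + o + b) ≡ false
          αs = next-false (2 + o + b) (trans (cong (λ z → A z K.x) src) e₁)
          βs : A K.x (F.c′ (4 + o + b)) ≡ true
          βs = P.β-of (3 + o + b) αs
          -- The index may leave the window: m + 1 is the place of the inserted y, reached by x → y,
          -- and m + 2 is an old vertex again.
          split : Dec (4 + o ≤ m) → A K.x (c swapped (4 + o)) ≡ true
          split (yes le) = trans (cong (A K.x) (at-old (4 + o) (s≤s (s≤s z≤n)) le)) βs
          split (no ≰) = split′ (4 + o ≟ m + 1)
            where
            split′ : Dec (4 + o ≡ m + 1) → A K.x (c swapped (4 + o)) ≡ true
            split′ (yes eq′) = trans (cong (A K.x) (trans (cong (c swapped) eq′) (trans (per swapped 1) at-1))) (proj₁ sgl′)
            split′ (no ne) = trans (cong (A K.x) (trans (cong (c swapped) eq″) (trans (per swapped 2) (trans (at-old 2 ≤-refl (<⇒≤ 1<m))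
                (trans (sym (per K.C (2 + b))) (cong F.c′ (trans (sym (+-assoc m 2 b)) (cong (_+ b) (sym eq″)))))))) ) βs
              where
              eq″ : 4 + o ≡ m + 2
              eq″ = ≤-antisym ((lin₁ (1 ∷ 1 ∷ []) (o ∷ m ∷ []) (λ o m → (κ 2 ⊕ o ≼ m) ⇛ ⊢ (κ 4 ⊕ o ≼ m ⊕ κ 2))) o≤)
                (subst (_≤ 4 + o) (sym (+-suc m 1)) (≤∧≢⇒< (subst (_≤ 4 + o) (+-comm 1 m) (≰⇒> ≰)) (ne ∘ sym)))

    go : α 0 ≡ true ⊎ α 0 ≡ false → ⊥
    go (inj₁ e0) = with-α0 K sgl alt e0
    go (inj₂ e0) = with-α0 (rotK 1 K) sgl (λ i → trans (alt (i + 1)) refl) (no-00 0 e0)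

-- The case of both arcs between x and y, and defects

module BothWays {N : ℕ} (A : Digraph (Fin (suc N))) (S : Counterexample A) (m : ℕ) (N≡ : N ≡ suc m) where

  open Graph hiding (reduce)
  open Cycles A
  open Setup.Structures A
  open Counterexample S
  open Configuration A S m N≡

  open OneWay A S m N≡

  both : ∀ K → let open Conf K in A x y ≡ true × A y x ≡ true
  both K = go (bool-cases (A x y)) (bool-cases (A y x))
    where
    open Conf K
    go : _ → _ → A x y ≡ true × A y x ≡ true
    go (inj₁ a) (inj₁ b) = a , b
    go (inj₁ a) (inj₂ b) = ⊥-elim (single-absurd K (a , b))
    go (inj₂ a) (inj₁ b) = ⊥-elim (single-absurd (flipK K) (b , a))
    go (inj₂ a) (inj₂ b) = ⊥-elim (nonadjacent K a b)

  module Rules (K : Conf) where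
    open Conf K
    open Facts K public
    private
      module G = Facts (flipK K)

    xy : x ⇒ y
    xy = proj₁ (both K)
    yx : y ⇒ x
    yx = proj₂ (both K)

    F1y : ∀ i → γ i ≡ true → δ (1 + i) ≡ true → ⊥
    F1y = G.F1x

    F2 : ∀ i → α i ≡ true → δ (2 + i) ≡ true → ⊥
    F2 = F2xy xy

    F2′ : ∀ i → γ i ≡ true → β (2 + i) ≡ true → ⊥
    F2′ = G.F2xy yx

    -- When x takes the place of c_{i+1}, the pair (c_{i+1}, y) lies off a cycle of length m, and
    -- `both` applies to it.
    F3 : ∀ i → α i ≡ true → β (2 + i) ≡ true → γ (1 + i) ≡ true × δ (1 + i) ≡ true
    F3 i a b = both (Facts.Swap.swap (rotK i K) a b)

    gaps≤1 : gaps ≤ 1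
    gaps≤1 = (lin₁ (1 ∷ 1 ∷ 0 ∷ 1 ∷ 0 ∷ 1 ∷ 0 ∷ 1 ∷ 1 ∷ 1 ∷ 0 ∷ 1 ∷ []) (indeg A x ∷ outdeg A x ∷ # α m ∷ # β m ∷ bit (A y x) ∷ bit (A x y) ∷ gaps ∷ N ∷ m ∷ []) (λ i o a b p q g N m → (N ≐ κ 1 ⊕ m) ⇛ (N ≼ i ⊕ o) ⇛ (i ≼ a ⊕ p) ⇛ (o ≼ b ⊕ q) ⇛ (p ≐ κ 1) ⇛ (q ≐ κ 1) ⇛ (a ⊕ b ⊕ g ≐ m) ⇛ ⊢ (g ≼ κ 1)))
      N≡ (deg x) in-x out-x (bit-true yx) (bit-true xy) gaps-eq

    α-size : m ≤ 2 * # α m + 2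
    α-size = (lin₁ (1 ∷ 2 ∷ 0 ∷ 2 ∷ 1 ∷ 0 ∷ 1 ∷ []) (indeg A x ∷ # α m ∷ bit (A y x) ∷ N ∷ m ∷ []) (λ i a p N m → (N ≐ κ 1 ⊕ m) ⇛ (N ≼ 2 ⊛ i ⊕ κ 1) ⇛ (i ≼ a ⊕ p) ⇛ (p ≐ κ 1) ⇛ ⊢ (m ≼ 2 ⊛ a ⊕ κ 2))) N≡ (deg-in x) in-x (bit-true yx)

    β-size : m ≤ 2 * # β m + 2
    β-size = (lin₁ (1 ∷ 2 ∷ 0 ∷ 2 ∷ 1 ∷ 0 ∷ 1 ∷ []) (outdeg A x ∷ # β m ∷ bit (A x y) ∷ N ∷ m ∷ []) (λ i a p N m → (N ≐ κ 1 ⊕ m) ⇛ (N ≼ 2 ⊛ i ⊕ κ 1) ⇛ (i ≼ a ⊕ p) ⇛ (p ≐ κ 1) ⇛ ⊢ (m ≼ 2 ⊛ a ⊕ κ 2))) N≡ (deg-out x) out-x (bit-true xy)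

    gap-unique : ∀ i j → i < j → j < m → α i ≡ false → β (1 + i) ≡ false → α j ≡ false → β (1 + j) ≡ false → ⊥
    gap-unique i j i<j j<m a b a′ b′ = <⇒≱ (#-2≤ (nor α (β ∘ suc)) i j i<j j<m
      (nor-intro {α} {β ∘ suc} i a b) (nor-intro {α} {β ∘ suc} j a′ b′)) gaps≤1

  -- As x and y are joined both ways, both fit between c_j and c_{j+1}: the digraph is Hamiltonian
  -- through C.
  Insertion : Conf → Set
  Insertion K = ∃ λ j → (α j ≡ true × δ (1 + j) ≡ true) ⊎ (γ j ≡ true × β (1 + j) ≡ true)
    where open Conf K

  -- A defect is the pattern 1 0 0 of α around a gap. Since a second gap is impossible, x → c₃, and
  -- the cycle D = c₃ ... c₀ x of length m - 1 leaves y, c₁ and c₂ outside. Counting on D shows that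
  -- y has the same defect, and then a Hamiltonian insertion is impossible.
  module Defect (K : Conf) (α0 : Conf.α K 0 ≡ true) (α1 : Conf.α K 1 ≡ false) (β2 : Conf.β K 2 ≡ false) (α2 : Conf.α K 2 ≡ false) where
    open Conf K
    open Rules K
    private
      module G = Rules (flipK K)

    β1 : β 1 ≡ false
    β1 = ¬true (F1x 0 α0)

    β3 : β 3 ≡ true
    β3 = ¬false (gap-unique 1 2 ≤-refl 1<m α1 β2 α2)

    γ1 : γ 1 ≡ false
    γ1 = ¬true λ g → F2′ 1 g β3

    δ2 : δ 2 ≡ false
    δ2 = ¬true (F2 0 α0)

    δ1 : γ 0 ≡ false → δ 1 ≡ true
    δ1 g = ¬false λ d → G.gap-unique 0 1 z<s (<⇒≤ 1<m) g d γ1 δ2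

    δ3 : γ 2 ≡ false → δ 3 ≡ true
    δ3 g = ¬false λ d → G.gap-unique 1 2 ≤-refl 1<m γ1 δ2 g d

    private
      r = proj₁ (m≤n⇒∃[o]m+o≡n {3} {m} 1<m)
      3+r : 3 + r ≡ m
      3+r = proj₂ (m≤n⇒∃[o]m+o≡n {3} {m} 1<m)

    open Detour C 3 r 3+r (s≤s z≤n) (x ∷ []) (α0 , β3) one-unique (λ i _ → ∉-∷ (x∉ (i + 3)) ∉-[])

    D : Cyc (2 + r)
    D = detour (cong suc (+-comm r 1))

    D-at : ∀ i → i ≤ r → c D i ≡ c′ (i + 3)
    D-at = detour-old (cong suc (+-comm r 1))

    D-x : c D (suc r) ≡ x
    D-x = trans (cong (c D) (sym (+-identityʳ (suc r)))) (detour-new (cong suc (+-comm r 1)) 0 z<s)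

    D-0 : c D r ≡ c′ 0
    D-0 = trans (D-at r ≤-refl) (trans (cong c′ (trans (+-comm r 3) 3+r)) (c-m C))

    D-3 : c D (2 + r) ≡ c′ 3
    D-3 = trans (c-m D) (D-at 0 z≤n)

    off-D : ∀ {v} → (∀ i → i ≤ r → c′ (i + 3) ≢ v) → x ≢ v → Off D v
    off-D {v} h x≢ = off-window D (s≤s z≤n) go
      where
      go : ∀ i → i < 2 + r → c D i ≢ v
      go i lt e = split (i ≤? r)
        where
        split : Dec (i ≤ r) → ⊥
        split (yes le) = h i le (trans (sym (D-at i le)) e)
        split (no ≰) = x≢ (trans (sym D-x) (trans (cong (c D) (≤-antisym (≰⇒> ≰) (s≤s⁻¹ lt))) e))

    y-off : Off D y
    y-off = off-D (λ i _ → y∉ (i + 3)) x≢y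

    far : ∀ i → i ≤ r → ∀ j → j < 2 → c′ (i + 3) ≢ c′ (1 + j)
    far i le j lt e = <⇒≢ (≤-trans lt (m≤n+m 2 i)) (sym (inj (rot 1 C) (i + 2) j
      ((lin₁ (1 ∷ 1 ∷ 1 ∷ 0 ∷ []) (i ∷ r ∷ m ∷ []) (λ i r m → (κ 3 ⊕ r ≐ m) ⇛ (i ≼ r) ⇛ ⊢ (κ 1 ⊕ (i ⊕ κ 2) ≼ m))) 3+r le) (≤-trans lt (<⇒≤ 1<m))
      (trans (cong c′ (+-assoc i 2 1)) (trans e (cong c′ (+-comm 1 j))))))

    c1-off : Off D (c′ 1)
    c1-off = off-D (λ i le → far i le 0 z<s) (x∉ 1 ∘ sym)

    c2-off : Off D (c′ 2)
    c2-off = off-D (λ i le → far i le 1 (s≤s (s≤s z≤n))) (x∉ 2 ∘ sym)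

    c1≢c2 : c′ 1 ≢ c′ 2
    c1≢c2 e = case inj C 1 2 (<⇒≤ 1<m) 1<m e of λ ()

    inD outD : V → ℕ
    inD v = # (λ i → A (c D i) v) (2 + r)
    outD v = # (λ i → A v (c D i)) (2 + r)

    private
      split-count : ∀ (f : V → Bool) → # (λ i → f (c′ i)) m + bit (f x) ≡ # (λ i → f (c D i)) (2 + r) + bit (f (c′ 1)) + bit (f (c′ 2))
      split-count f = (lin₂ (1 ∷ 0 ∷ 1 ∷ 1 ∷ 0 ∷ 1 ∷ 0 ∷ 0 ∷ 1 ∷ []) (1 ∷ 1 ∷ 0 ∷ 0 ∷ 1 ∷ 0 ∷ 1 ∷ 1 ∷ 0 ∷ []) (# (λ i → f (c′ i)) m ∷ # (λ i → f (c′ (suc i))) m ∷ # (λ i → f (c′ (3 + i))) (suc r) ∷ # (λ i → f (c′ (i + 3))) (suc r) ∷ # (λ i → f (c D i)) (2 + r) ∷ bit (f x) ∷ bit (f (c′ 1)) ∷ bit (f (c′ 2)) ∷ []) (λ n n′ n″ n‴ d p q s → (n′ ≐ n) ⇛ (n′ ≐ q ⊕ (s ⊕ n″)) ⇛ (n″ ≐ n‴) ⇛ (d ≐ n‴ ⊕ (p ⊕ κ 0)) ⇛ ⊢ (n ⊕ p ≐ d ⊕ q ⊕ s)))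
        (periodic-suc {λ i → f (c′ i)} (λ i → cong f (per C i)))
        (cong (# (λ i → f (c′ (suc i)))) (sym 3+r))
        (#-cong (suc r) λ i _ → cong (λ z → f (c′ z)) (+-comm 3 i))
        (detour-# f (cong suc (+-comm r 1)))

    indeg-D : ∀ v → indeg A v ≤ inD v + bit (A y v) + bit (A (c′ 1) v) + bit (A (c′ 2) v)
    indeg-D v = (lin₁ (1 ∷ 1 ∷ 0 ∷ 1 ∷ []) (indeg A v ∷ bit (A x v) ∷ bit (A y v) ∷ # (λ i → A (c′ i) v) m ∷ inD v ∷ bit (A (c′ 1) v) ∷ bit (A (c′ 2) v) ∷ []) (λ d p q n i s t → (d ≼ p ⊕ (q ⊕ n)) ⇛ (n ⊕ p ≐ i ⊕ s ⊕ t) ⇛ ⊢ (d ≼ i ⊕ q ⊕ s ⊕ t))) (in-count v) (split-count (λ u → A u v))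

    outdeg-D : ∀ v → outdeg A v ≤ outD v + bit (A v y) + bit (A v (c′ 1)) + bit (A v (c′ 2))
    outdeg-D v = (lin₁ (1 ∷ 1 ∷ 0 ∷ 1 ∷ []) (outdeg A v ∷ bit (A v x) ∷ bit (A v y) ∷ # (λ i → A v (c′ i)) m ∷ outD v ∷ bit (A v (c′ 1)) ∷ bit (A v (c′ 2)) ∷ []) (λ d p q n i s t → (d ≼ p ⊕ (q ⊕ n)) ⇛ (n ⊕ p ≐ i ⊕ s ⊕ t) ⇛ ⊢ (d ≼ i ⊕ q ⊕ s ⊕ t))) (out-count v) (split-count (A v))

    nors : V → V → ℕ
    nors u v = # (nor (λ i → A (c D i) u) (λ i → A v (c D (suc i)))) (2 + r)

    -- An arc u → v off D cannot be inserted between consecutive vertices of D, because m - 1 + 2 =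
    -- N.
    pair : ∀ u v → u ⇒ v → Off D u → Off D v → inD u + outD v + nors u v ≡ 2 + r
    pair u v uv u∉ v∉ = trans (cong (λ z → inD u + z + nors u v) (sym (#-shift (λ i → A v (c D i)) (2 + r) (cong (A v) (c-m D)))))
      (#-nor _ _ (2 + r) λ i _ a b → no-detour (rot i D) 1 (suc r) (u ∷ v ∷ []) refl
        (trans ((lin₂ (1 ∷ 0 ∷ 1 ∷ 1 ∷ 0 ∷ []) (1 ∷ 1 ∷ 0 ∷ 0 ∷ 1 ∷ []) (r ∷ m ∷ N ∷ []) (λ r m N → (κ 3 ⊕ r ≐ m) ⇛ (N ≐ κ 1 ⊕ m) ⇛ ⊢ (κ 1 ⊕ (κ 1 ⊕ r) ⊕ κ 2 ≐ N))) 3+r N≡) refl) ≤-refl (a , uv , b) (pair-unique (loop-free uv))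
        λ j _ → ∉-∷ (u∉ _) (∉-∷ (v∉ _) ∉-[]))

    before-x : ∀ u v → A (c′ 0) u ≡ false → A v x ≡ false → 1 ≤ nors u v
    before-x u v a b = #-1≤ (nor (λ i → A (c D i) u) (λ i → A v (c D (suc i)))) r (s≤s (n≤1+n r))
      (nor-intro {λ i → A (c D i) u} {λ i → A v (c D (suc i))} r (trans (cong (λ z → A z u) D-0) a) (trans (cong (A v) D-x) b))

    after-x : ∀ u v → A x u ≡ false → A v (c′ 3) ≡ false → 1 ≤ nors u v
    after-x u v a b = #-1≤ (nor (λ i → A (c D i) u) (λ i → A v (c D (suc i)))) (suc r) ≤-refl
      (nor-intro {λ i → A (c D i) u} {λ i → A v (c D (suc i))} (suc r) (trans (cong (λ z → A z u) D-x) a) (trans (cong (A v) D-3) b))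

    b₁₂ : bit (A (c′ 1) (c′ 2)) ≡ 1
    b₁₂ = bit-true (arc C 1)

    -- The place between c₀ and x is idle for the arc y → c₁, so the neighbours counted on D number
    -- at most m - 2. One more arc, c₁ → c₂, does not reach the m that the half-degree conditions
    -- require.
    no-yc1 : γ 0 ≡ false → γ 2 ≡ false → ⊥
    no-yc1 g0 g2 = (lin₁ (2 ∷ 2 ∷ 0 ∷ 2 ∷ 0 ∷ 2 ∷ 0 ∷ 2 ∷ 0 ∷ 4 ∷ 0 ∷ 2 ∷ 0 ∷ 2 ∷ 2 ∷ 1 ∷ 1 ∷ 2 ∷ 0 ∷ 0 ∷ 2 ∷ []) (indeg A y ∷ outdeg A (c′ 1) ∷ inD y ∷ outD (c′ 1) ∷ nors y (c′ 1) ∷ bit (A y y) ∷ bit (γ 1) ∷ bit (γ 2) ∷ bit (A (c′ 1) (c′ 1)) ∷ bit (A (c′ 1) (c′ 2)) ∷ N ∷ m ∷ r ∷ []) (λ i o I O n a b d e f N m r → (N ≐ κ 1 ⊕ m) ⇛ (κ 3 ⊕ r ≐ m) ⇛ (N ≼ 2 ⊛ i ⊕ κ 1) ⇛ (N ≼ 2 ⊛ o ⊕ κ 1) ⇛ (i ≼ I ⊕ a ⊕ b ⊕ d) ⇛ (o ≼ O ⊕ b ⊕ e ⊕ f) ⇛ (a ≐ κ 0) ⇛ (b ≐ κ 0) ⇛ (d ≐ κ 0) ⇛ (e ≐ κ 0) ⇛ (f ≐ κ 1) ⇛ (I ⊕ O ⊕ n ≐ κ 2 ⊕ r) ⇛ (κ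 1 ≼ n) ⇛ ⊢ (ff)))
      N≡ 3+r (deg-in y) (deg-out (c′ 1)) (indeg-D y) (outdeg-D (c′ 1)) (bit-false (loopless y)) (bit-false γ1) (bit-false g2) (bit-false (loopless _)) b₁₂
      (pair y (c′ 1) (δ1 g0) y-off c1-off) (before-x y (c′ 1) g0 α1)

    no-c2y : γ 0 ≡ true → γ 2 ≡ true → ⊥
    no-c2y g0 g2 = (lin₁ (2 ∷ 2 ∷ 0 ∷ 2 ∷ 0 ∷ 2 ∷ 0 ∷ 4 ∷ 0 ∷ 2 ∷ 0 ∷ 2 ∷ 0 ∷ 2 ∷ 2 ∷ 1 ∷ 1 ∷ 2 ∷ 0 ∷ 0 ∷ 2 ∷ []) (indeg A (c′ 2) ∷ outdeg A y ∷ inD (c′ 2) ∷ outD y ∷ nors (c′ 2) y ∷ bit (A y y) ∷ bit (δ 1) ∷ bit (δ 2) ∷ bit (A (c′ 2) (c′ 2)) ∷ bit (A (c′ 1) (c′ 2)) ∷ N ∷ m ∷ r ∷ []) (λ i o I O n a b d e f N m r → (N ≐ κ 1 ⊕ m) ⇛ (κ 3 ⊕ r ≐ m) ⇛ (N ≼ 2 ⊛ i ⊕ κ 1) ⇛ (N ≼ 2 ⊛ o ⊕ κ 1) ⇛ (i ≼ I ⊕ d ⊕ f ⊕ e) ⇛ (o ≼ O ⊕ a ⊕ b ⊕ d) ⇛ (a ≐ κ 0) ⇛ (b ≐ κ 0) ⇛ (d ≐ κ 0) ⇛ (e ≐ κ 0) ⇛ (f ≐ κ 1) ⇛ (I ⊕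 O ⊕ n ≐ κ 2 ⊕ r) ⇛ (κ 1 ≼ n) ⇛ ⊢ (ff)))
      N≡ 3+r (deg-in (c′ 2)) (deg-out y) (indeg-D (c′ 2)) (outdeg-D y) (bit-false (loopless y)) (bit-false (¬true (F1y 0 g0))) (bit-false δ2) (bit-false (loopless _)) b₁₂
      (pair (c′ 2) y g2 c2-off y-off) (after-x (c′ 2) y β2 (¬true (F1y 2 g2)))

    -- Both c₂ → y and y → c₁ are present, and each has an idle place next to x. The two
    -- inequalities added, with the full degree of y, are contradictory.
    no-triangle : γ 0 ≡ false → γ 2 ≡ true → ⊥
    no-triangle g0 g2 = (lin₁ (2 ∷ 2 ∷ 0 ∷ 2 ∷ 2 ∷ 0 ∷ 2 ∷ 0 ∷ 2 ∷ 0 ∷ 4 ∷ 0 ∷ 4 ∷ 0 ∷ 2 ∷ 0 ∷ 4 ∷ 0 ∷ 2 ∷ 0 ∷ 4 ∷ 0 ∷ 2 ∷ 2 ∷ 2 ∷ 2 ∷ 2 ∷ 1 ∷ 1 ∷ 4 ∷ 0 ∷ 0 ∷ 4 ∷ []) (indeg A (c′ 2) ∷ outdeg A y ∷ indeg A y ∷ outdeg A (c′ 1) ∷ inD (c′ 2) ∷ outD y ∷ nors (c′ 2) y ∷ inD y ∷ outD (c′ 1) ∷ nors y (c′ 1) ∷ bit (A y y) ∷ bit (δ 1) ∷ bit (δ 2) ∷ bit (A (c′ 2) (c′ 2)) ∷ bit (A (c′ 1) (c′ 2)) ∷ bit (γ 1) ∷ bit (γ 2) ∷ bit (A (c′ 1)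 (c′ 1)) ∷ N ∷ m ∷ r ∷ []) (λ i o i′ o′ I O n I′ O′ n′ a b d e f g h e′ N m r → (N ≐ κ 1 ⊕ m) ⇛ (κ 3 ⊕ r ≐ m) ⇛ (N ≼ 2 ⊛ i ⊕ κ 1) ⇛ (N ≼ 2 ⊛ o′ ⊕ κ 1) ⇛ (N ≼ i′ ⊕ o) ⇛ (i ≼ I ⊕ d ⊕ f ⊕ e) ⇛ (o ≼ O ⊕ a ⊕ b ⊕ d) ⇛ (i′ ≼ I′ ⊕ a ⊕ g ⊕ h) ⇛ (o′ ≼ O′ ⊕ g ⊕ e′ ⊕ f) ⇛ (a ≐ κ 0) ⇛ (b ≐ κ 1) ⇛ (d ≐ κ 0) ⇛ (e ≐ κ 0) ⇛ (f ≐ κ 1) ⇛ (g ≐ κ 0) ⇛ (h ≐ κ 1) ⇛ (e′ ≐ κ 0) ⇛ (I ⊕ O ⊕ n ≐ κ 2 ⊕ r) ⇛ (κ 1 ≼ n) ⇛ (I′ ⊕ O′ ⊕ n′ ≐ κ 2 ⊕ r) ⇛ (κ 1 ≼ n′) ⇛ ⊢ (ff)))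
      N≡ 3+r (deg-in (c′ 2)) (deg-out (c′ 1)) (deg y) (indeg-D (c′ 2)) (outdeg-D y) (indeg-D y) (outdeg-D (c′ 1))
      (bit-false (loopless y)) (bit-true (δ1 g0)) (bit-false δ2) (bit-false (loopless _)) b₁₂ (bit-false γ1) (bit-true g2) (bit-false (loopless _))
      (pair (c′ 2) y g2 c2-off y-off) (after-x (c′ 2) y β2 (¬true (F1y 2 g2)))
      (pair y (c′ 1) (δ1 g0) y-off c1-off) (before-x y (c′ 1) g0 α1)

    -- The other three values are refuted by counting. With γ₁ and δ₂ false, y shows the same defect
    -- at the same place as x.
    twin : γ 0 ≡ true × γ 2 ≡ false
    twin = go (bool-cases (γ 0)) (bool-cases (γ 2))
      where
      go : _ → _ → γ 0 ≡ true × γ 2 ≡ false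
      go (inj₁ a) (inj₁ b) = ⊥-elim (no-c2y a b)
      go (inj₁ a) (inj₂ b) = a , b
      go (inj₂ a) (inj₁ b) = ⊥-elim (no-triangle a b)
      go (inj₂ a) (inj₂ b) = ⊥-elim (no-yc1 a b)

    private
      γ0 = proj₁ twin
      γ2 = proj₂ twin

    twin-δ1 : δ 1 ≡ false
    twin-δ1 = ¬true (F1y 0 γ0)

    twin-δ3 : δ 3 ≡ true
    twin-δ3 = δ3 γ2

    -- In c₀ → x → y → c₃ the vertices x, y replace c₁, c₂, and `both` applies to the pair left out.
    c2⇒c1 : c′ 2 ⇒ c′ 1
    c2⇒c1 = proj₂ (both K₂)
      where
      module E = Detour C 3 r 3+r (s≤s z≤n) (x ∷ y ∷ []) (α0 , xy , twin-δ3) (pair-unique x≢y) (λ i _ → ∉-∷ (x∉ (i + 3)) (∉-∷ (y∉ (i + 3)) ∉-[]))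
      len : suc r + 2 ≡ m
      len = trans (cong suc (+-comm r 2)) 3+r
      off : ∀ {v} → (∀ i → i ≤ r → c′ (i + 3) ≢ v) → x ≢ v → y ≢ v → Off (E.detour len) v
      off {v} h x≢ y≢ = off-window (E.detour len) (<⇒≤ (<⇒≤ 1<m)) λ i lt e → split i lt e (λ ≰ → m≤n⇒∃[o]m+o≡n {suc r} {i} (≰⇒> ≰)) (i ≤? r)
        where
        split : ∀ i → i < m → c (E.detour len) i ≡ v → (¬ (i ≤ r) → ∃ λ o → suc r + o ≡ i) → Dec (i ≤ r) → ⊥
        split i lt e _ (yes le) = h i le (trans (sym (E.detour-old len i le)) e)
        split i lt e f (no ≰) = last (f ≰)
          where
          last : (∃ λ o → suc r + o ≡ i) → ⊥
          last (0 , refl) = x≢ (trans (sym (E.detour-new len 0 z<s)) e)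
          last (1 , refl) = y≢ (trans (sym (E.detour-new len 1 (s≤s (s≤s z≤n)))) e)
          last (suc (suc o) , refl) = (lin₁ (1 ∷ 0 ∷ 1 ∷ []) (r ∷ o ∷ m ∷ []) (λ r o m → (κ 3 ⊕ r ≐ m) ⇛ (κ 1 ⊕ (κ 1 ⊕ r ⊕ (κ 2 ⊕ o)) ≼ m) ⇛ ⊢ (ff))) 3+r lt
      K₂ : Conf
      K₂ = record { C = E.detour len ; x = c′ 1 ; y = c′ 2
        ; x∉ = off (λ i le → far i le 0 z<s) (x∉ 1 ∘ sym) (y∉ 1 ∘ sym)
        ; y∉ = off (λ i le → far i le 1 (s≤s (s≤s z≤n))) (x∉ 2 ∘ sym) (y∉ 2 ∘ sym)
        ; x≢y = c1≢c2 }

    -- Otherwise the place between x and c₃ is idle for c₂ → c₁, and the degrees of c₁ and c₂, which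
    -- are not joined to y, cannot both be met.
    c1⇒c3 : c′ 1 ⇒ c′ 3
    c1⇒c3 = ¬false λ no →
      (lin₁ (1 ∷ 1 ∷ 0 ∷ 1 ∷ 0 ∷ 2 ∷ 0 ∷ 2 ∷ 0 ∷ 2 ∷ 2 ∷ 1 ∷ 0 ∷ 1 ∷ 0 ∷ 1 ∷ 0 ∷ 1 ∷ 0 ∷ 1 ∷ 1 ∷ 1 ∷ 1 ∷ 1 ∷ 1 ∷ 2 ∷ 0 ∷ 0 ∷ 2 ∷ []) (indeg A (c′ 1) ∷ outdeg A (c′ 1) ∷ indeg A (c′ 2) ∷ outdeg A (c′ 2) ∷ inD (c′ 1) ∷ outD (c′ 1) ∷ inD (c′ 2) ∷ outD (c′ 2) ∷ nors (c′ 1) (c′ 2) ∷ nors (c′ 2) (c′ 1) ∷ bit (δ 1) ∷ bit (δ 2) ∷ bit (γ 1) ∷ bit (γ 2) ∷ bit (A (c′ 1) (c′ 2)) ∷ bit (A (c′ 2) (c′ 1)) ∷ bit (A (c′ 1) (c′ 1)) ∷ bit (A (c′ 2) (c′ 2)) ∷ N ∷ m ∷ r ∷ []) (λ i₁ o₁ i₂ o₂ I₁ O₁ I₂ O₂ n n′ a b d e f g h₁ h₂ N m r → (N ≐ κ 1 ⊕ m) ⇛ (κ 3 ⊕ r ≐ m) ⇛ (N ≼ i₁ ⊕ o₁) ⇛ (N ≼ i₂ ⊕ o₂) ⇛ (i₁ ≼ I₁ ⊕ a ⊕ h₁ ⊕ g) ⇛ (o₁ ≼ O₁ ⊕ d ⊕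 h₁ ⊕ f) ⇛ (i₂ ≼ I₂ ⊕ b ⊕ f ⊕ h₂) ⇛ (o₂ ≼ O₂ ⊕ e ⊕ g ⊕ h₂) ⇛ (a ≐ κ 0) ⇛ (b ≐ κ 0) ⇛ (d ≐ κ 0) ⇛ (e ≐ κ 0) ⇛ (f ≼ κ 1) ⇛ (g ≼ κ 1) ⇛ (h₁ ≐ κ 0) ⇛ (h₂ ≐ κ 0) ⇛ (I₁ ⊕ O₂ ⊕ n ≐ κ 2 ⊕ r) ⇛ (I₂ ⊕ O₁ ⊕ n′ ≐ κ 2 ⊕ r) ⇛ (κ 1 ≼ n′) ⇛ ⊢ (ff)))
      N≡ 3+r (deg (c′ 1)) (deg (c′ 2)) (indeg-D (c′ 1)) (outdeg-D (c′ 1)) (indeg-D (c′ 2)) (outdeg-D (c′ 2))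
      (bit-false twin-δ1) (bit-false δ2) (bit-false γ1) (bit-false γ2) (bit≤1 _) (bit≤1 _) (bit-false (loopless _)) (bit-false (loopless _))
      (pair (c′ 1) (c′ 2) (arc C 1) c1-off c2-off) (pair (c′ 2) (c′ 1) c2⇒c1 c2-off c1-off)
      (after-x (c′ 2) (c′ 1) β2 no)

    -- The cycle c₀ c₁ c₃ ... has length m - 1, and x, y inserted between two of its vertices give
    -- length N. The three places next to c₁ and c₂ are ruled out by the pattern itself.
    no-insertion : Insertion K → ⊥
    no-insertion (j , h) =
      let s , lt , f = reduce 0 j
          α≡ = f α-per ; β≡ = f (λ i → trans (cong β (sym (+-suc m i))) (β-per (suc i)))
          γ≡ = f γ-per ; δ≡ = f (λ i → trans (cong δ (sym (+-suc m i))) (δ-per (suc i)))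
      in go s lt (transport s α≡ β≡ γ≡ δ≡ h)
      where
      transport : ∀ s → α j ≡ α (s + 0) → β (suc j) ≡ β (suc (s + 0)) → γ j ≡ γ (s + 0) → δ (suc j) ≡ δ (suc (s + 0)) →
        (α j ≡ true × δ (1 + j) ≡ true) ⊎ (γ j ≡ true × β (1 + j) ≡ true) →
        (α s ≡ true × δ (1 + s) ≡ true) ⊎ (γ s ≡ true × β (1 + s) ≡ true)
      transport s a b g d h rewrite +-identityʳ s = [ (λ (p , q) → inj₁ (trans (sym a) p , trans (sym d) q)) , (λ (p , q) → inj₂ (trans (sym g) p , trans (sym b) q)) ]′ h
      module E = Detour C 3 r 3+r (s≤s z≤n) (c′ 1 ∷ []) (arc C 0 , c1⇒c3) one-unique (λ i le → ∉-∷ (far i le 0 z<s) ∉-[])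
      E = E.detour (cong suc (+-comm r 1))
      E-at : ∀ i → i ≤ r → c E i ≡ c′ (i + 3)
      E-at = E.detour-old (cong suc (+-comm r 1))
      E-1 : c E (suc r) ≡ c′ 1
      E-1 = trans (cong (c E) (sym (+-identityʳ (suc r)))) (E.detour-new (cong suc (+-comm r 1)) 0 z<s)
      off-E : ∀ {v} → Off C v → Off E v
      off-E {v} off = off-window E (s≤s z≤n) λ i lt e → split i lt e (i ≤? r)
        where
        split : ∀ i → i < 2 + r → c E i ≡ v → Dec (i ≤ r) → ⊥
        split i lt e (yes le) = off (i + 3) (trans (sym (E-at i le)) e)
        split i lt e (no ≰) = off 1 (trans (sym E-1) (trans (cong (c E) (≤-antisym (≰⇒> ≰) (s≤s⁻¹ lt))) e))
      insert : ∀ u v t → u ⇒ v → Off C u → Off C v → suc t ≤ r → c′ (3 + t) ⇒ u → v ⇒ c′ (4 + t) → ⊥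
      insert u v t uv u∉ v∉ lt a b = no-detour (rot t E) 1 (suc r) (u ∷ v ∷ []) refl
        (trans ((lin₂ (1 ∷ 0 ∷ 1 ∷ 1 ∷ 0 ∷ []) (1 ∷ 1 ∷ 0 ∷ 0 ∷ 1 ∷ []) (r ∷ m ∷ N ∷ []) (λ r m N → (κ 3 ⊕ r ≐ m) ⇛ (N ≐ κ 1 ⊕ m) ⇛ ⊢ (κ 1 ⊕ (κ 1 ⊕ r) ⊕ κ 2 ≐ N))) 3+r N≡) refl) ≤-refl
        (subst (_⇒ u) (trans (cong c′ (+-comm 3 t)) (sym (E-at t (<⇒≤ lt)))) a , uv , subst (v ⇒_) (trans (cong c′ (cong suc (+-comm 3 t))) (sym (E-at (suc t) lt))) b)
        (pair-unique (loop-free uv)) λ j _ → ∉-∷ (off-E u∉ _) (∉-∷ (off-E v∉ _) ∉-[])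
      go : ∀ s → s < m → (α s ≡ true × δ (1 + s) ≡ true) ⊎ (γ s ≡ true × β (1 + s) ≡ true) → ⊥
      go 0 _ (inj₁ (_ , d)) = true≢false d twin-δ1
      go 0 _ (inj₂ (_ , b)) = true≢false b β1
      go 1 _ (inj₁ (a , _)) = true≢false a α1
      go 1 _ (inj₂ (g , _)) = true≢false g γ1
      go 2 _ (inj₁ (a , _)) = true≢false a α2
      go 2 _ (inj₂ (g , _)) = true≢false g γ2
      go (suc (suc (suc t))) lt (inj₁ (a , d)) = insert x y t xy x∉ y∉ ((lin₁ (1 ∷ 1 ∷ 0 ∷ 1 ∷ []) (r ∷ t ∷ m ∷ []) (λ r t m → (κ 3 ⊕ r ≐ m) ⇛ (κ 1 ⊕ (κ 3 ⊕ t) ≼ m) ⇛ ⊢ (κ 1 ⊕ t ≼ r))) 3+r lt) a d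
      go (suc (suc (suc t))) lt (inj₂ (g , b)) = insert y x t yx y∉ x∉ ((lin₁ (1 ∷ 1 ∷ 0 ∷ 1 ∷ []) (r ∷ t ∷ m ∷ []) (λ r t m → (κ 3 ⊕ r ≐ m) ⇛ (κ 1 ⊕ (κ 3 ⊕ t) ≼ m) ⇛ ⊢ (κ 1 ⊕ t ≼ r))) 3+r lt) g b

-- The neighbour patterns of x that have no defect

module Classification {N : ℕ} (A : Digraph (Fin (suc N))) (S : Counterexample A) (m : ℕ) (N≡ : N ≡ suc m) where

  open Graph hiding (reduce)
  open Cycles A
  open Setup.Structures A
  open Counterexample S
  open Configuration A S m N≡

  open OneWay A S m N≡ using (halve; module Bipartition)
  open BothWays A S m N≡

  Alternating : (ℕ → Bool) → Set
  Alternating e = (∀ i → e (suc i) ≡ not (e i)) × Periodic m e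

  Within : Conf → (ℕ → Bool) → Set
  Within K e = (∀ i → α i ≡ true → e i ≡ true) × (∀ i → β i ≡ true → e i ≡ true)
    where open Conf K

  -- Only a colouring that contains α and β is kept, since next to a gap α may miss positions of its
  -- colour.
  Legit : Conf → Set
  Legit K = ∃ λ e → Alternating e × Within K e

  -- The remaining shape: α reads 0 0 1 around the gap and alternates elsewhere, which makes m odd.
  record Odd (K : Conf) : Set where
    open Conf K
    field
      base : ℕ
      α0 : α base ≡ false
      α1 : α (1 + base) ≡ false
      β2 : β (2 + base) ≡ false
      α2 : α (2 + base) ≡ true
      no-11-α : ∀ i → α i ≡ true → α (1 + i) ≡ true → ⊥
      no-11-β : ∀ i → β i ≡ true → β (1 + i) ≡ true → ⊥
      last : ∀ n → suc n ≡ m → α (n + base) ≡ true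
      odd : 2 * # α m + 1 ≡ m

  NoDefect : Conf → Set
  NoDefect K = ∀ i → α i ≡ true → α (1 + i) ≡ false → β (2 + i) ≡ false → α (2 + i) ≡ false → ⊥
    where open Conf K

  not-false : ∀ {b} → not b ≡ false → b ≡ true
  not-false {true} _ = refl

  not-true : ∀ {b} → not b ≡ true → b ≡ false
  not-true {false} _ = refl

  m-pred : ∃ λ n → suc n ≡ m
  m-pred = m≤n⇒∃[o]m+o≡n {1} {m} (<⇒≤ (<⇒≤ 1<m))

  from-suc : ∀ {f g : ℕ → Bool} {b} → Periodic m f → Periodic m g →
    (∀ i → f (suc i) ≡ true → g (suc i) ≡ b) → ∀ i → f i ≡ true → g i ≡ b
  from-suc {f} {g} fp gp h i fi = go m-pred
    where
    go : (∃ λ n → suc n ≡ m) → g i ≡ _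
    go (n , eq) = trans (sym (gp i)) (trans (cong (λ z → g (z + i)) (sym eq)) (h (n + i) (trans (cong (λ z → f (z + i)) eq) (trans (fp i) fi))))

  alternating-window : ∀ {e} → Periodic m e → (∀ i → i < m → e (suc i) ≡ not (e i)) → Alternating e
  alternating-window {e} per h = (λ i → let s , lt , f = reduce 0 i in
      trans (trans (f {f = e ∘ suc} (λ j → trans (cong e (sym (+-suc m j))) (per (suc j)))) (cong (e ∘ suc) (+-identityʳ s)))
        (trans (h s lt) (cong not (trans (cong e (sym (+-identityʳ s))) (sym (f per)))))) , per

  -- Rotating back by a is rotating on by a · n, where m = n + 1.
  unrotate : ∀ {e : ℕ → Bool} a → ∃ λ (a′ : ℕ) → ∀ {X : Set} {f : ℕ → X} → Periodic m f → ∀ i → f (i + a′ + a) ≡ f i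
  unrotate a = go m-pred
    where
    go : (∃ λ n → suc n ≡ m) → ∃ λ a′ → ∀ {X : Set} {f : ℕ → X} → Periodic m f → ∀ i → f (i + a′ + a) ≡ f i
    go (n , refl) = a * n , λ {_} {f} per i → trans (cong f ((lin₂ (1 ∷ 0 ∷ 1 ∷ []) (1 ∷ 1 ∷ 0 ∷ []) (i ∷ a * n ∷ a ∷ a * suc n ∷ []) (λ i k a q → (q ≐ a ⊕ k) ⇛ ⊢ (i ⊕ k ⊕ a ≐ q ⊕ i))) (*-suc a n))) (period-* per a i)

  module Local (K : Conf) where
    open Conf K
    open Rules K

    -- The arcs c_{i+1} → x → c_{i+3} give y → c_{i+2} by `F3`, and then x, y could replace c_{i+1}
    -- between c_i and c_{i+2}.
    r110 : ∀ i → α i ≡ true → α (1 + i) ≡ true → β (3 + i) ≡ true → ⊥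
    r110 i a a′ b = F2 i a (proj₂ (F3 (1 + i) a′ b))

    r100 : ∀ i → α i ≡ true → β (2 + i) ≡ true → β (3 + i) ≡ true → ⊥
    r100 i a b b′ = F2′ (1 + i) (proj₁ (F3 i a b)) b′

    α-some : 1 ≤ # α m
    α-some = (lin₁ (2 ∷ 1 ∷ 1 ∷ []) (# α m ∷ m ∷ []) (λ a m → (m ≼ 2 ⊛ a ⊕ κ 2) ⇛ (κ 3 ≼ m) ⇛ ⊢ (κ 1 ≼ a))) α-size 1<m

    β-some : 1 ≤ # β m
    β-some = (lin₁ (2 ∷ 1 ∷ 1 ∷ []) (# β m ∷ m ∷ []) (λ a m → (m ≼ 2 ⊛ a ⊕ κ 2) ⇛ (κ 3 ≼ m) ⇛ ⊢ (κ 1 ≼ a))) β-size 1<m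

    propagate : (∀ i → α i ≡ true → α (1 + i) ≡ true → α (2 + i) ≡ false → ⊥) →
      ∀ i → α i ≡ true → α (1 + i) ≡ true → # α m ≡ m
    propagate no-110 i a a′ = trans (sym (#-rot {α} {m} i α-per)) (#-all m λ t _ → proj₁ (ones t))
      where
      ones : ∀ t → α (t + i) ≡ true × α (suc t + i) ≡ true
      ones zero = a , a′
      ones (suc t) = let p , q = ones t in q , ¬false (no-110 (t + i) p q)

    cover-pairs : (∀ i → α i ≡ true → α (1 + i) ≡ false → α (2 + i) ≡ false → ⊥) → α 0 ≡ true → ∀ i → α i ≡ false → α (1 + i) ≡ true
    cover-pairs no-100 a0 zero e = ⊥-elim (true≢false a0 e)
    cover-pairs no-100 a0 (suc i) e = ¬false λ e′ → no-100 i (¬false λ e″ → true≢false (cover-pairs no-100 a0 i e″) e) e e′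

    pairs-eq : (∀ i → α i ≡ true → α (1 + i) ≡ true → ⊥) → # α m + # α m + # (nor α (α ∘ suc)) m ≡ m
    pairs-eq no-11 = trans (cong (λ z → # α m + z + # (nor α (α ∘ suc)) m) (sym (periodic-suc {α} α-per)))
      (#-nor α (α ∘ suc) m λ i _ → no-11 i)

    alternates : (∀ i → α i ≡ true → α (1 + i) ≡ true → ⊥) → (∀ i → α i ≡ false → α (1 + i) ≡ true) → Legit K
    alternates no-11 no-00 = α , ((λ i → go i (bool-cases (α i))) , α-per) , (λ i a → a) ,
        from-suc β-per α-per (λ i b → no-00 i (¬true λ a → F1x i a b))
      where
      go : ∀ i → _ → α (suc i) ≡ not (α i)
      go i (inj₁ a) = trans (¬true (no-11 i a)) (cong not (sym a))
      go i (inj₂ a) = trans (no-00 i a) (cong not (sym a))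

  module NoGap (K : Conf) (g : Facts.gaps K ≡ 0) (α0 : Conf.α K 0 ≡ true) where
    open Conf K
    open Rules K
    open Local K

    β-of : ∀ i → α i ≡ false → β (1 + i) ≡ true
    β-of i a = let s , lt , f = reduce 0 i in
      trans (trans (f {f = β ∘ suc} (λ j → trans (cong β (sym (+-suc m j))) (β-per (suc j)))) (cong (β ∘ suc) (+-identityʳ s)))
        (nor-elim {α} {β ∘ suc} s (#-0 (nor α (β ∘ suc)) s g lt) (trans (cong α (sym (+-identityʳ s))) (trans (sym (f α-per)) a)))

    no-110 : ∀ i → α i ≡ true → α (1 + i) ≡ true → α (2 + i) ≡ false → ⊥
    no-110 i a a′ a″ = r110 i a a′ (β-of (2 + i) a″)

    no-100 : ∀ i → α i ≡ true → α (1 + i) ≡ false → α (2 + i) ≡ false → ⊥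
    no-100 i a a′ a″ = r100 i a (β-of (1 + i) a′) (β-of (2 + i) a″)

    -- Without gaps `r110` and `r100` exclude 110 and 100 from α. What remains alternates, since α
    -- constantly true would leave x no out-neighbour on C.
    legit : Legit K
    legit = alternates
      (λ i a a′ → (lin₁ (1 ∷ 1 ∷ 0 ∷ 0 ∷ 1 ∷ []) (# α m ∷ # β m ∷ gaps ∷ m ∷ []) (λ a b g m → (a ≐ m) ⇛ (a ⊕ b ⊕ g ≐ m) ⇛ (κ 1 ≼ b) ⇛ ⊢ (ff))) (propagate no-110 i a a′) gaps-eq β-some)
      (cover-pairs no-100 α0)

  module OneGap (K : Conf) (α1 : Conf.α K 1 ≡ false) (β2 : Conf.β K 2 ≡ false) where
    open Conf K
    open Rules K
    open Local K

    -- The gap is unique modulo m; stating this through arbitrary periodic functions avoids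
    -- congruences.
    gap-at : ∀ t → α t ≡ false → β (1 + t) ≡ false → ∀ {X : Set} {f : ℕ → X} → Periodic m f → f t ≡ f 1
    gap-at t a b {X} {f} per = let s , lt , h = reduce 1 t in go s lt (h α-per)
        (trans (h {f = β ∘ suc} (λ j → trans (cong β (sym (+-suc m j))) (β-per (suc j)))) refl) (h per)
      where
      go : ∀ s → s < m → α t ≡ α (s + 1) → β (1 + t) ≡ β (suc (s + 1)) → f t ≡ f (s + 1) → f t ≡ f 1
      go zero lt _ _ e = e
      go (suc s) lt e e′ _ = ⊥-elim (Rules.gap-unique (rotK 1 K) 0 (suc s) z<s lt α1 β2 (trans (sym e) a) (trans (sym e′) b))

    gap-before : ∀ t → α (suc t) ≡ false → β (2 + t) ≡ false → ∀ {X : Set} {f : ℕ → X} → Periodic m f → f t ≡ f 0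
    gap-before t a b {X} {f} per = go m-pred
      where
      go : (∃ λ n → suc n ≡ m) → f t ≡ f 0
      go (n , refl) = trans (sym (per t)) (trans (cong f (cong suc (+-comm n t)))
        (trans (gap-at (suc t) a b {f = λ i → f (i + n)} (period-shift n per)) (trans (cong f (sym (+-identityʳ (suc n)))) (per 0))))

    one-gap : gaps ≡ 1
    one-gap = ≤-antisym gaps≤1 (#-1≤ (nor α (β ∘ suc)) 1 (<⇒≤ 1<m) (nor-intro {α} {β ∘ suc} 1 α1 β2))

    module A (α0 : α 0 ≡ true) (α2 : α 2 ≡ true) where
      no-100 : ∀ i → α i ≡ true → α (1 + i) ≡ false → α (2 + i) ≡ false → ⊥
      no-100 i a a′ a″ = go (bool-cases (β (2 + i)))
        where
        go : _ → ⊥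
        go (inj₁ b) = true≢false (trans (gap-before (1 + i) a″ (¬true (r100 i a b)) α-per) α0) a′
        go (inj₂ b) = true≢false (trans (gap-at (1 + i) a′ b {f = α ∘ suc} (λ j → trans (cong α (sym (+-suc m j))) (α-per (suc j)))) α2) a″

      no-00 = cover-pairs no-100 α0

      -- Zeros of α are isolated by `no-100`. With one gap there are |β| + 1 of them, at least m / 2
      -- by `β-size`, which leaves no room for two consecutive ones.
      legit : Legit K
      legit = alternates no-11 no-00
        where
        ᾱ : ℕ → Bool
        ᾱ = not ∘ α
        half : # ᾱ m + # ᾱ m + # (nor ᾱ (ᾱ ∘ suc)) m ≡ m
        half = trans (cong (λ z → # ᾱ m + z + # (nor ᾱ (ᾱ ∘ suc)) m) (sym (periodic-suc {ᾱ} (cong not ∘ α-per))))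
          (#-nor ᾱ (ᾱ ∘ suc) m λ i _ a a′ → true≢false (no-00 i (not-true a)) (not-true a′))
        none : # (nor ᾱ (ᾱ ∘ suc)) m ≡ 0
        none = (lin₂ (1 ∷ 1 ∷ 0 ∷ 2 ∷ 2 ∷ 0 ∷ 0 ∷ 2 ∷ 1 ∷ 0 ∷ []) (1 ∷ 0 ∷ 0 ∷ 0 ∷ 0 ∷ 0 ∷ 0 ∷ 0 ∷ 0 ∷ 0 ∷ []) (# α m ∷ # ᾱ m ∷ # β m ∷ gaps ∷ # (nor ᾱ (ᾱ ∘ suc)) m ∷ m ∷ []) (λ a a′ b g n m → (a′ ⊕ a′ ⊕ n ≐ m) ⇛ (a ⊕ a′ ≐ m) ⇛ (a ⊕ b ⊕ g ≐ m) ⇛ (g ≐ κ 1) ⇛ (m ≼ 2 ⊛ b ⊕ κ 2) ⇛ ⊢ (n ≐ κ 0))) half (#-not α m) gaps-eq one-gap β-size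
        no-11 : ∀ i → α i ≡ true → α (1 + i) ≡ true → ⊥
        no-11 i a a′ = let s , lt , f = reduce 0 i
                           a₁ = trans (cong α (sym (+-identityʳ s))) (trans (sym (f α-per)) a)
                           a₂ = trans (cong (α ∘ suc) (sym (+-identityʳ s))) (trans (sym (f {f = α ∘ suc} (λ j → trans (cong α (sym (+-suc m j))) (α-per (suc j))))) a′)
          in true≢false (nor-intro {ᾱ} {ᾱ ∘ suc} s (cong not a₁) (cong not a₂)) (#-0 (nor ᾱ (ᾱ ∘ suc)) s none lt)

    module Zero (α0 : α 0 ≡ false) where
      no-110 : ∀ i → α i ≡ true → α (1 + i) ≡ true → α (2 + i) ≡ false → ⊥
      no-110 i a a′ a″ = go (bool-cases (β (3 + i)))
        where
        go : _ → ⊥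
        go (inj₁ b) = r110 i a a′ b
        go (inj₂ b) = true≢false a′ (trans (gap-before (1 + i) a″ b α-per) α0)

      no-11 : ∀ i → α i ≡ true → α (1 + i) ≡ true → ⊥
      no-11 i a a′ = true≢false (#-full α m (≤-reflexive (sym (propagate no-110 i a a′))) 0 (≤-trans (s≤s z≤n) 1<m)) α0

      β1 : β 1 ≡ true
      β1 = ¬false λ b → gap-unique 0 1 z<s (<⇒≤ 1<m) α0 b α1 β2

      module B (α2 : α 2 ≡ false) where
        private
          ν = nor α (α ∘ suc)
          ν0 : ν 0 ≡ true
          ν0 = nor-intro {α} {α ∘ suc} 0 α0 α1
          ν1 : ν 1 ≡ true
          ν1 = nor-intro {α} {α ∘ suc} 1 α1 α2

        rest : ∀ j → 2 + j < m → α (2 + j) ≡ false → α (3 + j) ≡ true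
        rest j lt = go (m≤n⇒∃[o]m+o≡n {2} {m} (<⇒≤ 1<m))
          where
          go : (∃ λ n → 2 + n ≡ m) → α (2 + j) ≡ false → α (3 + j) ≡ true
          go (n , eq) = nor-elim {α} {α ∘ suc} (2 + j) (#-0 (λ i → ν (2 + i)) j zero′ (+-cancelˡ-< 2 j n (subst (2 + j <_) (sym eq) lt)))
            where
            zero′ : # (λ i → ν (2 + i)) n ≡ 0
            zero′ = (lin₂ (1 ∷ 1 ∷ 0 ∷ 1 ∷ 0 ∷ 1 ∷ 0 ∷ 1 ∷ 1 ∷ 0 ∷ []) (1 ∷ 0 ∷ 0 ∷ 0 ∷ 0 ∷ 0 ∷ 0 ∷ 0 ∷ 0 ∷ 0 ∷ []) (# α m ∷ # ν m ∷ bit (ν 0) ∷ bit (ν 1) ∷ # (λ i → ν (2 + i)) n ∷ m ∷ []) (λ a t u v w m → (a ⊕ a ⊕ t ≐ m) ⇛ (t ≐ u ⊕ (v ⊕ w)) ⇛ (u ≐ κ 1) ⇛ (v ≐ κ 1) ⇛ (m ≼ 2 ⊛ a ⊕ κ 2) ⇛ ⊢ (w ≐ κ 0)))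
              (pairs-eq no-11) (cong (# ν) (sym eq)) (bit-true ν0) (bit-true ν1) α-size

        -- Here α has three consecutive zeros, so the colouring is read off from β.
        e : ℕ → Bool
        e i = not (β (1 + i))

        e-per : Periodic m e
        e-per i = cong not (trans (cong β (sym (+-suc m i))) (β-per (suc i)))

        β-of : ∀ j → 2 ≤ j → j ≤ m → α j ≡ false → β (1 + j) ≡ true
        β-of j 2≤j j≤m a = go (j ≟ m)
          where
          go : Dec (j ≡ m) → β (1 + j) ≡ true
          go (yes refl) = trans (trans (cong β (+-comm 1 m)) (β-per 1)) β1
          go (no ne) = ¬false λ b → gap-unique 1 j 2≤j (≤∧≢⇒< j≤m ne) α1 β2 a b

        e-α : ∀ j → 2 ≤ j → j ≤ m → e j ≡ α j
        e-α j 2≤j j≤m = go (bool-cases (α j))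
          where
          go : _ → e j ≡ α j
          go (inj₁ a) = trans (cong not (¬true (F1x j a))) (sym a)
          go (inj₂ a) = trans (cong not (β-of j 2≤j j≤m a)) (sym a)

        legit : Legit K
        legit = e , alternating-window e-per window , (λ i a → cong not (¬true (F1x i a))) ,
            from-suc β-per e-per (λ i b → trans (proj₁ (alternating-window e-per window) i) (cong not (cong not b)))
          where
          window : ∀ i → i < m → e (suc i) ≡ not (e i)
          window 0 lt = trans (cong not β2) (sym (cong (not ∘ not) β1))
          window 1 lt = trans (cong not (β-of 2 ≤-refl (<⇒≤ 1<m) α2)) (sym (cong (not ∘ not) β2))
          window (suc (suc j)) lt = trans (e-α (3 + j) (s≤s (s≤s z≤n)) lt) (trans (go (bool-cases (α (2 + j)))) (cong not (sym (e-α (2 + j) (s≤s (s≤s z≤n)) (<⇒≤ lt)))))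
            where
            go : _ → α (3 + j) ≡ not (α (2 + j))
            go (inj₁ a) = trans (¬true (no-11 (2 + j) a)) (cong not (sym a))
            go (inj₂ a) = trans (rest j lt a) (cong not (sym a))

      module Cc (α2 : α 2 ≡ true) where
        cover-window : ∀ j → 1 ≤ j → j < m → α j ≡ false → α (1 + j) ≡ true
        cover-window 1 _ _ _ = α2
        cover-window (suc (suc j)) _ lt a = ¬false λ a′ → go a′ (¬false λ a″ → true≢false (cover-window (suc j) (s≤s z≤n) (<⇒≤ lt) a″) a) (bool-cases (β (3 + j)))
          where
          go : α (3 + j) ≡ false → α (1 + j) ≡ true → _ → ⊥
          go a′ a₀ (inj₂ b) = gap-unique 1 (2 + j) (s≤s (s≤s z≤n)) lt α1 β2 a b
          go a′ a₀ (inj₁ b) = split (3 + j ≟ m)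
            where
            b′ : β (4 + j) ≡ false
            b′ = ¬true (r100 (1 + j) a₀ b)
            split : Dec (3 + j ≡ m) → ⊥
            split (no ne) = gap-unique 1 (3 + j) (s≤s (s≤s z≤n)) (≤∧≢⇒< lt ne) α1 β2 a′ b′
            split (yes eq) = true≢false β1 (trans (sym (β-per 1)) (trans (cong β (trans (+-comm m 1) (cong suc (sym eq)))) b′))

        private
          ν = nor α (α ∘ suc)

        odd : 2 * # α m + 1 ≡ m
        odd = go m-pred
          where
          go : (∃ λ n → suc n ≡ m) → 2 * # α m + 1 ≡ m
          go (n , eq) = (lin₂ (1 ∷ 0 ∷ 0 ∷ 0 ∷ 1 ∷ 0 ∷ 1 ∷ 1 ∷ 0 ∷ []) (1 ∷ 1 ∷ 0 ∷ 1 ∷ 0 ∷ 1 ∷ 0 ∷ 0 ∷ 1 ∷ []) (# α m ∷ # ν m ∷ bit (ν 0) ∷ # (ν ∘ suc) n ∷ m ∷ []) (λ a t u w m → (a ⊕ a ⊕ t ≐ m) ⇛ (t ≐ u ⊕ w) ⇛ (u ≐ κ 1) ⇛ (w ≐ κ 0) ⇛ ⊢ (2 ⊛ a ⊕ κ 1 ≐ m)))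
            (pairs-eq no-11) (cong (# ν) (sym eq)) (bit-true (nor-intro {α} {α ∘ suc} 0 α0 α1))
            (#-none n λ i lt → ¬true λ v → contra i (subst (suc i <_) eq (s≤s lt)) v)
            where
            contra : ∀ i → suc i < m → ν (suc i) ≡ true → ⊥
            contra i lt v = let p , q = nor-true {α} {α ∘ suc} (suc i) v in true≢false (cover-window (suc i) (s≤s z≤n) lt p) q

        no-11-β : ∀ i → β i ≡ true → β (1 + i) ≡ true → ⊥
        no-11-β i b b′ = go m-pred
          where
          go : (∃ λ n → suc n ≡ m) → ⊥
          go (n , eq) = let s , lt , f = reduce 0 (n + i) in
              step s lt (trans (sym (trans (f {f = β ∘ suc} β1-per) (cong (β ∘ suc) (+-identityʳ s)))) b₁)
                (trans (sym (trans (f {f = λ j → β (2 + j)} β2-per) (cong (λ z → β (2 + z)) (+-identityʳ s)))) b₂)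
            where
            β1-per : Periodic m (β ∘ suc)
            β1-per j = trans (cong β (sym (+-suc m j))) (β-per (suc j))
            β2-per : Periodic m (λ j → β (2 + j))
            β2-per j = trans (cong (β ∘ suc) (sym (+-suc m j))) (β1-per (suc j))
            b₁ : β (suc (n + i)) ≡ true
            b₁ = trans (cong (λ z → β (z + i)) eq) (trans (β-per i) b)
            b₂ : β (2 + (n + i)) ≡ true
            b₂ = trans (cong (λ z → β (suc z + i)) eq) (trans (β1-per i) b′)
            step : ∀ s → s < m → β (1 + s) ≡ true → β (2 + s) ≡ true → ⊥
            step zero lt b₁ b₂ = true≢false b₂ β2
            step (suc s) lt b₁ b₂ = F1x (2 + s) (cover-window (suc s) (s≤s z≤n) lt (¬true λ a → F1x (suc s) a b₁)) b₂

  -- There is at most one gap. If there is one, the values of α before and after it give four cases: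
  -- 1 0 0 is the defect, 0 0 1 the odd shape, and the other two admit a colouring.
  classify : ∀ K → NoDefect K → Legit K ⊎ Odd K
  classify K noD = go (some-or-none (nor α (β ∘ suc)) m)
    where
    open Conf K
    open Rules K
    open Local K using (α-some)

    legit-rot : ∀ a → Legit (rotK a K) → Legit K
    legit-rot a (e , (alt , per) , wα , wβ) = back (unrotate {e} a)
      where
      back : (∃ λ a′ → ∀ {X : Set} {f : ℕ → X} → Periodic m f → ∀ i → f (i + a′ + a) ≡ f i) → Legit K
      back (a′ , h) = (λ i → e (i + a′)) , ((λ i → alt (i + a′)) , period-shift a′ per) ,
        (λ i p → wα (i + a′) (trans (h α-per i) p)) , (λ i p → wβ (i + a′) (trans (h β-per i) p))

    from-gap : ∀ a → α (1 + a) ≡ false → β (2 + a) ≡ false → Legit K ⊎ Odd K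
    from-gap a g g′ = cases (bool-cases (α a)) (bool-cases (α (2 + a)))
      where
      open OneGap (rotK a K) g g′
      cases : _ → _ → Legit K ⊎ Odd K
      cases (inj₁ p) (inj₁ q) = inj₁ (legit-rot a (A.legit p q))
      cases (inj₁ p) (inj₂ q) = ⊥-elim (noD a p g g′ q)
      cases (inj₂ p) (inj₂ q) = inj₁ (legit-rot a (Zero.B.legit p q))
      cases (inj₂ p) (inj₁ q) = inj₂ (back (unrotate {α} a))
        where
        open Zero.Cc p q
        back : (∃ λ a′ → ∀ {X : Set} {f : ℕ → X} → Periodic m f → ∀ i → f (i + a′ + a) ≡ f i) → Odd K
        back (a′ , h) = record { base = a ; α0 = p ; α1 = g ; β2 = g′ ; α2 = q
          ; no-11-α = λ i x₁ x₂ → Zero.no-11 p (i + a′) (trans (h α-per i) x₁) (trans (h α-per (1 + i)) x₂)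
          ; no-11-β = λ i x₁ x₂ → no-11-β (i + a′) (trans (h β-per i) x₁) (trans (h β-per (1 + i)) x₂)
          ; last = λ n eq → ¬false λ z → true≢false (cover-window n (s≤s⁻¹ (subst (2 ≤_) (sym eq) (<⇒≤ 1<m))) (≤-reflexive eq) z)
              (trans (cong (λ z → α (z + a)) eq) (trans (α-per a) p))
          ; odd = subst (λ z → 2 * z + 1 ≡ m) (#-rot {α} {m} a α-per) odd }

    go : _ → Legit K ⊎ Odd K
    go (inj₂ none) = let i , _ , e = #-find α m α-some in inj₁ (legit-rot i (NoGap.legit (rotK i K) (zero-gaps i) e))
      where
      zero-gaps : ∀ i → Facts.gaps (rotK i K) ≡ 0
      zero-gaps i = (lin₂ (1 ∷ 1 ∷ 0 ∷ 1 ∷ 0 ∷ 0 ∷ 1 ∷ 0 ∷ 1 ∷ 0 ∷ 1 ∷ []) (1 ∷ 0 ∷ 0 ∷ 0 ∷ 0 ∷ 0 ∷ 0 ∷ 0 ∷ 0 ∷ 0 ∷ 0 ∷ []) (# α m ∷ # β m ∷ # (λ t → α (t + i)) m ∷ # (λ t → β (t + i)) m ∷ gaps ∷ Facts.gaps (rotK i K) ∷ m ∷ []) (λ a b a′ b′ g g′ m → (a′ ≐ a) ⇛ (b′ ≐ b) ⇛ (a ⊕ b ⊕ g ≐ m) ⇛ (a′ ⊕ b′ ⊕ g′ ≐ m) ⇛ (g ≐ κ 0) ⇛ ⊢ (g′ ≐ κ 0)))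
        (#-rot {α} {m} i α-per) (#-rot {β} {m} i β-per) gaps-eq (Facts.gaps-eq (rotK i K)) (#-none m none)
    go (inj₁ (i , lt , ν)) = start m-pred
      where
      start : (∃ λ n → suc n ≡ m) → Legit K ⊎ Odd K
      -- The gap must stand at offset 1, so the base is i - 1, written n + i with m = n + 1.
      start (n , eq) = from-gap (n + i) (trans (cong (λ z → α (z + i)) eq) (trans (α-per i) (proj₁ gap)))
          (trans (cong (λ z → β (suc z + i)) eq) (trans (trans (cong β (sym (+-suc m i))) (β-per (suc i))) (proj₂ gap)))
        where
        gap : α i ≡ false × β (suc i) ≡ false
        gap = nor-true {α} {β ∘ suc} i ν

-- Hamiltonian digraphs with two vertices off C

module HamiltonTwo {N : ℕ} (A : Digraph (Fin (suc N))) (S : Counterexample A) (m : ℕ) (N≡ : N ≡ suc m) where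

  open Graph hiding (reduce)
  open Cycles A
  open Setup.Structures A
  open Counterexample S
  open Configuration A S m N≡

  open OneWay A S m N≡ using (halve; b≢not; module Bipartition)
  open BothWays A S m N≡
  open Classification A S m N≡

  insertion-rot : ∀ a K → Insertion K → Insertion (rotK a K)
  insertion-rot a K (j , h) = go (unrotate {λ _ → true} a) h
    where
    open Conf K
    shift : ∀ {f : ℕ → Bool} → Periodic m f → Periodic m (f ∘ suc)
    shift {f} per i = trans (cong f (sym (+-suc m i))) (per (suc i))
    go : (∃ λ a′ → ∀ {X : Set} {f : ℕ → X} → Periodic m f → ∀ i → f (i + a′ + a) ≡ f i) →
      (α j ≡ true × δ (1 + j) ≡ true) ⊎ (γ j ≡ true × β (1 + j) ≡ true) → Insertion (rotK a K)
    go (a′ , h) (inj₁ (p , q)) = j + a′ , inj₁ (trans (h α-per j) p , trans (h {f = δ ∘ suc} (shift {δ} δ-per) j) q)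
    go (a′ , h) (inj₂ (p , q)) = j + a′ , inj₂ (trans (h γ-per j) p , trans (h {f = β ∘ suc} (shift {β} β-per) j) q)

  insertion-flip : ∀ K → Insertion K → Insertion (flipK K)
  insertion-flip K (j , inj₁ p) = j , inj₂ p
  insertion-flip K (j , inj₂ p) = j , inj₁ p

  no-defect : ∀ K → Insertion K → NoDefect K
  no-defect K ins i a a′ b a″ = Defect.no-insertion (rotK i K) a a′ b a″ (insertion-rot i K ins)

  legit-even : ∀ K → Legit K → ∃ λ h → h + h ≡ m
  legit-even K (e , (alt , per) , _) = halve e alt per

  odd-legit : ∀ {K} K′ → Odd K → Legit K′ → ⊥
  odd-legit {K} K′ o l = let h , eq = legit-even K′ l in uneven (# (Conf.α K) m) h (trans (Odd.odd o) (sym eq))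
    where
    uneven : ∀ a h → 2 * a + 1 ≡ h + h → ⊥
    uneven a zero e = case trans (+-comm 1 (2 * a)) e of λ ()
    uneven zero (suc h) e = case suc-injective (trans e (cong suc (+-suc h h))) of λ ()
    uneven (suc a) (suc h) e = uneven a h ((lin₂ (1 ∷ 1 ∷ 0 ∷ []) (1 ∷ 0 ∷ 1 ∷ []) (a ∷ h ∷ []) (λ a h → (2 ⊛ (κ 1 ⊕ a) ⊕ κ 1 ≐ κ 1 ⊕ h ⊕ (κ 1 ⊕ h)) ⇛ ⊢ (2 ⊛ a ⊕ κ 1 ≐ h ⊕ h))) e)

  -- `F3` on both sides of the gap of x joins y with c₀ and c₃ in both directions. With the odd
  -- shape of y this is a defect of y, incompatible with an insertion.
  odd-odd : ∀ K → Insertion K → Odd K → Odd (flipK K) → ⊥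
  odd-odd K ins o o′ = Defect.no-insertion (flipK K₀) γ0 γ1 δ2 γ2 (insertion-flip K₀ (insertion-rot base K ins))
    where
    open Odd o
    K₀ = rotK base K
    open Conf K₀
    open Rules K₀
    module G = Odd o′
    module Gp = OneGap K₀ α1 β2

    β4 : β 4 ≡ true
    β4 = ¬false λ b → true≢false α2
        (trans (Gp.gap-before 2 (¬true (no-11-α (2 + base) α2)) b {f = α} α-per) α0)

    mids : γ 0 ≡ true × δ 0 ≡ true
    mids = go m-pred
      where
      go : (∃ λ n → suc n ≡ m) → γ 0 ≡ true × δ 0 ≡ true
      go (n , eq) = let p , q = F3 n (last n eq) (trans (cong (λ z → β (suc z)) eq) (trans (cong β (+-comm 1 m)) (trans (β-per 1) (Gp.Zero.β1 α0))))
        in trans (trans (sym (γ-per 0)) (cong γ (trans (+-identityʳ m) (sym eq)))) p , trans (trans (sym (δ-per 0)) (cong δ (trans (+-identityʳ m) (sym eq)))) q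

    γ0 : γ 0 ≡ true
    γ0 = proj₁ mids

    γδ3 : γ 3 ≡ true × δ 3 ≡ true
    γδ3 = F3 2 α2 β4

    γ1 : γ 1 ≡ false
    γ1 = ¬true (G.no-11-α base γ0)

    δ2 : δ 2 ≡ false
    δ2 = ¬true λ d → G.no-11-β (2 + base) d (proj₂ γδ3)

    γ2 : γ 2 ≡ false
    γ2 = ¬true λ g → F1y 2 g (proj₂ γδ3)

  alt-from-0 : ∀ {e e′ : ℕ → Bool} → (∀ i → e (suc i) ≡ not (e i)) → (∀ i → e′ (suc i) ≡ not (e′ i)) → e 0 ≡ e′ 0 → ∀ i → e i ≡ e′ i
  alt-from-0 a a′ eq zero = eq
  alt-from-0 a a′ eq (suc i) = trans (a i) (trans (cong not (alt-from-0 a a′ eq i)) (sym (a′ i)))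

  module Blocked (K : Conf) (e : ℕ → Bool) (alt : ∀ i → e (suc i) ≡ not (e i)) (x-in : Within K e) where
    open Conf K
    open Rules K

    Gap-at : ℕ → Set
    Gap-at i = α i ≡ false × β (1 + i) ≡ false

    -- No neighbour of x stands at position a + 1, whose colour is false, so a missing arc c_a → x
    -- or x → c_{a+2} is a gap.
    blocked : ∀ a → e a ≡ true → (α a ≡ true × β (2 + a) ≡ true) ⊎ (Gap-at a ⊎ Gap-at (1 + a))
    blocked a ea = go (bool-cases (α a)) (bool-cases (β (2 + a)))
      where
      e1 : e (1 + a) ≡ false
      e1 = trans (alt a) (cong not ea)
      go : _ → _ → _
      go (inj₁ p) (inj₁ q) = inj₁ (p , q)
      go (inj₂ p) _ = inj₂ (inj₁ (p , ¬true λ b → true≢false (proj₂ x-in (1 + a) b) e1))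
      go (inj₁ p) (inj₂ q) = inj₂ (inj₂ ((¬true λ b → true≢false (proj₁ x-in (1 + a) b) e1) , q))

    two-blocked : ∀ a s → 2 ≤ s → 1 + s < m → Gap-at a ⊎ Gap-at (1 + a) → Gap-at (s + a) ⊎ Gap-at (1 + (s + a)) → ⊥
    two-blocked a s 2≤s s<m = go
      where
      gu : ∀ i j → i < j → j < m → Gap-at (i + a) → Gap-at (j + a) → ⊥
      gu i j lt lt′ (p , q) (p′ , q′) = Rules.gap-unique (rotK a K) i j lt lt′ p q p′ q′
      go : Gap-at a ⊎ Gap-at (1 + a) → Gap-at (s + a) ⊎ Gap-at (1 + (s + a)) → ⊥
      go (inj₁ g) (inj₁ g′) = gu 0 s (≤-trans (s≤s z≤n) 2≤s) (<⇒≤ s<m) g g′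
      go (inj₁ g) (inj₂ g′) = gu 0 (suc s) z<s s<m g g′
      go (inj₂ g) (inj₁ g′) = gu 1 s 2≤s (<⇒≤ s<m) g g′
      go (inj₂ g) (inj₂ g′) = gu 1 (suc s) (s≤s (≤-trans (s≤s z≤n) 2≤s)) s<m g g′

  module Colour (K : Conf) (e : ℕ → Bool) (alt : ∀ i → e (suc i) ≡ not (e i)) (e-per : Periodic m e)
    (x-in : Within K e) (y-in : Within (flipK K) (not ∘ e)) where
    open Conf K
    open Rules K
    open Blocked K e alt x-in

    module Exchange (a : ℕ) (p : α a ≡ true) (q : β (2 + a) ≡ true) where
      K₁ = rotK a K
      open Facts.Swap K₁ p q
      e₁ : ℕ → Bool
      e₁ i = e (i + a)
      alt₁ : ∀ i → e₁ (suc i) ≡ not (e₁ i)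
      alt₁ i = alt (i + a)
      e₁-per : Periodic m e₁
      e₁-per = period-shift a e-per

      window : (f : V → Bool) → (∀ i → f (c′ i) ≡ true → e i ≡ false) → (f x ≡ true → e₁ 1 ≡ false) → ∀ i → f (c swapped i) ≡ true → e₁ i ≡ false
      window f h hx i fi = let s , lt , g = reduce 0 i in
        trans (g e₁-per) (go s lt (trans (cong f (sym (trans (g (per swapped)) (cong (c swapped) (+-identityʳ s))))) fi) (+-identityʳ s))
        where
        go : ∀ s → s < m → f (c swapped s) ≡ true → s + 0 ≡ s → e₁ (s + 0) ≡ false
        go s lt fs eq = trans (cong e₁ eq) (at-s s lt fs)
          where
          at-s : ∀ s → s < m → f (c swapped s) ≡ true → e₁ s ≡ false
          at-s 0 lt fs = h a (trans (cong f (sym at-0)) fs)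
          at-s 1 lt fs = hx (trans (cong f (sym at-1)) fs)
          at-s (suc (suc s)) lt fs = h (2 + s + a) (trans (cong f (sym (at-old (2 + s) (s≤s (s≤s z≤n)) (<⇒≤ lt)))) fs)

      e₁1 : e₁ 1 ≡ false
      e₁1 = trans (alt a) (cong not (proj₁ x-in a p))

      y-in′ : ∀ i → A (c swapped i) y ≡ true → e₁ i ≡ false
      y-in′ = window (λ v → A v y) (λ i g → not-true (proj₁ y-in i g)) λ _ → e₁1

      y-out′ : ∀ i → A y (c swapped i) ≡ true → e₁ i ≡ false
      y-out′ = window (A y) (λ i g → not-true (proj₂ y-in i g)) λ _ → e₁1

      -- By `twin` and `twin-δ3` a defect at i would make y a neighbour of the vertices at i and i +
      -- 3, which have opposite colours.
      no-defect′ : NoDefect swap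
      no-defect′ i a a′ b a″ = b≢not (trans (sym (y-out′ (3 + i) twin-δ3)) (trans (alt₁ (2 + i)) (cong not
          (trans (trans (alt₁ (1 + i)) (trans (cong not (trans (alt₁ i) (cong not (y-in′ i (proj₁ twin))))) refl)) refl))))
        where open Defect (rotK i swap) a a′ b a″

      -- The exchanged vertex c_{a+1} is classified in its turn. Its colouring agrees with e,
      -- because its in-neighbour c_a has the colour true in both.
      colour : ∀ t → 2 ≤ t → t ≤ m → (c′ (1 + a) ⇒ c′ (t + a) → e₁ t ≡ true) × (c′ (t + a) ⇒ c′ (1 + a) → e₁ t ≡ true)
      colour t 2≤t t≤m = go (classify swap no-defect′)
        where
        go : Legit swap ⊎ Odd swap → _
        go (inj₂ o) = ⊥-elim (odd-legit K o (e , (alt , e-per) , x-in))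
        go (inj₁ (e″ , (alt″ , _) , wα , wβ)) =
            (λ arc′ → trans (sym (same t)) (wβ t (subst (c′ (1 + a) ⇒_) (sym (at-old t 2≤t t≤m)) arc′)))
          , (λ arc′ → trans (sym (same t)) (wα t (subst (_⇒ c′ (1 + a)) (sym (at-old t 2≤t t≤m)) arc′)))
          where
          same : ∀ t → e″ t ≡ e₁ t
          same = alt-from-0 alt″ alt₁ (trans (wα 0 (subst (_⇒ c′ (1 + a)) (sym at-0) (arc C a))) (sym (proj₁ x-in a p)))

    -- One end of the arc can be exchanged for x, and then `colour` applies to it: if both ends were
    -- blocked, x would have two gaps.
    independent′ : ∀ a s → 1 ≤ s → s < m → e (suc a) ≡ false → e (s + suc a) ≡ false → c′ (suc a) ⇒ c′ (s + suc a) → ⊥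
    independent′ a s 1≤s s<m e₁ e₂ arc′ = first (blocked a ea)
      where
      ea : e a ≡ true
      ea = not-false (trans (sym (alt a)) e₁)
      b = s + a
      e₂′ : e (suc b) ≡ false
      e₂′ = trans (cong e (sym (+-suc s a))) e₂
      eb : e b ≡ true
      eb = not-false (trans (sym (alt b)) e₂′)
      s≢1 : s ≢ 1
      s≢1 refl = b≢not (trans (sym e₂′) (trans (alt (suc a)) (cong not e₁)))
      s+1≢m : suc s ≢ m
      s+1≢m eq = true≢false ea (trans (sym (e-per a)) (trans (cong (λ z → e (z + a)) (sym eq)) e₂′))
      first : _ → ⊥
      first (inj₁ (p , q)) = true≢false (proj₁ (Exchange.colour a p q (suc s) (s≤s 1≤s) s<m) (subst (λ z → c′ (suc a) ⇒ c′ z) (+-suc s a) arc′)) e₂′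
      first (inj₂ g) = second (blocked b eb)
        where
        second : _ → ⊥
        second (inj₂ g′) = two-blocked a s (≤∧≢⇒< 1≤s (s≢1 ∘ sym)) (≤∧≢⇒< s<m s+1≢m) g g′
        second (inj₁ (p , q)) = go (m≤n⇒∃[o]m+o≡n s<m)
          where
          go : (∃ λ o → suc s + o ≡ m) → ⊥
          go (o , eq) = true≢false (proj₂ (Exchange.colour b p q (2 + o) (s≤s (s≤s z≤n)) ((lin₁ (1 ∷ 1 ∷ 1 ∷ 0 ∷ []) (s ∷ o ∷ m ∷ []) (λ s o m → (κ 1 ⊕ s ⊕ o ≐ m) ⇛ (κ 1 ≼ s) ⇛ ⊢ (κ 2 ⊕ o ≼ m))) eq 1≤s))
                (subst₂ _⇒_ (sym (trans (cong c′ idx) (per C (suc a)))) (cong c′ (+-suc s a)) arc′))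
              (trans (cong e idx) (trans (e-per (suc a)) e₁))
            where
            idx : 2 + o + b ≡ m + suc a
            idx = (lin₂ (1 ∷ 1 ∷ 0 ∷ []) (1 ∷ 0 ∷ 1 ∷ []) (s ∷ o ∷ m ∷ a ∷ []) (λ s o m a → (κ 1 ⊕ s ⊕ o ≐ m) ⇛ ⊢ (κ 2 ⊕ o ⊕ (s ⊕ a) ≐ m ⊕ (κ 1 ⊕ a)))) eq

  -- Exchanging x shows that the odd positions are independent; exchanging y, with the colours
  -- reversed, does the same for the even ones.
  even-absurd : ∀ K e → Alternating e → Within K e → Within (flipK K) (not ∘ e) → e 0 ≡ true → ⊥
  even-absurd K e (alt , per′) x-in y-in e0 = bipartite
      (λ i → proj₁ x-in i , proj₂ x-in i , (λ g → not-true (proj₁ y-in i g)) , (λ g → not-true (proj₂ y-in i g)))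
      (λ a s 1≤s s<m p q → Y.independent′ a s 1≤s s<m (cong not p) (cong not q))
      X.independent′
    where
    open Bipartition K e alt per′ e0
    module X = Colour K e alt per′ x-in y-in
    module Y = Colour (flipK K) (not ∘ e) (λ i → cong not (alt i)) (λ i → cong not (per′ i)) y-in
      ((λ i a → cong (not ∘ not) (proj₁ x-in i a)) , (λ i a → cong (not ∘ not) (proj₂ x-in i a)))

  -- A vertex exchangeable with x is adjacent to y, so y sees the opposite colour.
  opposite : ∀ K e e′ → Alternating e → Within K e → Alternating e′ → Within (flipK K) e′ → e 0 ≡ true → ∀ i → e′ i ≡ not (e i)
  opposite K e e′ (alt , per′) w (alt′ , _) w′ e0 = alt-from-0 alt′ (λ i → cong not (alt i)) (pick (blocked 0 e0) (blocked 2 e2))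
    where
    open Conf K
    open Rules K
    open Blocked K e alt w
    e2 : e 2 ≡ true
    e2 = trans (alt 1) (cong not (trans (alt 0) (cong not e0)))

    3<m : 3 < m
    3<m = ≤∧≢⇒< 1<m λ { refl → let h , eq = halve e alt per′ in three h eq }
      where
      three : ∀ h → h + h ≡ 3 → ⊥
      three 1 ()
      three (suc (suc h)) eq = (lin₁ (1 ∷ 0 ∷ []) (h ∷ []) (λ h → (κ 2 ⊕ h ⊕ (κ 2 ⊕ h) ≐ κ 3) ⇛ ⊢ (ff))) eq

    at-1+ : ∀ a → e a ≡ true → α a ≡ true × β (2 + a) ≡ true → e′ (1 + a) ≡ true
    at-1+ a ea (p , q) = proj₁ w′ (1 + a) (proj₁ (F3 a p q))

    pick : _ → _ → e′ 0 ≡ not (e 0)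
    pick (inj₁ pq) _ = trans (not-true (trans (sym (alt′ 0)) (at-1+ 0 e0 pq))) (cong not (sym e0))
    pick (inj₂ g) (inj₁ pq) = trans (not-true (trans (sym (alt′ 0)) (not-false (trans (sym (alt′ 1)) (not-true (trans (sym (alt′ 2)) (at-1+ 2 e2 pq))))))) (cong not (sym e0))
    pick (inj₂ g) (inj₂ g′) = ⊥-elim (two-blocked 0 2 ≤-refl 3<m g g′)

  hamilton-two : ∀ K → Insertion K → ⊥
  hamilton-two K ins = go (classify K (no-defect K ins)) (classify (flipK K) (no-defect (flipK K) (insertion-flip K ins)))
    where
    go : Legit K ⊎ Odd K → Legit (flipK K) ⊎ Odd (flipK K) → ⊥
    go (inj₁ l) (inj₂ o) = odd-legit K o l
    go (inj₂ o) (inj₁ l) = odd-legit (flipK K) o l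
    go (inj₂ o) (inj₂ o′) = odd-odd K ins o o′
    go (inj₁ (e , a , w)) (inj₁ (e′ , a′ , w′)) = start (bool-cases (e 0))
      where
      fin : ∀ K e e′ → Alternating e → Within K e → Alternating e′ → Within (flipK K) e′ → e 0 ≡ true → ⊥
      fin K e e′ a w a′ w′ e0 = even-absurd K e a w
        ((λ i p → trans (sym (opp i)) (proj₁ w′ i p)) , (λ i p → trans (sym (opp i)) (proj₂ w′ i p))) e0
        where opp = opposite K e e′ a w a′ w′ e0
      start : _ → ⊥
      start (inj₁ e0) = fin K e e′ a w a′ w′ e0
      start (inj₂ e0) = fin (rotK 1 K) (λ i → e (i + 1)) (λ i → e′ (i + 1))
        ((λ i → proj₁ a (i + 1)) , period-shift 1 (proj₂ a)) ((λ i → proj₁ w (i + 1)) , λ i → proj₂ w (i + 1))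
        ((λ i → proj₁ a′ (i + 1)) , period-shift 1 (proj₂ a′)) ((λ i → proj₁ w′ (i + 1)) , λ i → proj₂ w′ (i + 1))
        (trans (proj₁ a 0) (cong not e0))

-- Chords of a Hamiltonian cycle that extends C

module Hamilton {N : ℕ} (A : Digraph (Fin (suc N))) (S : Counterexample A) (m h : ℕ) (m+h : m + h ≡ suc N) (2≤m : 2 ≤ m) (2≤h : 2 ≤ h)
  (longest : ∀ k → m < k → k ≤ N → Graph.Cycles.Cyc A k → ⊥) where

  open Graph
  open Cycles A
  open Setup.Structures A
  open Counterexample S

  detour-bound : ∀ (C : Cyc m) k r Q → k + r ≡ m → 1 ≤ k → Walk (c C 0) Q (c C k) → Unique Q →
    (∀ i → i ≤ r → c C (i + k) ∉ Q) → m < suc r + length Q → suc r + length Q ≤ N → ⊥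
  detour-bound C k r Q k+r 1≤k w u off lt le = longest _ lt le (Detour.detour C k r k+r 1≤k Q w u off refl)

  module Sub (C : Cyc m) (Q : List V) (offQ : OffL C Q) (uQ : Unique Q) {u v : V} (path : Path u Q v) where

    s t : ℕ → Bool
    s i = A (c C i) u
    t i = A v (c C i)
    s-per : Periodic m s
    s-per i = cong (λ z → A z u) (per C i)
    t-per : Periodic m t
    t-per i = cong (A v) (per C i)

    apart : length Q < h → ∀ i j → 1 ≤ j → j ≤ length Q → j ≤ m → s i ≡ true → t (j + i) ≡ true → ⊥
    apart short i j 1≤j j≤Q j≤m si tj =
      let r , j+r = m≤n⇒∃[o]m+o≡n j≤m in
      detour-bound (rot i C) j r Q j+r 1≤j (path si tj) uQ (λ k _ → offQ (k + j + i))
        ((lin₁ (1 ∷ 1 ∷ 0 ∷ 1 ∷ []) (r ∷ j ∷ length Q ∷ m ∷ []) (λ r j q m → (j ⊕ r ≐ m) ⇛ (j ≼ q) ⇛ ⊢ (κ 1 ⊕ m ≼ κ 1 ⊕ r ⊕ q))) j+r j≤Q)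
        ((lin₁ (1 ∷ 1 ∷ 0 ∷ 1 ∷ 1 ∷ 1 ∷ 0 ∷ []) (r ∷ j ∷ length Q ∷ m ∷ h ∷ N ∷ []) (λ r j q m h N → (j ⊕ r ≐ m) ⇛ (κ 1 ≼ j) ⇛ (κ 1 ⊕ q ≼ h) ⇛ (m ⊕ h ≐ κ 1 ⊕ N) ⇛ ⊢ (κ 1 ⊕ r ⊕ q ≼ N))) j+r 1≤j short m+h)

    -- With all h vertices, distance 1 gives length N + 1 and no contradiction; hence 2 ≤ j here,
    -- and the loss of one in `bound-full`.
    apart-full : length Q ≡ h → ∀ i j → 2 ≤ j → j ≤ h → j ≤ m → s i ≡ true → t (j + i) ≡ true → ⊥
    apart-full full i j 2≤j j≤h j≤m si tj =
      let r , j+r = m≤n⇒∃[o]m+o≡n j≤m in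
      detour-bound (rot i C) j r Q j+r (<⇒≤ 2≤j) (path si tj) uQ (λ k _ → offQ (k + j + i))
        ((lin₁ (1 ∷ 1 ∷ 0 ∷ 1 ∷ 0 ∷ 1 ∷ []) (r ∷ j ∷ length Q ∷ m ∷ h ∷ []) (λ r j q m h → (j ⊕ r ≐ m) ⇛ (q ≐ h) ⇛ (j ≼ h) ⇛ ⊢ (κ 1 ⊕ m ≼ κ 1 ⊕ r ⊕ q))) j+r full j≤h)
        ((lin₁ (1 ∷ 1 ∷ 0 ∷ 1 ∷ 0 ∷ 1 ∷ 1 ∷ 0 ∷ []) (r ∷ j ∷ length Q ∷ m ∷ h ∷ N ∷ []) (λ r j q m h N → (j ⊕ r ≐ m) ⇛ (κ 2 ≼ j) ⇛ (q ≐ h) ⇛ (m ⊕ h ≐ κ 1 ⊕ N) ⇛ ⊢ (κ 1 ⊕ r ⊕ q ≼ N))) j+r 2≤j full m+h)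

    bound : length Q < h → h ≤ m → 1 ≤ length Q → 1 ≤ inC C u → 1 ≤ outC C v → inC C u + outC C v + length Q ≤ suc m
    bound short h≤m = Gap.bound {m} {length Q} {s} {t} s-per t-per (apart short)

    bound-full : length Q ≡ h → h ≤ m → 1 ≤ inC C u → 1 ≤ outC C v → inC C u + outC C v + h ≤ 2 + m
    bound-full full h≤m sne tne = go (m≤n⇒∃[o]m+o≡n {1} (<⇒≤ 2≤h))
      where
      -- Shifting t by one absorbs the distance 1 that is not excluded, and the gap inequality
      -- applies with h - 1.
      t₁ : ℕ → Bool
      t₁ i = t (suc i)
      t₁-per : Periodic m t₁
      t₁-per i = trans (cong t (sym (+-suc m i))) (t-per (suc i))
      t-eq : # t₁ m ≡ outC C v
      t-eq = #-shift t m (trans (cong t (sym (+-identityʳ m))) (t-per 0))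
      go : (∃ λ l → 1 + l ≡ h) → inC C u + outC C v + h ≤ 2 + m
      go (l , e) = (lin₁ (1 ∷ 0 ∷ 1 ∷ 1 ∷ 0 ∷ 1 ∷ []) (inC C u ∷ outC C v ∷ # t₁ m ∷ l ∷ m ∷ h ∷ []) (λ a b b′ l m h → (b′ ≐ b) ⇛ (a ⊕ b′ ⊕ l ≼ κ 1 ⊕ m) ⇛ (κ 1 ⊕ l ≐ h) ⇛ ⊢ (a ⊕ b ⊕ h ≼ κ 2 ⊕ m))) t-eq
        (Gap.bound {m} {l} {s} {t₁} s-per t₁-per
          (λ i j 1≤j j≤l _ → apart-full full i (suc j) (s≤s 1≤j) (subst (suc j ≤_) e (s≤s j≤l)) (≤-trans (subst (suc j ≤_) e (s≤s j≤l)) h≤m))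
          (s≤s⁻¹ (subst (2 ≤_) (sym e) 2≤h)) sne (subst (1 ≤_) (sym t-eq) tne)) e

  two : {u v : V} → u ⇒ v → Path u (u ∷ v ∷ []) v
  two uv a b = a , uv , b

  module Hamiltonian (C : Cyc m) (Q : List V) (len : length Q ≡ h) (uQ : Unique Q) (offQ : OffL C Q) (w : Walk (c C 0) Q (c C 1)) where

    private
      n = proj₁ (m≤n⇒∃[o]m+o≡n {1} {m} (<⇒≤ 2≤m))
      1+n : 1 + n ≡ m
      1+n = proj₂ (m≤n⇒∃[o]m+o≡n {1} {m} (<⇒≤ 2≤m))
      module D = Detour C 1 n 1+n ≤-refl Q w uQ (λ i _ → offQ (i + 1))
      lenD : suc n + length Q ≡ suc N
      lenD = trans (cong₂ _+_ 1+n len) m+h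

    -- Rotated so that Q occupies the positions 0 to h - 1, followed by c₁, ..., c_m.
    H : Cyc (suc N)
    H = rot m (D.detour lenD)

    q : ℕ → V
    q = c H

    q-new : ∀ j → j < h → q j ≡ at (c C 1) Q j
    q-new j lt = trans (cong (c (D.detour lenD)) (trans (+-comm j m) (cong (_+ j) (sym 1+n)))) (D.detour-new lenD j (subst (j <_) (sym len) lt))

    q-∈ : ∀ j → j < h → q j ∈ Q
    q-∈ j lt = subst (_∈ Q) (sym (q-new j lt)) (at-∈ (c C 1) Q j (subst (j <_) (sym len) lt))

    q-old : ∀ i → i < m → q (h + i) ≡ c C (i + 1)
    q-old i lt = trans (cong (c (D.detour lenD)) (trans ((lin₂ (1 ∷ 1 ∷ 0 ∷ []) (1 ∷ 0 ∷ 1 ∷ []) (h ∷ i ∷ m ∷ N ∷ []) (λ h i m N → (m ⊕ h ≐ κ 1 ⊕ N) ⇛ ⊢ (h ⊕ i ⊕ m ≐ κ 1 ⊕ N ⊕ i))) m+h) refl))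
      (trans (per (D.detour lenD) i) (D.detour-old lenD i (s≤s⁻¹ (subst (i <_) (sym 1+n) lt))))

    -- A chord over k steps leaves a cycle of N + 2 - k vertices, a length between m + 1 and N.
    no-chord : ∀ i k → 2 ≤ k → k ≤ h → A (q i) (q (k + i)) ≡ false
    no-chord i k 2≤k k≤h = ¬true λ a →
      let r , k+r = m≤n⇒∃[o]m+o≡n {k} {suc N} (≤-trans k≤h (subst (h ≤_) m+h (m≤n+m h m))) in
      longest (suc r + 0) ((lin₁ (1 ∷ 1 ∷ 1 ∷ 0 ∷ 0 ∷ 1 ∷ []) (r ∷ k ∷ m ∷ h ∷ N ∷ []) (λ r k m h N → (k ⊕ r ≐ κ 1 ⊕ N) ⇛ (m ⊕ h ≐ κ 1 ⊕ N) ⇛ (k ≼ h) ⇛ ⊢ (κ 1 ⊕ m ≼ κ 1 ⊕ r ⊕ κ 0))) k+r m+h k≤h)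
        ((lin₁ (1 ∷ 1 ∷ 1 ∷ 0 ∷ []) (r ∷ k ∷ N ∷ []) (λ r k N → (k ⊕ r ≐ κ 1 ⊕ N) ⇛ (κ 2 ≼ k) ⇛ ⊢ (κ 1 ⊕ r ⊕ κ 0 ≼ N))) k+r 2≤k)
        (Detour.detour (rot i H) k r k+r (<⇒≤ 2≤k) [] a [] (λ _ _ → ∉-[]) refl)

    everything : List V
    everything = applyUpTo q (suc N)

    all∈ : ∀ v → v ∈ everything
    all∈ = cover everything (seg-unique q (suc N) (inj H)) (≤-reflexive (sym (length-applyUpTo q (suc N))))

    indeg-H : ∀ v → indeg A v ≤ # (λ i → A (q i) v) (suc N)
    indeg-H v = ≤-trans (indeg≤ v everything λ u _ → all∈ u) (≤-reflexive (cnt-applyUpTo (λ u → A u v) q (suc N)))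

    outdeg-H : ∀ v → outdeg A v ≤ # (λ i → A v (q i)) (suc N)
    outdeg-H v = ≤-trans (outdeg≤ v everything λ u _ → all∈ u) (≤-reflexive (cnt-applyUpTo (A v) q (suc N)))

    private
      split : ∀ (f : V → Bool) → # (λ i → f (q i)) (suc N) ≡ # (λ i → f (q i)) h + # (λ i → f (c C i)) m
      split f = trans (cong (# (λ i → f (q i))) (trans (sym m+h) (+-comm m h)))
        (trans (#-+ (λ i → f (q i)) h m) (cong (# (λ i → f (q i)) h +_)
          (trans (#-cong m λ i lt → trans (cong f (q-old i lt)) (cong (λ z → f (c C z)) (+-comm i 1)))
            (#-shift (λ i → f (c C i)) m (cong f (c-m C))))))

    inQ outQ : V → ℕ
    inQ v = # (λ i → A (q i) v) h
    outQ v = # (λ i → A v (q i)) h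

    indeg-split : ∀ v → indeg A v ≤ inQ v + inC C v
    indeg-split v = ≤-trans (indeg-H v) (≤-reflexive (split (λ u → A u v)))

    outdeg-split : ∀ v → outdeg A v ≤ outQ v + outC C v
    outdeg-split v = ≤-trans (outdeg-H v) (≤-reflexive (split (A v)))

    module Long (m<h : m < h) where

      out-zero : ∀ i → # (λ k → A (q i) (q (k + i))) (suc N) ≡ bit (A (q i) (q (1 + i))) + # (λ k → A (q i) (q (1 + h + k + i))) n
      out-zero i = go (m≤n⇒∃[o]m+o≡n {1} {h} (<⇒≤ 2≤h))
        where
        f : ℕ → Bool
        f k = A (q i) (q (k + i))
        go : (∃ λ l → 1 + l ≡ h) → # f (suc N) ≡ bit (f 1) + # (λ k → f (1 + h + k)) n
        go (l , refl) = (lin₂ (1 ∷ 1 ∷ 0 ∷ 1 ∷ 0 ∷ 1 ∷ 0 ∷ []) (1 ∷ 0 ∷ 0 ∷ 0 ∷ 0 ∷ 0 ∷ 1 ∷ []) (# f (suc N) ∷ bit (f 0) ∷ bit (f 1) ∷ # (λ k → f (2 + (l + k))) n ∷ # (λ k → f (2 + k)) l ∷ []) (λ t a b d e → (t ≐ a ⊕ (b ⊕ (e ⊕ d))) ⇛ (a ≐ κ 0) ⇛ (e ≐ κ 0) ⇛ ⊢ (t ≐ b ⊕ d)))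
          (trans (cong (# f) ((lin₂ (1 ∷ 0 ∷ 1 ∷ 0 ∷ 1 ∷ []) (1 ∷ 1 ∷ 0 ∷ 1 ∷ 0 ∷ []) (m ∷ l ∷ n ∷ N ∷ []) (λ m l n N → (m ⊕ (κ 1 ⊕ l) ≐ κ 1 ⊕ N) ⇛ (κ 1 ⊕ n ≐ m) ⇛ ⊢ (κ 1 ⊕ N ≐ κ 2 ⊕ (l ⊕ n)))) m+h 1+n))
            (cong (λ z → bit (f 0) + (bit (f 1) + z)) (#-+ (λ k → f (2 + k)) l n)))
          (bit-false (loopless (q i)))
          (#-none l λ k lt → no-chord i (2 + k) (s≤s (s≤s z≤n)) (s≤s lt))

      in-few : # (λ k → A (q k) (q 0)) (suc N) ≤ m
      in-few = go (m≤n⇒∃[o]m+o≡n {1} {h} (<⇒≤ 2≤h))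
        where
        f : ℕ → Bool
        f k = A (q k) (q 0)
        go : (∃ λ l → 1 + l ≡ h) → # f (suc N) ≤ m
        go (l , refl) = (lin₁ (1 ∷ 1 ∷ 0 ∷ 1 ∷ 1 ∷ 0 ∷ 1 ∷ 1 ∷ 0 ∷ 1 ∷ 0 ∷ []) (# f (suc N) ∷ bit (f 0) ∷ # (λ k → f (1 + k)) n ∷ # (λ k → f (suc n + k)) l ∷ # (λ k → f (suc n + (l + k))) 1 ∷ n ∷ m ∷ []) (λ t a b d e n m → (t ≐ a ⊕ b ⊕ (d ⊕ e)) ⇛ (a ≐ κ 0) ⇛ (b ≼ n) ⇛ (d ≐ κ 0) ⇛ (e ≼ κ 1) ⇛ (κ 1 ⊕ n ≐ m) ⇛ ⊢ (t ≼ m)))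
          (trans (cong (# f) ((lin₂ (1 ∷ 0 ∷ 1 ∷ 0 ∷ 1 ∷ []) (1 ∷ 1 ∷ 0 ∷ 1 ∷ 0 ∷ []) (m ∷ l ∷ n ∷ N ∷ []) (λ m l n N → (m ⊕ (κ 1 ⊕ l) ≐ κ 1 ⊕ N) ⇛ (κ 1 ⊕ n ≐ m) ⇛ ⊢ (κ 1 ⊕ N ≐ κ 1 ⊕ n ⊕ (l ⊕ κ 1)))) m+h 1+n))
            (trans (#-+ f (suc n) (l + 1)) (cong (# f (suc n) +_) (#-+ (λ k → f (suc n + k)) l 1))))
          (bit-false (loopless (q 0))) (#≤ (λ k → f (suc k)) n)
          (#-none l λ k lt → ¬true λ a → excluded k lt a (m≤n⇒∃[o]m+o≡n lt))
          (#≤ (λ k → f (suc n + (l + k))) 1) 1+n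
          where
          excluded : ∀ k → k < l → f (suc n + k) ≡ true → (∃ λ o → suc k + o ≡ l) → ⊥
          excluded k lt a (o , e) = true≢false (subst (λ z → A (q (suc n + k)) z ≡ true) (trans (sym (per H 0)) (cong q idx)) a)
              (no-chord (suc n + k) (2 + o) (s≤s (s≤s z≤n)) (s≤s ((lin₁ (1 ∷ 1 ∷ 0 ∷ []) (k ∷ o ∷ l ∷ []) (λ k o l → (κ 1 ⊕ k ⊕ o ≐ l) ⇛ ⊢ (κ 1 ⊕ o ≼ l))) e)))
            where
            idx : suc N + 0 ≡ 2 + o + (suc n + k)
            idx = (lin₂ (1 ∷ 0 ∷ 1 ∷ 0 ∷ 1 ∷ 0 ∷ 1 ∷ []) (1 ∷ 1 ∷ 0 ∷ 1 ∷ 0 ∷ 1 ∷ 0 ∷ []) (m ∷ l ∷ n ∷ N ∷ k ∷ o ∷ []) (λ m l n N k o → (m ⊕ (κ 1 ⊕ l) ≐ κ 1 ⊕ N) ⇛ (κ 1 ⊕ n ≐ m) ⇛ (κ 1 ⊕ k ⊕ o ≐ l) ⇛ ⊢ (κ 1 ⊕ N ⊕ κ 0 ≐ κ 2 ⊕ o ⊕ (κ 1 ⊕ n ⊕ k)))) m+h 1+n e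

      -- By `no-chord` q₀ has at most m in-neighbours and at most 1 + (m - 1) out-neighbours, so m +
      -- h - 1 ≤ 2 m.
      h≡ : h ≡ suc m
      h≡ = ≤-antisym ((lin₁ (1 ∷ 1 ∷ 0 ∷ 1 ∷ 0 ∷ 1 ∷ 1 ∷ 1 ∷ 0 ∷ 1 ∷ 0 ∷ 1 ∷ 1 ∷ 1 ∷ 1 ∷ []) (indeg A (q 0) ∷ outdeg A (q 0) ∷ # (λ k → A (q k) (q 0)) (suc N) ∷ # (λ k → A (q 0) (q k)) (suc N) ∷ # (λ k → A (q 0) (q (k + 0))) (suc N) ∷ bit (A (q 0) (q 1)) ∷ # (λ k → A (q 0) (q (1 + h + k + 0))) n ∷ m ∷ h ∷ n ∷ N ∷ []) (λ i o a b b′ d e m h n N → (N ≼ i ⊕ o) ⇛ (i ≼ a) ⇛ (o ≼ b) ⇛ (b′ ≐ b) ⇛ (a ≼ m) ⇛ (b′ ≐ d ⊕ e) ⇛ (d ≼ κ 1) ⇛ (e ≼ n) ⇛ (κ 1 ⊕ n ≐ m) ⇛ (m ⊕ h ≐ κ 1 ⊕ N) ⇛ ⊢ (h ≼ κ 1 ⊕ m)))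
          (deg (q 0)) (indeg-H (q 0)) (outdeg-H (q 0)) (#-cong (suc N) λ k _ → cong (λ z → A (q 0) (q z)) (+-identityʳ k))
          in-few (out-zero 0) (bit≤1 (A (q 0) (q 1))) (#≤ (λ k → A (q 0) (q (1 + h + k + 0))) n) 1+n m+h) m<h

      -- As h = m + 1, at least m out-neighbours are required. `no-chord` leaves exactly m
      -- candidates: the successor of q_i and the m - 1 vertices that precede it.
      chord : ∀ i k → k < n → q i ⇒ q (1 + h + k + i)
      chord i = #-full (λ k → A (q i) (q (1 + h + k + i))) n ((lin₁ (2 ∷ 0 ∷ 1 ∷ 1 ∷ 0 ∷ 2 ∷ 0 ∷ 2 ∷ 2 ∷ 0 ∷ 0 ∷ 2 ∷ 2 ∷ 1 ∷ []) (outdeg A (q i) ∷ # (λ k → A (q i) (q k)) (suc N) ∷ # (λ k → A (q i) (q (k + i))) (suc N) ∷ bit (A (q i) (q (1 + i))) ∷ # (λ k → A (q i) (q (1 + h + k + i))) n ∷ m ∷ h ∷ n ∷ N ∷ []) (λ o a b d e m h n N → (N ≼ 2 ⊛ o ⊕ κ 1) ⇛ (o ≼ a) ⇛ (b ≐ a) ⇛ (b ≐ d ⊕ e) ⇛ (d ≼ κ 1) ⇛ (κ 1 ⊕ n ≐ m) ⇛ (m ⊕ h ≐ κ 1 ⊕ N) ⇛ (h ≐ κ 1 ⊕ m) ⇛ ⊢ (n ≼ e)))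
          (deg-out (q i)) (outdeg-H (q i)) (#-rot {λ k → A (q i) (q k)} {suc N} i (λ k → cong (A (q i)) (per H k)))
          (out-zero i) (bit≤1 (A (q i) (q (1 + i)))) 1+n m+h h≡)

      N≡ : N ≡ h + n
      N≡ = (lin₂ (1 ∷ 0 ∷ 1 ∷ 0 ∷ 1 ∷ []) (1 ∷ 1 ∷ 0 ∷ 1 ∷ 0 ∷ []) (m ∷ h ∷ n ∷ N ∷ []) (λ m h n N → (m ⊕ h ≐ κ 1 ⊕ N) ⇛ (κ 1 ⊕ n ≐ m) ⇛ ⊢ (N ≐ h ⊕ n))) m+h 1+n

      down : ∀ i → q (suc i) ⇒ q i
      down i = go (m≤n⇒∃[o]m+o≡n {1} {n} (s≤s⁻¹ (subst (2 ≤_) (sym 1+n) 2≤m)))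
        where
        go : (∃ λ o → 1 + o ≡ n) → q (suc i) ⇒ q i
        go (o , e) = subst (q (suc i) ⇒_) (trans (cong q ((lin₂ (1 ∷ 1 ∷ 0 ∷ 0 ∷ 1 ∷ []) (1 ∷ 0 ∷ 1 ∷ 1 ∷ 0 ∷ []) (h ∷ o ∷ n ∷ N ∷ i ∷ []) (λ h o n N i → (N ≐ h ⊕ n) ⇛ (κ 1 ⊕ o ≐ n) ⇛ ⊢ (κ 1 ⊕ h ⊕ o ⊕ (κ 1 ⊕ i) ≐ κ 1 ⊕ N ⊕ i))) N≡ e)) (per H i))
          (chord (suc i) o (≤-reflexive e))

      q-inj : ∀ i j → i < suc N → j < suc N → q i ≡ q j → i ≡ j
      q-inj = inj H

      -- For m = 2 the digraph is the symmetric pentagon. For m ≥ 3 there are arcs back over two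
      -- steps and over one, and q₀ → q_{N-1} → q_{N-2} → ... → q₀ has length N.
      absurd : ⊥
      absurd = go n refl
        where
        go : ∀ k → k ≡ n → ⊥
        go 0 e = <⇒≱ 2≤m (≤-reflexive (trans (sym 1+n) (cong suc (sym e))))
        go 1 e = five (suc-injective (trans (sym m+h) (trans (cong₂ _+_ (trans (sym 1+n) (cong suc (sym e))) (trans h≡ (cong suc (trans (sym 1+n) (cong suc (sym e)))))) refl)))
          where
          five : N ≡ 4 → ⊥
          five refl = noQ H record { p≡5 = refl ; back = λ i → subst (λ z → q i ⇒ q (z + i)) four (chord i 0 (≤-reflexive e))
            ; no-chord = λ i → no-chord i 2 ≤-refl 2≤h , no-chord i 3 (s≤s (s≤s z≤n)) (≤-reflexive (sym h3)) }
            where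
            h3 : h ≡ 3
            h3 = trans h≡ (cong suc (trans (sym 1+n) (cong suc (sym e))))
            four : 1 + h + 0 ≡ 4
            four = trans (+-identityʳ (1 + h)) (cong suc h3)
        go (suc (suc o)) e = noC (close (q 0) (applyUpTo (λ t → q (k ∸ t)) k) (trans (cong suc (length-applyUpTo _ k)) 1+k)
            (walk k first) unique)
          where
          k = h + suc o
          1+k : suc k ≡ N
          1+k = (lin₂ (1 ∷ 1 ∷ 0 ∷ 0 ∷ 1 ∷ []) (1 ∷ 0 ∷ 1 ∷ 1 ∷ 0 ∷ []) (h ∷ o ∷ n ∷ N ∷ []) (λ h o n N → (N ≐ h ⊕ n) ⇛ (κ 2 ⊕ o ≐ n) ⇛ ⊢ (κ 1 ⊕ (h ⊕ (κ 1 ⊕ o)) ≐ N))) N≡ e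
          first : q 0 ⇒ q k
          first = subst (λ z → q 0 ⇒ q z) ((lin₂ (1 ∷ []) (1 ∷ []) (h ∷ o ∷ []) (λ h o → ⊢ (κ 1 ⊕ h ⊕ o ⊕ κ 0 ≐ h ⊕ (κ 1 ⊕ o))))) (chord 0 o (subst (o <_) e (s≤s (n≤1+n o))))
          walk : ∀ {u} j → u ⇒ q j → Walk u (applyUpTo (λ t → q (j ∸ t)) j) (q 0)
          walk 0 a = a
          walk (suc j) a = a , walk j (down j)
          k<N : k < suc N
          k<N = <⇒≤ (s≤s (≤-reflexive 1+k))
          unique : Unique (q 0 ∷ applyUpTo (λ t → q (k ∸ t)) k)
          unique = ∷-unique
            (λ v∈ → let t , lt , e = ∈-seg⁻ (λ t → q (k ∸ t)) k v∈ in
              <⇒≢ (m<n⇒0<n∸m lt) (q-inj 0 (k ∸ t) z<s (≤-<-trans (m∸n≤m k t) k<N) e))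
            (seg-unique (λ t → q (k ∸ t)) k λ i j lt lt′ e → ∸-cancelˡ-≡ (<⇒≤ lt) (<⇒≤ lt′)
              (q-inj (k ∸ i) (k ∸ j) (≤-<-trans (m∸n≤m k i) k<N) (≤-<-trans (m∸n≤m k j) k<N) e))

    q-inj′ : ∀ i j → i < h → j < h → q i ≡ q j → i ≡ j
    q-inj′ i j lt lt′ = inj H i j (≤-trans lt h≤) (≤-trans lt′ h≤)
      where
      h≤ : h ≤ suc N
      h≤ = subst (h ≤_) m+h (m≤n+m h m)

    forward : ∀ i j → 2 + i ≤ j → j < h → A (q i) (q j) ≡ false
    forward i j le lt = go (m≤n⇒∃[o]m+o≡n le)
      where
      go : (∃ λ o → 2 + i + o ≡ j) → A (q i) (q j) ≡ false
      go (o , refl) = subst (λ z → A (q i) (q z) ≡ false) ((lin₂ (1 ∷ []) (1 ∷ []) (o ∷ i ∷ []) (λ o i → ⊢ (κ 2 ⊕ o ⊕ i ≐ κ 2 ⊕ i ⊕ o)))) (no-chord i (2 + o) (s≤s (s≤s z≤n))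
        ((lin₁ (1 ∷ 1 ∷ []) (i ∷ o ∷ h ∷ []) (λ i o h → (κ 1 ⊕ (κ 2 ⊕ i ⊕ o) ≼ h) ⇛ ⊢ (κ 2 ⊕ o ≼ h))) lt))

    -- As h ≥ 3, the two ends of an arc inside Q form a path that misses some vertex off C, so the
    -- inequality holds without loss.
    chord-bound : 3 ≤ h → h ≤ m → ∀ i j → i < h → j < h → q i ⇒ q j → 1 ≤ inC C (q i) → 1 ≤ outC C (q j) → inC C (q i) + outC C (q j) + 2 ≤ suc m
    chord-bound 3≤h h≤m i j lt lt′ a = Sub.bound C (q i ∷ q j ∷ []) (λ k → ∉-∷ (λ e → offQ k (subst (_∈ Q) (sym e) (q-∈ i lt))) (∉-∷ (λ e → offQ k (subst (_∈ Q) (sym e) (q-∈ j lt′))) ∉-[]))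
      (∷-unique (∉-∷ (loop-free a) ∉-[]) (∷-unique ∉-[] [])) (two a) 3≤h h≤m (s≤s z≤n)

    module Short (3≤h : 3 ≤ h) (h≤m : h ≤ m) where

      private
        l = proj₁ (m≤n⇒∃[o]m+o≡n {3} 3≤h)
        3+l : 3 + l ≡ h
        3+l = proj₂ (m≤n⇒∃[o]m+o≡n {3} 3≤h)
        last = 2 + l
        last<h : last < h
        last<h = ≤-reflexive 3+l

      -- `forward` leaves the predecessor q_a and the o vertices that come later on Q.
      inQ-bound : ∀ a o → 2 + a + o ≡ h → inQ (q (suc a)) ≤ 1 + o
      inQ-bound a o e = (lin₁ (1 ∷ 1 ∷ 1 ∷ 1 ∷ 0 ∷ 1 ∷ 0 ∷ 1 ∷ 0 ∷ 1 ∷ 0 ∷ []) (inQ (q (suc a)) ∷ # f a ∷ # (λ k → f (a + k)) 2 ∷ # (λ k → f (a + 2 + k)) o ∷ bit (f (a + 0)) ∷ bit (f (a + 1)) ∷ o ∷ []) (λ t x y z u v o → (t ≐ x ⊕ y ⊕ z) ⇛ (x ≐ κ 0) ⇛ (y ≐ u ⊕ (v ⊕ κ 0)) ⇛ (v ≐ κ 0) ⇛ (u ≼ κ 1) ⇛ (z ≼ o) ⇛ ⊢ (t ≼ κ 1 ⊕ o)))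
        (trans (cong (# f) (trans (sym e) (cong (_+ o) (+-comm 2 a)))) (trans (#-+ f (a + 2) o) (cong (_+ # (λ k → f (a + 2 + k)) o) (#-+ f a 2))))
        (#-none a λ i lt → forward i (suc a) (s≤s lt) (subst (suc a <_) e (s≤s (s≤s (m≤m+n a o)))))
        refl (bit-false (trans (cong f (+-comm a 1)) (loopless _))) (bit≤1 (f (a + 0))) (#≤ (λ k → f (a + 2 + k)) o)
        where
        f : ℕ → Bool
        f j = A (q j) (q (suc a))

      outQ-bound : ∀ j o → 2 + j + o ≡ h → outQ (q j) ≤ 1 + j
      outQ-bound j o e = (lin₁ (1 ∷ 1 ∷ 1 ∷ 1 ∷ 0 ∷ 1 ∷ 0 ∷ 1 ∷ 0 ∷ 1 ∷ 0 ∷ []) (outQ (q j) ∷ # f j ∷ # (λ k → f (j + k)) 2 ∷ # (λ k → f (j + 2 + k)) o ∷ bit (f (j + 0)) ∷ bit (f (j + 1)) ∷ j ∷ []) (λ t x y z u v j → (t ≐ x ⊕ y ⊕ z) ⇛ (z ≐ κ 0) ⇛ (y ≐ u ⊕ (v ⊕ κ 0)) ⇛ (u ≐ κ 0) ⇛ (v ≼ κ 1) ⇛ (x ≼ j) ⇛ ⊢ (t ≼ κ 1 ⊕ j)))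
        (trans (cong (# f) (trans (sym e) (cong (_+ o) (+-comm 2 j)))) (trans (#-+ f (j + 2) o) (cong (_+ # (λ k → f (j + 2 + k)) o) (#-+ f j 2))))
        (#-none o λ i lt → forward j (j + 2 + i) (subst (_≤ j + 2 + i) (+-comm j 2) (m≤m+n (j + 2) i)) ((lin₁ (1 ∷ 1 ∷ 1 ∷ 0 ∷ []) (j ∷ o ∷ i ∷ h ∷ []) (λ j o i h → (κ 2 ⊕ j ⊕ o ≐ h) ⇛ (κ 1 ⊕ i ≼ o) ⇛ ⊢ (κ 1 ⊕ (j ⊕ κ 2 ⊕ i) ≼ h))) e lt))
        refl (bit-false (trans (cong f (+-identityʳ j)) (loopless _))) (bit≤1 (f (j + 1))) (#≤ f j)
        where
        f : ℕ → Bool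
        f k = A (q j) (q k)

      outQ-0 : outQ (q 0) ≤ 1
      outQ-0 = outQ-bound 0 (suc l) (trans (cong (2 +_) refl) 3+l)

      inQ-last : inQ (q last) ≤ 1
      inQ-last = subst (λ z → inQ (q last) ≤ z) refl (inQ-bound (suc l) 0 (trans (+-identityʳ (3 + l)) 3+l))

      some-T0 : 1 ≤ outC C (q 0)
      some-T0 = (lin₁ (2 ∷ 2 ∷ 2 ∷ 1 ∷ 1 ∷ []) (outdeg A (q 0) ∷ outQ (q 0) ∷ outC C (q 0) ∷ N ∷ []) (λ o a b N → (κ 4 ≼ N) ⇛ (N ≼ 2 ⊛ o ⊕ κ 1) ⇛ (o ≼ a ⊕ b) ⇛ (a ≼ κ 1) ⇛ ⊢ (κ 1 ≼ b)))
        order (deg-out (q 0)) (outdeg-split (q 0)) outQ-0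

      some-S-last : 1 ≤ inC C (q last)
      some-S-last = (lin₁ (2 ∷ 2 ∷ 2 ∷ 1 ∷ 1 ∷ []) (indeg A (q last) ∷ inQ (q last) ∷ inC C (q last) ∷ N ∷ []) (λ o a b N → (κ 4 ≼ N) ⇛ (N ≼ 2 ⊛ o ⊕ κ 1) ⇛ (o ≼ a ⊕ b) ⇛ (a ≼ κ 1) ⇛ ⊢ (κ 1 ≼ b)))
        order (deg-in (q last)) (indeg-split (q last)) inQ-last

      -- Such an arc would bound the neighbours of its ends on C by `chord-bound`, and those in Q
      -- are few by `inQ-bound` and `outQ-0`; the sum stays below the N - 1 that the half-degree
      -- conditions require.
      to-first : ∀ i → 3 ≤ i → i < h → A (q i) (q 0) ≡ false
      to-first (suc a) (s≤s 2≤a) lt = ¬true λ b → go b (m≤n⇒∃[o]m+o≡n lt)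
        where
        go : q (suc a) ⇒ q 0 → (∃ λ o → suc (suc a) + o ≡ h) → ⊥
        go b (o , e) = (lin₁ (2 ∷ 2 ∷ 2 ∷ 2 ∷ 2 ∷ 1 ∷ 1 ∷ 2 ∷ 0 ∷ 2 ∷ 2 ∷ 0 ∷ []) (indeg A (q (suc a)) ∷ outdeg A (q 0) ∷ inQ (q (suc a)) ∷ outQ (q 0) ∷ inC C (q (suc a)) ∷ outC C (q 0) ∷ N ∷ m ∷ h ∷ a ∷ o ∷ []) (λ i o′ p r s t N m h a o → (m ⊕ h ≐ κ 1 ⊕ N) ⇛ (κ 2 ≼ a) ⇛ (κ 2 ⊕ a ⊕ o ≐ h) ⇛ (N ≼ 2 ⊛ i ⊕ κ 1) ⇛ (N ≼ 2 ⊛ o′ ⊕ κ 1) ⇛ (i ≼ p ⊕ s) ⇛ (o′ ≼ r ⊕ t) ⇛ (p ≼ κ 1 ⊕ o) ⇛ (r ≼ κ 1) ⇛ (s ⊕ t ⊕ κ 2 ≼ κ 1 ⊕ m) ⇛ ⊢ (ff)))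
          m+h 2≤a e (deg-in _) (deg-out _) (indeg-split _) (outdeg-split _) (inQ-bound a o e) outQ-0
          (chord-bound 3≤h h≤m (suc a) 0 lt (≤-trans (s≤s z≤n) 3≤h) b
            ((lin₁ (2 ∷ 2 ∷ 2 ∷ 1 ∷ 2 ∷ 0 ∷ 1 ∷ 2 ∷ 1 ∷ 0 ∷ []) (indeg A (q (suc a)) ∷ inQ (q (suc a)) ∷ inC C (q (suc a)) ∷ N ∷ m ∷ h ∷ a ∷ o ∷ []) (λ i p s N m h a o → (m ⊕ h ≐ κ 1 ⊕ N) ⇛ (κ 2 ≼ a) ⇛ (h ≼ m) ⇛ (κ 2 ⊕ a ⊕ o ≐ h) ⇛ (N ≼ 2 ⊛ i ⊕ κ 1) ⇛ (i ≼ p ⊕ s) ⇛ (p ≼ κ 1 ⊕ o) ⇛ ⊢ (κ 1 ≼ s))) m+h 2≤a h≤m e (deg-in _) (indeg-split _) (inQ-bound a o e))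
            some-T0)

      from-last : ∀ j → 3 + j < h → A (q last) (q j) ≡ false
      from-last j lt = ¬true λ b → go b (m≤n⇒∃[o]m+o≡n lt)
        where
        go : q last ⇒ q j → (∃ λ o → suc (3 + j) + o ≡ h) → ⊥
        go b (o , e) = (lin₁ (2 ∷ 2 ∷ 2 ∷ 2 ∷ 2 ∷ 1 ∷ 1 ∷ 2 ∷ 0 ∷ 2 ∷ 0 ∷ []) (indeg A (q last) ∷ outdeg A (q j) ∷ inQ (q last) ∷ outQ (q j) ∷ inC C (q last) ∷ outC C (q j) ∷ N ∷ m ∷ h ∷ j ∷ o ∷ []) (λ i o′ p r s t N m h j o → (m ⊕ h ≐ κ 1 ⊕ N) ⇛ (κ 4 ⊕ j ⊕ o ≐ h) ⇛ (N ≼ 2 ⊛ i ⊕ κ 1) ⇛ (N ≼ 2 ⊛ o′ ⊕ κ 1) ⇛ (i ≼ p ⊕ s) ⇛ (o′ ≼ r ⊕ t) ⇛ (p ≼ κ 1) ⇛ (r ≼ κ 1 ⊕ j) ⇛ (s ⊕ t ⊕ κ 2 ≼ κ 1 ⊕ m) ⇛ ⊢ (ff)))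
          m+h e (deg-in _) (deg-out _) (indeg-split _) (outdeg-split _) inQ-last out
          (chord-bound 3≤h h≤m last j last<h (≤-trans (s≤s (m≤n+m j 3)) lt) b some-S-last
            ((lin₁ (2 ∷ 2 ∷ 2 ∷ 1 ∷ 2 ∷ 0 ∷ 1 ∷ 1 ∷ 0 ∷ []) (outdeg A (q j) ∷ outQ (q j) ∷ outC C (q j) ∷ N ∷ m ∷ h ∷ j ∷ o ∷ []) (λ i p s N m h j o → (m ⊕ h ≐ κ 1 ⊕ N) ⇛ (h ≼ m) ⇛ (κ 4 ⊕ j ⊕ o ≐ h) ⇛ (N ≼ 2 ⊛ i ⊕ κ 1) ⇛ (i ≼ p ⊕ s) ⇛ (p ≼ κ 1 ⊕ j) ⇛ ⊢ (κ 1 ≼ s))) m+h h≤m e (deg-out _) (outdeg-split _) out))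
          where
          out : outQ (q j) ≤ 1 + j
          out = outQ-bound j (2 + o) ((lin₂ (1 ∷ 1 ∷ 0 ∷ []) (1 ∷ 0 ∷ 1 ∷ []) (j ∷ o ∷ h ∷ []) (λ j o h → (κ 4 ⊕ j ⊕ o ≐ h) ⇛ ⊢ (κ 2 ⊕ j ⊕ (κ 2 ⊕ o) ≐ h))) e)

      inQ-first : inQ (q 0) ≡ bit (A (q 1) (q 0)) + bit (A (q 2) (q 0))
      inQ-first = (lin₂ (1 ∷ 1 ∷ 0 ∷ 1 ∷ 0 ∷ 1 ∷ 0 ∷ []) (1 ∷ 0 ∷ 0 ∷ 0 ∷ 0 ∷ 0 ∷ 1 ∷ []) (inQ (q 0) ∷ bit (A (q 0) (q 0)) ∷ bit (A (q 1) (q 0)) ∷ bit (A (q 2) (q 0)) ∷ # (λ k → A (q (3 + k)) (q 0)) l ∷ []) (λ t a b d z → (t ≐ a ⊕ (b ⊕ (d ⊕ z))) ⇛ (a ≐ κ 0) ⇛ (z ≐ κ 0) ⇛ ⊢ (t ≐ b ⊕ d)))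
        (cong (# (λ k → A (q k) (q 0))) (sym 3+l)) (bit-false (loopless _))
        (#-none l λ k lt → to-first (3 + k) (s≤s (s≤s (s≤s z≤n))) (subst (3 + k <_) 3+l (s≤s (s≤s (s≤s lt)))))

      outQ-last : outQ (q last) ≡ bit (A (q last) (q l)) + bit (A (q last) (q (1 + l)))
      outQ-last = (lin₂ (1 ∷ 1 ∷ 0 ∷ 1 ∷ 0 ∷ 1 ∷ 0 ∷ 1 ∷ 0 ∷ 1 ∷ 0 ∷ []) (1 ∷ 0 ∷ 0 ∷ 0 ∷ 1 ∷ 0 ∷ 1 ∷ 0 ∷ 0 ∷ 0 ∷ 1 ∷ []) (outQ (q last) ∷ # f l ∷ bit (f (l + 0)) ∷ bit (f (l + 1)) ∷ bit (f (l + 2)) ∷ bit (f l) ∷ bit (f (1 + l)) ∷ []) (λ t z a b d a′ b′ → (t ≐ z ⊕ (a ⊕ (b ⊕ (d ⊕ κ 0)))) ⇛ (z ≐ κ 0) ⇛ (a ≐ a′) ⇛ (b ≐ b′) ⇛ (d ≐ κ 0) ⇛ ⊢ (t ≐ a′ ⊕ b′)))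
        (trans (cong (# f) (trans (sym 3+l) (+-comm 3 l))) (#-+ f l 3))
        (#-none l λ k lt → from-last k (subst (3 + k <_) 3+l (s≤s (s≤s (s≤s lt)))))
        (cong (bit ∘ f) (+-identityʳ l)) (cong (bit ∘ f) (+-comm l 1)) (bit-false (trans (cong f (+-comm l 2)) (loopless _)))
        where
        f : ℕ → Bool
        f k = A (q last) (q k)

      some-S0 : 1 ≤ inC C (q 0)
      some-S0 = subst (1 ≤_) (#-shift (λ i → A (c C i) (q 0)) m (cong (λ z → A z (q 0)) (c-m C)))
        (#-1≤ (λ i → A (c C (suc i)) (q 0)) n (≤-reflexive 1+n)
          (subst₂ _⇒_ (trans (q-old n (≤-reflexive 1+n)) (cong (c C) (+-comm n 1)))
            (trans (cong q ((lin₂ (1 ∷ 1 ∷ 0 ∷ 1 ∷ 0 ∷ []) (1 ∷ 0 ∷ 1 ∷ 0 ∷ 1 ∷ []) (h ∷ n ∷ m ∷ N ∷ []) (λ h n m N → (m ⊕ h ≐ κ 1 ⊕ N) ⇛ (κ 1 ⊕ n ≐ m) ⇛ ⊢ (κ 1 ⊕ (h ⊕ n) ≐ κ 1 ⊕ N ⊕ κ 0))) m+h 1+n)) (per H 0)) (arc H (h + n))))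

      some-T-last : 1 ≤ outC C (q last)
      some-T-last = #-1≤ (λ i → A (q last) (c C i)) 1 2≤m
        (subst (q last ⇒_) (trans (cong q (trans 3+l (sym (+-identityʳ h)))) (q-old 0 (<⇒≤ 2≤m))) (arc H last))

      whole : List V
      whole = applyUpTo q (suc last)

      whole-off : OffL C whole
      whole-off k v∈ = let i , lt , e = ∈-seg⁻ q (suc last) v∈ in offQ k (subst (_∈ Q) (sym e) (q-∈ i (subst (i <_) 3+l lt)))

      whole-unique : Unique whole
      whole-unique = seg-unique q (suc last) λ i j lt lt′ → q-inj′ i j (subst (i <_) 3+l lt) (subst (j <_) 3+l lt′)

      ends : inC C (q 0) + outC C (q last) + h ≤ 2 + m
      ends = Sub.bound-full C whole whole-off whole-unique
        (λ a b → a , walk-arcs q last (λ i _ → arc H i) b) (trans (length-applyUpTo q (suc last)) 3+l) h≤m some-S0 some-T-last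

      q2⇒q0-bound : q 2 ⇒ q 0 → 1 ≤ inC C (q 2) → inC C (q 2) + outC C (q 0) + 2 ≤ suc m
      q2⇒q0-bound b s = chord-bound 3≤h h≤m 2 0 3≤h (≤-trans (s≤s z≤n) 3≤h) b s some-T0

      -- In Q, q₀ has at most two in-neighbours and the last vertex at most two out-neighbours,
      -- which contradicts `ends` for h ≥ 5. The cases h = 4 and h = 3 are split by the chord q₂ →
      -- q₀.
      absurd : ⊥
      absurd = by l refl
        where
        b₁ = bit (A (q 1) (q 0))
        b₂ = bit (A (q 2) (q 0))
        e₁ = bit (A (q last) (q l))
        e₂ = bit (A (q last) (q (1 + l)))
        by : ∀ k → k ≡ l → ⊥
        by (suc (suc k)) eq = (lin₁ (2 ∷ 2 ∷ 2 ∷ 2 ∷ 2 ∷ 2 ∷ 0 ∷ 2 ∷ 0 ∷ 2 ∷ 2 ∷ 1 ∷ 1 ∷ 4 ∷ 0 ∷ 4 ∷ 0 ∷ 2 ∷ 0 ∷ []) (indeg A (q 0) ∷ outdeg A (q last) ∷ inQ (q 0) ∷ outQ (q last) ∷ inC C (q 0) ∷ outC C (q last) ∷ b₁ ∷ b₂ ∷ e₁ ∷ e₂ ∷ N ∷ m ∷ h ∷ k ∷ l ∷ []) (λ i o p r s t b₁ b₂ e₁ e₂ N m h k l → (m ⊕ h ≐ κ 1 ⊕ N) ⇛ (κ 3 ⊕ l ≐ h) ⇛ (κ 2 ⊕ k ≐ l) ⇛ (N ≼ 2 ⊛ i ⊕ κ 1) ⇛ (N ≼ 2 ⊛ o ⊕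 κ 1) ⇛ (i ≼ p ⊕ s) ⇛ (o ≼ r ⊕ t) ⇛ (p ≐ b₁ ⊕ b₂) ⇛ (r ≐ e₁ ⊕ e₂) ⇛ (b₁ ≼ κ 1) ⇛ (b₂ ≼ κ 1) ⇛ (e₁ ≼ κ 1) ⇛ (e₂ ≼ κ 1) ⇛ (s ⊕ t ⊕ h ≼ κ 2 ⊕ m) ⇛ ⊢ (ff)))
            m+h 3+l eq (deg-in _) (deg-out _) (indeg-split _) (outdeg-split _) inQ-first outQ-last
            (bit≤1 (A (q 1) (q 0))) (bit≤1 (A (q 2) (q 0))) (bit≤1 (A (q last) (q l))) (bit≤1 (A (q last) (q (1 + l)))) ends
        by 1 eq = four (bool-cases (A (q 2) (q 0)))
          where
          four : _ → ⊥
          four (inj₂ f) = (lin₁ (2 ∷ 2 ∷ 2 ∷ 2 ∷ 0 ∷ 2 ∷ 2 ∷ 0 ∷ 2 ∷ 0 ∷ 2 ∷ 2 ∷ 1 ∷ 1 ∷ 4 ∷ 0 ∷ 4 ∷ 0 ∷ 2 ∷ 0 ∷ []) (indeg A (q 0) ∷ outdeg A (q last) ∷ inQ (q 0) ∷ outQ (q last) ∷ inC C (q 0) ∷ outC C (q last) ∷ b₁ ∷ b₂ ∷ e₁ ∷ e₂ ∷ N ∷ m ∷ h ∷ l ∷ []) (λ i o p r s t b₁ b₂ e₁ e₂ N m h l → (m ⊕ h ≐ κ 1 ⊕ N) ⇛ (κ 3 ⊕ l ≐ h) ⇛ (κ 1 ≐ l) ⇛ (N ≼ 2 ⊛ i ⊕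 κ 1) ⇛ (N ≼ 2 ⊛ o ⊕ κ 1) ⇛ (i ≼ p ⊕ s) ⇛ (o ≼ r ⊕ t) ⇛ (p ≐ b₁ ⊕ b₂) ⇛ (r ≐ e₁ ⊕ e₂) ⇛ (b₁ ≼ κ 1) ⇛ (b₂ ≐ κ 0) ⇛ (e₁ ≼ κ 1) ⇛ (e₂ ≼ κ 1) ⇛ (s ⊕ t ⊕ h ≼ κ 2 ⊕ m) ⇛ ⊢ (ff)))
            m+h 3+l eq (deg-in _) (deg-out _) (indeg-split _) (outdeg-split _) inQ-first outQ-last
            (bit≤1 (A (q 1) (q 0))) (bit-false f) (bit≤1 (A (q last) (q l))) (bit≤1 (A (q last) (q (1 + l)))) ends
          four (inj₁ t′) = (lin₁ (2 ∷ 2 ∷ 2 ∷ 2 ∷ 2 ∷ 2 ∷ 2 ∷ 2 ∷ 2 ∷ 0 ∷ 2 ∷ 0 ∷ 2 ∷ 2 ∷ 2 ∷ 2 ∷ 1 ∷ 1 ∷ 2 ∷ 6 ∷ 0 ∷ 6 ∷ 0 ∷ 4 ∷ 0 ∷ []) (indeg A (q 0) ∷ outdeg A (q last) ∷ indeg A (q 2) ∷ outdeg A (q 0) ∷ inQ (q 0) ∷ outQ (q last) ∷ inC C (q 0) ∷ outC C (q last) ∷ inQ (q 2) ∷ outQ (q 0) ∷ inC C (q 2) ∷ outC C (q 0) ∷ b₁ ∷ b₂ ∷ e₁ ∷ e₂ ∷ N ∷ m ∷ h ∷ l ∷ []) (λ i o i₂ o₀ p r s t p₂ r₀ s₂ t₀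 b₁ b₂ e₁ e₂ N m h l → (m ⊕ h ≐ κ 1 ⊕ N) ⇛ (κ 3 ⊕ l ≐ h) ⇛ (κ 1 ≐ l) ⇛ (N ≼ i ⊕ o₀) ⇛ (N ≼ 2 ⊛ i₂ ⊕ κ 1) ⇛ (N ≼ 2 ⊛ o ⊕ κ 1) ⇛ (i ≼ p ⊕ s) ⇛ (o ≼ r ⊕ t) ⇛ (i₂ ≼ p₂ ⊕ s₂) ⇛ (o₀ ≼ r₀ ⊕ t₀) ⇛ (p ≐ b₁ ⊕ b₂) ⇛ (r ≐ e₁ ⊕ e₂) ⇛ (b₁ ≼ κ 1) ⇛ (b₂ ≼ κ 1) ⇛ (e₁ ≼ κ 1) ⇛ (e₂ ≼ κ 1) ⇛ (p₂ ≼ κ 2) ⇛ (r₀ ≼ κ 1) ⇛ (s ⊕ t ⊕ h ≼ κ 2 ⊕ m) ⇛ (s₂ ⊕ t₀ ⊕ κ 2 ≼ κ 1 ⊕ m) ⇛ ⊢ (ff)))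
            m+h 3+l eq (deg _) (deg-in _) (deg-out _) (indeg-split _) (outdeg-split _) (indeg-split _) (outdeg-split _) inQ-first outQ-last
            (bit≤1 (A (q 1) (q 0))) (bit≤1 (A (q 2) (q 0))) (bit≤1 (A (q last) (q l))) (bit≤1 (A (q last) (q (1 + l)))) in2 outQ-0 ends
            (q2⇒q0-bound t′ ((lin₁ (2 ∷ 2 ∷ 2 ∷ 1 ∷ 2 ∷ 0 ∷ 2 ∷ 0 ∷ 1 ∷ 1 ∷ 0 ∷ []) (indeg A (q 2) ∷ inQ (q 2) ∷ inC C (q 2) ∷ N ∷ m ∷ h ∷ l ∷ []) (λ i p s N m h l → (m ⊕ h ≐ κ 1 ⊕ N) ⇛ (h ≼ m) ⇛ (κ 3 ⊕ l ≐ h) ⇛ (κ 1 ≐ l) ⇛ (N ≼ 2 ⊛ i ⊕ κ 1) ⇛ (i ≼ p ⊕ s) ⇛ (p ≼ κ 2) ⇛ ⊢ (κ 1 ≼ s))) m+h h≤m 3+l eq (deg-in _) (indeg-split _) in2))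
            where
            in2 : inQ (q 2) ≤ 2
            in2 = inQ-bound 1 1 (trans (cong (3 +_) eq) 3+l)
        by 0 eq = three (bool-cases (A (q 2) (q 0)))
          where
          h3 : h ≡ 3
          h3 = trans (sym 3+l) (cong (3 +_) (sym eq))
          m≡ : 2 + m ≡ N
          m≡ = (lin₂ (1 ∷ 0 ∷ 1 ∷ 1 ∷ 0 ∷ []) (1 ∷ 1 ∷ 0 ∷ 0 ∷ 1 ∷ []) (m ∷ h ∷ N ∷ []) (λ m h N → (m ⊕ h ≐ κ 1 ⊕ N) ⇛ (h ≐ κ 3) ⇛ ⊢ (κ 2 ⊕ m ≐ N))) m+h h3
          last≡ : q last ≡ q 2
          last≡ = cong (λ z → q (2 + z)) (sym eq)
          d₁ = bit (A (q 2) (q 1))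
          out2 : outQ (q 2) ≡ b₂ + d₁
          out2 = subst (λ v → outQ v ≡ bit (A v (q 0)) + bit (A v (q 1))) last≡ (subst (λ z → outQ (q last) ≡ bit (A (q last) (q z)) + bit (A (q last) (q (1 + z)))) (sym eq) outQ-last)
          ends3 : inC C (q 0) + outC C (q 2) + h ≤ 2 + m
          ends3 = subst (λ v → inC C (q 0) + outC C v + h ≤ 2 + m) last≡ ends
          in2 : inQ (q 2) ≤ 1
          in2 = subst (λ v → inQ v ≤ 1) last≡ inQ-last
          s2 : 1 ≤ inC C (q 2)
          s2 = subst (λ v → 1 ≤ inC C v) last≡ some-S-last
          q2<h : 2 < h
          q2<h = 3≤h
          q1<h : 1 < h
          q1<h = 2≤h
          q0<h : 0 < h
          q0<h = <⇒≤ 2≤h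

          three : _ → ⊥
          three (inj₁ t₂₀) = go (bool-cases (A (q 2) (q 1))) (bool-cases (A (q 1) (q 0)))
            where
            short : inC C (q 2) + outC C (q 0) + 2 ≤ suc m
            short = q2⇒q0-bound t₂₀ s2
            few : b₁ + d₁ ≤ 1 → ⊥
            few le = (lin₁ (1 ∷ 1 ∷ 1 ∷ 1 ∷ 1 ∷ 2 ∷ 1 ∷ 0 ∷ 1 ∷ 0 ∷ 1 ∷ 1 ∷ 1 ∷ 1 ∷ 1 ∷ 1 ∷ 0 ∷ 1 ∷ 2 ∷ 0 ∷ []) (indeg A (q 0) ∷ outdeg A (q 2) ∷ indeg A (q 2) ∷ outdeg A (q 0) ∷ inQ (q 0) ∷ outQ (q 2) ∷ inC C (q 0) ∷ outC C (q 2) ∷ inQ (q 2) ∷ outQ (q 0) ∷ inC C (q 2) ∷ outC C (q 0) ∷ b₁ ∷ b₂ ∷ d₁ ∷ N ∷ m ∷ h ∷ []) (λ i o i₂ o₀ p r s t p₂ r₀ s₂ t₀ b₁ b₂ d₁ N m h → (κ 2 ⊕ m ≐ N) ⇛ (h ≐ κ 3) ⇛ (N ≼ i ⊕ o₀) ⇛ (N ≼ i₂ ⊕ o) ⇛ (i ≼ p ⊕ s) ⇛ (o ≼ r ⊕ t) ⇛ (i₂ ≼ p₂ ⊕ s₂) ⇛ (o₀ ≼ r₀ ⊕ t₀) ⇛ (p ≐ b₁ ⊕ b₂) ⇛ (r ≐ b₂ ⊕ d₁) ⇛ (b₂ ≼ κ 1) ⇛ (b₁ ⊕ d₁ ≼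 κ 1) ⇛ (p₂ ≼ κ 1) ⇛ (r₀ ≼ κ 1) ⇛ (s ⊕ t ⊕ h ≼ κ 2 ⊕ m) ⇛ (s₂ ⊕ t₀ ⊕ κ 2 ≼ κ 1 ⊕ m) ⇛ ⊢ (ff)))
              m≡ h3 (deg _) (deg _) (indeg-split _) (outdeg-split _) (indeg-split _) (outdeg-split _) inQ-first out2 (bit≤1 (A (q 2) (q 0))) le in2 outQ-0 ends3 short
            go : _ → _ → ⊥
            go (inj₂ f) _ = few ((lin₁ (1 ∷ 1 ∷ 0 ∷ 1 ∷ []) (b₁ ∷ d₁ ∷ []) (λ b₁ d₁ → (b₁ ≼ κ 1) ⇛ (d₁ ≐ κ 0) ⇛ ⊢ (b₁ ⊕ d₁ ≼ κ 1))) (bit≤1 (A (q 1) (q 0))) (bit-false f))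
            go (inj₁ _) (inj₂ f) = few ((lin₁ (1 ∷ 1 ∷ 0 ∷ 1 ∷ []) (b₁ ∷ d₁ ∷ []) (λ b₁ d₁ → (d₁ ≼ κ 1) ⇛ (b₁ ≐ κ 0) ⇛ ⊢ (b₁ ⊕ d₁ ≼ κ 1))) (bit≤1 (A (q 2) (q 1))) (bit-false f))
            go (inj₁ t₂₁) (inj₁ t₁₀) = (lin₁ (2 ∷ 2 ∷ 2 ∷ 2 ∷ 2 ∷ 1 ∷ 1 ∷ 2 ∷ 0 ∷ []) (indeg A (q 2) ∷ outdeg A (q 0) ∷ inQ (q 2) ∷ outQ (q 0) ∷ inC C (q 2) ∷ outC C (q 0) ∷ N ∷ m ∷ []) (λ i o p r s t N m → (κ 2 ⊕ m ≐ N) ⇛ (N ≼ 2 ⊛ i ⊕ κ 1) ⇛ (N ≼ 2 ⊛ o ⊕ κ 1) ⇛ (i ≼ p ⊕ s) ⇛ (o ≼ r ⊕ t) ⇛ (p ≼ κ 1) ⇛ (r ≼ κ 1) ⇛ (s ⊕ t ⊕ κ 3 ≼ κ 1 ⊕ m) ⇛ ⊢ (ff)))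
                m≡ (deg-in _) (deg-out _) (indeg-split _) (outdeg-split _) in2 outQ-0 backward
              where
              P₂ P₃ : List V
              P₂ = q 2 ∷ q 0 ∷ []
              P₃ = q 2 ∷ q 1 ∷ q 0 ∷ []
              P₂⊆ : ∀ {v} → v ∈ P₂ → v ∈ Q
              P₂⊆ (here refl) = q-∈ 2 q2<h
              P₂⊆ (there (here refl)) = q-∈ 0 q0<h
              P₃⊆ : ∀ {v} → v ∈ P₃ → v ∈ Q
              P₃⊆ (here refl) = q-∈ 2 q2<h
              P₃⊆ (there (here refl)) = q-∈ 1 q1<h
              P₃⊆ (there (there (here refl))) = q-∈ 0 q0<h
              u₂ : Unique P₂
              u₂ = ∷-unique (∉-∷ (loop-free t₂₀) ∉-[]) (∷-unique ∉-[] [])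
              u₃ : Unique P₃
              u₃ = ∷-unique (∉-∷ (loop-free t₂₁) (∉-∷ (loop-free t₂₀) ∉-[])) (∷-unique (∉-∷ (loop-free t₁₀) ∉-[]) (∷-unique ∉-[] []))
              p₂ : Path (q 2) P₂ (q 0)
              p₂ a b = a , t₂₀ , b
              p₃ : Path (q 2) P₃ (q 0)
              p₃ a b = a , t₂₁ , t₁₀ , b
              module S₂ = Sub C P₂ (λ k v∈ → offQ k (P₂⊆ v∈)) u₂ {q 2} {q 0} (λ {a} {b} → p₂ {a} {b})
              module S₃ = Sub C P₃ (λ k v∈ → offQ k (P₃⊆ v∈)) u₃ {q 2} {q 0} (λ {a} {b} → p₃ {a} {b})
              -- The path q₂ q₁ q₀ excludes the distances 2 and 3, and the shorter path q₂ q₀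
              -- excludes distance 1, so the loss of `bound-full` is avoided.
              backward : inC C (q 2) + outC C (q 0) + 3 ≤ suc m
              backward = Gap.bound {m} {3} {S₃.s} {S₃.t} S₃.s-per S₃.t-per apart₃ (s≤s z≤n) s2 some-T0
                where
                apart₃ : ∀ i j → 1 ≤ j → j ≤ 3 → j ≤ m → S₃.s i ≡ true → S₃.t (j + i) ≡ true → ⊥
                apart₃ i 1 _ _ _ = S₂.apart 3≤h i 1 ≤-refl (s≤s z≤n) (<⇒≤ 2≤m)
                apart₃ i (suc (suc j)) _ le _ = S₃.apart-full (sym h3) i (2 + j) (s≤s (s≤s z≤n)) (subst (2 + j ≤_) (sym h3) le) (≤-trans (subst (2 + j ≤_) (sym h3) le) h≤m)
          three (inj₂ f₂₀) = go (bool-cases (A (q 2) (q 1))) (bool-cases (A (q 1) (q 0)))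
            where
            few : b₁ + d₁ ≤ 1 → ⊥
            few le = (lin₁ (2 ∷ 2 ∷ 4 ∷ 0 ∷ 2 ∷ 0 ∷ 2 ∷ 0 ∷ 2 ∷ 2 ∷ 1 ∷ 1 ∷ 0 ∷ 2 ∷ 2 ∷ 0 ∷ []) (indeg A (q 0) ∷ outdeg A (q 2) ∷ inQ (q 0) ∷ outQ (q 2) ∷ inC C (q 0) ∷ outC C (q 2) ∷ b₁ ∷ b₂ ∷ d₁ ∷ N ∷ m ∷ h ∷ []) (λ i o p r s t b₁ b₂ d₁ N m h → (κ 2 ⊕ m ≐ N) ⇛ (h ≐ κ 3) ⇛ (N ≼ 2 ⊛ i ⊕ κ 1) ⇛ (N ≼ 2 ⊛ o ⊕ κ 1) ⇛ (i ≼ p ⊕ s) ⇛ (o ≼ r ⊕ t) ⇛ (p ≐ b₁ ⊕ b₂) ⇛ (r ≐ b₂ ⊕ d₁) ⇛ (b₂ ≐ κ 0) ⇛ (b₁ ⊕ d₁ ≼ κ 1) ⇛ (s ⊕ t ⊕ h ≼ κ 2 ⊕ m) ⇛ ⊢ (ff)))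
              m≡ h3 (deg-in _) (deg-out _) (indeg-split _) (outdeg-split _) inQ-first out2 (bit-false f₂₀) le ends3
            ends-sum : indeg A (q 0) + outdeg A (q 2) + 1 ≤ N
            ends-sum = (lin₁ (1 ∷ 1 ∷ 1 ∷ 1 ∷ 2 ∷ 0 ∷ 1 ∷ 0 ∷ 1 ∷ 0 ∷ 1 ∷ 1 ∷ 0 ∷ 1 ∷ 1 ∷ 0 ∷ []) (indeg A (q 0) ∷ outdeg A (q 2) ∷ inQ (q 0) ∷ outQ (q 2) ∷ inC C (q 0) ∷ outC C (q 2) ∷ b₁ ∷ b₂ ∷ d₁ ∷ N ∷ m ∷ h ∷ []) (λ i o p r s t b₁ b₂ d₁ N m h → (κ 2 ⊕ m ≐ N) ⇛ (h ≐ κ 3) ⇛ (i ≼ p ⊕ s) ⇛ (o ≼ r ⊕ t) ⇛ (p ≐ b₁ ⊕ b₂) ⇛ (r ≐ b₂ ⊕ d₁) ⇛ (b₂ ≐ κ 0) ⇛ (b₁ ≼ κ 1) ⇛ (d₁ ≼ κ 1) ⇛ (s ⊕ t ⊕ h ≼ κ 2 ⊕ m) ⇛ ⊢ (i ⊕ o ⊕ κ 1 ≼ N)))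
              m≡ h3 (indeg-split _) (outdeg-split _) inQ-first out2 (bit-false f₂₀) (bit≤1 (A (q 1) (q 0))) (bit≤1 (A (q 2) (q 1))) ends3
            in1 : inQ (q 1) ≤ 2
            in1 = inQ-bound 0 1 (sym h3)
            out1 : outQ (q 1) ≤ 2
            out1 = outQ-bound 1 0 (sym h3)
            go : _ → _ → ⊥
            go (inj₂ f) _ = few ((lin₁ (1 ∷ 1 ∷ 0 ∷ 1 ∷ []) (b₁ ∷ d₁ ∷ []) (λ b₁ d₁ → (b₁ ≼ κ 1) ⇛ (d₁ ≐ κ 0) ⇛ ⊢ (b₁ ⊕ d₁ ≼ κ 1))) (bit≤1 (A (q 1) (q 0))) (bit-false f))
            go (inj₁ _) (inj₂ f) = few ((lin₁ (1 ∷ 1 ∷ 0 ∷ 1 ∷ []) (b₁ ∷ d₁ ∷ []) (λ b₁ d₁ → (d₁ ≼ κ 1) ⇛ (b₁ ≐ κ 0) ⇛ ⊢ (b₁ ⊕ d₁ ≼ κ 1))) (bit≤1 (A (q 2) (q 1))) (bit-false f))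
            go (inj₁ t₂₁) (inj₁ t₁₀) = (lin₁ (2 ∷ 2 ∷ 2 ∷ 2 ∷ 2 ∷ 1 ∷ 2 ∷ 1 ∷ 2 ∷ 2 ∷ 2 ∷ 0 ∷ []) (indeg A (q 2) ∷ outdeg A (q 1) ∷ indeg A (q 0) ∷ outdeg A (q 2) ∷ indeg A (q 1) ∷ inQ (q 2) ∷ outQ (q 1) ∷ inC C (q 2) ∷ outC C (q 1) ∷ N ∷ m ∷ []) (λ i o i₀ o₂ i₁ p r s t N m → (κ 2 ⊕ m ≐ N) ⇛ (N ≼ i ⊕ o₂) ⇛ (N ≼ i₁ ⊕ o) ⇛ (2 ⊛ i₁ ⊕ κ 1 ≼ N) ⇛ (i₀ ⊕ o₂ ⊕ κ 1 ≼ N) ⇛ (N ≼ 2 ⊛ i₀ ⊕ κ 1) ⇛ (i ≼ p ⊕ s) ⇛ (o ≼ r ⊕ t) ⇛ (p ≼ κ 1) ⇛ (r ≼ κ 2) ⇛ (s ⊕ t ⊕ κ 2 ≼ κ 1 ⊕ m) ⇛ ⊢ (ff)))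
                m≡ (deg _) (deg _) small-in ends-sum (deg-in _) (indeg-split _) (outdeg-split _) in2 out1
                (chord-bound 3≤h h≤m 2 1 q2<h q1<h t₂₁ s2 T1)
              where
              -- A small in-degree of q₁ forces a large out-degree, which the arc q₂ → q₁ then
              -- contradicts.
              small-in : 2 * indeg A (q 1) + 1 ≤ N
              small-in = sub (inC C (q 1) ≟ 0)
                where
                sub : Dec (inC C (q 1) ≡ 0) → 2 * indeg A (q 1) + 1 ≤ N
                sub (yes e) = (lin₁ (1 ∷ 2 ∷ 0 ∷ 2 ∷ 2 ∷ 1 ∷ 0 ∷ 1 ∷ 1 ∷ 0 ∷ []) (indeg A (q 1) ∷ inQ (q 1) ∷ inC C (q 1) ∷ N ∷ m ∷ h ∷ []) (λ i p s N m h → (κ 2 ⊕ m ≐ N) ⇛ (h ≐ κ 3) ⇛ (h ≼ m) ⇛ (i ≼ p ⊕ s) ⇛ (p ≼ κ 2) ⇛ (s ≐ κ 0) ⇛ ⊢ (2 ⊛ i ⊕ κ 1 ≼ N))) m≡ h3 h≤m (indeg-split _) in1 e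
                sub (no ne) = (lin₁ (1 ∷ 2 ∷ 2 ∷ 2 ∷ 2 ∷ 2 ∷ 1 ∷ 2 ∷ 2 ∷ 2 ∷ 0 ∷ []) (indeg A (q 1) ∷ outdeg A (q 0) ∷ indeg A (q 0) ∷ outdeg A (q 2) ∷ inQ (q 1) ∷ outQ (q 0) ∷ inC C (q 1) ∷ outC C (q 0) ∷ N ∷ m ∷ []) (λ i o i₀ o₂ p r s t N m → (κ 2 ⊕ m ≐ N) ⇛ (N ≼ i₀ ⊕ o) ⇛ (i₀ ⊕ o₂ ⊕ κ 1 ≼ N) ⇛ (N ≼ 2 ⊛ o₂ ⊕ κ 1) ⇛ (i ≼ p ⊕ s) ⇛ (o ≼ r ⊕ t) ⇛ (p ≼ κ 2) ⇛ (r ≼ κ 1) ⇛ (s ⊕ t ⊕ κ 2 ≼ κ 1 ⊕ m) ⇛ ⊢ (2 ⊛ i ⊕ κ 1 ≼ N)))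
                  m≡ (deg _) ends-sum (deg-out _) (indeg-split _) (outdeg-split _) in1 outQ-0 (chord-bound 3≤h h≤m 1 0 q1<h q0<h t₁₀ (n≢0⇒n>0 ne) some-T0)
              T1 : 1 ≤ outC C (q 1)
              T1 = (lin₁ (2 ∷ 2 ∷ 2 ∷ 1 ∷ 2 ∷ 1 ∷ 0 ∷ 1 ∷ 1 ∷ 0 ∷ []) (indeg A (q 1) ∷ outdeg A (q 1) ∷ outQ (q 1) ∷ outC C (q 1) ∷ N ∷ m ∷ h ∷ []) (λ i₁ o r t N m h → (κ 2 ⊕ m ≐ N) ⇛ (h ≐ κ 3) ⇛ (h ≼ m) ⇛ (N ≼ i₁ ⊕ o) ⇛ (2 ⊛ i₁ ⊕ κ 1 ≼ N) ⇛ (o ≼ r ⊕ t) ⇛ (r ≼ κ 2) ⇛ ⊢ (κ 1 ≼ t)))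
                m≡ h3 h≤m (deg _) small-in (outdeg-split _) out1

  hamiltonian-absurd : ∀ (C : Cyc m) Q → length Q ≡ h → Unique Q → OffL C Q → Walk (c C 0) Q (c C 1) → ⊥
  hamiltonian-absurd C Q len uQ offQ w = go (h ≤? m) (3 ≤? h)
    where
    open Hamiltonian C Q len uQ offQ w
    go : Dec (h ≤ m) → Dec (3 ≤ h) → ⊥
    go (no h≰m) _ = Long.absurd (≰⇒> h≰m)
    go (yes h≤m) (yes 3≤h) = Short.absurd 3≤h h≤m
    go (yes h≤m) (no 3≰h) = pair Q len uQ offQ w
      where
      h2 : h ≡ 2
      h2 = ≤-antisym (s≤s⁻¹ (≰⇒> 3≰h)) 2≤h
      N≡ : N ≡ suc m
      N≡ = (lin₂ (1 ∷ 1 ∷ 0 ∷ 0 ∷ 1 ∷ []) (1 ∷ 0 ∷ 1 ∷ 1 ∷ 0 ∷ []) (m ∷ h ∷ N ∷ []) (λ m h N → (m ⊕ h ≐ κ 1 ⊕ N) ⇛ (h ≐ κ 2) ⇛ ⊢ (N ≐ κ 1 ⊕ m))) m+h h2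
      module K = Configuration A S m N≡
      pair : ∀ Q → length Q ≡ h → Unique Q → OffL C Q → Walk (c C 0) Q (c C 1) → ⊥
      pair [] e _ _ _ = case trans e h2 of λ ()
      pair (x ∷ []) e _ _ _ = case trans e h2 of λ ()
      pair (x ∷ y ∷ z ∷ Q) e _ _ _ = case trans e h2 of λ ()
      pair (x ∷ y ∷ []) e u off (a , _ , b) = HamiltonTwo.hamilton-two A S m N≡
        record { C = C ; x = x ; y = y ; x∉ = λ i e → off i (here e) ; y∉ = λ i e → off i (there (here e)) ; x≢y = λ e → unique-∉ u (here e) }
        (0 , inj₁ (a , b))

-- A path spanning the vertices off C

module SpanningPath {N : ℕ} (A : Digraph (Fin (suc N))) (S : Counterexample A) (m : ℕ) (2≤m : 2 ≤ m) (m<N : suc m ≤ N)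
  (longest : ∀ k → m < k → k ≤ N → Graph.Cycles.Cyc A k → ⊥) where

  open Graph
  open Cycles A
  open Setup.Structures A
  open Counterexample S

  -- The detour is longer than C. Either its length is at most N, against the choice of C, or Q
  -- contains all vertices off C and j = 1, which is the Hamiltonian case.
  gap-apart : ∀ (C : Cyc m) Q {u v} → Path u Q v → Unique Q → OffL C Q → m + length Q ≤ suc N →
    ∀ i j → 1 ≤ j → j ≤ length Q → j ≤ m → A (c C i) u ≡ true → A v (c C (j + i)) ≡ true → ⊥
  gap-apart C Q path uQ offQ m+Q i j 1≤j j≤Q j≤m a b = go (m≤n⇒∃[o]m+o≡n j≤m)
    where
    go : (∃ λ r → j + r ≡ m) → ⊥
    go (r , j+r) = cases (suc r + length Q ≤? N)
      where
      cases : Dec (suc r + length Q ≤ N) → ⊥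
      cases (yes le) = longest _ ((lin₁ (1 ∷ 1 ∷ 0 ∷ 1 ∷ []) (r ∷ j ∷ length Q ∷ m ∷ []) (λ r j q m → (j ⊕ r ≐ m) ⇛ (j ≼ q) ⇛ ⊢ (κ 1 ⊕ m ≼ κ 1 ⊕ r ⊕ q))) j+r j≤Q) le
        (Detour.detour (rot i C) j r j+r 1≤j Q (path a b) uQ (λ k _ → offQ (k + j + i)) refl)
      cases (no ≰) = Hamilton.hamiltonian-absurd A S m (length Q) full 2≤m
          ((lin₁ (1 ∷ 1 ∷ 0 ∷ 1 ∷ []) (length Q ∷ m ∷ N ∷ []) (λ q m N → (m ⊕ q ≐ κ 1 ⊕ N) ⇛ (κ 1 ⊕ m ≼ N) ⇛ ⊢ (κ 2 ≼ q))) full m<N) longest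
          (rot i C) Q refl uQ (λ k → offQ (k + i)) (path a (subst (λ z → _ ⇒ c C (z + i)) j≡1 b))
        where
        full : m + length Q ≡ suc N
        full = (lin₂ (1 ∷ 0 ∷ 1 ∷ 0 ∷ 0 ∷ 0 ∷ []) (1 ∷ 1 ∷ 0 ∷ 1 ∷ 1 ∷ 0 ∷ []) (r ∷ j ∷ length Q ∷ m ∷ N ∷ []) (λ r j q m N → (j ⊕ r ≐ m) ⇛ (κ 1 ≼ j) ⇛ (m ⊕ q ≼ κ 1 ⊕ N) ⇛ (κ 1 ⊕ N ≼ κ 1 ⊕ r ⊕ q) ⇛ ⊢ (m ⊕ q ≐ κ 1 ⊕ N))) j+r 1≤j m+Q (≰⇒> ≰)
        j≡1 : j ≡ 1
        j≡1 = (lin₂ (1 ∷ 1 ∷ 1 ∷ 0 ∷ 1 ∷ 0 ∷ []) (1 ∷ 0 ∷ 0 ∷ 1 ∷ 0 ∷ 0 ∷ []) (r ∷ j ∷ length Q ∷ m ∷ N ∷ []) (λ r j q m N → (j ⊕ r ≐ m) ⇛ (κ 1 ≼ j) ⇛ (m ⊕ q ≼ κ 1 ⊕ N) ⇛ (κ 1 ⊕ N ≼ κ 1 ⊕ r ⊕ q) ⇛ ⊢ (j ≐ κ 1))) j+r 1≤j m+Q (≰⇒> ≰)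

  gap-bound : ∀ (C : Cyc m) Q {u v} → Path u Q v → Unique Q → OffL C Q → m + length Q ≤ suc N → 1 ≤ length Q →
    1 ≤ inC C u → 1 ≤ outC C v → inC C u + outC C v + length Q ≤ suc m
  gap-bound C Q {u} {v} path uQ offQ m+Q = Gap.bound {m} {length Q} {λ i → A (c C i) u} {λ i → A v (c C i)}
    (λ i → cong (λ z → A z u) (per C i)) (λ i → cong (A v) (per C i)) (gap-apart C Q path uQ offQ m+Q)

  -- If j is the last true position, all true positions lie in 1, ..., j.
  max-true : ∀ f l → f 0 ≡ false → 1 ≤ # f (suc l) → ∃ λ j → j ≤ l × f j ≡ true × # f (suc l) ≤ j
  max-true f zero e le = ⊥-elim (<⇒≱ le (≤-reflexive (cong (λ z → bit z + 0) e)))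
  max-true f (suc l) e le = go (bool-cases (f (suc l)))
    where
    go : _ → ∃ λ j → j ≤ suc l × f j ≡ true × # f (2 + l) ≤ j
    go (inj₁ t) = suc l , ≤-refl , t , subst (λ z → z + # (f ∘ suc) (suc l) ≤ suc l) (sym (bit-false e)) (#≤ (f ∘ suc) (suc l))
    go (inj₂ t) = let eq = trans (#-snoc f (suc l)) (trans (cong (# f (suc l) +_) (bit-false t)) (+-identityʳ _))
                      j , le′ , p , q = max-true f l e (subst (1 ≤_) eq le) in j , m≤n⇒m≤1+n le′ , p , subst (_≤ j) (sym eq) q

  min-true : ∀ f l → f l ≡ false → 1 ≤ # f (suc l) → ∃ λ i → i ≤ l × f i ≡ true × # f (suc l) + i ≤ l
  min-true f zero e le = ⊥-elim (<⇒≱ le (≤-reflexive (cong (λ z → bit z + 0) e)))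
  min-true f (suc l) e le = go (bool-cases (f 0))
    where
    go : _ → ∃ λ i → i ≤ suc l × f i ≡ true × # f (2 + l) + i ≤ suc l
    go (inj₁ t) = 0 , z≤n , t , ((lin₁ (1 ∷ 1 ∷ 1 ∷ 0 ∷ 1 ∷ 0 ∷ []) (# f (2 + l) ∷ # f (suc l) ∷ bit (f (suc l)) ∷ l ∷ []) (λ n n′ d l → (n ≐ n′ ⊕ d) ⇛ (d ≐ κ 0) ⇛ (n′ ≼ κ 1 ⊕ l) ⇛ ⊢ (n ⊕ κ 0 ≼ κ 1 ⊕ l)))
      (#-snoc f (suc l)) (bit-false e) (#≤ f (suc l)))
    go (inj₂ t) = let eq = cong (_+ # (f ∘ suc) (suc l)) (bit-false t)
                      i , le′ , p , q = min-true (f ∘ suc) l e (subst (1 ≤_) eq le)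
      in suc i , s≤s le′ , p , subst (λ z → z + suc i ≤ suc l) (sym eq) (subst (_≤ suc l) (sym (+-suc _ i)) (s≤s q))

  module PathFacts (C : Cyc m) (l : ℕ) (P : FPath C l) (size : m + suc l ≤ suc N)
    (in-closed : ∀ u → u ⇒ FPath.q P 0 → u ∈ applyUpTo (c C) m ++ FPath.whole P)
    (out-closed : ∀ u → FPath.q P l ⇒ u → u ∈ applyUpTo (c C) m ++ FPath.whole P) where
    open FPath P

    indeg-first : indeg A (q 0) ≤ inC C (q 0) + inP (q 0)
    indeg-first = ≤-trans (indeg≤ (q 0) _ in-closed) (≤-reflexive (trans (cnt-++ _ (applyUpTo (c C) m) whole)
      (cong₂ _+_ (cnt-applyUpTo (λ u → A u (q 0)) (c C) m) (cnt-applyUpTo (λ u → A u (q 0)) q (suc l)))))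

    outdeg-last : outdeg A (q l) ≤ outC C (q l) + outP (q l)
    outdeg-last = ≤-trans (outdeg≤ (q l) _ out-closed) (≤-reflexive (trans (cnt-++ _ (applyUpTo (c C) m) whole)
      (cong₂ _+_ (cnt-applyUpTo (A (q l)) (c C) m) (cnt-applyUpTo (A (q l)) q (suc l)))))

    inP-first : inP (q 0) ≤ l
    inP-first = (lin₁ (1 ∷ 1 ∷ 1 ∷ 0 ∷ 1 ∷ 0 ∷ []) (inP (q 0) ∷ bit (A (q 0) (q 0)) ∷ # (λ i → A (q (suc i)) (q 0)) l ∷ l ∷ []) (λ t a z l → (t ≐ a ⊕ z) ⇛ (a ≐ κ 0) ⇛ (z ≼ l) ⇛ ⊢ (t ≼ l)))
      refl (bit-false (loopless _)) (#≤ _ l)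

    outP-last : outP (q l) ≤ l
    outP-last = (lin₁ (1 ∷ 1 ∷ 1 ∷ 0 ∷ 1 ∷ 0 ∷ []) (outP (q l) ∷ bit (A (q l) (q l)) ∷ # (λ i → A (q l) (q i)) l ∷ l ∷ []) (λ t a z l → (t ≐ z ⊕ a) ⇛ (a ≐ κ 0) ⇛ (z ≼ l) ⇛ ⊢ (t ≼ l)))
      (#-snoc (λ i → A (q l) (q i)) l) (bit-false (loopless _)) (#≤ _ l)

    closing-in : ∀ j → j ≤ l → q j ⇒ q 0 → Cyc (suc j)
    closing-in j le a = close (q 0) (applyUpTo (q ∘ suc) j) (cong suc (length-applyUpTo (q ∘ suc) j))
      (walk-arcs q j (λ i lt → q-arc i (≤-trans lt le)) a)
      (seg-unique q (suc j) λ i k lt lt′ → q-inj i k (≤-trans (s≤s⁻¹ lt) le) (≤-trans (s≤s⁻¹ lt′) le))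

    closing-out : ∀ i o → i + o ≡ l → q l ⇒ q i → Cyc (suc o)
    closing-out i o e a = close (q (0 + i)) (applyUpTo (λ t → q (suc t + i)) o) (cong suc (length-applyUpTo _ o))
      (walk-arcs (λ t → q (t + i)) o (λ t lt → q-arc (t + i) ((lin₁ (1 ∷ 1 ∷ 1 ∷ 0 ∷ []) (t ∷ i ∷ o ∷ l ∷ []) (λ t i o l → (i ⊕ o ≐ l) ⇛ (κ 1 ⊕ t ≼ o) ⇛ ⊢ (κ 1 ⊕ (t ⊕ i) ≼ l))) e lt)) (subst (λ z → q z ⇒ q i) (trans (sym e) (+-comm i o)) a))
      (seg-unique (λ t → q (t + i)) (suc o) λ t u lt lt′ eq → +-cancelʳ-≡ i t u
        (q-inj _ _ ((lin₁ (1 ∷ 1 ∷ 1 ∷ 0 ∷ []) (t ∷ i ∷ o ∷ l ∷ []) (λ t i o l → (i ⊕ o ≐ l) ⇛ (κ 1 ⊕ t ≼ κ 1 ⊕ o) ⇛ ⊢ (t ⊕ i ≼ l))) e lt) ((lin₁ (1 ∷ 1 ∷ 1 ∷ 0 ∷ []) (u ∷ i ∷ o ∷ l ∷ []) (λ t i o l → (i ⊕ o ≐ l) ⇛ (κ 1 ⊕ t ≼ κ 1 ⊕ o) ⇛ ⊢ (t ⊕ i ≼ l))) e lt′) eq))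

    suc-l≤N : suc l ≤ N
    suc-l≤N = (lin₁ (1 ∷ 1 ∷ 1 ∷ []) (m ∷ l ∷ N ∷ []) (λ m l N → (m ⊕ (κ 1 ⊕ l) ≼ κ 1 ⊕ N) ⇛ (κ 2 ≼ m) ⇛ ⊢ (κ 1 ⊕ l ≼ N))) size 2≤m

    -- All in-neighbours of q₀ lie on the path, and the last of them closes a cycle with more than
    -- id(q₀) vertices, hence with at most m.
    no-in : inC C (q 0) ≡ 0 → indeg A (q 0) + 1 ≤ m
    no-in e = go (max-true (λ j → A (q j) (q 0)) l (loopless _) ((lin₁ (2 ∷ 2 ∷ 0 ∷ 2 ∷ 1 ∷ 1 ∷ []) (indeg A (q 0) ∷ inC C (q 0) ∷ inP (q 0) ∷ N ∷ []) (λ i s p N → (κ 4 ≼ N) ⇛ (N ≼ 2 ⊛ i ⊕ κ 1) ⇛ (i ≼ s ⊕ p) ⇛ (s ≐ κ 0) ⇛ ⊢ (κ 1 ≼ p))) order (deg-in _) indeg-first e))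
      where
      go : (∃ λ j → j ≤ l × q j ⇒ q 0 × inP (q 0) ≤ j) → _
      go (j , le , a , big) = (lin₁ (1 ∷ 1 ∷ 1 ∷ 1 ∷ 0 ∷ 1 ∷ []) (indeg A (q 0) ∷ inC C (q 0) ∷ inP (q 0) ∷ j ∷ m ∷ []) (λ i s p j m → (i ≼ s ⊕ p) ⇛ (s ≐ κ 0) ⇛ (p ≼ j) ⇛ (κ 1 ⊕ j ≼ m) ⇛ ⊢ (i ⊕ κ 1 ≼ m)))
        indeg-first e big (≮⇒≥ λ lt → longest (suc j) lt (≤-trans (s≤s le) suc-l≤N) (closing-in j le a))

    no-out : outC C (q l) ≡ 0 → outdeg A (q l) + 1 ≤ m
    no-out e = go (min-true (λ i → A (q l) (q i)) l (loopless _) ((lin₁ (2 ∷ 2 ∷ 0 ∷ 2 ∷ 1 ∷ 1 ∷ []) (outdeg A (q l) ∷ outC C (q l) ∷ outP (q l) ∷ N ∷ []) (λ i s p N → (κ 4 ≼ N) ⇛ (N ≼ 2 ⊛ i ⊕ κ 1) ⇛ (i ≼ s ⊕ p) ⇛ (s ≐ κ 0) ⇛ ⊢ (κ 1 ≼ p))) order (deg-out _) outdeg-last e))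
      where
      go : (∃ λ i → i ≤ l × q l ⇒ q i × outP (q l) + i ≤ l) → _
      go (i , le , a , big) = fin (m≤n⇒∃[o]m+o≡n le)
        where
        fin : (∃ λ o → i + o ≡ l) → outdeg A (q l) + 1 ≤ m
        fin (o , eq) = (lin₁ (1 ∷ 1 ∷ 0 ∷ 1 ∷ 1 ∷ 1 ∷ 0 ∷ 1 ∷ []) (outdeg A (q l) ∷ outC C (q l) ∷ outP (q l) ∷ i ∷ o ∷ l ∷ m ∷ []) (λ d s p i o l m → (d ≼ s ⊕ p) ⇛ (s ≐ κ 0) ⇛ (p ⊕ i ≼ l) ⇛ (i ⊕ o ≐ l) ⇛ (κ 1 ⊕ o ≼ m) ⇛ ⊢ (d ⊕ κ 1 ≼ m)))
          outdeg-last e big eq (≮⇒≥ λ lt → longest (suc o) lt (≤-trans (s≤s (subst (o ≤_) eq (m≤n+m o i))) suc-l≤N) (closing-out i o eq a))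

    sum : 1 ≤ inC C (q 0) → 1 ≤ outC C (q l) → inC C (q 0) + outC C (q l) + suc l ≤ suc m
    sum s t = subst (λ z → inC C (q 0) + outC C (q l) + z ≤ suc m) length-whole
      (gap-bound C whole whole-path whole-unique whole-off (subst (λ z → m + z ≤ suc N) (sym length-whole) size) (subst (1 ≤_) (sym length-whole) (s≤s z≤n)) s t)

    -- Unless both end points have neighbours on C, the degree conditions force m = l + 1.
    closing : 1 ≤ inC C (q 0) → 1 ≤ outC C (q l) → 1 ≤ l → q l ⇒ q 0
    closing s t 1≤l = ¬false λ a → go a (m≤n⇒∃[o]m+o≡n 1≤l)
      where
      go : A (q l) (q 0) ≡ false → (∃ λ k → 1 + k ≡ l) → ⊥
      go a (k , refl) = (lin₁ (2 ∷ 2 ∷ 2 ∷ 0 ∷ 2 ∷ 0 ∷ 2 ∷ 0 ∷ 2 ∷ 0 ∷ 2 ∷ 0 ∷ 2 ∷ 0 ∷ 2 ∷ 2 ∷ 2 ∷ 2 ∷ 1 ∷ 1 ∷ []) (indeg A (q 0) ∷ outdeg A (q l) ∷ inC C (q 0) ∷ inP (q 0) ∷ outC C (q l) ∷ outP (q l) ∷ bit (A (q 0) (q 0)) ∷ # (λ i → A (q (suc i)) (q 0)) k ∷ bit (A (q l) (q 0)) ∷ bit (A (q l) (q 0)) ∷ # (λ i → A (q l) (q (suc i))) k ∷ bit (A (q l) (q l)) ∷ k ∷ m ∷ N ∷ []) (λ i o s p t r p₀ p₁ p₂ r₀ r₁ r₂ k m N → (N ≼ 2 ⊛ i ⊕ κ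 1) ⇛ (N ≼ 2 ⊛ o ⊕ κ 1) ⇛ (i ≼ s ⊕ p) ⇛ (o ≼ t ⊕ r) ⇛ (s ⊕ t ⊕ (κ 1 ⊕ (κ 1 ⊕ k)) ≼ κ 1 ⊕ m) ⇛ (m ⊕ (κ 1 ⊕ (κ 1 ⊕ k)) ≼ κ 1 ⊕ N) ⇛ (p ≐ p₀ ⊕ (p₁ ⊕ p₂)) ⇛ (r ≐ r₀ ⊕ (r₁ ⊕ r₂)) ⇛ (p₀ ≐ κ 0) ⇛ (p₂ ≐ κ 0) ⇛ (r₀ ≐ κ 0) ⇛ (r₂ ≐ κ 0) ⇛ (p₁ ≼ k) ⇛ (r₁ ≼ k) ⇛ ⊢ (ff)))
        (deg-in _) (deg-out _) indeg-first outdeg-last (sum s t) size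
        (cong (bit (A (q 0) (q 0)) +_) (#-snoc (λ i → A (q (suc i)) (q 0)) k))
        (cong (bit (A (q l) (q 0)) +_) (#-snoc (λ i → A (q l) (q (suc i))) k))
        (bit-false (loopless _)) (bit-false a) (bit-false a) (bit-false (loopless _)) (#≤ _ k) (#≤ _ k)

    closed-path : q l ⇒ q 0 → Cyc (suc l)
    closed-path = closing-in l ≤-refl

    closed-at : ∀ a i → i ≤ l → c (closed-path a) i ≡ q i
    closed-at a i le = trans (close-at (q 0) (applyUpTo (q ∘ suc) l) (cong suc (length-applyUpTo (q ∘ suc) l)) _ _ i (s≤s le))
      (at-applyUpTo (q 0) q (suc l) i (s≤s le))

    closed-off : ∀ a i → Off C (c (closed-path a) i)
    closed-off a i k e = q-off (wrap l i) (wrap-≤ l i) k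
      (trans e (trans (wrap-periodic (per (closed-path a)) i) (closed-at a (wrap l i) (wrap-≤ l i))))

  module NonSpanning (C : Cyc m) (l : ℕ) (size : m + suc l ≤ N) (longer : FPath C (suc l) → ⊥) where

    module _ (P : FPath C l) where
      open FPath P

      L : List V
      L = applyUpTo (c C) m ++ whole

      outside : ∀ {z} → z ∉ L → Off C z × (∀ i → i ≤ l → q i ≢ z)
      outside {z} z∉ = off , λ i le e → z∉ (∈-++⁺ʳ (applyUpTo (c C) m) (subst (_∈ whole) e (∈-applyUpTo⁺ q (s≤s le))))
        where
        off : Off C z
        off i e = z∉ (∈-++⁺ˡ (subst (_∈ applyUpTo (c C) m) (trans (sym (cycle-window C i (≤-trans (s≤s z≤n) 2≤m) .proj₂ .proj₂)) e)
          (∈-applyUpTo⁺ (c C) (cycle-window C i (≤-trans (s≤s z≤n) 2≤m) .proj₂ .proj₁))))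

      in-closed : ∀ u → u ⇒ q 0 → u ∈ L
      in-closed z a = go (z ∈? L)
        where
        go : Dec (z ∈ L) → z ∈ L
        go (yes z∈) = z∈
        go (no z∉) = ⊥-elim (longer record { q = q′ ; q-inj = inj′ ; q-arc = arc′ ; q-off = off′ })
          where
          q′ : ℕ → V
          q′ zero = z
          q′ (suc i) = q i
          inj′ : ∀ i j → i ≤ suc l → j ≤ suc l → q′ i ≡ q′ j → i ≡ j
          inj′ zero zero _ _ _ = refl
          inj′ zero (suc j) _ le e = ⊥-elim (proj₂ (outside z∉) j (s≤s⁻¹ le) (sym e))
          inj′ (suc i) zero le _ e = ⊥-elim (proj₂ (outside z∉) i (s≤s⁻¹ le) e)
          inj′ (suc i) (suc j) le le′ e = cong suc (q-inj i j (s≤s⁻¹ le) (s≤s⁻¹ le′) e)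
          arc′ : ∀ i → i < suc l → q′ i ⇒ q′ (suc i)
          arc′ zero _ = a
          arc′ (suc i) lt = q-arc i (s≤s⁻¹ lt)
          off′ : ∀ i → i ≤ suc l → Off C (q′ i)
          off′ zero _ = proj₁ (outside z∉)
          off′ (suc i) le = q-off i (s≤s⁻¹ le)

      out-closed : ∀ u → q l ⇒ u → u ∈ L
      out-closed z a = go (z ∈? L)
        where
        go : Dec (z ∈ L) → z ∈ L
        go (yes z∈) = z∈
        go (no z∉) = ⊥-elim (longer record { q = q′ ; q-inj = inj′ ; q-arc = arc′ ; q-off = off′ })
          where
          q′ : ℕ → V
          -- The default value z of `at` is what index l + 1 returns, so this is the path prolonged
          -- by z.
          q′ i = at z whole i
          q′-old : ∀ i → i ≤ l → q′ i ≡ q i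
          q′-old i le = at-applyUpTo z q (suc l) i (s≤s le)
          q′-new : q′ (suc l) ≡ z
          q′-new = at-past z whole (suc l) (≤-reflexive (length-applyUpTo q (suc l)))
          split : ∀ i → i ≤ suc l → i ≤ l ⊎ i ≡ suc l
          split i le = case i ≤? l of λ { (yes p) → inj₁ p ; (no p) → inj₂ (≤-antisym le (≰⇒> p)) }
          inj′ : ∀ i j → i ≤ suc l → j ≤ suc l → q′ i ≡ q′ j → i ≡ j
          inj′ i j le le′ e = by (split i le) (split j le′)
            where
            by : _ → _ → i ≡ j
            by (inj₁ p) (inj₁ p′) = q-inj i j p p′ (trans (sym (q′-old i p)) (trans e (q′-old j p′)))
            by (inj₁ p) (inj₂ refl) = ⊥-elim (proj₂ (outside z∉) i p (trans (sym (q′-old i p)) (trans e q′-new)))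
            by (inj₂ refl) (inj₁ p) = ⊥-elim (proj₂ (outside z∉) j p (trans (sym (q′-old j p)) (trans (sym e) q′-new)))
            by (inj₂ refl) (inj₂ refl) = refl
          arc′ : ∀ i → i < suc l → q′ i ⇒ q′ (suc i)
          arc′ i (s≤s le) = by (split (suc i) (s≤s le))
            where
            by : _ → q′ i ⇒ q′ (suc i)
            by (inj₁ p) = subst₂ _⇒_ (sym (q′-old i le)) (sym (q′-old (suc i) p)) (q-arc i p)
            by (inj₂ refl) = subst₂ _⇒_ (sym (q′-old l le)) (sym q′-new) a
          off′ : ∀ i → i ≤ suc l → Off C (q′ i)
          off′ i le = by (split i le)
            where
            by : _ → Off C (q′ i)
            by (inj₁ p) k e = q-off i p k (trans e (q′-old i p))
            by (inj₂ refl) k e = proj₁ (outside z∉) k (trans e q′-new)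

      module F = PathFacts C l P (m≤n⇒m≤1+n size) in-closed out-closed

      -- Otherwise id(q₀) is at most l and at most m - 1, so 2 id(q₀) + 1 ≤ m + l < N.
      some-in : 1 ≤ inC C (q 0)
      some-in = n≢0⇒n>0 λ e → (lin₁ (1 ∷ 1 ∷ 0 ∷ 1 ∷ 1 ∷ 1 ∷ 1 ∷ []) (indeg A (q 0) ∷ inC C (q 0) ∷ inP (q 0) ∷ l ∷ m ∷ N ∷ []) (λ i s p l m N → (m ⊕ (κ 1 ⊕ l) ≼ N) ⇛ (N ≼ 2 ⊛ i ⊕ κ 1) ⇛ (i ⊕ κ 1 ≼ m) ⇛ (i ≼ s ⊕ p) ⇛ (s ≐ κ 0) ⇛ (p ≼ l) ⇛ ⊢ (ff))) size (deg-in _) (F.no-in e) F.indeg-first e F.inP-first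

      some-out : 1 ≤ outC C (q l)
      some-out = n≢0⇒n>0 λ e → (lin₁ (1 ∷ 1 ∷ 0 ∷ 1 ∷ 1 ∷ 1 ∷ 1 ∷ []) (outdeg A (q l) ∷ outC C (q l) ∷ outP (q l) ∷ l ∷ m ∷ N ∷ []) (λ i s p l m N → (m ⊕ (κ 1 ⊕ l) ≼ N) ⇛ (N ≼ 2 ⊛ i ⊕ κ 1) ⇛ (i ⊕ κ 1 ≼ m) ⇛ (i ≼ s ⊕ p) ⇛ (s ≐ κ 0) ⇛ (p ≼ l) ⇛ ⊢ (ff))) size (deg-out _) (F.no-out e) F.outdeg-last e F.outP-last

      total : indeg A (q 0) + outdeg A (q l) + 1 ≤ N
      total = (lin₁ (1 ∷ 1 ∷ 1 ∷ 1 ∷ 1 ∷ 1 ∷ 1 ∷ []) (indeg A (q 0) ∷ outdeg A (q l) ∷ inC C (q 0) ∷ inP (q 0) ∷ outC C (q l) ∷ outP (q l) ∷ l ∷ m ∷ N ∷ []) (λ i o s p t r l m N → (m ⊕ (κ 1 ⊕ l) ≼ N) ⇛ (i ≼ s ⊕ p) ⇛ (o ≼ t ⊕ r) ⇛ (p ≼ l) ⇛ (r ≼ l) ⇛ (s ⊕ t ⊕ (κ 1 ⊕ l) ≼ κ 1 ⊕ m) ⇛ ⊢ (i ⊕ o ⊕ κ 1 ≼ N)))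
        size F.indeg-first F.outdeg-last F.inP-first F.outP-last (F.sum some-in some-out)

    -- For l = 0 `total` contradicts the degree of q₀. For l ≥ 1 the path closes to a cycle, and
    -- `total` also holds for the path from q₁ around to q₀; the two inequalities together
    -- contradict the degree of q₀ and the half-degrees of q₁ and q_l.
    absurd : FPath C l → ⊥
    absurd P = go l refl
      where
      open FPath P
      go : ∀ k → k ≡ l → ⊥
      go 0 refl = <⇒≱ (subst (_≤ N) (+-comm _ 1) (total P)) (deg (q 0))
      go (suc k) refl = (lin₁ (1 ∷ 1 ∷ 2 ∷ 2 ∷ 2 ∷ []) (indeg A (q 0) ∷ outdeg A (q l) ∷ indeg A (q 1) ∷ outdeg A (q 0) ∷ N ∷ []) (λ i o i′ o′ N → (i ⊕ o ⊕ κ 1 ≼ N) ⇛ (i′ ⊕ o′ ⊕ κ 1 ≼ N) ⇛ (N ≼ i ⊕ o′) ⇛ (N ≼ 2 ⊛ i′ ⊕ κ 1) ⇛ (N ≼ 2 ⊛ o ⊕ κ 1) ⇛ ⊢ (ff)))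
          (total P) (subst₂ (λ u v → indeg A u + outdeg A v + 1 ≤ N) first′ last′ (total P′)) (deg _) (deg-in _) (deg-out _)
        where
        a = F.closing P (some-in P) (some-out P) (s≤s z≤n)
        Q = F.closed-path P a
        P′ : FPath C l
        P′ = cycle-path C Q (F.closed-off P a) 1
        first′ : c Q 1 ≡ q 1
        first′ = F.closed-at P a 1 (s≤s z≤n)
        last′ : c Q (l + 1) ≡ q 0
        last′ = trans (cong (c Q) (+-comm l 1)) (trans (c-m Q) (F.closed-at P a 0 z≤n))

  -- Recursion on the number d of vertices off both C and the path: the refutation of longer paths
  -- makes the present one maximal.
  spanning-path : ∀ (C : Cyc m) → (∀ l → m + suc l ≡ suc N → FPath C l → ⊥) → ∀ d l → m + suc l + d ≡ suc N → FPath C l → ⊥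
  spanning-path C full zero l e P = full l (trans (sym (+-identityʳ _)) e) P
  spanning-path C full (suc d) l e = NonSpanning.absurd C l ((lin₁ (1 ∷ 1 ∷ 0 ∷ []) (m ∷ l ∷ d ∷ N ∷ []) (λ m l d N → (m ⊕ (κ 1 ⊕ l) ⊕ (κ 1 ⊕ d) ≐ κ 1 ⊕ N) ⇛ ⊢ (m ⊕ (κ 1 ⊕ l) ≼ N))) e)
    (spanning-path C full d (suc l) ((lin₂ (1 ∷ 1 ∷ 0 ∷ []) (1 ∷ 0 ∷ 1 ∷ []) (m ∷ l ∷ d ∷ N ∷ []) (λ m l d N → (m ⊕ (κ 1 ⊕ l) ⊕ (κ 1 ⊕ d) ≐ κ 1 ⊕ N) ⇛ ⊢ (m ⊕ (κ 1 ⊕ (κ 1 ⊕ l)) ⊕ d ≐ κ 1 ⊕ N))) e))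

-- Equality around the cycle Q through the vertices off C

module NoInsertion {N : ℕ} (A : Digraph (Fin (suc N))) (S : Counterexample A) (m l : ℕ) (m+h : m + suc l ≡ suc N) (2≤m : 2 ≤ m) (1≤l : 1 ≤ l)
  (longest : ∀ k → m < k → k ≤ N → Graph.Cycles.Cyc A k → ⊥) where

  open Graph
  open TightGaps
  open Cycles A
  open Setup.Structures A
  open Counterexample S
  open Self loopless

  m<N : suc m ≤ N
  m<N = (lin₁ (1 ∷ 1 ∷ 1 ∷ 0 ∷ []) (m ∷ l ∷ N ∷ []) (λ m l N → (m ⊕ (κ 1 ⊕ l) ≐ κ 1 ⊕ N) ⇛ (κ 1 ≼ l) ⇛ ⊢ (κ 1 ⊕ m ≼ N))) m+h 1≤l

  open SpanningPath A S m 2≤m m<N longest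

  1≤m : 1 ≤ m
  1≤m = <⇒≤ 2≤m

  module Spanned (C : Cyc m) (P : FPath C l) where
    open FPath P
    everything : List V
    everything = applyUpTo (c C) m ++ whole

    everything-unique : Unique everything
    everything-unique = ++-unique (seg-unique (c C) m (inj C)) whole-unique λ v∈ v∈′ →
      let i , _ , e = ∈-seg⁻ (c C) m v∈ in whole-off i (subst (_∈ whole) e v∈′)

    everything-length : length everything ≡ suc N
    everything-length = trans (length-++ (applyUpTo (c C) m)) (trans (cong₂ _+_ (length-applyUpTo (c C) m) length-whole) m+h)

    all∈ : ∀ v → v ∈ everything
    all∈ = cover everything everything-unique (≤-reflexive (sym everything-length))

    open PathFacts C l P (≤-reflexive m+h) (λ u _ → all∈ u) (λ u _ → all∈ u) public

  module TwoCycles (C : Cyc m) (Q : Cyc (suc l)) (off : ∀ i → Off C (c Q i)) where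

    path : ℕ → FPath C l
    path = cycle-path C Q off

    module At a = Spanned C (path a)
    open At 0 using (everything; everything-unique; everything-length; all∈) public

    last≡ : ∀ i → c Q (l + suc i) ≡ c Q i
    last≡ i = trans (cong (c Q) (+-suc l i)) (per Q i)

    private
      list-Q : ∀ (f : V → Bool) → cnt f (applyUpTo (λ i → c Q (i + 0)) (suc l)) ≡ # (λ i → f (c Q i)) (suc l)
      list-Q f = trans (cnt-applyUpTo f (λ i → c Q (i + 0)) (suc l)) (#-cong (suc l) λ i _ → cong (λ z → f (c Q z)) (+-identityʳ i))

    indeg-split : ∀ v → indeg A v ≤ inC C v + inC Q v
    indeg-split v = ≤-trans (indeg≤ v everything λ u _ → all∈ u) (≤-reflexive (trans (cnt-++ _ (applyUpTo (c C) m) _)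
      (cong₂ _+_ (cnt-applyUpTo (λ u → A u v) (c C) m) (list-Q λ u → A u v))))

    outdeg-split : ∀ v → outdeg A v ≤ outC C v + outC Q v
    outdeg-split v = ≤-trans (outdeg≤ v everything λ u _ → all∈ u) (≤-reflexive (trans (cnt-++ _ (applyUpTo (c C) m) _)
      (cong₂ _+_ (cnt-applyUpTo (A v) (c C) m) (list-Q (A v)))))

    inQ≤ : ∀ i → inC Q (c Q i) ≤ l
    inQ≤ i = subst (_≤ l) (sym (in-self Q i)) (#≤ _ l)

    outQ≤ : ∀ i → outC Q (c Q i) ≤ l
    outQ≤ i = subst (_≤ l) (sym (out-self Q i)) (#≤ _ l)

    sum : ∀ i → 1 ≤ inC C (c Q (suc i)) → 1 ≤ outC C (c Q i) → inC C (c Q (suc i)) + outC C (c Q i) + suc l ≤ suc m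
    sum i s t = subst (λ v → inC C (c Q (suc i)) + outC C v + suc l ≤ suc m) (last≡ i)
      (At.sum (suc i) s (subst (λ v → 1 ≤ outC C v) (sym (last≡ i)) t))

    FQ BC : List V
    FQ = applyUpTo (c Q) (suc l)
    BC = applyUpTo (c C) m

    FQ-BC-unique : Unique (FQ ++ BC)
    FQ-BC-unique = ++-unique (seg-unique (c Q) (suc l) (inj Q)) (seg-unique (c C) m (inj C)) λ v∈ v∈′ →
      let i , _ , e = ∈-seg⁻ (c Q) (suc l) v∈ ; j , _ , e′ = ∈-seg⁻ (c C) m v∈′ in off i j (trans (sym e′) e)

    BC-FQ-unique : Unique (BC ++ FQ)
    BC-FQ-unique = ++-unique (seg-unique (c C) m (inj C)) (seg-unique (c Q) (suc l) (inj Q)) λ v∈′ v∈ →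
      let i , _ , e = ∈-seg⁻ (c Q) (suc l) v∈ ; j , _ , e′ = ∈-seg⁻ (c C) m v∈′ in off i j (trans (sym e′) e)

    module Balanced (bal : m ≡ suc l) where
      private
        N≡ : N ≡ l + suc l
        N≡ = suc-injective (trans (sym m+h) (cong (_+ suc l) bal))

      -- A vertex q_i without in-neighbours on C has an out-neighbour there by its degree. For m = l
      -- + 1 the gap inequality allows one arc in all, so q_{i+1} has no in-neighbour on C.
      next-in : ∀ i → inC C (c Q i) ≡ 0 → inC C (c Q (suc i)) ≡ 0
      next-in i e = go (inC C (c Q (suc i)) ≟ 0)
        where
        out≥1 : 1 ≤ outC C (c Q i)
        out≥1 = (lin₁ (1 ∷ 1 ∷ 0 ∷ 1 ∷ 1 ∷ 1 ∷ 1 ∷ 1 ∷ 0 ∷ 1 ∷ []) (indeg A (c Q i) ∷ outdeg A (c Q i) ∷ inC C (c Q i) ∷ outC C (c Q i) ∷ inC Q (c Q i) ∷ outC Q (c Q i) ∷ l ∷ N ∷ []) (λ i′ o s t p r l N → (N ≐ l ⊕ (κ 1 ⊕ l)) ⇛ (N ≼ i′ ⊕ o) ⇛ (i′ ≼ s ⊕ p) ⇛ (o ≼ t ⊕ r) ⇛ (p ≼ l) ⇛ (r ≼ l) ⇛ (s ≐ κ 0) ⇛ ⊢ (κ 1 ≼ t)))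
          N≡ (deg _) (indeg-split _) (outdeg-split _) (inQ≤ i) (outQ≤ i) e
        go : Dec (inC C (c Q (suc i)) ≡ 0) → inC C (c Q (suc i)) ≡ 0
        go (yes z) = z
        go (no nz) = ⊥-elim ((lin₁ (1 ∷ 1 ∷ 1 ∷ 0 ∷ 1 ∷ []) (inC C (c Q (suc i)) ∷ outC C (c Q i) ∷ l ∷ m ∷ []) (λ s t l m → (s ⊕ t ⊕ (κ 1 ⊕ l) ≼ κ 1 ⊕ m) ⇛ (m ≐ κ 1 ⊕ l) ⇛ (κ 1 ≼ s) ⇛ (κ 1 ≼ t) ⇛ ⊢ (ff)))
          (sum i (n≢0⇒n>0 nz) out≥1) bal (n≢0⇒n>0 nz) out≥1)

      prev-out : ∀ i → outC C (c Q (suc i)) ≡ 0 → outC C (c Q i) ≡ 0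
      prev-out i e = go (outC C (c Q i) ≟ 0)
        where
        in≥1 : 1 ≤ inC C (c Q (suc i))
        in≥1 = (lin₁ (1 ∷ 1 ∷ 0 ∷ 1 ∷ 1 ∷ 1 ∷ 1 ∷ 1 ∷ 0 ∷ 1 ∷ []) (indeg A (c Q (suc i)) ∷ outdeg A (c Q (suc i)) ∷ inC C (c Q (suc i)) ∷ outC C (c Q (suc i)) ∷ inC Q (c Q (suc i)) ∷ outC Q (c Q (suc i)) ∷ l ∷ N ∷ []) (λ i′ o s t p r l N → (N ≐ l ⊕ (κ 1 ⊕ l)) ⇛ (N ≼ i′ ⊕ o) ⇛ (i′ ≼ s ⊕ p) ⇛ (o ≼ t ⊕ r) ⇛ (p ≼ l) ⇛ (r ≼ l) ⇛ (t ≐ κ 0) ⇛ ⊢ (κ 1 ≼ s)))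
          N≡ (deg _) (indeg-split _) (outdeg-split _) (inQ≤ (suc i)) (outQ≤ (suc i)) e
        go : Dec (outC C (c Q i) ≡ 0) → outC C (c Q i) ≡ 0
        go (yes z) = z
        go (no nz) = ⊥-elim ((lin₁ (1 ∷ 1 ∷ 1 ∷ 0 ∷ 1 ∷ []) (inC C (c Q (suc i)) ∷ outC C (c Q i) ∷ l ∷ m ∷ []) (λ s t l m → (s ⊕ t ⊕ (κ 1 ⊕ l) ≼ κ 1 ⊕ m) ⇛ (m ≐ κ 1 ⊕ l) ⇛ (κ 1 ≼ s) ⇛ (κ 1 ≼ t) ⇛ ⊢ (ff)))
          (sum i in≥1 (n≢0⇒n>0 nz)) bal in≥1 (n≢0⇒n>0 nz))

      -- `next-in` carries the zero around Q, so no arc goes from C to Q. The half-degree conditions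
      -- then make Q and C complete, and the digraph lies in 𝓗(n,n).
      no-arcs-in : ∀ a → inC C (c Q a) ≡ 0 → ⊥
      no-arcs-in a e₀ = noH FQ BC record
        { spanning = FQ-BC-unique , trans (length-++ FQ) (trans (cong₂ _+_ (length-applyUpTo (c Q) (suc l)) (length-applyUpTo (c C) m)) (trans (+-comm (suc l) m) m+h))
        ; balanced = trans (length-applyUpTo (c Q) (suc l)) (trans (sym bal) (sym (length-applyUpTo (c C) m)))
        ; F-complete = λ u∈ v∈ → F u∈ v∈ ; B-complete = λ u∈ v∈ → B u∈ v∈ ; no-back = λ u∈ v∈ → none u∈ v∈ }
        where
        zeros : ∀ t → inC C (c Q (t + a)) ≡ 0
        zeros zero = e₀
        zeros (suc t) = next-in (t + a) (zeros t)
        zero-at : ∀ j → inC C (c Q j) ≡ 0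
        zero-at j = let s , _ , f = reduce (s≤s z≤n) a j in trans (cong (inC C) (f (per Q))) (zeros s)
        none : ∀ {u v} → u ∈ BC → v ∈ FQ → A u v ≡ false
        none u∈ v∈ = let k , lt , e = ∈-seg⁻ (c C) m u∈ ; i , _ , e′ = ∈-seg⁻ (c Q) (suc l) v∈ in
          subst₂ (λ u v → A u v ≡ false) (sym e) (sym e′) (#-0 (λ k → A (c C k) (c Q i)) k (zero-at i) lt)
        F : ∀ {u v} → u ∈ FQ → v ∈ FQ → u ≢ v → A u v ≡ true
        F u∈ v∈ ne = let j , _ , e = ∈-seg⁻ (c Q) (suc l) u∈ ; i , _ , e′ = ∈-seg⁻ (c Q) (suc l) v∈ in
          subst₂ _⇒_ (sym e) (sym e′) (full-in Q l refl i
            ((lin₁ (2 ∷ 2 ∷ 0 ∷ 2 ∷ 1 ∷ 0 ∷ 1 ∷ []) (indeg A (c Q i) ∷ inC C (c Q i) ∷ inC Q (c Q i) ∷ l ∷ N ∷ []) (λ d s p l N → (N ≐ l ⊕ (κ 1 ⊕ l)) ⇛ (N ≼ 2 ⊛ d ⊕ κ 1) ⇛ (d ≼ s ⊕ p) ⇛ (s ≐ κ 0) ⇛ ⊢ (l ≼ p))) N≡ (deg-in _) (indeg-split _) (zero-at i))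
            j λ q → ne (trans e (trans q (sym e′))))
        B : ∀ {u v} → u ∈ BC → v ∈ BC → u ≢ v → A u v ≡ true
        B u∈ v∈ ne = let k , lt , e = ∈-seg⁻ (c C) m u∈ ; j , _ , e′ = ∈-seg⁻ (c C) m v∈ in
          subst₂ _⇒_ (sym e) (sym e′) (full-out C l (sym bal) k
            ((lin₁ (2 ∷ 2 ∷ 0 ∷ 2 ∷ 1 ∷ 0 ∷ 1 ∷ []) (outdeg A (c C k) ∷ outC C (c C k) ∷ outC Q (c C k) ∷ l ∷ N ∷ []) (λ d t r l N → (N ≐ l ⊕ (κ 1 ⊕ l)) ⇛ (N ≼ 2 ⊛ d ⊕ κ 1) ⇛ (d ≼ t ⊕ r) ⇛ (r ≐ κ 0) ⇛ ⊢ (l ≼ t))) N≡ (deg-out _) (outdeg-split _)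
              (#-none (suc l) λ i _ → #-0 (λ k → A (c C k) (c Q i)) k (zero-at i) lt))
            j λ q → ne (trans e (trans (sym q) (sym e′))))

      no-arcs-out : ∀ a → outC C (c Q a) ≡ 0 → ⊥
      no-arcs-out a e₀ = noH BC FQ record
        { spanning = BC-FQ-unique , trans (length-++ BC) (trans (cong₂ _+_ (length-applyUpTo (c C) m) (length-applyUpTo (c Q) (suc l))) m+h)
        ; balanced = trans (length-applyUpTo (c C) m) (trans bal (sym (length-applyUpTo (c Q) (suc l))))
        ; F-complete = λ u∈ v∈ → B u∈ v∈ ; B-complete = λ u∈ v∈ → F u∈ v∈ ; no-back = λ u∈ v∈ → none u∈ v∈ }
        where
        back : ∀ t b → outC C (c Q (t + b)) ≡ 0 → outC C (c Q b) ≡ 0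
        back zero b e = e
        back (suc t) b e = back t b (prev-out (t + b) e)
        zero-at : ∀ j → outC C (c Q j) ≡ 0
        zero-at j = let s , _ , f = reduce (s≤s z≤n) j a in back s j (trans (cong (outC C) (sym (f (per Q)))) e₀)
        none : ∀ {u v} → u ∈ FQ → v ∈ BC → A u v ≡ false
        none v∈ u∈ = let k , lt , e = ∈-seg⁻ (c C) m u∈ ; i , _ , e′ = ∈-seg⁻ (c Q) (suc l) v∈ in
          subst₂ (λ u v → A u v ≡ false) (sym e′) (sym e) (#-0 (λ k → A (c Q i) (c C k)) k (zero-at i) lt)
        F : ∀ {u v} → u ∈ FQ → v ∈ FQ → u ≢ v → A u v ≡ true
        F u∈ v∈ ne = let j , _ , e = ∈-seg⁻ (c Q) (suc l) u∈ ; i , _ , e′ = ∈-seg⁻ (c Q) (suc l) v∈ in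
          subst₂ _⇒_ (sym e) (sym e′) (full-out Q l refl j
            ((lin₁ (2 ∷ 2 ∷ 0 ∷ 2 ∷ 1 ∷ 0 ∷ 1 ∷ []) (outdeg A (c Q j) ∷ outC C (c Q j) ∷ outC Q (c Q j) ∷ l ∷ N ∷ []) (λ d s p l N → (N ≐ l ⊕ (κ 1 ⊕ l)) ⇛ (N ≼ 2 ⊛ d ⊕ κ 1) ⇛ (d ≼ s ⊕ p) ⇛ (s ≐ κ 0) ⇛ ⊢ (l ≼ p))) N≡ (deg-out _) (outdeg-split _) (zero-at j))
            i λ q → ne (trans e (trans (sym q) (sym e′))))
        B : ∀ {u v} → u ∈ BC → v ∈ BC → u ≢ v → A u v ≡ true
        B u∈ v∈ ne = let k , _ , e = ∈-seg⁻ (c C) m u∈ ; j , lt , e′ = ∈-seg⁻ (c C) m v∈ in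
          subst₂ _⇒_ (sym e) (sym e′) (full-in C l (sym bal) j
            ((lin₁ (2 ∷ 2 ∷ 0 ∷ 2 ∷ 1 ∷ 0 ∷ 1 ∷ []) (indeg A (c C j) ∷ inC C (c C j) ∷ inC Q (c C j) ∷ l ∷ N ∷ []) (λ d t r l N → (N ≐ l ⊕ (κ 1 ⊕ l)) ⇛ (N ≼ 2 ⊛ d ⊕ κ 1) ⇛ (d ≼ t ⊕ r) ⇛ (r ≐ κ 0) ⇛ ⊢ (l ≼ t))) N≡ (deg-in _) (indeg-split _)
              (#-none (suc l) λ i _ → #-0 (λ k → A (c Q i) (c C k)) j (zero-at i) lt))
            k λ q → ne (trans e (trans q (sym e′))))

  module Ends (C : Cyc m) (P : FPath C l) where
    open FPath P
    open Spanned C P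

    private
      k = proj₁ (m≤n⇒∃[o]m+o≡n 1≤l)
      1+k : 1 + k ≡ l
      1+k = proj₂ (m≤n⇒∃[o]m+o≡n 1≤l)

    closed-0 : ∀ a → c (closed-path a) 0 ≡ q 0
    closed-0 a = closed-at a 0 z≤n

    -- Otherwise the half-degree condition forces m = l + 1 and makes all of q₁, ..., q_l
    -- in-neighbours of q₀. The path closes to a cycle, to which `no-arcs-in` applies.
    some-in : 1 ≤ inC C (q 0)
    some-in = n≢0⇒n>0 λ e →
      let d = indeg A (q 0)
          bal : m ≡ suc l
          bal = (lin₂ (1 ∷ 2 ∷ 2 ∷ 0 ∷ 2 ∷ 0 ∷ 1 ∷ 1 ∷ 0 ∷ []) (1 ∷ 0 ∷ 0 ∷ 0 ∷ 0 ∷ 2 ∷ 1 ∷ 1 ∷ 0 ∷ []) (d ∷ inC C (q 0) ∷ inP (q 0) ∷ m ∷ l ∷ N ∷ []) (λ d s p m l N → (m ⊕ (κ 1 ⊕ l) ≐ κ 1 ⊕ N) ⇛ (N ≼ 2 ⊛ d ⊕ κ 1) ⇛ (d ⊕ κ 1 ≼ m) ⇛ (d ≼ s ⊕ p) ⇛ (s ≐ κ 0) ⇛ (p ≼ l) ⇛ ⊢ (m ≐ κ 1 ⊕ l)))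
            m+h (deg-in _) (no-in e) indeg-first e inP-first
          big : l ≤ # (λ i → A (q (suc i)) (q 0)) l
          big = (lin₁ (2 ∷ 2 ∷ 0 ∷ 2 ∷ 0 ∷ 2 ∷ 0 ∷ 2 ∷ 1 ∷ 0 ∷ 1 ∷ 1 ∷ 0 ∷ []) (d ∷ inC C (q 0) ∷ inP (q 0) ∷ # (λ i → A (q (suc i)) (q 0)) l ∷ bit (A (q 0) (q 0)) ∷ m ∷ l ∷ N ∷ []) (λ d s p z b m l N → (m ⊕ (κ 1 ⊕ l) ≐ κ 1 ⊕ N) ⇛ (m ≐ κ 1 ⊕ l) ⇛ (N ≼ 2 ⊛ d ⊕ κ 1) ⇛ (d ≼ s ⊕ p) ⇛ (s ≐ κ 0) ⇛ (p ≐ b ⊕ z) ⇛ (b ≐ κ 0) ⇛ ⊢ (l ≼ z)))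
            m+h bal (deg-in _) indeg-first e refl (bit-false (loopless _))
          a : q l ⇒ q 0
          a = subst (λ z → q z ⇒ q 0) 1+k (#-full (λ i → A (q (suc i)) (q 0)) l big k (≤-reflexive 1+k))
      in TwoCycles.Balanced.no-arcs-in C (closed-path a) (closed-off a) bal 0 (trans (cong (inC C) (closed-0 a)) e)

    some-out : 1 ≤ outC C (q l)
    some-out = n≢0⇒n>0 λ e →
      let d = outdeg A (q l)
          bal : m ≡ suc l
          bal = (lin₂ (1 ∷ 2 ∷ 2 ∷ 0 ∷ 2 ∷ 0 ∷ 1 ∷ 1 ∷ 0 ∷ []) (1 ∷ 0 ∷ 0 ∷ 0 ∷ 0 ∷ 2 ∷ 1 ∷ 1 ∷ 0 ∷ []) (d ∷ outC C (q l) ∷ outP (q l) ∷ m ∷ l ∷ N ∷ []) (λ d s p m l N → (m ⊕ (κ 1 ⊕ l) ≐ κ 1 ⊕ N) ⇛ (N ≼ 2 ⊛ d ⊕ κ 1) ⇛ (d ⊕ κ 1 ≼ m) ⇛ (d ≼ s ⊕ p) ⇛ (s ≐ κ 0) ⇛ (p ≼ l) ⇛ ⊢ (m ≐ κ 1 ⊕ l)))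
            m+h (deg-out _) (no-out e) outdeg-last e outP-last
          big : l ≤ # (λ i → A (q l) (q i)) l
          big = (lin₁ (2 ∷ 2 ∷ 0 ∷ 2 ∷ 0 ∷ 2 ∷ 0 ∷ 2 ∷ 1 ∷ 0 ∷ 1 ∷ 1 ∷ 0 ∷ []) (d ∷ outC C (q l) ∷ outP (q l) ∷ # (λ i → A (q l) (q i)) l ∷ bit (A (q l) (q l)) ∷ m ∷ l ∷ N ∷ []) (λ d s p z b m l N → (m ⊕ (κ 1 ⊕ l) ≐ κ 1 ⊕ N) ⇛ (m ≐ κ 1 ⊕ l) ⇛ (N ≼ 2 ⊛ d ⊕ κ 1) ⇛ (d ≼ s ⊕ p) ⇛ (s ≐ κ 0) ⇛ (p ≐ z ⊕ b) ⇛ (b ≐ κ 0) ⇛ ⊢ (l ≼ z)))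
            m+h bal (deg-out _) outdeg-last e (#-snoc (λ i → A (q l) (q i)) l) (bit-false (loopless _))
          a : q l ⇒ q 0
          a = #-full (λ i → A (q l) (q i)) l big 0 1≤l
      in TwoCycles.Balanced.no-arcs-out C (closed-path a) (closed-off a) bal l (trans (cong (outC C) (closed-at a l ≤-refl)) e)

    cycle : Cyc (suc l)
    cycle = closed-path (closing some-in some-out 1≤l)

    cycle-at : ∀ i → i ≤ l → c cycle i ≡ q i
    cycle-at = closed-at (closing some-in some-out 1≤l)

    cycle-off : ∀ i → Off C (c cycle i)
    cycle-off = closed-off (closing some-in some-out 1≤l)

  module Uniform (C : Cyc m) (Q : Cyc (suc l)) (off : ∀ i → Off C (c Q i)) where
    open TwoCycles C Q off public

    s t : ℕ → ℕ → Bool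
    s i k = A (c C k) (c Q i)
    t i k = A (c Q i) (c C k)

    s-per : ∀ i → Periodic m (s i)
    s-per i k = cong (λ z → A z (c Q i)) (per C k)
    t-per : ∀ i → Periodic m (t i)
    t-per i k = cong (A (c Q i)) (per C k)

    X Y : ℕ → ℕ
    X i = inC C (c Q i)
    Y i = outC C (c Q i)

    X≥1 : ∀ i → 1 ≤ X i
    X≥1 i = Ends.some-in C (path i)

    Y≥1 : ∀ i → 1 ≤ Y i
    Y≥1 i = subst (λ v → 1 ≤ outC C v) (last≡ i) (Ends.some-out C (path (suc i)))

    lower : ∀ i → m ≤ X i + Y i + l
    lower i = (lin₁ (1 ∷ 1 ∷ 1 ∷ 1 ∷ 1 ∷ 1 ∷ 1 ∷ 0 ∷ []) (indeg A (c Q i) ∷ outdeg A (c Q i) ∷ X i ∷ Y i ∷ inC Q (c Q i) ∷ outC Q (c Q i) ∷ l ∷ m ∷ N ∷ []) (λ i′ o s t p r l m N → (m ⊕ (κ 1 ⊕ l) ≐ κ 1 ⊕ N) ⇛ (N ≼ i′ ⊕ o) ⇛ (i′ ≼ s ⊕ p) ⇛ (o ≼ t ⊕ r) ⇛ (p ≼ l) ⇛ (r ≼ l) ⇛ ⊢ (m ≼ s ⊕ t ⊕ l)))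
      m+h (deg _) (indeg-split _) (outdeg-split _) (inQ≤ i) (outQ≤ i)

    -- The degree of q_i gives X i + Y i ≥ m - l, and the path from q_{i+1} around to q_i gives X (i
    -- + 1) + Y i ≤ m - l.
    X-step : ∀ i → X (suc i) ≤ X i
    X-step i = (lin₁ (1 ∷ 1 ∷ 1 ∷ []) (X (suc i) ∷ X i ∷ Y i ∷ l ∷ m ∷ []) (λ x′ x y l m → (m ≼ x ⊕ y ⊕ l) ⇛ (x′ ⊕ y ⊕ (κ 1 ⊕ l) ≼ κ 1 ⊕ m) ⇛ ⊢ (x′ ≼ x)))
      (lower i) (sum i (X≥1 (suc i)) (Y≥1 i))

    X-steps : ∀ t i → X (t + i) ≤ X i
    X-steps zero i = ≤-refl
    X-steps (suc t) i = ≤-trans (X-step (t + i)) (X-steps t i)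

    -- After one turn around Q the start is reached again, so a count that never increases is
    -- constant.
    X-const : ∀ i → X (suc i) ≡ X i
    X-const i = ≤-antisym (X-step i) (subst (_≤ X (suc i)) (cong (inC C) (last≡ i)) (X-steps l (suc i)))

    total : ∀ i → X i + Y i + suc l ≡ suc m
    total i = ≤-antisym (subst (λ x → x + Y i + suc l ≤ suc m) (X-const i) (sum i (X≥1 (suc i)) (Y≥1 i)))
      ((lin₁ (1 ∷ 1 ∷ []) (X i ∷ Y i ∷ l ∷ m ∷ []) (λ x y l m → (m ≼ x ⊕ y ⊕ l) ⇛ ⊢ (κ 1 ⊕ m ≼ x ⊕ y ⊕ (κ 1 ⊕ l)))) (lower i))

    X≡ : ∀ i → X i ≡ X 0
    X≡ zero = refl
    X≡ (suc i) = trans (X-const i) (X≡ i)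

    Y≡ : ∀ i → Y i ≡ Y 0
    Y≡ i = (lin₂ (1 ∷ 0 ∷ 1 ∷ 0 ∷ 1 ∷ 1 ∷ 0 ∷ []) (1 ∷ 1 ∷ 0 ∷ 1 ∷ 0 ∷ 0 ∷ 1 ∷ []) (X i ∷ X 0 ∷ Y i ∷ Y 0 ∷ l ∷ m ∷ []) (λ x x′ y y′ l m → (x ⊕ y ⊕ (κ 1 ⊕ l) ≐ κ 1 ⊕ m) ⇛ (x′ ⊕ y′ ⊕ (κ 1 ⊕ l) ≐ κ 1 ⊕ m) ⇛ (x ≐ x′) ⇛ ⊢ (y ≐ y′))) (total i) (total 0) (X≡ i)

    -- With X i + Y i = m - l the degree of q_i requires all 2 l arcs between q_i and the rest of Q.
    complete : ∀ i j → c Q j ≢ c Q i → c Q j ⇒ c Q i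
    complete i = full-in Q l refl i ((lin₁ (1 ∷ 1 ∷ 0 ∷ 1 ∷ 1 ∷ 1 ∷ 1 ∷ 1 ∷ 0 ∷ []) (indeg A (c Q i) ∷ outdeg A (c Q i) ∷ X i ∷ Y i ∷ inC Q (c Q i) ∷ outC Q (c Q i) ∷ l ∷ m ∷ N ∷ []) (λ i′ o s t p r l m N → (m ⊕ (κ 1 ⊕ l) ≐ κ 1 ⊕ N) ⇛ (N ≼ i′ ⊕ o) ⇛ (i′ ≼ s ⊕ p) ⇛ (o ≼ t ⊕ r) ⇛ (r ≼ l) ⇛ (s ⊕ t ⊕ (κ 1 ⊕ l) ≐ κ 1 ⊕ m) ⇛ ⊢ (l ≼ p)))
      m+h (deg _) (indeg-split _) (outdeg-split _) (outQ≤ i) (total i))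

    private
      list-apart : ∀ P {u v} → Path u P v → Unique P → OffL C P → length P ≤ suc l → Apart m (length P) (λ k → A (c C k) u) (λ k → A v (c C k))
      list-apart P path uP offP le = gap-apart C P path uP offP (subst (m + length P ≤_) m+h (+-monoʳ-≤ m le))

    -- Started at q_{i+1}, the path around Q ends at q_i; therefore the in-neighbours of one vertex
    -- meet the out-neighbours of the one before it.
    consecutive : ∀ i → Apart m (suc l) (s (suc i)) (t i)
    consecutive i = subst₂ (λ n v → Apart m n (s (suc i)) (λ k → A v (c C k))) (FPath.length-whole P) (last≡ i)
      (list-apart (FPath.whole P) (FPath.whole-path P) (FPath.whole-unique P) (FPath.whole-off P) (≤-reflexive (FPath.length-whole P)))
      where P = path (suc i)

    single : ∀ i → Apart m 1 (s i) (t i)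
    single i = list-apart (c Q i ∷ []) (λ a b → a , b) (∷-unique ∉-[] []) (λ k → ∉-∷ (off i k) ∉-[]) (s≤s z≤n)

    module Ext i = Extremal {m} {suc l} {s (suc i)} {t i} (s-per (suc i)) (t-per i) (s≤s z≤n) (consecutive i) (X≥1 (suc i)) (Y≥1 i)
      (trans (cong (λ x → x + Y i + suc l) (X-const i)) (total i))

    -- For at least three vertices off C, exchanging the first two of the path shows that they have the same in-neighbours.
    s-next : 2 ≤ l → ∀ i k → s (2 + i) k ≡ s (suc i) k
    s-next 2≤l i = Ext.same-s i (s-per (2 + i)) apart′ (X-const (suc i))
      where
      o = proj₁ (m≤n⇒∃[o]m+o≡n 2≤l)
      2+o : 2 + o ≡ l
      2+o = proj₂ (m≤n⇒∃[o]m+o≡n 2≤l)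
      g : ℕ → V
      g k = c Q (k + (3 + i))
      tailP P : List V
      tailP = applyUpTo g (suc o)
      P = c Q (2 + i) ∷ c Q (1 + i) ∷ tailP
      lenP : length P ≡ suc l
      lenP = trans (cong (2 +_) (length-applyUpTo g (suc o))) (cong suc 2+o)
      dist : ∀ a b → a < suc l → b < suc l → a ≢ b → c Q (a + suc i) ≢ c Q (b + suc i)
      dist a b lt lt′ ne e = ne (inj (rot (suc i) Q) a b lt lt′ e)
      bound : ∀ k → k < suc o → 2 + k < suc l
      bound k lt = subst (λ z → 2 + k < suc z) 2+o (s≤s (s≤s (subst (k <_) refl lt)))
      0<l : 0 < suc l
      0<l = s≤s z≤n
      1<l : 1 < suc l
      1<l = s≤s 1≤l
      shift : ∀ k → c Q (k + (3 + i)) ≡ c Q (2 + k + suc i)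
      shift k = cong (c Q) ((lin₂ (1 ∷ []) (1 ∷ []) (k ∷ i ∷ []) (λ k i → ⊢ (k ⊕ (κ 3 ⊕ i) ≐ κ 2 ⊕ k ⊕ (κ 1 ⊕ i)))))
      2∉ : c Q (2 + i) ∉ tailP
      2∉ v∈ = let k , lt , e = ∈-seg⁻ g (suc o) v∈ in dist 1 (2 + k) 1<l (bound k lt) (λ ()) (trans e (shift k))
      1∉ : c Q (1 + i) ∉ tailP
      1∉ v∈ = let k , lt , e = ∈-seg⁻ g (suc o) v∈ in dist 0 (2 + k) 0<l (bound k lt) (λ ()) (trans e (shift k))
      uP : Unique P
      uP = ∷-unique (∉-∷ (dist 1 0 1<l 0<l λ ()) 2∉) (∷-unique 1∉ (seg-unique g (suc o) λ a b lt lt′ e →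
        +-cancelˡ-≡ 2 a b (inj (rot (suc i) Q) (2 + a) (2 + b) (bound a lt) (bound b lt′) (trans (sym (shift a)) (trans e (shift b))))))
      offP : OffL C P
      offP k = ∉-∷ (off (2 + i) k) (∉-∷ (off (1 + i) k) λ v∈ → let j , _ , e = ∈-seg⁻ g (suc o) v∈ in off (j + (3 + i)) k e)
      end≡ : g o ≡ c Q i
      end≡ = trans (cong (c Q) (trans ((lin₂ (1 ∷ 1 ∷ 0 ∷ []) (1 ∷ 0 ∷ 1 ∷ []) (o ∷ i ∷ l ∷ []) (λ o i l → (κ 2 ⊕ o ≐ l) ⇛ ⊢ (o ⊕ (κ 3 ⊕ i) ≐ κ 1 ⊕ l ⊕ i))) 2+o) refl)) (per Q i)
      pathP : Path (c Q (2 + i)) P (c Q i)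
      pathP a b = a , complete (1 + i) (2 + i) (dist 1 0 1<l 0<l λ ()) ,
        complete (3 + i) (1 + i) (λ e → dist 0 2 0<l (bound 0 (s≤s z≤n)) (λ ()) e) ,
        walk-arcs g o (λ k _ → arc Q (k + (3 + i))) (subst (_⇒ _) (sym end≡) b)
      apart′ : Apart m (suc l) (s (2 + i)) (t i)
      apart′ = subst (λ n → Apart m n (s (2 + i)) (t i)) lenP (list-apart P pathP uP offP (≤-reflexive lenP))

    s-pair : l ≡ 1 → ∀ i k → s i k ≡ s (suc i) k
    s-pair refl i = Pair.same {m} {s (suc i)} {t i} {s i} {t (suc i)} (s-per (suc i)) (t-per i) (s-per i) (t-per (suc i))
      (consecutive i) (λ a j 1≤j j≤2 j≤m p q → consecutive (suc i) a j 1≤j j≤2 j≤m (subst (λ v → A (c C a) v ≡ true) (sym (per Q i)) p) q)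
      (single i) (single (suc i)) (X≥1 (suc i)) (Y≥1 i) (trans (cong (λ x → x + Y i + 2) (X-const i)) (total i))
      (sym (X-const i)) (trans (Y≡ (suc i)) (sym (Y≡ i)))

    s-suc : ∀ i k → s (2 + i) k ≡ s (suc i) k
    s-suc i k = go (2 ≤? l)
      where
      go : Dec (2 ≤ l) → s (2 + i) k ≡ s (suc i) k
      go (yes 2≤l) = s-next 2≤l i k
      go (no ≰) = sym (s-pair (≤-antisym (s≤s⁻¹ (≰⇒> ≰)) 1≤l) (suc i) k)

    s-1 : ∀ i k → s (suc i) k ≡ s 1 k
    s-1 zero k = refl
    s-1 (suc i) k = trans (s-suc i k) (s-1 i k)

    s-all : ∀ i j k → s i k ≡ s j k
    s-all i j k = trans (to i) (sym (to j))
      where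
      to : ∀ i → s i k ≡ s 1 k
      to zero = trans (cong (A (c C k)) (sym (trans (cong (c Q) (sym (+-identityʳ (suc l)))) (per Q 0)))) (s-1 l k)
      to (suc i) = s-1 i k

    apart-all : ∀ i j → Apart m (suc l) (s i) (t j)
    apart-all i j a k 1≤k k≤h k≤m p = consecutive j a k 1≤k k≤h k≤m (trans (s-all (suc j) i a) p)

    t-all : ∀ i j k → t i k ≡ t j k
    t-all i j k = Ext.same-t j (t-per i) (apart-all (suc j) i) (trans (Y≡ i) (sym (Y≡ j))) k

    module Ext0 = Extremal {m} {suc l} {s 0} {t 0} (s-per 0) (t-per 0) (s≤s z≤n) (apart-all 0 0) (X≥1 0) (Y≥1 0) (total 0)

-- Two exchangeable complete digraphs P and Q joined by a path W

module Sandwiched {N : ℕ} (A : Digraph (Fin (suc N))) (S : Counterexample A) (m l : ℕ) (m+h : m + suc l ≡ suc N) (2≤m : 2 ≤ m) (1≤l : 1 ≤ l)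
  (longest : ∀ k → m < k → k ≤ N → Graph.Cycles.Cyc A k → ⊥) where

  open Graph
  open TightGaps
  open Cycles A
  open Setup.Structures A
  open Counterexample S
  open Self loopless
  open NoInsertion A S m l m+h 2≤m 1≤l longest

  -- The vertices off P ∪ Q form a path W; every vertex of W sends arcs to all or none of Q, and likewise for P.
  record Sandwich : Set where
    field
      r : ℕ
      w : ℕ → V
      Q P : Cyc (suc l)
    W : List V
    W = applyUpTo w (suc r)
    FQ : List V
    FQ = applyUpTo (c Q) (suc l)
    FP : List V
    FP = applyUpTo (c P) (suc l)
    field
      unique : Unique (W ++ FQ ++ FP)
      size : suc r + (suc l + suc l) ≡ suc N
      Q-complete : ∀ i j → c Q j ≢ c Q i → c Q j ⇒ c Q i
      P-complete : ∀ i j → c P j ≢ c P i → c P j ⇒ c P i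
      Q-P : ∀ i j → A (c Q i) (c P j) ≡ false
      P-Q : ∀ i j → A (c P i) (c Q j) ≡ false
      chain : ∀ i → i < r → w i ⇒ w (suc i)
      sQ tQ sP tP : ℕ → Bool
      W-Q : ∀ i j → i ≤ r → A (w i) (c Q j) ≡ sQ i
      Q-W : ∀ i j → i ≤ r → A (c Q j) (w i) ≡ tQ i
      W-P : ∀ i j → i ≤ r → A (w i) (c P j) ≡ sP i
      P-W : ∀ i j → i ≤ r → A (c P j) (w i) ≡ tP i
      tQ-0 : tQ 0 ≡ true
      tP-0 : tP 0 ≡ true
      tQ-suc : ∀ i → i < r → tQ (suc i) ≡ not (sQ i)
      tP-suc : ∀ i → i < r → tP (suc i) ≡ not (sP i)
      sQ-r : sQ r ≡ true
      sP-r : sP r ≡ true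
      sQ-up : ∀ i → i < r → sQ i ≡ true → sQ (suc i) ≡ true
      sP-up : ∀ i → i < r → sP i ≡ true → sP (suc i) ≡ true

  swap-unique : (xs ys zs : List V) → Unique (xs ++ ys ++ zs) → Unique (xs ++ zs ++ ys)
  swap-unique xs ys zs u = ++-unique (++-unique-left xs u)
    (++-unique (++-unique-right ys yz) (++-unique-left ys yz) λ v∈ v∈′ → ++-disjoint ys yz v∈′ v∈)
    λ v∈ v∈′ → ++-disjoint xs u v∈ ([ ∈-++⁺ʳ ys , ∈-++⁺ˡ ]′ (∈-++⁻ zs v∈′))
    where
    yz : Unique (ys ++ zs)
    yz = ++-unique-right xs u

  flip : Sandwich → Sandwich
  flip D = record { r = r ; w = w ; Q = P ; P = Q ; unique = swap-unique W FQ FP unique ; size = size ; Q-complete = P-complete ; P-complete = Q-complete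
    ; Q-P = P-Q ; P-Q = Q-P ; chain = chain ; sQ = sP ; tQ = tP ; sP = sQ ; tP = tQ ; W-Q = W-P ; Q-W = P-W ; W-P = W-Q ; P-W = Q-W
    ; tQ-0 = tP-0 ; tP-0 = tQ-0 ; tQ-suc = tP-suc ; tP-suc = tQ-suc ; sQ-r = sP-r ; sP-r = sQ-r ; sQ-up = sP-up ; sP-up = sQ-up }
    where open Sandwich D

  module Analysis (D : Sandwich) where
    open Sandwich D

    everything : List V
    everything = W ++ FQ ++ FP

    total-length : length everything ≡ suc N
    total-length = trans (length-++ W) (trans (cong₂ _+_ (length-applyUpTo w (suc r)) (trans (length-++ FQ) (cong₂ _+_ (length-applyUpTo (c Q) (suc l)) (length-applyUpTo (c P) (suc l))))) size)

    all∈ : ∀ v → v ∈ everything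
    all∈ = cover everything unique (≤-reflexive (sym total-length))

    W∌QP : ∀ {v} → v ∈ W → v ∉ FQ ++ FP
    W∌QP = ++-disjoint W unique

    Q∌P : ∀ {v} → v ∈ FQ → v ∉ FP
    Q∌P = ++-disjoint FQ (++-unique-right W unique)

    w-inj : ∀ i j → i ≤ r → j ≤ r → w i ≡ w j → i ≡ j
    w-inj i j le le′ e = at-inj (w 0) W (++-unique-left W unique) i j (subst (i <_) (sym (length-applyUpTo w (suc r))) (s≤s le)) (subst (j <_) (sym (length-applyUpTo w (suc r))) (s≤s le′))
      (trans (at-applyUpTo (w 0) w (suc r) i (s≤s le)) (trans e (sym (at-applyUpTo (w 0) w (suc r) j (s≤s le′)))))

    split : ∀ (f : V → Bool) → cnt f everything ≡ # (λ i → f (w i)) (suc r) + (# (λ i → f (c Q i)) (suc l) + # (λ i → f (c P i)) (suc l))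
    split f = trans (cnt-++ f W _) (cong₂ _+_ (cnt-applyUpTo f w (suc r)) (trans (cnt-++ f FQ FP) (cong₂ _+_ (cnt-applyUpTo f (c Q) (suc l)) (cnt-applyUpTo f (c P) (suc l)))))

    indeg-split : ∀ v → indeg A v ≤ # (λ i → A (w i) v) (suc r) + (inC Q v + inC P v)
    indeg-split v = ≤-trans (indeg≤ v everything λ u _ → all∈ u) (≤-reflexive (split λ u → A u v))

    outdeg-split : ∀ v → outdeg A v ≤ # (λ i → A v (w i)) (suc r) + (outC Q v + outC P v)
    outdeg-split v = ≤-trans (outdeg≤ v everything λ u _ → all∈ u) (≤-reflexive (split (A v)))

    -- An arc w_i w_j frees the segment between its ends, which together with P fits between Q and w₀.
    forbidden : ∀ i j → suc i ≤ j → suc j ≤ r → w i ⇒ w (suc j) → tQ (suc i) ≡ true → sP j ≡ true → ⊥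
    forbidden i j i<j j<r a t s = go (m≤n⇒∃[o]m+o≡n i<j) (m≤n⇒∃[o]m+o≡n j<r) (m≤n⇒∃[o]m+o≡n 1≤l)
      where
      go : (∃ λ p → suc i + p ≡ j) → (∃ λ o → suc j + o ≡ r) → (∃ λ k → 1 + k ≡ l) → ⊥
      go (p , i+p) (o , j+o) (k , 1+k) = noC (close (w 0) (applyUpTo (w ∘ suc) i ++ R₁) len walk uniq)
        where
        b₁ b₂ : ℕ → V
        b₁ t = w (t + suc j)
        b₂ t = w (t + suc i)
        S₁ S₂ Q′ R₁ R₂ R₃ : List V
        S₁ = applyUpTo b₁ (suc o)
        S₂ = applyUpTo b₂ (suc p)
        -- One vertex of Q is left out, as l = k + 1; this brings the length from p down to N.
        Q′ = applyUpTo (c Q) (suc k)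
        R₃ = S₂ ++ FP
        R₂ = Q′ ++ R₃
        R₁ = S₁ ++ R₂
        b₁≤ : ∀ t → t < suc o → t + suc j ≤ r
        b₁≤ t lt = (lin₁ (1 ∷ 1 ∷ 1 ∷ 0 ∷ []) (t ∷ j ∷ o ∷ r ∷ []) (λ t j o r → (κ 1 ⊕ j ⊕ o ≐ r) ⇛ (κ 1 ⊕ t ≼ κ 1 ⊕ o) ⇛ ⊢ (t ⊕ (κ 1 ⊕ j) ≼ r))) j+o lt
        b₂≤ : ∀ t → t < suc p → t + suc i ≤ j
        b₂≤ t lt = (lin₁ (1 ∷ 1 ∷ 1 ∷ 0 ∷ []) (t ∷ j ∷ p ∷ i ∷ []) (λ t j p i → (κ 1 ⊕ i ⊕ p ≐ j) ⇛ (κ 1 ⊕ t ≼ κ 1 ⊕ p) ⇛ ⊢ (t ⊕ (κ 1 ⊕ i) ≼ j))) i+p lt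
        b₂≤r : ∀ t → t < suc p → t + suc i ≤ r
        b₂≤r t lt = ≤-trans (b₂≤ t lt) (<⇒≤ j<r)
        walk : Walk (w 0) (applyUpTo (w ∘ suc) i ++ R₁) (w 0)
        walk = walk-seg w i (λ t lt → chain t (≤-trans lt (≤-trans (<⇒≤ i<j) (<⇒≤ j<r))))
          (a , walk-seg b₁ o (λ t lt → chain (t + suc j) (b₁≤ (suc t) (s≤s lt)))
            (subst (λ z → A z (c Q 0) ≡ true) (cong w (trans (sym j+o) (+-comm (suc j) o))) (trans (W-Q r 0 ≤-refl) sQ-r) ,
              walk-seg (c Q) k (λ t _ → arc Q t)
                (trans (Q-W (suc i) k (≤-trans i<j (<⇒≤ j<r))) t ,
                  walk-seg b₂ p (λ t lt → chain (t + suc i) (≤-trans (b₂≤ (suc t) (s≤s lt)) (<⇒≤ j<r)))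
                    (subst (λ z → A z (c P 0) ≡ true) (cong w (trans (sym i+p) (+-comm (suc i) p))) (trans (W-P j 0 (<⇒≤ j<r)) s) ,
                      walk-arcs (c P) l (λ t _ → arc P t) (trans (P-W 0 l z≤n) tP-0)))))
        W∈ : ∀ t → t ≤ r → w t ∈ W
        W∈ t le = ∈-applyUpTo⁺ w (s≤s le)
        Q′⊆ : ∀ {v} → v ∈ Q′ → v ∈ FQ
        Q′⊆ v∈ = let t , lt , e = ∈-seg⁻ (c Q) (suc k) v∈ in subst (_∈ FQ) (sym e) (∈-applyUpTo⁺ (c Q) (≤-trans lt (subst (λ z → suc k ≤ suc z) 1+k (s≤s (n≤1+n k)))))
        not-QP : ∀ {v} t → t ≤ r → v ≡ w t → v ∈ FQ ⊎ v ∈ FP → ⊥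
        not-QP t le e (inj₁ v∈) = W∌QP (W∈ t le) (∈-++⁺ˡ (subst (_∈ FQ) e v∈))
        not-QP t le e (inj₂ v∈) = W∌QP (W∈ t le) (∈-++⁺ʳ FQ (subst (_∈ FP) e v∈))
        Mid : ℕ → V → Set
        Mid top v = ∃ λ t → suc i ≤ t × t ≤ top × v ≡ w t
        mid₁ : ∀ {v} → v ∈ S₁ → ∃ λ t → suc j ≤ t × t ≤ r × v ≡ w t
        mid₁ v∈ = let t , lt , e = ∈-seg⁻ b₁ (suc o) v∈ in t + suc j , m≤n+m (suc j) t , b₁≤ t lt , e
        mid₂ : ∀ {v} → v ∈ S₂ → Mid j v
        mid₂ v∈ = let t , lt , e = ∈-seg⁻ b₂ (suc p) v∈ in t + suc i , m≤n+m (suc i) t , b₂≤ t lt , e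
        R₃-cases : ∀ {v} → v ∈ R₃ → Mid j v ⊎ v ∈ FP
        R₃-cases {v} v∈ = by (∈-++⁻ S₂ v∈)
          where
          by : v ∈ S₂ ⊎ v ∈ FP → Mid j v ⊎ v ∈ FP
          by (inj₁ h) = inj₁ (mid₂ h)
          by (inj₂ h) = inj₂ h
        R₂-cases : ∀ {v} → v ∈ R₂ → Mid j v ⊎ (v ∈ FQ ⊎ v ∈ FP)
        R₂-cases {v} v∈ = by (∈-++⁻ Q′ v∈)
          where
          by′ : Mid j v ⊎ v ∈ FP → Mid j v ⊎ (v ∈ FQ ⊎ v ∈ FP)
          by′ (inj₁ h) = inj₁ h
          by′ (inj₂ h) = inj₂ (inj₂ h)
          by : v ∈ Q′ ⊎ v ∈ R₃ → Mid j v ⊎ (v ∈ FQ ⊎ v ∈ FP)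
          by (inj₁ h) = inj₂ (inj₁ (Q′⊆ h))
          by (inj₂ h) = by′ (R₃-cases h)
        apart₁ : ∀ {v} → v ∈ applyUpTo w (suc i) → v ∉ R₁
        apart₁ {v} v∈ v∈′ = by (∈-++⁻ S₁ v∈′)
          where
          τ = proj₁ (∈-seg⁻ w (suc i) v∈)
          τ< = proj₁ (proj₂ (∈-seg⁻ w (suc i) v∈))
          vτ = proj₂ (proj₂ (∈-seg⁻ w (suc i) v∈))
          τ≤r : τ ≤ r
          τ≤r = ≤-trans (s≤s⁻¹ τ<) (≤-trans (<⇒≤ i<j) (<⇒≤ j<r))
          clash : ∀ u → τ < u → u ≤ r → v ≡ w u → ⊥
          clash u τ<u le e′ = <⇒≢ τ<u (w-inj τ u τ≤r le (trans (sym vτ) e′))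
          by′ : Mid j v ⊎ (v ∈ FQ ⊎ v ∈ FP) → ⊥
          by′ (inj₁ (u , ge , le , e′)) = clash u (≤-trans τ< ge) (≤-trans le (<⇒≤ j<r)) e′
          by′ (inj₂ h) = not-QP τ τ≤r vτ h
          by : v ∈ S₁ ⊎ v ∈ R₂ → ⊥
          by (inj₁ h) = let u , ge , le , e′ = mid₁ h in clash u (≤-trans (≤-trans τ< i<j) (≤-trans (n≤1+n j) ge)) le e′
          by (inj₂ h) = by′ (R₂-cases h)
        apart₂ : ∀ {v} → v ∈ S₁ → v ∉ R₂
        apart₂ {v} v∈ v∈′ = by (mid₁ v∈) (R₂-cases v∈′)
          where
          by : (∃ λ t → suc j ≤ t × t ≤ r × v ≡ w t) → Mid j v ⊎ (v ∈ FQ ⊎ v ∈ FP) → ⊥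
          by (t , ge , le , e) (inj₁ (u , _ , le′ , e′)) = <⇒≱ (≤-<-trans le′ ge) (≤-reflexive (w-inj t u le (≤-trans le′ (<⇒≤ j<r)) (trans (sym e) e′)))
          by (t , ge , le , e) (inj₂ h) = not-QP t le e h
        apart₃ : ∀ {v} → v ∈ Q′ → v ∉ R₃
        apart₃ {v} v∈ v∈′ = by (R₃-cases v∈′)
          where
          by : Mid j v ⊎ v ∈ FP → ⊥
          by (inj₁ (t , _ , le , e)) = not-QP t (≤-trans le (<⇒≤ j<r)) e (inj₁ (Q′⊆ v∈))
          by (inj₂ h) = Q∌P (Q′⊆ v∈) h
        apart₄ : ∀ {v} → v ∈ S₂ → v ∉ FP
        apart₄ {v} v∈ v∈′ = let t , _ , le , e = mid₂ v∈ in not-QP t (≤-trans le (<⇒≤ j<r)) e (inj₂ v∈′)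
        uniq : Unique (applyUpTo w (suc i) ++ R₁)
        uniq = ++-unique (seg-unique w (suc i) λ x y lt lt′ → w-inj x y (low x lt) (low y lt′))
          (++-unique (seg-unique b₁ (suc o) λ x y lt lt′ e → +-cancelʳ-≡ (suc j) x y (w-inj _ _ (b₁≤ x lt) (b₁≤ y lt′) e))
            (++-unique (seg-unique (c Q) (suc k) λ x y lt lt′ → inj Q x y (up lt) (up lt′))
              (++-unique (seg-unique b₂ (suc p) λ x y lt lt′ e → +-cancelʳ-≡ (suc i) x y (w-inj _ _ (b₂≤r x lt) (b₂≤r y lt′) e))
                (seg-unique (c P) (suc l) (inj P)) apart₄) apart₃) apart₂) apart₁
          where
          low : ∀ t → t < suc i → t ≤ r
          low t lt = ≤-trans (s≤s⁻¹ lt) (≤-trans (<⇒≤ i<j) (<⇒≤ j<r))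
          up : ∀ {x} → x < suc k → x < suc l
          up lt = ≤-trans lt (subst (λ z → suc k ≤ suc z) 1+k (s≤s (n≤1+n k)))
        len : suc (length (applyUpTo (w ∘ suc) i ++ R₁)) ≡ N
        len = trans (cong suc (trans (length-++ (applyUpTo (w ∘ suc) i)) (cong₂ _+_ (length-applyUpTo (w ∘ suc) i)
            (trans (length-++ S₁) (cong₂ _+_ (length-applyUpTo b₁ (suc o)) (trans (length-++ Q′) (cong₂ _+_ (length-applyUpTo (c Q) (suc k))
              (trans (length-++ S₂) (cong₂ _+_ (length-applyUpTo b₂ (suc p)) (length-applyUpTo (c P) (suc l)))))))))))
          ((lin₂ (1 ∷ 1 ∷ 0 ∷ 1 ∷ 0 ∷ 1 ∷ 0 ∷ 1 ∷ 0 ∷ []) (1 ∷ 0 ∷ 1 ∷ 0 ∷ 1 ∷ 0 ∷ 1 ∷ 0 ∷ 1 ∷ []) (i ∷ o ∷ k ∷ p ∷ l ∷ j ∷ r ∷ N ∷ []) (λ i o k p l j r N → (κ 1 ⊕ r ⊕ (κ 1 ⊕ l ⊕ (κ 1 ⊕ l)) ≐ κ 1 ⊕ N) ⇛ (κ 1 ⊕ i ⊕ p ≐ j) ⇛ (κ 1 ⊕ j ⊕ o ≐ r) ⇛ (κ 1 ⊕ k ≐ l) ⇛ ⊢ (κ 1 ⊕ (i ⊕ (κ 1 ⊕ o ⊕ (κ 1 ⊕ k ⊕ (κ 1 ⊕ p ⊕ (κ 1 ⊕ l))))) ≐ N))) size i+p j+o 1+k)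

    in-Q0 : indeg A (c Q 0) ≤ # sQ (suc r) + l
    in-Q0 = (lin₁ (1 ∷ 1 ∷ 0 ∷ 1 ∷ 1 ∷ 0 ∷ 1 ∷ 0 ∷ 1 ∷ []) (indeg A (c Q 0) ∷ # (λ i → A (w i) (c Q 0)) (suc r) ∷ # sQ (suc r) ∷ inC Q (c Q 0) ∷ inC P (c Q 0) ∷ # (λ k → A (c Q (suc k + 0)) (c Q 0)) l ∷ l ∷ []) (λ d x s y z y′ l → (d ≼ x ⊕ (y ⊕ z)) ⇛ (x ≐ s) ⇛ (y ≐ y′) ⇛ (y′ ≼ l) ⇛ (z ≐ κ 0) ⇛ ⊢ (d ≼ s ⊕ l)))
      (indeg-split _) (#-cong (suc r) λ i lt → W-Q i 0 (s≤s⁻¹ lt)) (in-self Q 0) (#≤ _ l) (#-none (suc l) λ i _ → P-Q i 0)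

    out-Q0 : outdeg A (c Q 0) ≤ # tQ (suc r) + l
    out-Q0 = (lin₁ (1 ∷ 1 ∷ 0 ∷ 1 ∷ 1 ∷ 0 ∷ 1 ∷ 0 ∷ 1 ∷ []) (outdeg A (c Q 0) ∷ # (λ i → A (c Q 0) (w i)) (suc r) ∷ # tQ (suc r) ∷ outC Q (c Q 0) ∷ outC P (c Q 0) ∷ # (λ k → A (c Q 0) (c Q (suc k + 0))) l ∷ l ∷ []) (λ d x s y z y′ l → (d ≼ x ⊕ (y ⊕ z)) ⇛ (x ≐ s) ⇛ (y ≐ y′) ⇛ (y′ ≼ l) ⇛ (z ≐ κ 0) ⇛ ⊢ (d ≼ s ⊕ l)))
      (outdeg-split _) (#-cong (suc r) λ i lt → Q-W i 0 (s≤s⁻¹ lt)) (out-self Q 0) (#≤ _ l) (#-none (suc l) λ i _ → Q-P 0 i)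

    tQ-count : # tQ (suc r) ≡ 1 + # (not ∘ sQ) r
    tQ-count = cong₂ _+_ (bit-true tQ-0) (#-cong r tQ-suc)

  module TooFew (D : Sandwich) where
    open Sandwich D
    open Analysis D

    -- Then neither Q nor P sends arcs to w_r, and by `forbidden` w_i → w_r requires that w_i sends
    -- arcs to Q. With the out-degree of a vertex of Q this gives at most r + l + 1, less than N -
    -- 1.
    last-sees : ∀ r′ → suc r′ ≡ r → sQ r′ ≡ true → sP r′ ≡ true → ⊥
    last-sees r′ refl q p = (lin₁ (2 ∷ 2 ∷ 0 ∷ 2 ∷ 1 ∷ 2 ∷ 0 ∷ 2 ∷ 0 ∷ 2 ∷ 2 ∷ 0 ∷ 2 ∷ 0 ∷ 2 ∷ 0 ∷ 2 ∷ 0 ∷ 2 ∷ 1 ∷ []) (indeg A (w r) ∷ # (λ i → A (w i) (w r)) (suc r) ∷ # (λ i → A (w i) (w r)) r ∷ bit (A (w r) (w r)) ∷ inC Q (w r) ∷ inC P (w r) ∷ # sQ r ∷ # (not ∘ sQ) r ∷ outdeg A (c Q 0) ∷ # tQ (suc r) ∷ r ∷ l ∷ N ∷ []) (λ d x x′ b y z s n o t r l N → (N ≼ 2 ⊛ d ⊕ κ 1) ⇛ (d ≼ x ⊕ (y ⊕ z)) ⇛ (x ≐ x′ ⊕ b) ⇛ (b ≐ κ 0) ⇛ (y ≐ κ 0) ⇛ (z ≐ κ 0) ⇛ (x′ ≼ s) ⇛ (s ⊕ n ≐ r) ⇛ (t ≐ κ 1 ⊕ n) ⇛ (N ≼ 2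 ⊛ o ⊕ κ 1) ⇛ (o ≼ t ⊕ l) ⇛ (κ 1 ⊕ r ⊕ (κ 1 ⊕ l ⊕ (κ 1 ⊕ l)) ≐ κ 1 ⊕ N) ⇛ (κ 1 ≼ l) ⇛ ⊢ (ff)))
        (deg-in _) (indeg-split _) (#-snoc (λ i → A (w i) (w r)) r) (bit-false (loopless _))
        (#-none (suc l) λ i _ → trans (Q-W r i ≤-refl) (trans (tQ-suc r′ ≤-refl) (cong not q)))
        (#-none (suc l) λ i _ → trans (P-W r i ≤-refl) (trans (tP-suc r′ ≤-refl) (cong not p)))
        (#-mono r only) (#-not sQ r) tQ-count (deg-out _) out-Q0 size 1≤l
      where
      only : ∀ i → i < r → w i ⇒ w r → sQ i ≡ true
      only i lt a = go (i ≟ r′)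
        where
        go : Dec (i ≡ r′) → sQ i ≡ true
        go (yes refl) = q
        go (no ne) = ¬false λ f → forbidden i r′ (≤∧≢⇒< (s≤s⁻¹ lt) ne) ≤-refl a (trans (tQ-suc i lt) (cong not f)) p

    -- Dually, w₀ has out-neighbours only in W, and by `forbidden` w_{j+1} is one of them only if
    -- w_j sends no arc to P.
    first-blind : 1 ≤ r → sQ 0 ≡ false → sP 0 ≡ false → ⊥
    first-blind 1≤r q p = (lin₁ (2 ∷ 2 ∷ 0 ∷ 2 ∷ 1 ∷ 2 ∷ 2 ∷ 0 ∷ 2 ∷ 0 ∷ 2 ∷ 2 ∷ 0 ∷ 2 ∷ 0 ∷ 2 ∷ 0 ∷ 2 ∷ 0 ∷ 2 ∷ 1 ∷ []) (outdeg A (w 0) ∷ # (λ i → A (w 0) (w i)) (suc r) ∷ # (λ i → A (w 0) (w (suc i))) r ∷ bit (A (w 0) (w 0)) ∷ outC Q (w 0) ∷ outC P (w 0) ∷ # sP r ∷ # sP (suc r) ∷ bit (sP r) ∷ # (not ∘ sP) r ∷ indeg A (c P 0) ∷ r ∷ l ∷ N ∷ []) (λ d x x′ b y z s s₁ e n i r l N → (N ≼ 2 ⊛ d ⊕ κ 1) ⇛ (d ≼ x ⊕ (y ⊕ z)) ⇛ (x ≐ b ⊕ x′) ⇛ (b ≐ κ 0) ⇛ (y ≐ κ 0) ⇛ (z ≐ κ 0) ⇛ (x′ ≼ n) ⇛ (s ⊕ n ≐ r) ⇛ (s₁ ≐ s ⊕ e) ⇛ (e ≼ κ 1) ⇛ (N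 ≼ 2 ⊛ i ⊕ κ 1) ⇛ (i ≼ s₁ ⊕ l) ⇛ (κ 1 ⊕ r ⊕ (κ 1 ⊕ l ⊕ (κ 1 ⊕ l)) ≐ κ 1 ⊕ N) ⇛ (κ 1 ≼ l) ⇛ ⊢ (ff)))
        (deg-out _) (outdeg-split _) refl (bit-false (loopless _))
        (#-none (suc l) λ i _ → trans (W-Q 0 i z≤n) q) (#-none (suc l) λ i _ → trans (W-P 0 i z≤n) p)
        (#-mono r only) (#-not sP r) (#-snoc sP r) (bit≤1 (sP r)) (deg-in _) (Analysis.in-Q0 (flip D)) size 1≤l
      where
      only : ∀ j → j < r → w 0 ⇒ w (suc j) → not (sP j) ≡ true
      only zero lt a = cong not p
      only (suc j) lt a = cong not (¬true λ s → forbidden 0 (suc j) (s≤s z≤n) lt a (trans (tQ-suc 0 1≤r) (cong not q)) s)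

  module Extreme (D : Sandwich) where
    open Sandwich D
    open Analysis D

    sQ-down : ∀ i t → t + i < r → sQ (t + i) ≡ false → sQ i ≡ false
    sQ-down i zero lt f = f
    sQ-down i (suc t) lt f = sQ-down i t (<⇒≤ lt) (¬true λ a → true≢false (sQ-up (t + i) (<⇒≤ lt) a) f)

    sP-ups : sP 0 ≡ true → ∀ i → i ≤ r → sP i ≡ true
    sP-ups a zero le = a
    sP-ups a (suc i) le = sP-up i le (sP-ups a i (<⇒≤ le))

    in-Q : ∀ {v} → v ∈ FQ → ∃ λ i → v ≡ c Q i
    in-Q v∈ = let i , _ , e = ∈-seg⁻ (c Q) (suc l) v∈ in i , e

    in-P : ∀ {v} → v ∈ FP → ∃ λ i → v ≡ c P i
    in-P v∈ = let i , _ , e = ∈-seg⁻ (c P) (suc l) v∈ in i , e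

    balanced : length FP ≡ length FQ
    balanced = trans (length-applyUpTo (c P) (suc l)) (sym (length-applyUpTo (c Q) (suc l)))

    completeQ : Complete FQ
    completeQ u∈ v∈ ne = let i , e = in-Q u∈ ; j , e′ = in-Q v∈ in subst₂ _⇒_ (sym e) (sym e′) (Q-complete j i λ q → ne (trans e (trans q (sym e′))))

    completeP : Complete FP
    completeP u∈ v∈ ne = let i , e = in-P u∈ ; j , e′ = in-P v∈ in subst₂ _⇒_ (sym e) (sym e′) (P-complete j i λ q → ne (trans e (trans q (sym e′))))

    noPQ : NoArc FP FQ
    noPQ u∈ v∈ = let i , e = in-P u∈ ; j , e′ = in-Q v∈ in subst₂ (λ u v → A u v ≡ false) (sym e) (sym e′) (P-Q i j)

    noQP : NoArc FQ FP
    noQP u∈ v∈ = let i , e = in-Q u∈ ; j , e′ = in-P v∈ in subst₂ (λ u v → A u v ≡ false) (sym e) (sym e′) (Q-P i j)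

    kk : r ≡ 0 → ⊥
    kk refl = noK FQ FP (w 0) record { spanning = unique , total-length ; balanced = sym balanced ; F-complete = completeQ ; B-complete = completeP
      ; F-B = noQP ; B-F = noPQ
      ; to-a = λ { u∈ (here refl) → [ (λ h → let i , e = in-Q h in subst (_⇒ w 0) (sym e) (trans (Q-W 0 i z≤n) tQ-0))
                                     , (λ h → let i , e = in-P h in subst (_⇒ w 0) (sym e) (trans (P-W 0 i z≤n) tP-0)) ]′ (∈-++⁻ FQ u∈) }
      ; from-a = λ { (here refl) v∈ → [ (λ h → let i , e = in-Q h in subst (w 0 ⇒_) (sym e) (trans (W-Q 0 i z≤n) sQ-r))
                                     , (λ h → let i , e = in-P h in subst (w 0 ⇒_) (sym e) (trans (W-P 0 i z≤n) sP-r)) ]′ (∈-++⁻ FQ v∈) } }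

    h2 : r ≡ 1 → sQ 0 ≡ false → sP 0 ≡ true → ⊥
    h2 refl q p = noH2 FP FQ (w 0) (w 1) record
      { spanning = swap-unique (w 0 ∷ w 1 ∷ []) FQ FP unique , trans (cong (2 +_) (trans (length-++ FP) (trans (+-comm (length FP) (length FQ)) (sym (length-++ FQ))))) total-length
      ; balanced = balanced ; F-complete = completeP ; B-complete = completeQ ; F-B = noPQ ; B-F = noQP
      ; F-x = λ { u∈ (here refl) → let i , e = in-P u∈ in subst (_⇒ w 0) (sym e) (trans (P-W 0 i z≤n) tP-0) }
      ; F-y = λ { u∈ (here refl) → let i , e = in-P u∈ in subst (λ u → A u (w 1) ≡ false) (sym e) (trans (P-W 1 i ≤-refl) (trans (tP-suc 0 ≤-refl) (cong not p))) }
      ; B-xy = λ { u∈ (here refl) → let i , e = in-Q u∈ in subst (_⇒ w 0) (sym e) (trans (Q-W 0 i z≤n) tQ-0)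
                 ; u∈ (there (here refl)) → let i , e = in-Q u∈ in subst (_⇒ w 1) (sym e) (trans (Q-W 1 i ≤-refl) (trans (tQ-suc 0 ≤-refl) (cong not q))) }
      ; x-F = λ { (here refl) v∈ → let i , e = in-P v∈ in subst (w 0 ⇒_) (sym e) (trans (W-P 0 i z≤n) p) }
      ; x-B = λ { (here refl) v∈ → let i , e = in-Q v∈ in subst (λ v → A (w 0) v ≡ false) (sym e) (trans (W-Q 0 i z≤n) q) }
      ; x-y = chain 0 ≤-refl
      ; y-FB = λ { (here refl) v∈ → [ (λ h → let i , e = in-P h in subst (w 1 ⇒_) (sym e) (trans (W-P 1 i ≤-refl) sP-r))
                                     , (λ h → let i , e = in-Q h in subst (w 1 ⇒_) (sym e) (trans (W-Q 1 i ≤-refl) sQ-r)) ]′ (∈-++⁻ FP v∈) } }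

    -- By `sQ-up` no w_i before w_r sends arcs to Q. So w₀ sends arcs to P by `first-blind`, and
    -- then all of W does. Hence P sends arcs to w₀ alone, its out-degrees are at most l + 1, and r
    -- = 1 follows: H or H′.
    blind-last : ∀ r′ → suc r′ ≡ r → sQ r′ ≡ false → ⊥
    blind-last r′ refl f = go (bool-cases (sP 0))
      where
      q0 : sQ 0 ≡ false
      q0 = sQ-down 0 r′ (≤-reflexive (cong suc (+-identityʳ r′))) (trans (cong sQ (+-identityʳ r′)) f)
      go : _ → ⊥
      go (inj₂ p) = TooFew.first-blind D (s≤s z≤n) q0 p
      go (inj₁ p) = h2 (≤-antisym r≤1 (s≤s z≤n)) q0 p
        where
        one : # tP (suc r) ≡ 1
        one = trans (Analysis.tQ-count (flip D)) (cong suc (#-none r λ i lt → cong not (sP-ups p i (<⇒≤ lt))))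
        r≤1 : r ≤ 1
        r≤1 = (lin₁ (1 ∷ 1 ∷ 0 ∷ 2 ∷ 0 ∷ 2 ∷ 1 ∷ []) (outdeg A (c P 0) ∷ # tP (suc r) ∷ r ∷ l ∷ N ∷ []) (λ d t r l N → (N ≼ 2 ⊛ d ⊕ κ 1) ⇛ (d ≼ t ⊕ l) ⇛ (t ≐ κ 1) ⇛ (κ 1 ⊕ r ⊕ (κ 1 ⊕ l ⊕ (κ 1 ⊕ l)) ≐ κ 1 ⊕ N) ⇛ ⊢ (r ≼ κ 1)))
          (deg-out _) (Analysis.out-Q0 (flip D)) one size

  sandwich-absurd : Sandwich → ⊥
  sandwich-absurd D = go r refl
    where
    open Sandwich D
    go : ∀ k → k ≡ r → ⊥
    go zero e = Extreme.kk D (sym e)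
    go (suc r′) e = cases (bool-cases (sQ r′)) (bool-cases (sP r′))
      where
      cases : _ → _ → ⊥
      cases (inj₁ q) (inj₁ p) = TooFew.last-sees D r′ e q p
      cases (inj₂ q) _ = Extreme.blind-last D r′ e q
      cases (inj₁ _) (inj₂ p) = Extreme.blind-last (flip D) r′ e p

  -- Positions normalised so that Q is avoided by c₁ … c_{l+1} and entered from c₀.
  module Normal (C : Cyc m) (Q : Cyc (suc l)) (off : ∀ i → Off C (c Q i)) (s0 : A (c C 0) (c Q 0) ≡ true)
    (zs : ∀ e → 1 ≤ e → e ≤ suc l → A (c C e) (c Q 0) ≡ false) where
    open Uniform C Q off public
    private
      h = suc l
      module E = Ext0.At 0 s0 (λ e 1≤e e≤h → trans (cong (λ z → A (c C z) (c Q 0)) (+-identityʳ e)) (zs e 1≤e e≤h))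

    h<m : h < m
    h<m = Ext0.h<m

    T-zero : ∀ e → 1 ≤ e → e ≤ h → t 0 e ≡ false
    T-zero e 1≤e e≤h = trans (cong (t 0) (sym (+-identityʳ e))) (E.t-zero e 1≤e e≤h)

    T-not : ∀ j → h ≤ j → j < m → t 0 (suc j) ≡ not (s 0 j)
    T-not j h≤j j<m = trans (cong (t 0) (sym (+-identityʳ (suc j)))) (trans (E.t-not j h≤j j<m) (cong (not ∘ s 0) (+-identityʳ j)))

    S-up : ∀ j → h < j → suc j ≤ m → s 0 j ≡ true → s 0 (suc j) ≡ true
    S-up j h<j j<m a = trans (cong (s 0) (sym (+-identityʳ (suc j)))) (E.up-closed (s≤s 1≤l) j h<j j<m (trans (cong (s 0) (+-identityʳ j)) a))

    T-first : t 0 (suc h) ≡ true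
    T-first = trans (T-not h ≤-refl h<m) (cong not (zs h (s≤s z≤n) ≤-refl))

    S-m : s 0 m ≡ true
    S-m = trans (cong (λ z → A z (c Q 0)) (c-m C)) s0

  module Build (C : Cyc m) (Q : Cyc (suc l)) (off : ∀ i → Off C (c Q i)) (s0 : A (c C 0) (c Q 0) ≡ true)
    (zs : ∀ e → 1 ≤ e → e ≤ suc l → A (c C e) (c Q 0) ≡ false) where
    private
      module F = Normal C Q off s0 zs
      h = suc l

    r : ℕ
    r = proj₁ (m≤n⇒∃[o]m+o≡n F.h<m)

    h+r : suc h + r ≡ m
    h+r = proj₂ (m≤n⇒∃[o]m+o≡n F.h<m)

    private
      FQ = applyUpTo (c Q) h
      off-FQ : ∀ i → c C (i + suc h) ∉ FQ
      off-FQ i v∈ = let j , _ , e = ∈-seg⁻ (c Q) h v∈ in off j (i + suc h) e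
      module D = Detour C (suc h) r h+r (s≤s z≤n) FQ (s0 , walk-arcs (c Q) l (λ i _ → arc Q i) (trans (F.t-all l 0 (suc h)) F.T-first))
        (seg-unique (c Q) h (inj Q)) (λ i _ → off-FQ i)
      len : suc r + length FQ ≡ m
      len = trans (cong (suc r +_) (length-applyUpTo (c Q) h)) ((lin₂ (1 ∷ 1 ∷ 0 ∷ []) (1 ∷ 0 ∷ 1 ∷ []) (l ∷ r ∷ m ∷ []) (λ l r m → (κ 2 ⊕ l ⊕ r ≐ m) ⇛ ⊢ (κ 1 ⊕ r ⊕ (κ 1 ⊕ l) ≐ m))) h+r)

    -- The cycle c₀ Q c_{h+1} ... is as long as C, and the vertices c₁, ..., c_h, now off the cycle,
    -- form the path P.
    C″ : Cyc m
    C″ = rot r (D.detour len)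

    at-0 : c C″ 0 ≡ c C 0
    at-0 = trans (D.detour-old len r ≤-refl) (trans (cong (c C) (trans (+-comm r (suc h)) h+r)) (c-m C))

    at-Q : ∀ j → j < h → c C″ (suc j) ≡ c Q j
    at-Q j lt = trans (cong (c (D.detour len)) ((lin₂ (1 ∷ []) (1 ∷ []) (j ∷ r ∷ []) (λ j r → ⊢ (κ 1 ⊕ j ⊕ r ≐ κ 1 ⊕ r ⊕ j)))))
      (trans (D.detour-new len j (subst (j <_) (sym (length-applyUpTo (c Q) h)) lt)) (at-applyUpTo _ (c Q) h j lt))

    at-W : ∀ i → i ≤ r → c C″ (suc h + i) ≡ c C (suc h + i)
    at-W i le = trans (cong (c (D.detour len)) (trans ((lin₂ (1 ∷ 1 ∷ 0 ∷ []) (1 ∷ 0 ∷ 1 ∷ []) (l ∷ i ∷ r ∷ m ∷ []) (λ l i r m → (κ 2 ⊕ l ⊕ r ≐ m) ⇛ ⊢ (κ 2 ⊕ l ⊕ i ⊕ r ≐ m ⊕ i))) h+r) refl))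
      (trans (per (D.detour len) i) (trans (D.detour-old len i le) (cong (c C) (+-comm i (suc h)))))

    P-path : FPath C″ l
    P-path = record { q = λ i → c C (suc i)
      ; q-inj = λ i j le le′ e → inj (rot 1 C) i j (small le) (small le′) (trans (cong (c C) (+-comm i 1)) (trans e (cong (c C) (+-comm 1 j))))
      ; q-arc = λ i _ → arc C (suc i)
      ; q-off = λ i le k e → let k′ , lt , e′ = cycle-window C″ k 1≤m in meet i le k′ lt (trans (sym e′) e) }
      where
      small : ∀ {i} → i ≤ l → i < m
      small le = ≤-<-trans (≤-trans le (n≤1+n l)) F.h<m
      meet : ∀ i → i ≤ l → ∀ k → k < m → c C″ k ≡ c C (suc i) → ⊥
      meet i le zero lt e = case inj C 0 (suc i) (≤-trans (s≤s z≤n) lt) (≤-<-trans (s≤s le) F.h<m) (trans (sym at-0) e) of λ ()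
      meet i le (suc j) lt e = go (j <? h)
        where
        go : Dec (j < h) → ⊥
        go (yes p) = off j (suc i) (trans (sym e) (at-Q j p))
        go (no p) = let o , eq = m≤n⇒∃[o]m+o≡n (≮⇒≥ p) in
          <⇒≢ (≤-<-trans le (≤-trans (n<1+n l) (≮⇒≥ p))) (sym (suc-injective (inj C (suc j) (suc i) lt (≤-<-trans (s≤s le) F.h<m)
            (trans (sym (trans (cong (c C″) (cong suc (sym eq))) (trans (at-W o ((lin₁ (1 ∷ 0 ∷ 1 ∷ 1 ∷ 1 ∷ 0 ∷ []) (l ∷ o ∷ j ∷ r ∷ m ∷ []) (λ l o j r m → (κ 1 ⊕ l ⊕ o ≐ j) ⇛ (κ 2 ⊕ j ≼ m) ⇛ (κ 2 ⊕ l ⊕ r ≐ m) ⇛ ⊢ (o ≼ r))) eq lt h+r)) (cong (c C) (cong suc eq))))) e))))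

  -- The cycle C″ runs through Q instead of P, and the roles of P and Q are exchanged.
  module Assemble (C : Cyc m) (Q : Cyc (suc l)) (off : ∀ i → Off C (c Q i)) (s0 : A (c C 0) (c Q 0) ≡ true)
    (zs : ∀ e → 1 ≤ e → e ≤ suc l → A (c C e) (c Q 0) ≡ false)
    (r : ℕ) (h+r : suc (suc l) + r ≡ m) (C″ : Cyc m) (at-0 : c C″ 0 ≡ c C 0)
    (at-Q : ∀ j → j < suc l → c C″ (suc j) ≡ c Q j) (at-W : ∀ i → i ≤ r → c C″ (suc (suc l) + i) ≡ c C (suc (suc l) + i))
    (P : Cyc (suc l)) (cycle-at : ∀ i → i ≤ l → c P i ≡ c C (suc i)) (cycle-off : ∀ i → Off C″ (c P i)) where
    private
      h = suc l
      module F = Normal C Q off s0 zs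
      Q-avoids-P : ∀ e → 1 ≤ e → e ≤ suc l → A (c C″ e) (c P 0) ≡ false
      Q-avoids-P (suc j) _ le = trans (cong₂ A (at-Q j le) (cycle-at 0 z≤n)) (trans (F.t-all j 0 1) (F.T-zero 1 ≤-refl (s≤s z≤n)))
      module G = Normal C″ P cycle-off (subst₂ _⇒_ (sym at-0) (sym (cycle-at 0 z≤n)) (arc C 0)) Q-avoids-P

      P-at : ∀ j → ∃ λ e → 1 ≤ e × e ≤ h × c P j ≡ c C e
      P-at j = let s , lt , e = cycle-window P j (s≤s z≤n) in suc s , s≤s z≤n , lt , trans e (cycle-at s (s≤s⁻¹ lt))

      <m : ∀ {i} → i < r → suc h + i < m
      <m {i} lt = subst (suc h + i <_) h+r (+-monoʳ-< (suc h) lt)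

      -- As h + 1 + r = m, the path W runs from c_{h+1} to c_m = c₀.
      w : ℕ → V
      w i = c C (suc h + i)

      suc-w : ∀ i → suc (suc h + i) ≡ suc h + suc i
      suc-w i = sym (+-suc (suc h) i)

    sandwich : Sandwich
    sandwich = record
      { r = r ; w = w ; Q = Q ; P = P
      ; unique = uniq
      ; size = (lin₂ (1 ∷ 1 ∷ 0 ∷ 1 ∷ 0 ∷ []) (1 ∷ 0 ∷ 1 ∷ 0 ∷ 1 ∷ []) (l ∷ r ∷ m ∷ N ∷ []) (λ l r m N → (κ 2 ⊕ l ⊕ r ≐ m) ⇛ (m ⊕ (κ 1 ⊕ l) ≐ κ 1 ⊕ N) ⇛ ⊢ (κ 1 ⊕ r ⊕ (κ 1 ⊕ l ⊕ (κ 1 ⊕ l)) ≐ κ 1 ⊕ N))) h+r m+h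
      ; Q-complete = F.complete ; P-complete = G.complete
      ; Q-P = λ i j → let e , 1≤e , e≤h , eq = P-at j in trans (cong (A (c Q i)) eq) (trans (F.t-all i 0 e) (F.T-zero e 1≤e e≤h))
      ; P-Q = λ i j → let e , 1≤e , e≤h , eq = P-at i in trans (cong (λ z → A z (c Q j)) eq) (trans (F.s-all j 0 e) (zs e 1≤e e≤h))
      ; chain = λ i _ → subst (λ z → w i ⇒ c C z) (suc-w i) (arc C (suc h + i))
      ; sQ = λ i → F.s 0 (suc h + i) ; tQ = λ i → F.t 0 (suc h + i)
      ; sP = λ i → G.s 0 (suc h + i) ; tP = λ i → G.t 0 (suc h + i)
      ; W-Q = λ i j _ → F.s-all j 0 (suc h + i)
      ; Q-W = λ i j _ → F.t-all j 0 (suc h + i)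
      ; W-P = λ i j le → trans (cong (λ z → A z (c P j)) (sym (at-W i le))) (G.s-all j 0 (suc h + i))
      ; P-W = λ i j le → trans (cong (A (c P j)) (sym (at-W i le))) (G.t-all j 0 (suc h + i))
      ; tQ-0 = trans (cong (F.t 0) (+-identityʳ (suc h))) F.T-first
      ; tP-0 = trans (cong (G.t 0) (+-identityʳ (suc h))) G.T-first
      ; tQ-suc = λ i lt → trans (cong (F.t 0) (sym (suc-w i))) (F.T-not (suc h + i) (≤-trans (n≤1+n h) (m≤m+n (suc h) i)) (<m lt))
      ; tP-suc = λ i lt → trans (cong (G.t 0) (sym (suc-w i))) (G.T-not (suc h + i) (≤-trans (n≤1+n h) (m≤m+n (suc h) i)) (<m lt))
      ; sQ-r = trans (cong (F.s 0) h+r) F.S-m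
      ; sP-r = trans (cong (G.s 0) h+r) G.S-m
      ; sQ-up = λ i lt a → trans (cong (F.s 0) (sym (suc-w i))) (F.S-up (suc h + i) (m≤m+n (suc h) i) (<m lt) a)
      ; sP-up = λ i lt a → trans (cong (G.s 0) (sym (suc-w i))) (G.S-up (suc h + i) (m≤m+n (suc h) i) (<m lt) a) }
      where
      uniq : Unique (applyUpTo w (suc r) ++ applyUpTo (c Q) h ++ applyUpTo (c P) h)
      uniq = ++-unique (seg-unique w (suc r) w-inj)
        (++-unique (seg-unique (c Q) h (inj Q)) (seg-unique (c P) h (inj P))
          λ v∈ v∈′ → let i , _ , e = ∈-seg⁻ (c Q) h v∈ ; j , _ , e′ = ∈-seg⁻ (c P) h v∈′ ; k , _ , _ , eq = P-at j in off i k (trans (sym eq) (trans (sym e′) e)))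
        λ v∈ v∈′ → let i , lt , e = ∈-seg⁻ w (suc r) v∈ in
          [ (λ p → let j , _ , e′ = ∈-seg⁻ (c Q) h p in off j (suc h + i) (trans (sym e) e′))
          , (λ p → let j , _ , e′ = ∈-seg⁻ (c P) h p in cycle-off j (suc h + i) (trans (at-W i (s≤s⁻¹ lt)) (trans (sym e) e′))) ]′ (∈-++⁻ (applyUpTo (c Q) h) v∈′)
        where
        w-inj : ∀ i j → i < suc r → j < suc r → w i ≡ w j → i ≡ j
        w-inj i j lt lt′ e = inj (rot (suc h) C) i j (≤-trans lt r<m) (≤-trans lt′ r<m) (trans (cong (c C) (+-comm i (suc h))) (trans e (cong (c C) (+-comm (suc h) j))))
          where
          r<m : suc r ≤ m
          r<m = (lin₁ (1 ∷ 1 ∷ 0 ∷ []) (l ∷ r ∷ m ∷ []) (λ l r m → (κ 2 ⊕ l ⊕ r ≐ m) ⇛ ⊢ (κ 1 ⊕ r ≼ m))) h+r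

  spanning-absurd : ∀ (C : Cyc m) → FPath C l → ⊥
  spanning-absurd C P = sandwich-absurd (Assemble.sandwich C₁ Q off₁ s0 zs B.r B.h+r B.C″ B.at-0 B.at-Q B.at-W R.cycle R.cycle-at R.cycle-off)
    where
    module E = Ends C P
    Q = E.cycle
    module U = Uniform C Q E.cycle-off
    σ = proj₁ U.Ext0.start
    C₁ = rot σ C
    off₁ : ∀ i → Off C₁ (c Q i)
    off₁ i k = E.cycle-off i (k + σ)
    s0 : A (c C₁ 0) (c Q 0) ≡ true
    s0 = proj₁ (proj₂ U.Ext0.start)
    zs : ∀ e → 1 ≤ e → e ≤ suc l → A (c C₁ e) (c Q 0) ≡ false
    zs = proj₂ (proj₂ U.Ext0.start)
    module B = Build C₁ Q off₁ s0 zs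
    -- The argument that closed Q is repeated for C″ and closes P to a cycle.
    module R = Ends B.C″ B.P-path

-- Existence of a cycle, and induction on its length

module Refutation {N : ℕ} (A : Digraph (Fin (suc N))) (S : Counterexample A) where

  open Graph
  open Cycles A
  open Counterexample S

  missed : ∀ L → length L < suc N → ∃ λ v → v ∉ L
  missed L lt = go (FinP.any? λ v → ¬? (v ∈? L))
    where
    go : Dec (∃ λ v → v ∉ L) → ∃ λ v → v ∉ L
    go (yes p) = p
    go (no none) = ⊥-elim (<⇒≱ lt (subst (_≤ length L) (length-tabulate {n = suc N} (λ i → i))
      (length-⊆ (allFin (suc N)) L (Uniq.allFin⁺ (suc N)) λ {v} _ → in-L v (v ∈? L))))
      where
      in-L : ∀ v → Dec (v ∈ L) → v ∈ L
      in-L v (yes p) = p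
      in-L v (no n) = ⊥-elim (none (v , n))

  -- Induction on d = N - m: for smaller d the hypothesis refutes every longer cycle of length at
  -- most N, so C may be taken as a longest one.
  cycle-absurd : ∀ d m → m + d ≡ N → 2 ≤ m → Cyc m → ⊥
  cycle-absurd = <-rec _ step
    where
    step : ∀ d → (∀ {e} → e < d → ∀ m → m + e ≡ N → 2 ≤ m → Cyc m → ⊥) → ∀ m → m + d ≡ N → 2 ≤ m → Cyc m → ⊥
    step zero rec m eq 2≤m C = noC (subst Cyc (trans (sym (+-identityʳ m)) eq) C)
    step (suc d) rec m eq 2≤m C = go (missed (applyUpTo (c C) m) (subst (_< suc N) (sym (length-applyUpTo (c C) m)) (m≤n⇒m≤1+n m<N)))
      where
      m<N : suc m ≤ N
      m<N = (lin₁ (1 ∷ 1 ∷ 0 ∷ []) (m ∷ d ∷ N ∷ []) (λ m d N → (m ⊕ (κ 1 ⊕ d) ≐ N) ⇛ ⊢ (κ 1 ⊕ m ≼ N))) eq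
      longest : ∀ k → m < k → k ≤ N → Cyc k → ⊥
      longest k m<k k≤N D = let b , e = m≤n⇒∃[o]m+o≡n k≤N in
        rec {b} ((lin₁ (1 ∷ 0 ∷ 1 ∷ 1 ∷ 0 ∷ 1 ∷ []) (b ∷ k ∷ m ∷ d ∷ N ∷ []) (λ b k m d N → (κ 1 ⊕ m ≼ k) ⇛ (k ⊕ b ≐ N) ⇛ (m ⊕ (κ 1 ⊕ d) ≐ N) ⇛ ⊢ (κ 1 ⊕ b ≼ κ 1 ⊕ d))) m<k e eq) k e (≤-trans 2≤m (<⇒≤ m<k)) D
      go : (∃ λ z → z ∉ applyUpTo (c C) m) → ⊥
      go (z , z∉) = SpanningPath.spanning-path A S m 2≤m m<N longest C
        (λ l e → Sandwiched.spanning-absurd A S m l e 2≤m ((lin₁ (1 ∷ 1 ∷ 0 ∷ 1 ∷ []) (m ∷ l ∷ N ∷ []) (λ m l N → (m ⊕ (κ 1 ⊕ l) ≐ κ 1 ⊕ N) ⇛ (κ 1 ⊕ m ≼ N) ⇛ ⊢ (κ 1 ≼ l))) e m<N) longest C)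
        (suc d) 0 (trans ((lin₂ (1 ∷ 1 ∷ 0 ∷ []) (1 ∷ 0 ∷ 1 ∷ []) (m ∷ d ∷ N ∷ []) (λ m d N → (m ⊕ (κ 1 ⊕ d) ≐ N) ⇛ ⊢ (m ⊕ κ 1 ⊕ (κ 1 ⊕ d) ≐ κ 1 ⊕ N))) eq) refl)
        record { q = λ _ → z ; q-inj = λ { zero zero _ _ _ → refl } ; q-arc = λ _ ()
               ; q-off = λ _ _ k e → let s , lt , e′ = cycle-window C k (<⇒≤ 2≤m) in z∉ (subst (_∈ applyUpTo (c C) m) (trans (sym e′) e) (∈-applyUpTo⁺ (c C) lt)) }

  record Chain (l : ℕ) : Set where
    field
      q : ℕ → V
      q-inj : ∀ i j → i ≤ l → j ≤ l → q i ≡ q j → i ≡ j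
      q-arc : ∀ i → i < l → q i ⇒ q (suc i)

    whole : List V
    whole = applyUpTo q (suc l)

  -- As N ≥ 4, q₀ has at least two in-neighbours, all on the path, so one of them is not q_l; this
  -- keeps the cycle it closes at length at most N.
  maximal-absurd : ∀ l (P : Chain l) → (∀ u → u ⇒ Chain.q P 0 → u ∈ Chain.whole P) → ⊥
  maximal-absurd l P shut = go (#-find f l two)
    where
    open Chain P
    f : ℕ → Bool
    f i = A (q i) (q 0)
    two : 1 ≤ # f l
    two = (lin₁ (2 ∷ 2 ∷ 2 ∷ 0 ∷ 2 ∷ 1 ∷ 1 ∷ []) (indeg A (q 0) ∷ # f l ∷ # f (suc l) ∷ bit (f l) ∷ N ∷ []) (λ d n n′ b N → (κ 4 ≼ N) ⇛ (N ≼ 2 ⊛ d ⊕ κ 1) ⇛ (d ≼ n′) ⇛ (n′ ≐ n ⊕ b) ⇛ (b ≼ κ 1) ⇛ ⊢ (κ 1 ≼ n)))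
      order (deg-in (q 0)) (≤-trans (indeg≤ (q 0) whole shut) (≤-reflexive (cnt-applyUpTo (λ u → A u (q 0)) q (suc l)))) (#-snoc f l) (bit≤1 (f l))
    uniq = seg-unique q (suc l) λ i j lt lt′ → q-inj i j (s≤s⁻¹ lt) (s≤s⁻¹ lt′)
    l≤N : suc l ≤ suc N
    l≤N = subst (_≤ suc N) (length-applyUpTo q (suc l)) (unique-length whole uniq)
    go : (∃ λ j → j < l × f j ≡ true) → ⊥
    go (zero , _ , a) = loop-free a refl
    go (suc j , lt , a) = let d , e = m≤n⇒∃[o]m+o≡n {2 + j} {N} (≤-trans lt (s≤s⁻¹ l≤N)) in cycle-absurd d (2 + j) e (s≤s (s≤s z≤n)) C
      where
      C : Cyc (2 + j)
      C = close (q 0) (applyUpTo (q ∘ suc) (suc j)) (cong suc (length-applyUpTo (q ∘ suc) (suc j)))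
        (walk-arcs q (suc j) (λ i lt′ → q-arc i (≤-trans lt′ (<⇒≤ lt))) a)
        (seg-unique q (2 + j) λ i k lt′ lt″ → q-inj i k (≤-trans (s≤s⁻¹ lt′) (<⇒≤ lt)) (≤-trans (s≤s⁻¹ lt″) (<⇒≤ lt)))

  grow : ∀ d l → suc l + d ≡ suc N → Chain l → ⊥
  grow d l eq P = maximal-absurd l P shut
    where
    open Chain P
    shut : ∀ u → u ⇒ q 0 → u ∈ whole
    shut z a = go (z ∈? whole)
      where
      go : Dec (z ∈ whole) → z ∈ whole
      go (yes p) = p
      go (no z∉) = ⊥-elim (longer d eq)
        where
        fresh : ∀ i → i ≤ l → q i ≢ z
        fresh i le e = z∉ (subst (_∈ whole) e (∈-applyUpTo⁺ q (s≤s le)))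
        q′ : ℕ → V
        q′ zero = z
        q′ (suc i) = q i
        P′ : Chain (suc l)
        P′ = record { q = q′ ; q-inj = inj′ ; q-arc = arc′ }
          where
          inj′ : ∀ i j → i ≤ suc l → j ≤ suc l → q′ i ≡ q′ j → i ≡ j
          inj′ zero zero _ _ _ = refl
          inj′ zero (suc j) _ le e = ⊥-elim (fresh j (s≤s⁻¹ le) (sym e))
          inj′ (suc i) zero le _ e = ⊥-elim (fresh i (s≤s⁻¹ le) e)
          inj′ (suc i) (suc j) le le′ e = cong suc (q-inj i j (s≤s⁻¹ le) (s≤s⁻¹ le′) e)
          arc′ : ∀ i → i < suc l → q′ i ⇒ q′ (suc i)
          arc′ zero _ = a
          arc′ (suc i) lt = q-arc i (s≤s⁻¹ lt)
        longer : ∀ d → suc l + d ≡ suc N → ⊥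
        longer zero e = <⇒≱ (subst (suc N <_) (sym (length-applyUpTo q′ (2 + l))) (s≤s (≤-reflexive (trans (sym e) (+-identityʳ (suc l))))))
          (unique-length (applyUpTo q′ (2 + l)) (seg-unique q′ (2 + l) λ i j lt lt′ → Chain.q-inj P′ i j (s≤s⁻¹ lt) (s≤s⁻¹ lt′)))
        longer (suc d) e = grow d (suc l) (trans (sym (+-suc (suc l) d)) e) P′

  counterexample-absurd : ⊥
  counterexample-absurd = grow N 0 refl record { q = λ _ → Fin.zero ; q-inj = λ { zero zero _ _ _ → refl } ; q-arc = λ _ () }

-- From vertex lists to isomorphisms with the models

module Models {N : ℕ} (A : Digraph (Fin (suc N))) (loopless : Loopless A) (deg : ∀ v → N ≤ indeg A v + outdeg A v) where

  open Graph
  open Cycles A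
  open Setup
  open Structures A

  make-iso : ∀ {M : Set} {D : Digraph M} (g : M → V) → (∀ {u v} → g u ≡ g v → u ≡ v) → (∀ x → ∃ λ u → g u ≡ x) →
    (∀ u v → A (g u) (g v) ≡ D u v) → Iso A D
  make-iso {M} {D} g g-inj surj arcs = mk↔ₛ′ to g (λ u → g-inj (proj₂ (surj (g u)))) (λ x → proj₂ (surj x)) ,
      λ x y → trans (sym (cong₂ A (proj₂ (surj x)) (proj₂ (surj y)))) (arcs (to x) (to y))
    where
    to : V → M
    to x = proj₁ (surj x)

  module Enum (L : List V) (n : ℕ) (len : length L ≡ n) (u : Unique L) where
    pt : Fin n → V
    pt i = at Fin.zero L (toℕ i)

    pt< : ∀ (i : Fin n) → toℕ i < length L
    pt< i = subst (toℕ i <_) (sym len) (FinP.toℕ<n i)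

    pt-∈ : ∀ i → pt i ∈ L
    pt-∈ i = at-∈ Fin.zero L (toℕ i) (pt< i)

    pt-inj : ∀ {i j} → pt i ≡ pt j → i ≡ j
    pt-inj {i} {j} e = FinP.toℕ-injective (at-inj Fin.zero L u _ _ (pt< i) (pt< j) e)

    pt-surj : ∀ {v} → v ∈ L → ∃ λ i → pt i ≡ v
    pt-surj v∈ = let i , lt , e = ∈-at Fin.zero L v∈ in
      fromℕ< (subst (i <_) len lt) , trans (cong (at Fin.zero L) (FinP.toℕ-fromℕ< (subst (i <_) len lt))) e

    complete-arc : Complete L → ∀ i j → A (pt i) (pt j) ≡ not (i == j)
    complete-arc comp i j = go (i FinP.≟ j)
      where
      go : (d : Dec (i ≡ j)) → A (pt i) (pt j) ≡ not ⌊ d ⌋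
      go (yes refl) = loopless _
      go (no ne) = comp (pt-∈ i) (pt-∈ j) (ne ∘ pt-inj)

  half-double : ∀ n → (n + n) / 2 ≡ n
  half-double n = trans (cong (_/ 2) (trans (cong (n +_) (sym (+-identityʳ n))) (*-comm 2 n))) (m*n/n≡m n 2)

  half-double-suc : ∀ n → suc (n + n) / 2 ≡ n
  half-double-suc n = trans (+-distrib-/-∣ʳ 1 {n + n} {2} (divides n (trans (cong (n +_) (sym (+-identityʳ n))) (*-comm 2 n)))) (half-double n)

  cnt≤ : ∀ (f : V → Bool) L → cnt f L ≤ length L
  cnt≤ f [] = z≤n
  cnt≤ f (x ∷ L) = +-mono-≤ (bit≤1 (f x)) (cnt≤ f L)

  cnt-none : ∀ (f : V → Bool) L → (∀ {x} → x ∈ L → f x ≡ false) → cnt f L ≡ 0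
  cnt-none f [] h = refl
  cnt-none f (x ∷ L) h = cong₂ _+_ (bit-false (h (here refl))) (cnt-none f L (h ∘ there))

  cnt-find : ∀ (f : V → Bool) L → 1 ≤ cnt f L → ∃ λ x → x ∈ L × f x ≡ true
  cnt-find f (x ∷ L) le = go (bool-cases (f x))
    where
    go : f x ≡ true ⊎ f x ≡ false → ∃ λ y → y ∈ x ∷ L × f y ≡ true
    go (inj₁ e) = x , here refl , e
    go (inj₂ e) = let y , y∈ , e′ = cnt-find f L (subst (λ z → 1 ≤ z + cnt f L) (bit-false e) le) in y , there y∈ , e′

  cnt-miss : ∀ (f : V → Bool) L {x} → x ∈ L → f x ≡ false → cnt f L + 1 ≤ length L
  cnt-miss f (x ∷ L) (here refl) e = (lin₁ (1 ∷ 1 ∷ 1 ∷ 0 ∷ []) (bit (f x) ∷ cnt f L ∷ length L ∷ []) (λ b n l → (b ≐ κ 0) ⇛ (n ≼ l) ⇛ ⊢ (b ⊕ n ⊕ κ 1 ≼ κ 1 ⊕ l))) (bit-false e) (cnt≤ f L)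
  cnt-miss f (y ∷ L) (there x∈) e = (lin₁ (1 ∷ 1 ∷ 1 ∷ []) (bit (f y) ∷ cnt f L ∷ length L ∷ []) (λ b n l → (b ≼ κ 1) ⇛ (n ⊕ κ 1 ≼ l) ⇛ ⊢ (b ⊕ n ⊕ κ 1 ≼ κ 1 ⊕ l))) (bit≤1 (f y)) (cnt-miss f L x∈ e)

  cnt-miss² : ∀ (f : V → Bool) L {x y} → x ∈ L → y ∈ L → x ≢ y → f x ≡ false → f y ≡ false → cnt f L + 2 ≤ length L
  cnt-miss² f (_ ∷ L) (here refl) (here refl) ne _ _ = ⊥-elim (ne refl)
  cnt-miss² f (x ∷ L) (here refl) (there y∈) ne e e′ = (lin₁ (1 ∷ 1 ∷ 1 ∷ 0 ∷ []) (bit (f x) ∷ cnt f L ∷ length L ∷ []) (λ b n l → (b ≐ κ 0) ⇛ (n ⊕ κ 1 ≼ l) ⇛ ⊢ (b ⊕ n ⊕ κ 2 ≼ κ 1 ⊕ l))) (bit-false e) (cnt-miss f L y∈ e′)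
  cnt-miss² f (y ∷ L) (there x∈) (here refl) ne e e′ = (lin₁ (1 ∷ 1 ∷ 1 ∷ 0 ∷ []) (bit (f y) ∷ cnt f L ∷ length L ∷ []) (λ b n l → (b ≐ κ 0) ⇛ (n ⊕ κ 1 ≼ l) ⇛ ⊢ (b ⊕ n ⊕ κ 2 ≼ κ 1 ⊕ l))) (bit-false e′) (cnt-miss f L x∈ e)
  cnt-miss² f (z ∷ L) (there x∈) (there y∈) ne e e′ = (lin₁ (1 ∷ 1 ∷ 1 ∷ []) (bit (f z) ∷ cnt f L ∷ length L ∷ []) (λ b n l → (b ≼ κ 1) ⇛ (n ⊕ κ 2 ≼ l) ⇛ ⊢ (b ⊕ n ⊕ κ 2 ≼ κ 1 ⊕ l))) (bit≤1 (f z)) (cnt-miss² f L x∈ y∈ ne e e′)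

  indeg-++ : ∀ L M → Spanning (L ++ M) → ∀ v → indeg A v ≤ cnt (λ u → A u v) L + cnt (λ u → A u v) M
  indeg-++ L M (u , e) v = ≤-trans (count-≤ (λ u → A u v) (L ++ M) λ w _ → cover (L ++ M) u (≤-reflexive (sym e)) w) (≤-reflexive (cnt-++ _ L M))

  outdeg-++ : ∀ L M → Spanning (L ++ M) → ∀ v → outdeg A v ≤ cnt (A v) L + cnt (A v) M
  outdeg-++ L M (u , e) v = ≤-trans (count-≤ (A v) (L ++ M) λ w _ → cover (L ++ M) u (≤-reflexive (sym e)) w) (≤-reflexive (cnt-++ _ L M))

  module _ {F B : List V} (H : IsH F B) where
    open IsH H
    private
      n = length F
      u = proj₁ spanning
      module EF = Enum F n refl (++-unique-left F u)
      module EB = Enum B n (sym balanced) (++-unique-right F u)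
      R : Fin n → Fin n → Bool
      R i j = A (EF.pt i) (EB.pt j)
      g : Fin n ⊎ Fin n → V
      g = [ EF.pt , EB.pt ]′
      size : n + n ≡ suc N
      size = trans (cong (n +_) balanced) (trans (sym (length-++ F)) (proj₂ spanning))
      g-inj : ∀ {x y} → g x ≡ g y → x ≡ y
      g-inj {inj₁ i} {inj₁ j} e = cong inj₁ (EF.pt-inj e)
      g-inj {inj₁ i} {inj₂ j} e = ⊥-elim (++-disjoint F u (EF.pt-∈ i) (subst (_∈ B) (sym e) (EB.pt-∈ j)))
      g-inj {inj₂ i} {inj₁ j} e = ⊥-elim (++-disjoint F u (EF.pt-∈ j) (subst (_∈ B) e (EB.pt-∈ i)))
      g-inj {inj₂ i} {inj₂ j} e = cong inj₂ (EB.pt-inj e)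
      surj : ∀ x → ∃ λ y → g y ≡ x
      surj x = [ (λ x∈ → let i , e = EF.pt-surj x∈ in inj₁ i , e) , (λ x∈ → let i , e = EB.pt-surj x∈ in inj₂ i , e) ]′
        (∈-++⁻ F (cover (F ++ B) u (≤-reflexive (sym (proj₂ spanning))) x))
      arcs : ∀ x y → A (g x) (g y) ≡ HModel n R x y
      arcs (inj₁ i) (inj₁ j) = EF.complete-arc F-complete i j
      arcs (inj₁ i) (inj₂ j) = refl
      arcs (inj₂ i) (inj₁ j) = no-back (EB.pt-∈ i) (EF.pt-∈ j)
      arcs (inj₂ i) (inj₂ j) = EB.complete-arc B-complete i j
      -- Within F a vertex has at most 2 (n - 1) arcs and none arrives from B, so the degree 2 n - 1
      -- requires an arc to B.
      out-B : ∀ i → 1 ≤ cnt (A (EF.pt i)) B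
      out-B i = (lin₁ (1 ∷ 1 ∷ 0 ∷ 1 ∷ 1 ∷ 1 ∷ 0 ∷ 1 ∷ 1 ∷ 1 ∷ []) (indeg A v ∷ outdeg A v ∷ cnt (λ w → A w v) F ∷ cnt (λ w → A w v) B ∷ cnt (A v) F ∷ cnt (A v) B ∷ n ∷ N ∷ []) (λ d o a b a′ b′ n N → (N ≼ d ⊕ o) ⇛ (d ≼ a ⊕ b) ⇛ (o ≼ a′ ⊕ b′) ⇛ (b ≐ κ 0) ⇛ (a ⊕ κ 1 ≼ n) ⇛ (a′ ⊕ κ 1 ≼ n) ⇛ (n ⊕ n ≐ κ 1 ⊕ N) ⇛ ⊢ (κ 1 ≼ b′)))
        (deg v) (indeg-++ F B spanning v) (outdeg-++ F B spanning v) (cnt-none _ B λ w∈ → no-back w∈ (EF.pt-∈ i))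
        (cnt-miss _ F (EF.pt-∈ i) (loopless v)) (cnt-miss _ F (EF.pt-∈ i) (loopless v)) size
        where v = EF.pt i
      in-F : ∀ j → 1 ≤ cnt (λ w → A w (EB.pt j)) F
      in-F j = (lin₁ (1 ∷ 1 ∷ 0 ∷ 0 ∷ 2 ∷ 1 ∷ 1 ∷ 1 ∷ 0 ∷ 1 ∷ 1 ∷ 1 ∷ []) (indeg A v ∷ outdeg A v ∷ cnt (λ w → A w v) F ∷ cnt (λ w → A w v) B ∷ cnt (A v) F ∷ cnt (A v) B ∷ n ∷ length B ∷ N ∷ []) (λ d o a b a′ b′ n n′ N → (N ≼ d ⊕ o) ⇛ (d ≼ a ⊕ b) ⇛ (o ≼ a′ ⊕ b′) ⇛ (a′ ≐ κ 0) ⇛ (b ⊕ κ 1 ≼ n′) ⇛ (b′ ⊕ κ 1 ≼ n′) ⇛ (n ≐ n′) ⇛ (n ⊕ n ≐ κ 1 ⊕ N) ⇛ ⊢ (κ 1 ≼ a)))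
        (deg v) (indeg-++ F B spanning v) (outdeg-++ F B spanning v) (cnt-none _ F λ w∈ → no-back (EB.pt-∈ j) w∈)
        (cnt-miss _ B (EB.pt-∈ j) (loopless v)) (cnt-miss _ B (EB.pt-∈ j) (loopless v)) balanced size
        where v = EB.pt j

    toH : InCalH A (suc N / 2)
    toH = subst (InCalH A) (trans (sym (half-double n)) (cong (_/ 2) size))
      (R , ((λ i → let y , y∈ , e = cnt-find _ B (out-B i) ; j , q = EB.pt-surj y∈ in j , trans (cong (A (EF.pt i)) q) e)
         , (λ j → let y , y∈ , e = cnt-find _ F (in-F j) ; i , q = EF.pt-surj y∈ in i , trans (cong (λ z → A z (EB.pt j)) q) e))
        , make-iso g g-inj surj arcs)

  module _ {X Y : List V} (H : IsB X Y) where
    open IsB H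
    private
      n = length X
      u = proj₁ spanning
      module EX = Enum X n refl (++-unique-left X u)
      module EY = Enum Y n (sym balanced) (++-unique-right X u)
      W = Fin n ⊎ Fin n
      g : W → V
      g = [ EX.pt , EY.pt ]′
      size : n + n ≡ suc N
      size = trans (cong (n +_) balanced) (trans (sym (length-++ X)) (proj₂ spanning))
      g-inj : ∀ {x y} → g x ≡ g y → x ≡ y
      g-inj {inj₁ i} {inj₁ j} e = cong inj₁ (EX.pt-inj e)
      g-inj {inj₁ i} {inj₂ j} e = ⊥-elim (++-disjoint X u (EX.pt-∈ i) (subst (_∈ Y) (sym e) (EY.pt-∈ j)))
      g-inj {inj₂ i} {inj₁ j} e = ⊥-elim (++-disjoint X u (EX.pt-∈ j) (subst (_∈ Y) e (EY.pt-∈ i)))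
      g-inj {inj₂ i} {inj₂ j} e = cong inj₂ (EY.pt-inj e)
      surj : ∀ x → ∃ λ y → g y ≡ x
      surj x = [ (λ x∈ → let i , e = EX.pt-surj x∈ in inj₁ i , e) , (λ x∈ → let i , e = EY.pt-surj x∈ in inj₂ i , e) ]′
        (∈-++⁻ X (cover (X ++ Y) u (≤-reflexive (sym (proj₂ spanning))) x))
      del : Digraph W
      del x y = cross x y ∧ not (A (g x) (g y))
      arcs : ∀ x y → A (g x) (g y) ≡ BModel n del x y
      arcs (inj₁ i) (inj₁ j) = X-independent (EX.pt-∈ i) (EX.pt-∈ j)
      arcs (inj₁ i) (inj₂ j) = not-not (A (EX.pt i) (EY.pt j))
        where
        not-not : ∀ b → b ≡ not (not b)
        not-not true = refl
        not-not false = refl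
      arcs (inj₂ i) (inj₁ j) = not-not (A (EY.pt i) (EX.pt j))
        where
        not-not : ∀ b → b ≡ not (not b)
        not-not true = refl
        not-not false = refl
      arcs (inj₂ i) (inj₂ j) = Y-independent (EY.pt-∈ i) (EY.pt-∈ j)
      opp : W → List V
      opp (inj₁ _) = Y
      opp (inj₂ _) = X
      opp-length : ∀ w → length (opp w) ≡ n
      opp-length (inj₁ _) = sym balanced
      opp-length (inj₂ _) = refl
      opp-∈ : ∀ x y → cross x y ≡ true → g y ∈ opp x × g x ∈ opp y
      opp-∈ (inj₁ i) (inj₂ j) _ = EY.pt-∈ j , EX.pt-∈ i
      opp-∈ (inj₂ i) (inj₁ j) _ = EX.pt-∈ j , EY.pt-∈ i
      opp-deg : ∀ w → N ≤ cnt (λ v → A v (g w)) (opp w) + cnt (A (g w)) (opp w)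
      opp-deg (inj₁ i) = (lin₁ (1 ∷ 1 ∷ 0 ∷ 1 ∷ 0 ∷ 1 ∷ 1 ∷ 1 ∷ []) (indeg A v ∷ outdeg A v ∷ cnt (λ w → A w v) X ∷ cnt (λ w → A w v) Y ∷ cnt (A v) X ∷ cnt (A v) Y ∷ N ∷ []) (λ d o a b a′ b′ N → (N ≼ d ⊕ o) ⇛ (d ≼ a ⊕ b) ⇛ (o ≼ a′ ⊕ b′) ⇛ (a ≐ κ 0) ⇛ (a′ ≐ κ 0) ⇛ ⊢ (N ≼ b ⊕ b′)))
        (deg v) (indeg-++ X Y spanning v) (outdeg-++ X Y spanning v) (cnt-none _ X λ w∈ → X-independent w∈ (EX.pt-∈ i)) (cnt-none _ X λ w∈ → X-independent (EX.pt-∈ i) w∈)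
        where v = EX.pt i
      opp-deg (inj₂ i) = (lin₁ (1 ∷ 1 ∷ 0 ∷ 1 ∷ 0 ∷ 1 ∷ 1 ∷ 1 ∷ []) (indeg A v ∷ outdeg A v ∷ cnt (λ w → A w v) X ∷ cnt (λ w → A w v) Y ∷ cnt (A v) X ∷ cnt (A v) Y ∷ N ∷ []) (λ d o a b a′ b′ N → (N ≼ d ⊕ o) ⇛ (d ≼ a ⊕ b) ⇛ (o ≼ a′ ⊕ b′) ⇛ (b ≐ κ 0) ⇛ (b′ ≐ κ 0) ⇛ ⊢ (N ≼ a ⊕ a′)))
        (deg v) (indeg-++ X Y spanning v) (outdeg-++ X Y spanning v) (cnt-none _ Y λ w∈ → Y-independent w∈ (EY.pt-∈ i)) (cnt-none _ Y λ w∈ → Y-independent (EY.pt-∈ i) w∈)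
        where v = EY.pt i
      del⁻ : ∀ x y → del x y ≡ true → cross x y ≡ true × A (g x) (g y) ≡ false
      del⁻ x y = go (cross x y) (A (g x) (g y))
        where
        go : ∀ a b → a ∧ not b ≡ true → a ≡ true × b ≡ false
        go true false _ = refl , refl
      -- A vertex has degree at least 2 n - 1 out of 2 n possible arcs, so at most one is missing;
      -- `miss-in` and `miss-both` rest on the same count.
      miss-out : ∀ w {y y′} → y ∈ opp w → y′ ∈ opp w → A (g w) y ≡ false → A (g w) y′ ≡ false → y ≡ y′
      miss-out w {y} {y′} y∈ y′∈ e e′ = go (y FinP.≟ y′)
        where
        go : Dec (y ≡ y′) → y ≡ y′
        go (yes q) = q
        go (no ne) = ⊥-elim ((lin₁ (1 ∷ 0 ∷ 2 ∷ 0 ∷ 1 ∷ 1 ∷ 1 ∷ []) (cnt (λ v → A v (g w)) (opp w) ∷ cnt (A (g w)) (opp w) ∷ n ∷ length (opp w) ∷ N ∷ []) (λ a b n m N → (N ≼ a ⊕ b) ⇛ (a ≼ m) ⇛ (b ⊕ κ 2 ≼ m) ⇛ (m ≐ n) ⇛ (n ⊕ n ≐ κ 1 ⊕ N) ⇛ ⊢ (ff))) (opp-deg w) (cnt≤ _ (opp w)) (cnt-miss² _ (opp w) y∈ y′∈ ne e e′) (opp-length w) size)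
      miss-in : ∀ w {y y′} → y ∈ opp w → y′ ∈ opp w → A y (g w) ≡ false → A y′ (g w) ≡ false → y ≡ y′
      miss-in w {y} {y′} y∈ y′∈ e e′ = go (y FinP.≟ y′)
        where
        go : Dec (y ≡ y′) → y ≡ y′
        go (yes q) = q
        go (no ne) = ⊥-elim ((lin₁ (1 ∷ 0 ∷ 2 ∷ 0 ∷ 1 ∷ 1 ∷ 1 ∷ []) (cnt (λ v → A v (g w)) (opp w) ∷ cnt (A (g w)) (opp w) ∷ n ∷ length (opp w) ∷ N ∷ []) (λ a b n m N → (N ≼ a ⊕ b) ⇛ (b ≼ m) ⇛ (a ⊕ κ 2 ≼ m) ⇛ (m ≐ n) ⇛ (n ⊕ n ≐ κ 1 ⊕ N) ⇛ ⊢ (ff))) (opp-deg w) (cnt≤ _ (opp w)) (cnt-miss² _ (opp w) y∈ y′∈ ne e e′) (opp-length w) size)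
      miss-both : ∀ w {y y′} → y ∈ opp w → y′ ∈ opp w → A y (g w) ≡ false → A (g w) y′ ≡ false → ⊥
      miss-both w y∈ y′∈ e e′ = (lin₁ (1 ∷ 0 ∷ 2 ∷ 0 ∷ 1 ∷ 1 ∷ 1 ∷ []) (cnt (λ v → A v (g w)) (opp w) ∷ cnt (A (g w)) (opp w) ∷ n ∷ length (opp w) ∷ N ∷ []) (λ a b n m N → (N ≼ a ⊕ b) ⇛ (a ⊕ κ 1 ≼ m) ⇛ (b ⊕ κ 1 ≼ m) ⇛ (m ≐ n) ⇛ (n ⊕ n ≐ κ 1 ⊕ N) ⇛ ⊢ (ff))) (opp-deg w) (cnt-miss _ (opp w) y∈ e) (cnt-miss _ (opp w) y′∈ e′) (opp-length w) size
      valid : ValidDel n del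
      valid = (λ x y d → proj₁ (del⁻ x y d)) , disjoint
        where
        disjoint : ∀ x y x′ y′ → del x y ≡ true → del x′ y′ ≡ true → (x ≡ x′ ⊎ x ≡ y′ ⊎ y ≡ x′ ⊎ y ≡ y′) → x ≡ x′ × y ≡ y′
        disjoint x y x′ y′ d d′ s = go (del⁻ x y d) (del⁻ x′ y′ d′) s
          where
          go : cross x y ≡ true × A (g x) (g y) ≡ false → cross x′ y′ ≡ true × A (g x′) (g y′) ≡ false →
            (x ≡ x′ ⊎ x ≡ y′ ⊎ y ≡ x′ ⊎ y ≡ y′) → x ≡ x′ × y ≡ y′
          go (p , e) (p′ , e′) (inj₁ refl) = refl , g-inj (miss-out x (proj₁ (opp-∈ x y p)) (proj₁ (opp-∈ x y′ p′)) e e′)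
          go (p , e) (p′ , e′) (inj₂ (inj₁ refl)) = ⊥-elim (miss-both x (proj₂ (opp-∈ x′ x p′)) (proj₁ (opp-∈ x y p)) e′ e)
          go (p , e) (p′ , e′) (inj₂ (inj₂ (inj₁ refl))) = ⊥-elim (miss-both y (proj₂ (opp-∈ x y p)) (proj₁ (opp-∈ y y′ p′)) e e′)
          go (p , e) (p′ , e′) (inj₂ (inj₂ (inj₂ refl))) = g-inj (miss-in y (proj₂ (opp-∈ x y p)) (proj₂ (opp-∈ x′ y p′)) e e′) , refl

    toB : InCalB A (suc N / 2)
    toB = subst (InCalB A) (trans (sym (half-double n)) (cong (_/ 2) size)) (del , valid , make-iso g g-inj surj arcs)

  module _ {F B : List V} {a : V} (H : IsK F B a) where
    open IsK H
    private
      n = length F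
      u = unique-tail (proj₁ spanning)
      a∉ = unique-∉ (proj₁ spanning)
      module EF = Enum F n refl (++-unique-left F u)
      module EB = Enum B n (sym balanced) (++-unique-right F u)
      inF : ∀ i → EF.pt i ∈ F ++ B
      inF i = ∈-++⁺ˡ (EF.pt-∈ i)
      inB : ∀ i → EB.pt i ∈ F ++ B
      inB i = ∈-++⁺ʳ F (EB.pt-∈ i)
      g : KV n → V
      g (k₁ i) = EF.pt i
      g (k₂ i) = EB.pt i
      g apex = a
      size : suc (n + n) ≡ suc N
      size = trans (cong suc (trans (cong (n +_) balanced) (sym (length-++ F)))) (proj₂ spanning)
      g-inj : ∀ {x y} → g x ≡ g y → x ≡ y
      g-inj {k₁ i} {k₁ j} e = cong k₁ (EF.pt-inj e)
      g-inj {k₁ i} {k₂ j} e = ⊥-elim (++-disjoint F u (EF.pt-∈ i) (subst (_∈ B) (sym e) (EB.pt-∈ j)))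
      g-inj {k₁ i} {apex} e = ⊥-elim (a∉ (subst (_∈ F ++ B) e (inF i)))
      g-inj {k₂ i} {k₁ j} e = ⊥-elim (++-disjoint F u (EF.pt-∈ j) (subst (_∈ B) e (EB.pt-∈ i)))
      g-inj {k₂ i} {k₂ j} e = cong k₂ (EB.pt-inj e)
      g-inj {k₂ i} {apex} e = ⊥-elim (a∉ (subst (_∈ F ++ B) e (inB i)))
      g-inj {apex} {k₁ j} e = ⊥-elim (a∉ (subst (_∈ F ++ B) (sym e) (inF j)))
      g-inj {apex} {k₂ j} e = ⊥-elim (a∉ (subst (_∈ F ++ B) (sym e) (inB j)))
      g-inj {apex} {apex} e = refl
      surj : ∀ x → ∃ λ y → g y ≡ x
      surj x = go (cover (a ∷ F ++ B) (proj₁ spanning) (≤-reflexive (sym (proj₂ spanning))) x)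
        where
        go : x ∈ a ∷ F ++ B → ∃ λ y → g y ≡ x
        go (here e) = apex , sym e
        go (there x∈) = [ (λ x∈ → let i , e = EF.pt-surj x∈ in k₁ i , e) , (λ x∈ → let i , e = EB.pt-surj x∈ in k₂ i , e) ]′ (∈-++⁻ F x∈)
      arcs : ∀ x y → A (g x) (g y) ≡ KKModel n x y
      arcs (k₁ i) (k₁ j) = EF.complete-arc F-complete i j
      arcs (k₁ i) (k₂ j) = F-B (EF.pt-∈ i) (EB.pt-∈ j)
      arcs (k₁ i) apex = to-a (inF i) (here refl)
      arcs (k₂ i) (k₁ j) = B-F (EB.pt-∈ i) (EF.pt-∈ j)
      arcs (k₂ i) (k₂ j) = EB.complete-arc B-complete i j
      arcs (k₂ i) apex = to-a (inB i) (here refl)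
      arcs apex (k₁ j) = from-a (here refl) (inF j)
      arcs apex (k₂ j) = from-a (here refl) (inB j)
      arcs apex apex = loopless a

    toK : Iso A (KKModel (suc N / 2))
    toK = subst (λ n → Iso A (KKModel n)) (trans (sym (half-double-suc n)) (cong (_/ 2) size)) (make-iso g g-inj surj arcs)

  module _ {F B : List V} {x y : V} (H : IsH2 F B x y) where
    open IsH2 H
    private
      n = length F
      u₂ = unique-tail (proj₁ spanning)
      u = unique-tail u₂
      x∉ = unique-∉ (proj₁ spanning)
      y∉ = unique-∉ u₂
      module EF = Enum F n refl (++-unique-left F u)
      module EB = Enum B n (sym balanced) (++-unique-right F u)
      inF : ∀ i → EF.pt i ∈ F ++ B
      inF i = ∈-++⁺ˡ (EF.pt-∈ i)
      inB : ∀ i → EB.pt i ∈ F ++ B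
      inB i = ∈-++⁺ʳ F (EB.pt-∈ i)
      g : HV n → V
      g (HV.f i) = EF.pt i
      g (HV.b i) = EB.pt i
      g vx = x
      g vy = y
      size : suc (suc (n + n)) ≡ suc N
      size = trans (cong (2 +_) (trans (cong (n +_) balanced) (sym (length-++ F)))) (proj₂ spanning)
      not-x : ∀ {z} → z ∈ F ++ B → z ≡ x → ⊥
      not-x z∈ e = x∉ (there (subst (_∈ F ++ B) e z∈))
      not-y : ∀ {z} → z ∈ F ++ B → z ≡ y → ⊥
      not-y z∈ e = y∉ (subst (_∈ F ++ B) e z∈)
      g-inj : ∀ {z w} → g z ≡ g w → z ≡ w
      g-inj {HV.f i} {HV.f j} e = cong HV.f (EF.pt-inj e)
      g-inj {HV.f i} {HV.b j} e = ⊥-elim (++-disjoint F u (EF.pt-∈ i) (subst (_∈ B) (sym e) (EB.pt-∈ j)))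
      g-inj {HV.f i} {vx} e = ⊥-elim (not-x (inF i) e)
      g-inj {HV.f i} {vy} e = ⊥-elim (not-y (inF i) e)
      g-inj {HV.b i} {HV.f j} e = ⊥-elim (++-disjoint F u (EF.pt-∈ j) (subst (_∈ B) e (EB.pt-∈ i)))
      g-inj {HV.b i} {HV.b j} e = cong HV.b (EB.pt-inj e)
      g-inj {HV.b i} {vx} e = ⊥-elim (not-x (inB i) e)
      g-inj {HV.b i} {vy} e = ⊥-elim (not-y (inB i) e)
      g-inj {vx} {HV.f j} e = ⊥-elim (not-x (inF j) (sym e))
      g-inj {vx} {HV.b j} e = ⊥-elim (not-x (inB j) (sym e))
      g-inj {vx} {vx} e = refl
      g-inj {vx} {vy} e = ⊥-elim (x∉ (here e))
      g-inj {vy} {HV.f j} e = ⊥-elim (not-y (inF j) (sym e))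
      g-inj {vy} {HV.b j} e = ⊥-elim (not-y (inB j) (sym e))
      g-inj {vy} {vx} e = ⊥-elim (x∉ (here (sym e)))
      g-inj {vy} {vy} e = refl
      surj : ∀ z → ∃ λ w → g w ≡ z
      surj z = go (cover (x ∷ y ∷ F ++ B) (proj₁ spanning) (≤-reflexive (sym (proj₂ spanning))) z)
        where
        go : z ∈ x ∷ y ∷ F ++ B → ∃ λ w → g w ≡ z
        go (here e) = vx , sym e
        go (there (here e)) = vy , sym e
        go (there (there z∈)) = [ (λ x∈ → let i , e = EF.pt-surj x∈ in HV.f i , e) , (λ x∈ → let i , e = EB.pt-surj x∈ in HV.b i , e) ]′ (∈-++⁻ F z∈)
      arcs : ∀ t → A y x ≡ t → ∀ z w → A (g z) (g w) ≡ H2Model n t z w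
      arcs t _ (HV.f i) (HV.f j) = EF.complete-arc F-complete i j
      arcs t _ (HV.f i) (HV.b j) = F-B (EF.pt-∈ i) (EB.pt-∈ j)
      arcs t _ (HV.f i) vx = F-x (EF.pt-∈ i) (here refl)
      arcs t _ (HV.f i) vy = F-y (EF.pt-∈ i) (here refl)
      arcs t _ (HV.b i) (HV.f j) = B-F (EB.pt-∈ i) (EF.pt-∈ j)
      arcs t _ (HV.b i) (HV.b j) = EB.complete-arc B-complete i j
      arcs t _ (HV.b i) vx = B-xy (EB.pt-∈ i) (here refl)
      arcs t _ (HV.b i) vy = B-xy (EB.pt-∈ i) (there (here refl))
      arcs t _ vx (HV.f j) = x-F (here refl) (EF.pt-∈ j)
      arcs t _ vx (HV.b j) = x-B (here refl) (EB.pt-∈ j)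
      arcs t _ vx vx = loopless x
      arcs t _ vx vy = x-y
      arcs t _ vy (HV.f j) = y-FB (here refl) (inF j)
      arcs t _ vy (HV.b j) = y-FB (here refl) (inB j)
      arcs t e vy vx = e
      arcs t _ vy vy = loopless y

    toH2 : Iso A (H2Model (suc N / 2 ∸ 1) false) ⊎ Iso A (H2Model (suc N / 2 ∸ 1) true)
    toH2 = subst (λ n → Iso A (H2Model n false) ⊎ Iso A (H2Model n true)) (cong (_∸ 1) halves) (go (bool-cases (A y x)))
      where
      halves : suc n ≡ suc N / 2
      halves = trans (sym (half-double (suc n))) (cong (_/ 2) (trans (cong suc (+-suc n n)) size))
      go : A y x ≡ true ⊎ A y x ≡ false → Iso A (H2Model n false) ⊎ Iso A (H2Model n true)
      go (inj₁ e) = inj₂ (make-iso g g-inj surj (arcs true e))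
      go (inj₂ e) = inj₁ (make-iso g g-inj surj (arcs false e))

-- Deciding the existence of each structure

module Conclusion {N : ℕ} (A : Digraph (Fin (suc N))) (loopless : Loopless A) (order : 4 ≤ N)
  (deg : ∀ v → N ≤ indeg A v + outdeg A v) (deg-in : ∀ v → N ≤ 2 * indeg A v + 1) (deg-out : ∀ v → N ≤ 2 * outdeg A v + 1) where

  open Graph
  open Cycles A
  open Setup
  open Structures A
  open Models A loopless deg

  -- The length bound leaves finitely many lists: the first entry ranges over V and the bound drops
  -- by one.
  search : ∀ n {P : List V → Set} → (∀ xs → Dec (P xs)) → (∀ {xs} → P xs → length xs ≤ n) → Dec (∃ P)
  search zero {P} P? short = map′ (λ e → [] , e) (λ (xs , e) → subst P (empty xs (short e)) e) (P? [])
    where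
    empty : ∀ xs → length xs ≤ 0 → xs ≡ []
    empty [] _ = refl
  search (suc n) {P} P? short = go (P? []) (FinP.any? λ v → search n (P? ∘ (v ∷_)) (s≤s⁻¹ ∘ short))
    where
    go : Dec (P []) → Dec (∃ λ v → ∃ λ xs → P (v ∷ xs)) → Dec (∃ P)
    go (yes e) _ = yes ([] , e)
    go (no _) (yes (v , xs , e)) = yes (v ∷ xs , e)
    go (no n) (no n′) = no λ { ([] , e) → n e ; (v ∷ xs , e) → n′ (v , xs , e) }

  ∀²? : {R : V → V → Set} → (∀ u v → Dec (R u v)) → Dec (∀ {u v} → R u v)
  ∀²? R? = map′ (λ h {u} {v} → h u v) (λ h u v → h) (FinP.all? λ u → FinP.all? (R? u))

  arc? : ∀ u v b → Dec (A u v ≡ b)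
  arc? u v b = A u v ≟ᵇ b

  arcs? : ∀ xs ys b → Dec (∀ {u v} → u ∈ xs → v ∈ ys → A u v ≡ b)
  arcs? xs ys b = ∀²? λ u v → (u ∈? xs) →-dec (v ∈? ys) →-dec arc? u v b

  complete? : ∀ xs → Dec (Complete xs)
  complete? xs = ∀²? λ u v → (u ∈? xs) →-dec (v ∈? xs) →-dec ¬? (u FinP.≟ v) →-dec arc? u v true

  unique? : (xs : List V) → Dec (Unique xs)
  unique? = UniqueDec.unique? FinP._≟_

  spanning? : ∀ xs → Dec (Spanning xs)
  spanning? xs = unique? xs ×-dec (length xs ≟ suc N)

  convert : {P Q : Set} → Dec P → (P → Q) → (Q → P) → Dec Q
  convert P? to from = map′ to from P?

  isH? : ∀ F B → Dec (IsH F B)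
  isH? F B = convert
    (spanning? (F ++ B) ×-dec (length F ≟ length B) ×-dec complete? F ×-dec complete? B ×-dec arcs? B F false)
    (λ (a , b , c , d , e) → record { spanning = a ; balanced = b ; F-complete = c ; B-complete = d ; no-back = e })
    (λ H → let open IsH H in spanning , balanced , F-complete , B-complete , no-back)

  isB? : ∀ X Y → Dec (IsB X Y)
  isB? X Y = convert
    (spanning? (X ++ Y) ×-dec (length X ≟ length Y) ×-dec arcs? X X false ×-dec arcs? Y Y false)
    (λ (a , b , c , d) → record { spanning = a ; balanced = b ; X-independent = c ; Y-independent = d })
    (λ H → let open IsB H in spanning , balanced , X-independent , Y-independent)

  isK? : ∀ F B a → Dec (IsK F B a)
  isK? F B a = convert
    (spanning? (a ∷ F ++ B) ×-dec (length F ≟ length B) ×-dec complete? F ×-dec complete? B ×-dec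
      arcs? F B false ×-dec arcs? B F false ×-dec arcs? (F ++ B) (a ∷ []) true ×-dec arcs? (a ∷ []) (F ++ B) true)
    (λ (p , q , r , s , t , u , v , w) → record
      { spanning = p ; balanced = q ; F-complete = r ; B-complete = s ; F-B = t ; B-F = u ; to-a = v ; from-a = w })
    (λ H → let open IsK H in spanning , balanced , F-complete , B-complete , F-B , B-F , to-a , from-a)

  isH2? : ∀ F B x y → Dec (IsH2 F B x y)
  isH2? F B x y = convert
    (spanning? (x ∷ y ∷ F ++ B) ×-dec (length F ≟ length B) ×-dec complete? F ×-dec complete? B ×-dec
      arcs? F B false ×-dec arcs? B F false ×-dec arcs? F (x ∷ []) true ×-dec arcs? F (y ∷ []) false ×-dec
      arcs? B (x ∷ y ∷ []) true ×-dec arcs? (x ∷ []) F true ×-dec arcs? (x ∷ []) B false ×-dec arc? x y true ×-dec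
      arcs? (y ∷ []) (F ++ B) true)
    (λ (a , b , c , d , e , f , g , h , i , j , k , l , m) → record
      { spanning = a ; balanced = b ; F-complete = c ; B-complete = d ; F-B = e ; B-F = f
      ; F-x = g ; F-y = h ; B-xy = i ; x-F = j ; x-B = k ; x-y = l ; y-FB = m })
    (λ H → let open IsH2 H in spanning , balanced , F-complete , B-complete , F-B , B-F , F-x , F-y , B-xy , x-F , x-B , x-y , y-FB)

  short : ∀ {zs} → Spanning zs → length zs ≤ suc N
  short (_ , e) = ≤-reflexive e

  search² : {P : List V → List V → Set} → (∀ F B → Dec (P F B)) → (∀ {F B} → P F B → length (F ++ B) ≤ suc N) →
    Dec (∃ λ F → ∃ λ B → P F B)
  search² P? bound = search (suc N) (λ F → search (suc N) (P? F) (λ {B} e → ≤-trans (length-++-≤ʳ B {F}) (bound e)))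
    (λ {F} (B , e) → ≤-trans (length-++-≤ˡ F) (bound e))

  existsH? : Dec (∃ λ F → ∃ λ B → IsH F B)
  existsH? = search² isH? λ H → short (IsH.spanning H)

  existsB? : Dec (∃ λ X → ∃ λ Y → IsB X Y)
  existsB? = search² isB? λ H → short (IsB.spanning H)

  existsK? : Dec (∃ λ a → ∃ λ F → ∃ λ B → IsK F B a)
  existsK? = FinP.any? λ a → search² (λ F B → isK? F B a) λ H → <⇒≤ (short (IsK.spanning H))

  existsH2? : Dec (∃ λ x → ∃ λ y → ∃ λ F → ∃ λ B → IsH2 F B x y)
  existsH2? = FinP.any? λ x → FinP.any? λ y → search² (λ F B → isH2? F B x y) λ H → <⇒≤ (<⇒≤ (short (IsH2.spanning H)))

  walk? : ∀ u xs v → Dec (Walk u xs v)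
  walk? u [] v = arc? u v true
  walk? u (x ∷ xs) v = arc? u x true ×-dec walk? x xs v

  -- A cycle as a function on ℕ is not a finite object; its list of vertices is, and can be searched
  -- for.
  ClosedWalk : V → List V → Set
  ClosedWalk x xs = suc (length xs) ≡ N × Walk x xs x × Unique (x ∷ xs)

  closedWalk? : ∀ x xs → Dec (ClosedWalk x xs)
  closedWalk? x xs = (suc (length xs) ≟ N) ×-dec walk? x xs x ×-dec unique? (x ∷ xs)

  existsC? : Dec (∃ λ x → ∃ λ xs → ClosedWalk x xs)
  existsC? = FinP.any? λ x → search N (closedWalk? x) λ (e , _) → ≤-trans (n≤1+n _) (≤-reflexive e)

  cyc-walk : ∀ m → suc m ≡ N → Cyc N → ∃ λ x → ∃ λ xs → ClosedWalk x xs
  cyc-walk m refl C = c C 0 , applyUpTo (c C ∘ suc) m , cong suc (length-applyUpTo (c C ∘ suc) m)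
    , walk-arcs (c C) m (λ i _ → arc C i) (subst (c C m ⇒_) (c-m C) (arc C m)) , seg-unique (c C) (suc m) (inj C)

  IsQList : List V → Set
  IsQList xs = Spanning xs × length xs ≡ 5 × (∀ (i j : Fin 5) → A (at Fin.zero xs (toℕ i)) (at Fin.zero xs (toℕ j)) ≡ Q5Model i j)

  isQList? : ∀ xs → Dec (IsQList xs)
  isQList? xs = spanning? xs ×-dec (length xs ≟ 5) ×-dec (FinP.all? λ i → FinP.all? λ j → arc? _ _ (Q5Model i j))

  existsQ? : Dec (∃ IsQList)
  existsQ? = search (suc N) isQList? (short ∘ proj₁)

  toQ : ∃ IsQList → Iso A Q5Model
  toQ (xs , (u , sp) , len , arcs) = make-iso E.pt E.pt-inj (λ v → E.pt-surj (cover xs u (≤-reflexive (sym sp)) v)) arcs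
    where module E = Enum xs 5 len u

  pentagon : ∀ C → IsQ C → ∃ IsQList
  pentagon C Q = applyUpTo (c C) 5 , (seg-unique (c C) 5 (inj C) , sym p≡5) , refl , λ i j →
      trans (cong₂ A (at-applyUpTo Fin.zero (c C) 5 (toℕ i) (FinP.toℕ<n i)) (at-applyUpTo Fin.zero (c C) 5 (toℕ j) (FinP.toℕ<n j))) (row i j)
    where
    open IsQ Q
    q = c C
    wrapped : ∀ {u b} k → A u (q (5 + k)) ≡ b → A u (q k) ≡ b
    wrapped {u} {b} k = subst (λ v → A u v ≡ b) (per C k)
    pattern i0 = Fin.zero
    pattern i1 = Fin.suc i0
    pattern i2 = Fin.suc i1
    pattern i3 = Fin.suc i2
    pattern i4 = Fin.suc i3
    row : ∀ (i j : Fin 5) → A (q (toℕ i)) (q (toℕ j)) ≡ Q5Model i j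
    row i0 i0 = loopless _
    row i0 i1 = arc C 0
    row i0 i2 = proj₁ (no-chord 0)
    row i0 i3 = proj₂ (no-chord 0)
    row i0 i4 = back 0
    row i1 i0 = wrapped 0 (back 1)
    row i1 i1 = loopless _
    row i1 i2 = arc C 1
    row i1 i3 = proj₁ (no-chord 1)
    row i1 i4 = proj₂ (no-chord 1)
    row i2 i0 = wrapped 0 (proj₂ (no-chord 2))
    row i2 i1 = wrapped 1 (back 2)
    row i2 i2 = loopless _
    row i2 i3 = arc C 2
    row i2 i4 = proj₁ (no-chord 2)
    row i3 i0 = wrapped 0 (proj₁ (no-chord 3))
    row i3 i1 = wrapped 1 (proj₂ (no-chord 3))
    row i3 i2 = wrapped 2 (back 3)
    row i3 i3 = loopless _
    row i3 i4 = arc C 3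
    row i4 i0 = wrapped 0 (arc C 4)
    row i4 i1 = wrapped 1 (proj₁ (no-chord 4))
    row i4 i2 = wrapped 2 (proj₂ (no-chord 4))
    row i4 i3 = wrapped 3 (back 4)
    row i4 i4 = loopless _

  conclusion : HasCycle A N ⊎ InExceptional A (suc N / 2)
  conclusion = go existsC? existsH? existsB? existsK? existsH2? existsQ?
    where
    N≡ : suc (pred N) ≡ N
    N≡ = suc-pred N {{>-nonZero (≤-trans (s≤s z≤n) order)}}
    go : Dec (∃ λ x → ∃ λ xs → ClosedWalk x xs) → Dec (∃ λ F → ∃ λ B → IsH F B) → Dec (∃ λ X → ∃ λ Y → IsB X Y) →
      Dec (∃ λ a → ∃ λ F → ∃ λ B → IsK F B a) → Dec (∃ λ x → ∃ λ y → ∃ λ F → ∃ λ B → IsH2 F B x y) → Dec (∃ IsQList) →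
      HasCycle A N ⊎ InExceptional A (suc N / 2)
    go (yes (x , xs , e , w , u)) _ _ _ _ _ = inj₁ (cyc⇒HasCycle (close x xs e w u) (≤-trans (s≤s z≤n) order))
    go _ (yes (_ , _ , H)) _ _ _ _ = inj₂ (inj₁ (toH H))
    go _ _ (yes (_ , _ , H)) _ _ _ = inj₂ (inj₂ (inj₁ (toB H)))
    go _ _ _ (yes (_ , _ , _ , H)) _ _ = inj₂ (inj₂ (inj₂ (inj₁ (toK H))))
    go _ _ _ _ (yes (_ , _ , _ , _ , H)) _ = inj₂ (inj₂ (inj₂ (inj₂ (h2 (toH2 H)))))
      where
      h2 : ∀ {P Q R : Set} → P ⊎ Q → P ⊎ Q ⊎ R
      h2 (inj₁ e) = inj₁ e
      h2 (inj₂ e) = inj₂ (inj₁ e)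
    go _ _ _ _ _ (yes q) = inj₂ (inj₂ (inj₂ (inj₂ (inj₂ (inj₂ (toQ q))))))
    go (no c) (no h) (no b) (no k) (no h2) (no q) = ⊥-elim (Refutation.counterexample-absurd A record
      { loopless = loopless ; order = order ; deg-in = deg-in ; deg-out = deg-out ; deg = deg
      ; noC = λ C → c (cyc-walk (pred N) N≡ C)
      ; noH = λ F B H → h (F , B , H)
      ; noB = λ X Y H → b (X , Y , H)
      ; noK = λ F B a H → k (a , F , B , H)
      ; noH2 = λ F B x y H → h2 (x , y , F , B , H)
      ; noQ = λ C Q → q (pentagon C Q) })

theorem5p1 : (p : ℕ) (A : Digraph (Fin p)) → Loopless A → 5 ≤ p
    → (∀ x → p ∸ 1 ≤ indeg A x + outdeg A x)
    → (∀ x → p ≤ 2 * indeg A x + 2)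
    → (∀ x → p ≤ 2 * outdeg A x + 2)
    → HasCycle A (p ∸ 1) ⊎ InExceptional A (p / 2)
theorem5p1 (suc N) A loopless (s≤s order) deg deg-in deg-out =
  Conclusion.conclusion A loopless order deg (λ v → drop (deg-in v)) (λ v → drop (deg-out v))
  where
  drop : ∀ {a b} → suc a ≤ b + 2 → a ≤ b + 1
  drop {a} {b} le = s≤s⁻¹ (subst (suc a ≤_) (+-suc b 1) le)
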